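{- As $r \to \infty$, \[ f_3\!\left(r, \{\mathcal{C}_2^{(3)}, \mathcal{C}_3^{(3)}, \mathcal{C}_4^{(3)}\}\right) = r + o(r). \]
   Context: Let $r \ge 3$ and $k$ be positive integers. A $3$-uniform hypergraph $G$ is an $(r,k)$-hypergraph if $V(G)$ can be partitioned into sets $V_1,\dots,V_r$ with $|V_i| \le k$ for all $i$ such that for every $3$-element subset $\{i_1,i_2,i_3\}$ of $[r]$ there is an edge $e \in E(G)$ with $|e \cap V_{i_j}| = 1$ for $j=1,2,3$. For a family $\mathcal{F}$ of $3$-uniform hypergraphs, $f_3(r,\mathcal{F})$ is the minimum $k$ such that there exists a $3$-uniform $(r,k)$-hypergraph containing no member of $\mathcal{F}$ as a subgraph. For a graph $F$, a hypergraph $H$ is a Berge-$F$ if there is a bijection $\phi: E(F) \to E(H)$ with $e \subseteq \phi(e)$ for every $e \in E(F)$. $\mathcal{C}_\ell^{(3)}$ is the family of $3$-uniform Berge cycles of length $\ell$, i.e. $3$-uniform Berge-$C_\ell$ hypergraphs (for $\ell = 2$: two distinct edges together with two distinct vertices each contained in both edges). $o(r)$ denotes a quantity $h(r)$ with $h(r)/r \to 0$. -}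

module Defs where

open import Data.Nat using (ℕ; zero; suc; _+_; _*_; _≤_; NonZero)
open import Data.Nat.DivMod using (_%_; m%n<n)
open import Data.Fin using (Fin; zero; suc; _≟_; toℕ; fromℕ<)
open import Data.Fin.Subset using (Subset; ∣_∣; _∈_; _∩_)
open import Data.Vec using (tabulate)
open import Data.List using (List; length; lookup)
open import Data.List.Relation.Unary.All using (All)
open import Data.List.Relation.Unary.Unique.Propositional using (Unique)
open import Data.List.Membership.Propositional renaming (_∈_ to _∈ₗ_)
open import Data.Product using (Σ; ∃; _×_)
open import Relation.Binary.PropositionalEquality using (_≡_; _≢_)
open import Relation.Nullary using (¬_)
open import Relation.Nullary.Decidable using (⌊_⌋)
open import Function.Definitions using (Injective)

record Hypergraph3 (n : ℕ) : Set where
  field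
    edges    : List (Subset n)
    uniform  : All (λ e → ∣ e ∣ ≡ 3) edges
    distinct : Unique edges
open Hypergraph3 public

next : (ℓ : ℕ) .{{_ : NonZero ℓ}} → Fin ℓ → Fin ℓ
next ℓ i = fromℕ< (m%n<n (suc (toℕ i)) ℓ)

ContainsBergeCycle : ∀ {n} (ℓ : ℕ) .{{_ : NonZero ℓ}} → Hypergraph3 n → Set
ContainsBergeCycle {n} ℓ G =
  Σ (Fin ℓ → Fin n) λ v →
  Σ (Fin ℓ → Fin (length (edges G))) λ e →
    Injective _≡_ _≡_ v × Injective _≡_ _≡_ e ×
    (∀ i → (v i ∈ lookup (edges G) (e i)) × (v (next ℓ i) ∈ lookup (edges G) (e i)))

Part : ∀ {n r} → (Fin n → Fin r) → Fin r → Subset n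
Part part j = tabulate (λ x → ⌊ part x ≟ j ⌋)

IsRKHypergraph : ∀ {n} (r k : ℕ) → Hypergraph3 n → Set
IsRKHypergraph {n} r k G =
  Σ (Fin n → Fin r) λ part →
    (∀ j → ∣ Part part j ∣ ≤ k) ×
    (∀ i₁ i₂ i₃ → i₁ ≢ i₂ → i₁ ≢ i₃ → i₂ ≢ i₃ →
      ∃ λ e → (e ∈ₗ edges G) ×
        (∣ e ∩ Part part i₁ ∣ ≡ 1) × (∣ e ∩ Part part i₂ ∣ ≡ 1) × (∣ e ∩ Part part i₃ ∣ ≡ 1))

Good : (r k : ℕ) → Set
Good r k = Σ ℕ λ n → Σ (Hypergraph3 n) λ G →
  IsRKHypergraph r k G ×
  ¬ ContainsBergeCycle 2 G × ¬ ContainsBergeCycle 3 G × ¬ ContainsBergeCycle 4 G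

module Submission where

-- Lower bound: assign to every ordered triple of parts an edge meeting them, with a centre in the first
-- part.  Girth five means that two vertices are the ends of at most one path of length two through
-- distinct edges, so the sum of the squared degrees is at most |V|² + O(r³); Cauchy-Schwarz gives
-- 2r² ≤ k² + rk + O(r).
--
-- Upper bound: for an odd prime p ≥ r join (x, a) and (y, b) in ℤ/p × ℤ/p when x ≠ y and a + b = 2xy.
-- This graph is C₄-free, and its triangles {(x, xy + xz - yz), ...} are the required hyperedges, one over
-- each triple {x, y, z}; hence f₃ ≤ p.
--
-- It remains to find a prime in (qz, (q+1)z] for every fixed q and all large z.  Selberg's formula
-- ψ(x) log x + Σ Λ(k) ψ(x/k) = 2x log x + O(x) bounds the prime density of an interval by 2.  If
-- (qz, (q+1)z] contains no prime, it forces density 2 in (qz/k, (q+1)z/k] for almost all prime powers k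
-- (in logarithmic measure).  Following such k alternately on both sides of the relation k ↔ z/k gives a
-- long chain of contiguous intervals of density almost 2, which contradicts Mertens' theorem, by which
-- the average density is 1.

-- The construction needs an odd prime p ≥ r and yields f₃ ≤ p. Bertrand's postulate would lose a
-- factor of two; primes in (qz, (q+1)z] for every fixed q bring the loss down to o(r). Selberg's
-- formula by itself allows the density of primes to swing between 0 and 2, and a prime-free
-- interval is the extreme case of such a swing. What excludes it is the function Q - L, the sum of
-- Λ(k)/k minus the logarithm. Mertens' theorem keeps it in [-2, 20], while every step of the chain
-- raises it by at least 1/(4(q+1)), so 92(q+1) steps, a rise of 23, are impossible. The analysis
-- takes place in ℚ. The logarithm is a Riemann sum of 1/t, corrected so as to be exactly additive
-- on products up to N. Hence log = Λ * 1 and the Möbius identities hold exactly, and only the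
-- estimates of size carry errors. Selberg's formula comes from the Tatuzawa-Iseki identity, and
-- Chebyshev's bound ψ(x) ≤ 20x is read off from the same identity.

module PrimeGaps where

  open import Data.Nat as ℕ using (ℕ; zero; suc; s≤s; z≤n)
  import Data.Nat.Properties as ℕ
  import Data.Nat.DivMod as ℕ
  open import Data.Nat.Divisibility using (_∣_; _∤_; _∣?_; ∣⇒≤; ∣-trans; m∣m*n; n∣m*n; ∣m⇒∣m*n; ∣n⇒∣m*n; *-cancelˡ-∣; ∣m+n∣m⇒∣n; m∣n⇒n≡m*quotient)
  open import Data.Nat.Primality using (Prime; prime?; prime⇒nonZero; prime⇒nonTrivial; prime⇒irreducible; euclidsLemma)
  open import Data.Nat.Primality.Factorisation using (factorise)
  open import Data.Nat.Induction using (<-rec)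
  open import Data.Nat.Tactic.RingSolver using () renaming (solve-∀ to solveℕ-∀)
  import Data.Integer as ℤ
  import Data.Integer.Properties as ℤ
  open import Data.Rational hiding (_≤ᵇ_)
  open import Data.Rational.Properties
  import Data.Rational.Unnormalised as ℚᵘ using (mkℚᵘ; *≡*)
  import Data.Rational.Unnormalised.Properties as ℚᵘ
  open import Data.Bool using (Bool; true; false; if_then_else_; _∧_)
  open import Data.List using (List; _∷_; [])
  import Data.List.Properties as List
  open import Data.List.Relation.Unary.All using (_∷_)
  open import Data.Product using (∃; _×_; _,_; proj₁; proj₂)
  open import Data.Sum using (_⊎_; inj₁; inj₂)
  open import Data.Empty using (⊥; ⊥-elim)
  open import Relation.Nullary using (Dec; yes; no; ¬_; does)
  open import Relation.Nullary.Decidable using (dec⇒maybe; True; toWitness)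
  open import Relation.Binary.PropositionalEquality
  open import Tactic.RingSolver using (solve-∀)
  open import Tactic.RingSolver.Core.AlmostCommutativeRing using (AlmostCommutativeRing; fromCommutativeRing)

  -- Polynomial identities over ℚ by reflection

  ℚ-ring : AlmostCommutativeRing _ _
  ℚ-ring = fromCommutativeRing +-*-commutativeRing (λ x → dec⇒maybe (0ℚ ≟ x))

  # : ℕ → ℚ
  # n = (ℤ.+ n) / 1

  -- Polynomial expressions over ℚ.  An identity is proved by normalising the difference of its sides to a
  -- list of monomials all of whose coefficients vanish.
  infix 8 :-_
  infixl 7 _:*_
  infixl 6 _:+_ _:-_
  data Expr : Set where
    var : ℕ → Expr
    con : ℚ → Expr
    :-_ : Expr → Expr
    _:+_ _:-_ _:*_ : Expr → Expr → Expr

  nat : ℕ → Expr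
  nat n = con (# n)

  at : List ℚ → ℕ → ℚ
  at [] _ = 0ℚ
  at (x ∷ ρ) zero = x
  at (x ∷ ρ) (suc i) = at ρ i

  ⟦_⟧ : Expr → List ℚ → ℚ
  ⟦ var i ⟧ ρ = at ρ i
  ⟦ con c ⟧ ρ = c
  ⟦ :- a ⟧ ρ = - ⟦ a ⟧ ρ
  ⟦ a :+ b ⟧ ρ = ⟦ a ⟧ ρ + ⟦ b ⟧ ρ
  ⟦ a :- b ⟧ ρ = ⟦ a ⟧ ρ - ⟦ b ⟧ ρ
  ⟦ a :* b ⟧ ρ = ⟦ a ⟧ ρ * ⟦ b ⟧ ρ

  Mono Poly : Set
  Mono = List ℕ
  Poly = List (ℚ × Mono)

  less : Mono → Mono → Bool
  less [] _ = true
  less (_ ∷ _) [] = false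
  less (i ∷ m) (j ∷ n) = if i ℕ.<ᵇ j then true else (if j ℕ.<ᵇ i then false else less m n)

  _≟ₘ_ : (m n : Mono) → Dec (m ≡ n)
  _≟ₘ_ = List.≡-dec ℕ._≟_

  insert-var : ℕ → Mono → Mono
  insert-var i [] = i ∷ []
  insert-var i (j ∷ m) = if i ℕ.≤ᵇ j then i ∷ j ∷ m else j ∷ insert-var i m

  merge : Mono → Mono → Mono
  merge [] n = n
  merge (i ∷ m) n = insert-var i (merge m n)

  insert : ℚ → Mono → Poly → Poly
  insert c m [] = (c , m) ∷ []
  insert c m ((d , n) ∷ p) = if does (m ≟ₘ n) then (c + d , n) ∷ p else (if less m n then (c , m) ∷ (d , n) ∷ p else (d , n) ∷ insert c m p)

  add : Poly → Poly → Poly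
  add [] q = q
  add ((c , m) ∷ p) q = insert c m (add p q)

  scale : ℚ → Mono → Poly → Poly
  scale c m [] = []
  scale c m ((d , n) ∷ p) = insert (c * d) (merge m n) (scale c m p)

  mul : Poly → Poly → Poly
  mul [] q = []
  mul ((c , m) ∷ p) q = add (scale c m q) (mul p q)

  normal : Expr → Poly
  normal (var i) = (1ℚ , i ∷ []) ∷ []
  normal (con c) = (c , []) ∷ []
  normal (:- a) = scale (- 1ℚ) [] (normal a)
  normal (a :+ b) = add (normal a) (normal b)
  normal (a :- b) = add (normal a) (scale (- 1ℚ) [] (normal b))
  normal (a :* b) = mul (normal a) (normal b)

  all-zero : Poly → Bool
  all-zero [] = true
  all-zero ((c , _) ∷ p) = does (c ≟ 0ℚ) ∧ all-zero p

  module _ (ρ : List ℚ) where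
    ⟦_⟧ₘ : Mono → ℚ
    ⟦ [] ⟧ₘ = 1ℚ
    ⟦ i ∷ m ⟧ₘ = at ρ i * ⟦ m ⟧ₘ

    ⟦_⟧ₚ : Poly → ℚ
    ⟦ [] ⟧ₚ = 0ℚ
    ⟦ (c , m) ∷ p ⟧ₚ = c * ⟦ m ⟧ₘ + ⟦ p ⟧ₚ

    insert-var-≡ : ∀ i m → ⟦ insert-var i m ⟧ₘ ≡ at ρ i * ⟦ m ⟧ₘ
    insert-var-≡ i [] = refl
    insert-var-≡ i (j ∷ m) with i ℕ.≤ᵇ j
    ... | true = refl
    ... | false = trans (cong (at ρ j *_) (insert-var-≡ i m)) (lem (at ρ j) (at ρ i) ⟦ m ⟧ₘ)
      where
      lem : ∀ a b c → a * (b * c) ≡ b * (a * c)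
      lem = solve-∀ ℚ-ring

    merge-≡ : ∀ m n → ⟦ merge m n ⟧ₘ ≡ ⟦ m ⟧ₘ * ⟦ n ⟧ₘ
    merge-≡ [] n = sym (*-identityˡ ⟦ n ⟧ₘ)
    merge-≡ (i ∷ m) n = trans (insert-var-≡ i (merge m n)) (trans (cong (at ρ i *_) (merge-≡ m n)) (sym (*-assoc (at ρ i) ⟦ m ⟧ₘ ⟦ n ⟧ₘ)))

    insert-≡ : ∀ c m p → ⟦ insert c m p ⟧ₚ ≡ c * ⟦ m ⟧ₘ + ⟦ p ⟧ₚ
    insert-≡ c m [] = refl
    insert-≡ c m ((d , n) ∷ p) with m ≟ₘ n
    ... | yes refl = lem c d ⟦ m ⟧ₘ ⟦ p ⟧ₚ
      where
      lem : ∀ c d m p → (c + d) * m + p ≡ c * m + (d * m + p)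
      lem = solve-∀ ℚ-ring
    ... | no _ with less m n
    ...   | true = refl
    ...   | false = trans (cong (λ t → d * ⟦ n ⟧ₘ + t) (insert-≡ c m p)) (lem (d * ⟦ n ⟧ₘ) (c * ⟦ m ⟧ₘ) ⟦ p ⟧ₚ)
      where
      lem : ∀ a b c → a + (b + c) ≡ b + (a + c)
      lem = solve-∀ ℚ-ring

    add-≡ : ∀ p q → ⟦ add p q ⟧ₚ ≡ ⟦ p ⟧ₚ + ⟦ q ⟧ₚ
    add-≡ [] q = sym (+-identityˡ ⟦ q ⟧ₚ)
    add-≡ ((c , m) ∷ p) q = trans (insert-≡ c m (add p q)) (trans (cong (λ t → c * ⟦ m ⟧ₘ + t) (add-≡ p q)) (sym (+-assoc (c * ⟦ m ⟧ₘ) ⟦ p ⟧ₚ ⟦ q ⟧ₚ)))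

    scale-≡ : ∀ c m p → ⟦ scale c m p ⟧ₚ ≡ c * ⟦ m ⟧ₘ * ⟦ p ⟧ₚ
    scale-≡ c m [] = sym (*-zeroʳ (c * ⟦ m ⟧ₘ))
    scale-≡ c m ((d , n) ∷ p) = trans (insert-≡ (c * d) (merge m n) (scale c m p)) (trans (cong₂ (λ s t → c * d * s + t) (merge-≡ m n) (scale-≡ c m p)) (lem c d ⟦ m ⟧ₘ ⟦ n ⟧ₘ ⟦ p ⟧ₚ))
      where
      lem : ∀ c d m n p → c * d * (m * n) + c * m * p ≡ c * m * (d * n + p)
      lem = solve-∀ ℚ-ring

    mul-≡ : ∀ p q → ⟦ mul p q ⟧ₚ ≡ ⟦ p ⟧ₚ * ⟦ q ⟧ₚ
    mul-≡ [] q = sym (*-zeroˡ ⟦ q ⟧ₚ)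
    mul-≡ ((c , m) ∷ p) q = trans (add-≡ (scale c m q) (mul p q)) (trans (cong₂ _+_ (scale-≡ c m q) (mul-≡ p q)) (sym (*-distribʳ-+ ⟦ q ⟧ₚ (c * ⟦ m ⟧ₘ) ⟦ p ⟧ₚ)))

    negate-≡ : ∀ p → ⟦ scale (- 1ℚ) [] p ⟧ₚ ≡ - ⟦ p ⟧ₚ
    negate-≡ p = trans (scale-≡ (- 1ℚ) [] p) (lem ⟦ p ⟧ₚ)
      where
      lem : ∀ a → - 1ℚ * 1ℚ * a ≡ - a
      lem = solve-∀ ℚ-ring

    normal-≡ : ∀ e → ⟦ normal e ⟧ₚ ≡ ⟦ e ⟧ ρ
    normal-≡ (var i) = lem (at ρ i)
      where
      lem : ∀ a → 1ℚ * (a * 1ℚ) + 0ℚ ≡ a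
      lem = solve-∀ ℚ-ring
    normal-≡ (con c) = trans (+-identityʳ (c * 1ℚ)) (*-identityʳ c)
    normal-≡ (:- a) = trans (negate-≡ (normal a)) (cong -_ (normal-≡ a))
    normal-≡ (a :+ b) = trans (add-≡ (normal a) (normal b)) (cong₂ _+_ (normal-≡ a) (normal-≡ b))
    normal-≡ (a :- b) = trans (add-≡ (normal a) (scale (- 1ℚ) [] (normal b))) (cong₂ _+_ (normal-≡ a) (trans (negate-≡ (normal b)) (cong -_ (normal-≡ b))))
    normal-≡ (a :* b) = trans (mul-≡ (normal a) (normal b)) (cong₂ _*_ (normal-≡ a) (normal-≡ b))

    all-zero-≡ : ∀ p → all-zero p ≡ true → ⟦ p ⟧ₚ ≡ 0ℚ
    all-zero-≡ [] _ = refl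
    all-zero-≡ ((c , m) ∷ p) h with c ≟ 0ℚ
    ... | yes refl = trans (cong₂ _+_ (*-zeroˡ ⟦ m ⟧ₘ) (all-zero-≡ p h)) refl
    all-zero-≡ ((c , m) ∷ p) () | no _

    -- The hypothesis is a Boolean equation between closed terms, so each use costs one evaluation
    -- of the normaliser and is closed by `refl`.
    ring-≡ : ∀ a b → all-zero (normal (a :- b)) ≡ true → ⟦ a ⟧ ρ ≡ ⟦ b ⟧ ρ
    ring-≡ a b h = trans (lem (⟦ a ⟧ ρ) (⟦ b ⟧ ρ)) (trans (cong (_+ ⟦ b ⟧ ρ) (trans (sym (normal-≡ (a :- b))) (all-zero-≡ (normal (a :- b)) h))) (+-identityˡ (⟦ b ⟧ ρ)))
      where
      lem : ∀ a b → a ≡ (a - b) + b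
      lem = solve-∀ ℚ-ring

  -- Certificates for polynomial inequalities

  infixl 6 _⊹_
  infixl 7 _⊠_

  _⊹_ : ∀ {a b} → 0ℚ ≤ a → 0ℚ ≤ b → 0ℚ ≤ a + b
  _⊹_ = +-mono-≤

  _⊠_ : ∀ {a b} → 0ℚ ≤ a → 0ℚ ≤ b → 0ℚ ≤ a * b
  _⊠_ {a} {b} p q = nonNegative⁻¹ (a * b) {{nonNeg*nonNeg⇒nonNeg a {{nonNegative p}} b {{nonNegative q}}}}

  gap : ∀ {a b} → a ≤ b → 0ℚ ≤ b - a
  gap {a} {b} p = subst (_≤ b - a) (+-inverseʳ a) (+-monoˡ-≤ (- a) p)

  -- An equation may be multiplied by a factor of either sign, so `c` carries no sign condition,
  -- unlike the factors in `_⊠_`.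
  eqgap : ∀ {a b} c → a ≡ b → 0ℚ ≤ (b - a) * c
  eqgap {a} c refl = ≤-reflexive (sym (trans (cong (_* c) (+-inverseʳ a)) (*-zeroˡ c)))

  lit : ∀ c → {_ : True (0ℚ ≤? c)} → 0ℚ ≤ c
  lit c {t} = toWitness t

  -- The form of nearly all estimates below: b - a is written as a sum of products of nonnegative
  -- quantities (`gap`, `eqgap`, `lit`) with positive coefficients, and `ring-≡` checks the
  -- identity.
  ≤-by : ∀ {a b s} → 0ℚ ≤ s → b ≡ a + s → a ≤ b
  ≤-by {a} {b} {s} p e = subst (a ≤_) (sym e) (subst (_≤ a + s) (+-identityʳ a) (+-monoʳ-≤ a p))

  ungap : ∀ a b → 0ℚ ≤ b - a → a ≤ b
  ungap a b h = ≤-by h (lem a b)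
    where
    lem : ∀ a b → b ≡ a + (b - a)
    lem = solve-∀ ℚ-ring

  cancel-≤ : ∀ c a b → 0ℚ < c → c * a ≤ c * b → a ≤ b
  cancel-≤ c a b p = *-cancelˡ-≤-pos c {{positive p}}

  -- Naturals and their reciprocals inside ℚ

  1+# : ∀ n → 1ℚ + # n ≡ # (suc n)
  1+# n = toℚᵘ-injective (ℚᵘ.≃-trans (toℚᵘ-homo-+ 1ℚ (# n)) (ℚᵘ.≃-trans
    (ℚᵘ.+-cong (ℚᵘ.≃-refl {toℚᵘ 1ℚ}) (toℚᵘ-fromℚᵘ (ℚᵘ.mkℚᵘ (ℤ.+ n) 0)))
    (ℚᵘ.≃-trans (ℚᵘ.*≡* {q = ℚᵘ.mkℚᵘ (ℤ.+ suc n) 0} (cong (λ t → (ℤ.1ℤ ℤ.+ t) ℤ.* ℤ.1ℤ) (ℤ.*-identityʳ (ℤ.+ n))))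
    (ℚᵘ.≃-sym (toℚᵘ-fromℚᵘ (ℚᵘ.mkℚᵘ (ℤ.+ suc n) 0))))))

  opaque
    -- Opaque, so that casts of compound naturals do not unfold. Numerals go through `#`, which
    -- computes, and `ι-lit` connects the two.
    ι : ℕ → ℚ
    ι zero = 0ℚ
    ι (suc n) = 1ℚ + ι n

    ι-0 : ι 0 ≡ 0ℚ
    ι-0 = refl

    ι-suc : ∀ n → ι (suc n) ≡ 1ℚ + ι n
    ι-suc n = refl

  ι-lit : ∀ n → ι n ≡ # n
  ι-lit zero = ι-0
  ι-lit (suc n) = trans (ι-suc n) (trans (cong (λ t → 1ℚ + t) (ι-lit n)) (1+# n))

  ι-1 : ι 1 ≡ 1ℚ
  ι-1 = ι-lit 1

  ι≥0 : ∀ n → 0ℚ ≤ ι n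
  ι≥0 zero = ≤-reflexive (sym ι-0)
  ι≥0 (suc n) = subst (0ℚ ≤_) (sym (ι-suc n)) (lit 1ℚ ⊹ ι≥0 n)

  ι-+ : ∀ m n → ι (m ℕ.+ n) ≡ ι m + ι n
  ι-+ zero n = trans (sym (+-identityˡ (ι n))) (cong (_+ ι n) (sym ι-0))
  ι-+ (suc m) n = trans (ι-suc (m ℕ.+ n)) (trans (cong (λ t → 1ℚ + t) (ι-+ m n))
    (trans (sym (+-assoc 1ℚ (ι m) (ι n))) (cong (_+ ι n) (sym (ι-suc m)))))

  ι-* : ∀ m n → ι (m ℕ.* n) ≡ ι m * ι n
  ι-* zero n = trans ι-0 (trans (sym (*-zeroˡ (ι n))) (cong (_* ι n) (sym ι-0)))
  ι-* (suc m) n = trans (ι-+ n (m ℕ.* n)) (trans (cong (λ t → ι n + t) (ι-* m n))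
    (trans (lem (ι m) (ι n)) (cong (_* ι n) (sym (ι-suc m)))))
    where
    lem : ∀ a b → b + a * b ≡ (1ℚ + a) * b
    lem = solve-∀ ℚ-ring

  ι-mono : ∀ {m n} → m ℕ.≤ n → ι m ≤ ι n
  ι-mono {m} {n} p = ≤-by (ι≥0 (n ℕ.∸ m)) (trans (cong ι (sym (ℕ.m+[n∸m]≡n p))) (ι-+ m (n ℕ.∸ m)))

  ι-< : ∀ {m n} → m ℕ.< n → 1ℚ + ι m ≤ ι n
  ι-< {m} {n} p = subst (_≤ ι n) (ι-suc m) (ι-mono p)

  1≤ι : ∀ {n} → 1 ℕ.≤ n → 1ℚ ≤ ι n
  1≤ι {n} p = subst (_≤ ι n) ι-1 (ι-mono p)

  1≰0 : 1ℚ ≤ 0ℚ → ⊥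
  1≰0 (*≤* (ℤ.+≤+ ()))

  1+≰ : ∀ a → 1ℚ + a ≤ a → ⊥
  1+≰ a p = 1≰0 (≤-by (gap p) (lem a))
    where
    lem : ∀ a → 0ℚ ≡ 1ℚ + (a - (1ℚ + a))
    lem = solve-∀ ℚ-ring

  ι-cancel-≤ : ∀ {m n} → ι m ≤ ι n → m ℕ.≤ n
  ι-cancel-≤ {m} {n} p with ℕ.≤-<-connex m n
  ... | inj₁ q = q
  ... | inj₂ q = ⊥-elim (1+≰ (ι n) (≤-trans (ι-< q) p))

  ι-pos : ∀ {n} → 1 ℕ.≤ n → 0ℚ < ι n
  ι-pos p = <-≤-trans (*<* (ℤ.+<+ (ℕ.s≤s ℕ.z≤n))) (1≤ι p)

  ι≢0 : ∀ n → NonZero (ι (suc n))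
  ι≢0 n = pos⇒nonZero (ι (suc n)) {{positive (ι-pos {suc n} (ℕ.s≤s ℕ.z≤n))}}

  opaque
    -- The value 0 at 0 keeps `inv≥0` and later `ι⫽≤` free of side conditions.
    inv : ℕ → ℚ
    inv zero = 0ℚ
    inv (suc n) = 1/_ (ι (suc n)) {{ι≢0 n}}

    inv-r : ∀ {n} → 1 ℕ.≤ n → ι n * inv n ≡ 1ℚ
    inv-r {suc n} _ = *-inverseʳ (ι (suc n)) {{ι≢0 n}}

    inv-0 : inv 0 ≡ 0ℚ
    inv-0 = refl

  inv≥0 : ∀ n → 0ℚ ≤ inv n
  inv≥0 zero = ≤-reflexive (sym inv-0)
  inv≥0 (suc n) = cancel-≤ (ι (suc n)) 0ℚ (inv (suc n)) (ι-pos (ℕ.s≤s ℕ.z≤n))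
    (subst₂ _≤_ (sym (*-zeroʳ (ι (suc n)))) (sym (inv-r (ℕ.s≤s ℕ.z≤n))) (lit 1ℚ))

  inv-unique : ∀ {n} c → 1 ℕ.≤ n → ι n * c ≡ 1ℚ → c ≡ inv n
  inv-unique {n} c p e = trans (lem (ι n) c (inv n) (inv-r p)) (trans (cong (inv n *_) e) (*-identityʳ _))
    where
    lem : ∀ a c i → a * i ≡ 1ℚ → c ≡ i * (a * c)
    lem a c i h = trans (sym (*-identityˡ c)) (trans (cong (_* c) (sym h)) (l2 a c i))
      where
      l2 : ∀ a c i → a * i * c ≡ i * (a * c)
      l2 = solve-∀ ℚ-ring

  inv-1 : inv 1 ≡ 1ℚ
  inv-1 = sym (inv-unique 1ℚ (ℕ.s≤s ℕ.z≤n) (trans (*-identityʳ _) ι-1))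

  inv-* : ∀ {m n} → 1 ℕ.≤ m → 1 ℕ.≤ n → inv (m ℕ.* n) ≡ inv m * inv n
  inv-* {m} {n} p q = sym (inv-unique (inv m * inv n) (ℕ.*-mono-≤ p q)
    (trans (cong (_* (inv m * inv n)) (ι-* m n)) (trans (lem (ι m) (ι n) (inv m) (inv n)) (cong₂ _*_ (inv-r p) (inv-r q)))))
    where
    lem : ∀ a b c d → a * b * (c * d) ≡ (a * c) * (b * d)
    lem = solve-∀ ℚ-ring

  inv-anti-lem : ∀ a b x y → a ≤ b → a * x ≡ 1ℚ → b * y ≡ 1ℚ → 0ℚ ≤ x → 0ℚ ≤ y → y ≤ x
  inv-anti-lem a b x y p ea eb hx hy = ≤-by (gap (≤-reflexive (sym ea)) ⊠ hy ⊹ gap (≤-reflexive eb) ⊠ hx ⊹ gap p ⊠ hx ⊠ hy) (ring-≡ (a ∷ b ∷ x ∷ y ∷ []) (var 2) (var 3 :+ ((var 0 :* var 2 :- nat 1) :* var 3 :+ (nat 1 :- var 1 :* var 3) :* var 2 :+ (var 1 :- var 0) :* var 2 :* var 3)) refl)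

  inv-anti : ∀ {m n} → 1 ℕ.≤ m → m ℕ.≤ n → inv n ≤ inv m
  inv-anti {m} {n} p q = inv-anti-lem (ι m) (ι n) (inv m) (inv n) (ι-mono q) (inv-r p) (inv-r (ℕ.≤-trans p q)) (inv≥0 m) (inv≥0 n)

  -- Finite sums and averaging arguments

  sum : ℕ → (ℕ → ℚ) → ℚ
  sum zero f = 0ℚ
  sum (suc n) f = sum n f + f (suc n)

  sum-cong : ∀ n {f g} → (∀ k → 1 ℕ.≤ k → k ℕ.≤ n → f k ≡ g k) → sum n f ≡ sum n g
  sum-cong zero h = refl
  sum-cong (suc n) h = cong₂ _+_ (sum-cong n (λ k p q → h k p (ℕ.m≤n⇒m≤1+n q))) (h (suc n) (ℕ.s≤s ℕ.z≤n) ℕ.≤-refl)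

  sum-mono : ∀ n {f g} → (∀ k → 1 ℕ.≤ k → k ℕ.≤ n → f k ≤ g k) → sum n f ≤ sum n g
  sum-mono zero h = ≤-refl
  sum-mono (suc n) h = +-mono-≤ (sum-mono n (λ k p q → h k p (ℕ.m≤n⇒m≤1+n q))) (h (suc n) (ℕ.s≤s ℕ.z≤n) ℕ.≤-refl)

  sum-0 : ∀ n → sum n (λ _ → 0ℚ) ≡ 0ℚ
  sum-0 zero = refl
  sum-0 (suc n) = trans (+-identityʳ _) (sum-0 n)

  sum≥0 : ∀ n {f} → (∀ k → 1 ℕ.≤ k → k ℕ.≤ n → 0ℚ ≤ f k) → 0ℚ ≤ sum n f
  sum≥0 n {f} h = subst (_≤ sum n f) (sum-0 n) (sum-mono n h)

  interchange : ∀ a b c d → (a + b) + (c + d) ≡ (a + c) + (b + d)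
  interchange = solve-∀ ℚ-ring

  sum-+ : ∀ n f g → sum n (λ k → f k + g k) ≡ sum n f + sum n g
  sum-+ zero f g = refl
  sum-+ (suc n) f g = trans (cong (_+ (f (suc n) + g (suc n))) (sum-+ n f g)) (interchange (sum n f) (sum n g) (f (suc n)) (g (suc n)))

  sum-*ˡ : ∀ n c f → sum n (λ k → c * f k) ≡ c * sum n f
  sum-*ˡ zero c f = sym (*-zeroʳ c)
  sum-*ˡ (suc n) c f = trans (cong (_+ c * f (suc n)) (sum-*ˡ n c f)) (sym (*-distribˡ-+ c (sum n f) (f (suc n))))

  sum-*ʳ : ∀ n c f → sum n (λ k → f k * c) ≡ sum n f * c
  sum-*ʳ n c f = trans (sum-cong n (λ k _ _ → *-comm (f k) c)) (trans (sum-*ˡ n c f) (*-comm c (sum n f)))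

  sum-- : ∀ n f g → sum n (λ k → f k - g k) ≡ sum n f - sum n g
  sum-- zero f g = refl
  sum-- (suc n) f g = trans (cong (_+ (f (suc n) - g (suc n))) (sum-- n f g)) (lem (sum n f) (sum n g) (f (suc n)) (g (suc n)))
    where
    lem : ∀ a b c d → (a - b) + (c - d) ≡ (a + c) - (b + d)
    lem = solve-∀ ℚ-ring

  sum-swap : ∀ m n (f : ℕ → ℕ → ℚ) → sum m (λ i → sum n (f i)) ≡ sum n (λ j → sum m (λ i → f i j))
  sum-swap zero n f = sym (sum-0 n)
  sum-swap (suc m) n f = trans (cong (_+ sum n (f (suc m))) (sum-swap m n f))
    (sym (sum-+ n (λ j → sum m (λ i → f i j)) (f (suc m))))

  sum-const : ∀ n c → sum n (λ _ → c) ≡ ι n * c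
  sum-const zero c = sym (trans (cong (_* c) ι-0) (*-zeroˡ c))
  sum-const (suc n) c = trans (cong (_+ c) (sum-const n c)) (trans (lem (ι n) c) (cong (_* c) (sym (ι-suc n))))
    where
    lem : ∀ a c → a * c + c ≡ (1ℚ + a) * c
    lem = solve-∀ ℚ-ring

  sum-split : ∀ m n f → sum (m ℕ.+ n) f ≡ sum m f + sum n (λ k → f (m ℕ.+ k))
  sum-split m zero f = trans (cong (λ t → sum t f) (ℕ.+-identityʳ m)) (sym (+-identityʳ _))
  sum-split m (suc n) f rewrite ℕ.+-suc m n = trans (cong (_+ f (suc (m ℕ.+ n))) (sum-split m n f))
    (+-assoc (sum m f) (sum n (λ k → f (m ℕ.+ k))) (f (suc (m ℕ.+ n))))

  sum-ext : ∀ {m n} f → m ℕ.≤ n → (∀ k → m ℕ.< k → k ℕ.≤ n → f k ≡ 0ℚ) → sum n f ≡ sum m f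
  sum-ext {m} {n} f p h = trans (cong (λ t → sum t f) (sym (ℕ.m+[n∸m]≡n p))) (trans (sum-split m (n ℕ.∸ m) f)
    (trans (cong (λ t → sum m f + t) (trans (sum-cong (n ℕ.∸ m) (λ k a b → h (m ℕ.+ k) (ℕ.m<m+n m a) (subst (m ℕ.+ k ℕ.≤_) (ℕ.m+[n∸m]≡n p) (ℕ.+-monoʳ-≤ m b)))) (sum-0 (n ℕ.∸ m))))
      (+-identityʳ _)))

  -- Sums over the interval (m, n] are written sum n f - sum m f.
  range-mono : ∀ {m n} f g → m ℕ.≤ n → (∀ k → m ℕ.< k → k ℕ.≤ n → f k ≤ g k) → sum n f - sum m f ≤ sum n g - sum m g
  range-mono {m} {n} f g p h = subst (λ t → sum t f - sum m f ≤ sum t g - sum m g) (ℕ.m+[n∸m]≡n p) go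
    where
    d = n ℕ.∸ m
    lem : ∀ a b → (a + b) - a ≡ b
    lem = solve-∀ ℚ-ring
    red : ∀ f → sum (m ℕ.+ d) f - sum m f ≡ sum d (λ k → f (m ℕ.+ k))
    red f = trans (cong (_- sum m f) (sum-split m d f)) (lem (sum m f) (sum d (λ k → f (m ℕ.+ k))))
    go : sum (m ℕ.+ d) f - sum m f ≤ sum (m ℕ.+ d) g - sum m g
    go = subst₂ _≤_ (sym (red f)) (sym (red g)) (sum-mono d (λ k a b → h (m ℕ.+ k) (ℕ.m<m+n m a) (subst (m ℕ.+ k ℕ.≤_) (ℕ.m+[n∸m]≡n p) (ℕ.+-monoʳ-≤ m b))))

  sum-mono-n : ∀ {m n} f → m ℕ.≤ n → (∀ k → m ℕ.< k → k ℕ.≤ n → 0ℚ ≤ f k) → sum m f ≤ sum n f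
  sum-mono-n {m} {n} f p h = ungap _ _ (subst (_≤ sum n f - sum m f) eq (range-mono (λ _ → 0ℚ) f p h))
    where
    eq : sum n (λ _ → 0ℚ) - sum m (λ _ → 0ℚ) ≡ 0ℚ
    eq = cong₂ _-_ (sum-0 n) (sum-0 m)

  +-drop-≤ : ∀ a b c d → a + b ≤ c + d → d ≤ b → a ≤ c
  +-drop-≤ a b c d p q = ≤-by (gap p ⊹ gap q) (ring-≡ (a ∷ b ∷ c ∷ d ∷ []) (var 2) (var 0 :+ (var 2 :+ var 3 :- (var 0 :+ var 1) :+ (var 1 :- var 3))) refl)

  -- The pigeonhole that selects a block of small slack in `contradiction`. If the last term of `f`
  -- is too large, dropping the last terms preserves the inequality.
  sum-≤-pick : ∀ n f g → sum (suc n) f ≤ sum (suc n) g → ∃ λ k → 1 ℕ.≤ k × k ℕ.≤ suc n × f k ≤ g k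
  sum-≤-pick zero f g h = 1 , ℕ.s≤s ℕ.z≤n , ℕ.≤-refl , subst₂ _≤_ (+-identityˡ (f 1)) (+-identityˡ (g 1)) h
  sum-≤-pick (suc n) f g h = choose (≤-total (f (suc (suc n))) (g (suc (suc n))))
    where
    Goal = ∃ λ k → 1 ℕ.≤ k × k ℕ.≤ suc (suc n) × f k ≤ g k
    weaken : (∃ λ k → 1 ℕ.≤ k × k ℕ.≤ suc n × f k ≤ g k) → Goal
    weaken (k , a , b , c) = k , a , ℕ.m≤n⇒m≤1+n b , c
    choose : f (suc (suc n)) ≤ g (suc (suc n)) ⊎ g (suc (suc n)) ≤ f (suc (suc n)) → Goal
    choose (inj₁ p) = suc (suc n) , ℕ.s≤s ℕ.z≤n , ℕ.≤-refl , p
    choose (inj₂ p) = weaken (sum-≤-pick n f g (+-drop-≤ (sum (suc n) f) (f (suc (suc n))) (sum (suc n) g) (g (suc (suc n))) h p))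

  range-<-pick : ∀ {m n} f g → m ℕ.≤ n → sum n f - sum m f < sum n g - sum m g → ∃ λ k → m ℕ.< k × k ℕ.≤ n × f k < g k
  range-<-pick {m} {n} f g m≤n h with go m n m≤n
    where
    go : ∀ m n → m ℕ.≤ n → (∃ λ k → m ℕ.< k × k ℕ.≤ n × f k < g k) ⊎ (∀ k → m ℕ.< k → k ℕ.≤ n → g k ≤ f k)
    go m zero p = inj₂ (λ k a b → ⊥-elim (ℕ.<⇒≱ a (ℕ.≤-trans b ℕ.z≤n)))
    go m (suc n) p with ℕ.m≤n⇒m<n∨m≡n p
    ... | inj₂ refl = inj₂ (λ k a b → ⊥-elim (ℕ.<⇒≱ a b))
    ... | inj₁ (ℕ.s≤s q) with go m n q
    ...   | inj₁ (k , a , b , c) = inj₁ (k , a , ℕ.m≤n⇒m≤1+n b , c)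
    ...   | inj₂ H with g (suc n) ≤? f (suc n)
    ...     | no ¬c = inj₁ (suc n , ℕ.s≤s q , ℕ.≤-refl , ≰⇒> ¬c)
    ...     | yes c = inj₂ H'
      where
      H' : ∀ k → m ℕ.< k → k ℕ.≤ suc n → g k ≤ f k
      H' k a b with ℕ.m≤n⇒m<n∨m≡n b
      ... | inj₁ (ℕ.s≤s b') = H k a b'
      ... | inj₂ refl = c
  ... | inj₁ r = r
  ... | inj₂ H = ⊥-elim (<⇒≢ (<-≤-trans h (range-mono g f m≤n H)) refl)

  𝟙 : ∀ {P : Set} → Dec P → ℚ
  𝟙 (yes _) = 1ℚ
  𝟙 (no _) = 0ℚ

  𝟙≥0 : ∀ {P : Set} (d : Dec P) → 0ℚ ≤ 𝟙 d
  𝟙≥0 (yes _) = lit 1ℚ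
  𝟙≥0 (no _) = lit 0ℚ

  𝟙≤1 : ∀ {P : Set} (d : Dec P) → 𝟙 d ≤ 1ℚ
  𝟙≤1 (yes _) = ≤-refl
  𝟙≤1 (no _) = lit 1ℚ

  𝟙-yes : ∀ {P : Set} (d : Dec P) → P → 𝟙 d ≡ 1ℚ
  𝟙-yes (yes _) _ = refl
  𝟙-yes (no ¬p) p = ⊥-elim (¬p p)

  𝟙-no : ∀ {P : Set} (d : Dec P) → ¬ P → 𝟙 d ≡ 0ℚ
  𝟙-no (yes p) ¬p = ⊥-elim (¬p p)
  𝟙-no (no _) _ = refl

  𝟙-⇔ : ∀ {P Q : Set} (d : Dec P) (e : Dec Q) → (P → Q) → (Q → P) → 𝟙 d ≡ 𝟙 e
  𝟙-⇔ (yes p) e f g = sym (𝟙-yes e (f p))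
  𝟙-⇔ (no ¬p) e f g = sym (𝟙-no e (λ q → ¬p (g q)))

  sum-single : ∀ n j f → 1 ℕ.≤ j → j ℕ.≤ n → (∀ k → 1 ℕ.≤ k → k ℕ.≤ n → k ≢ j → f k ≡ 0ℚ) → sum n f ≡ f j
  sum-single n (suc j) f _ q h = trans (sum-ext f q (λ k a b → h k (ℕ.≤-trans (ℕ.s≤s ℕ.z≤n) a) b (λ e → ℕ.<⇒≢ a (sym e))))
    (trans (cong (_+ f (suc j)) (trans (sum-cong j (λ k a b → h k a (ℕ.≤-trans (ℕ.m≤n⇒m≤1+n b) q) (λ e → ℕ.<⇒≢ (ℕ.s≤s b) e))) (sum-0 j))) (+-identityˡ _))

  sum-≤? : ∀ n m f → m ℕ.≤ n → sum n (λ k → 𝟙 (k ℕ.≤? m) * f k) ≡ sum m f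
  sum-≤? n m f p = trans (sum-ext _ p (λ k a _ → trans (cong (_* f k) (𝟙-no (k ℕ.≤? m) (ℕ.<⇒≱ a))) (*-zeroˡ (f k))))
    (sum-cong m (λ k _ b → trans (cong (_* f k) (𝟙-yes (k ℕ.≤? m) b)) (*-identityˡ (f k))))

  -- Harmonic sums and an approximate logarithm

  H : ℕ → ℚ
  H n = sum n inv

  H-block : ∀ j a → 1 ℕ.≤ a → H (suc j ℕ.* a) - H (j ℕ.* a) ≡ sum a (λ i → inv (j ℕ.* a ℕ.+ i))
  H-block j a _ = trans (cong (λ t → H t - H (j ℕ.* a)) (ℕ.+-comm a (j ℕ.* a))) (trans (cong (_- H (j ℕ.* a)) (sum-split (j ℕ.* a) a inv)) (lem (H (j ℕ.* a)) (sum a (λ i → inv (j ℕ.* a ℕ.+ i)))))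
    where
    lem : ∀ a b → (a + b) - a ≡ b
    lem = solve-∀ ℚ-ring

  a*inv[ja] : ∀ j a → 1 ℕ.≤ j → 1 ℕ.≤ a → ι a * inv (j ℕ.* a) ≡ inv j
  a*inv[ja] j a 1≤j 1≤a = trans (cong (ι a *_) (inv-* 1≤j 1≤a)) (trans (lem (ι a) (inv j) (inv a)) (trans (cong (inv j *_) (inv-r 1≤a)) (*-identityʳ _)))
    where
    lem : ∀ a b c → a * (b * c) ≡ b * (a * c)
    lem = solve-∀ ℚ-ring

  H-block-≤ : ∀ j a → 1 ℕ.≤ j → 1 ℕ.≤ a → H (suc j ℕ.* a) - H (j ℕ.* a) ≤ inv j
  H-block-≤ j a 1≤j 1≤a = subst₂ _≤_ (sym (H-block j a 1≤a)) (trans (sum-const a (inv (j ℕ.* a))) (a*inv[ja] j a 1≤j 1≤a))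
    (sum-mono a (λ i _ _ → inv-anti (ℕ.*-mono-≤ 1≤j 1≤a) (ℕ.m≤m+n (j ℕ.* a) i)))

  H-block-≥ : ∀ j a → 1 ℕ.≤ a → inv (suc j) ≤ H (suc j ℕ.* a) - H (j ℕ.* a)
  H-block-≥ j a 1≤a = subst₂ _≤_ (trans (sum-const a (inv (suc j ℕ.* a))) (a*inv[ja] (suc j) a (s≤s z≤n) 1≤a)) (sym (H-block j a 1≤a))
    (sum-mono a (λ i 1≤i i≤a → inv-anti (ℕ.≤-trans 1≤i (ℕ.m≤n+m i (j ℕ.* a))) (subst (j ℕ.* a ℕ.+ i ℕ.≤_) (ℕ.+-comm (j ℕ.* a) a) (ℕ.+-monoʳ-≤ (j ℕ.* a) i≤a))))

  stretch-≥-step : ∀ ht hM hta hMa i ht1 → ht - hM ≤ hta - hMa → i ≤ ht1 - hta → ht + i - hM ≤ ht1 - hMa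
  stretch-≥-step ht hM hta hMa i ht1 ih s = ≤-by (gap ih ⊹ gap s) (ring-≡ (ht ∷ hM ∷ hta ∷ hMa ∷ i ∷ ht1 ∷ []) (var 5 :- var 3) (var 0 :+ var 4 :- var 1 :+ (var 2 :- var 3 :- (var 0 :- var 1) :+ (var 5 :- var 2 :- var 4))) refl)

  stretch-≤-step : ∀ ht hM hta hMa j j1 m ht1 → hta - hMa ≤ ht - hM + (m - j) → ht1 - hta ≤ j → ht1 - hMa ≤ ht + j1 - hM + (m - j1)
  stretch-≤-step ht hM hta hMa j j1 m ht1 ih s = ≤-by (gap ih ⊹ gap s) (ring-≡ (ht ∷ hM ∷ hta ∷ hMa ∷ j ∷ j1 ∷ m ∷ ht1 ∷ []) (var 0 :+ var 5 :- var 1 :+ (var 6 :- var 5)) (var 7 :- var 3 :+ (var 0 :- var 1 :+ (var 6 :- var 4) :- (var 2 :- var 3) :+ (var 4 :- (var 7 :- var 2)))) refl)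

  -- The dilated range splits into blocks of `a` terms, and the block ending at j * a is at least
  -- `inv j`.
  H-stretch-≥ : ∀ M a d → 1 ℕ.≤ a → H (d ℕ.+ M) - H M ≤ H ((d ℕ.+ M) ℕ.* a) - H (M ℕ.* a)
  H-stretch-≥ M a zero 1≤a = ≤-reflexive (trans (+-inverseʳ (H M)) (sym (+-inverseʳ (H (M ℕ.* a)))))
  H-stretch-≥ M a (suc d) 1≤a = stretch-≥-step (H (d ℕ.+ M)) (H M) (H ((d ℕ.+ M) ℕ.* a)) (H (M ℕ.* a)) (inv (suc (d ℕ.+ M))) (H (suc (d ℕ.+ M) ℕ.* a))
    (H-stretch-≥ M a d 1≤a) (H-block-≥ (d ℕ.+ M) a 1≤a)

  -- A block of `a` terms after j * a is at most `inv j`, where the undilated sum has `inv (suc j)`.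
  -- The shift of the index telescopes to `inv M - inv (d + M)`.
  H-stretch-≤ : ∀ M a d → 1 ℕ.≤ M → 1 ℕ.≤ a → H ((d ℕ.+ M) ℕ.* a) - H (M ℕ.* a) ≤ H (d ℕ.+ M) - H M + (inv M - inv (d ℕ.+ M))
  H-stretch-≤ M a zero 1≤M 1≤a = ≤-reflexive (lem (H (M ℕ.* a)) (H M) (inv M))
    where
    lem : ∀ a b c → a - a ≡ b - b + (c - c)
    lem = solve-∀ ℚ-ring
  H-stretch-≤ M a (suc d) 1≤M 1≤a = stretch-≤-step (H (d ℕ.+ M)) (H M) (H ((d ℕ.+ M) ℕ.* a)) (H (M ℕ.* a)) (inv (d ℕ.+ M)) (inv (suc (d ℕ.+ M))) (inv M) (H (suc (d ℕ.+ M) ℕ.* a))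
    (H-stretch-≤ M a d 1≤M 1≤a) (H-block-≤ (d ℕ.+ M) a (ℕ.≤-trans 1≤M (ℕ.m≤n+m M d)) 1≤a)

  -- ℓ M n is the Riemann sum of 1/t over (1, n] with mesh 1/M, an approximation of log n.
  ℓ : ℕ → ℕ → ℚ
  ℓ M n = H (n ℕ.* M) - H M

  ℓ-step-≤ : ∀ M n → 1 ℕ.≤ M → 1 ℕ.≤ n → ℓ M (suc n) ≤ ℓ M n + inv n
  ℓ-step-≤ M n 1≤M 1≤n = lem (H (suc n ℕ.* M)) (H (n ℕ.* M)) (H M) (inv n) (H-block-≤ n M 1≤n 1≤M)
    where
    lem : ∀ a b c i → a - b ≤ i → a - c ≤ b - c + i
    lem a b c i p = ≤-by (gap p) (ring-≡ (a ∷ b ∷ c ∷ i ∷ []) (var 1 :- var 2 :+ var 3) (var 0 :- var 2 :+ (var 3 :- (var 0 :- var 1))) refl)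

  ℓ-step-≥ : ∀ M n → 1 ℕ.≤ M → ℓ M n + inv (suc n) ≤ ℓ M (suc n)
  ℓ-step-≥ M n 1≤M = lem (H (suc n ℕ.* M)) (H (n ℕ.* M)) (H M) (inv (suc n)) (H-block-≥ n M 1≤M)
    where
    lem : ∀ a b c i → i ≤ a - b → b - c + i ≤ a - c
    lem a b c i p = ≤-by (gap p) (ring-≡ (a ∷ b ∷ c ∷ i ∷ []) (var 0 :- var 2) (var 1 :- var 2 :+ var 3 :+ (var 0 :- var 1 :- var 3)) refl)

  ℓ-1 : ∀ M → ℓ M 1 ≡ 0ℚ
  ℓ-1 M = trans (cong (λ t → H t - H M) (ℕ.*-identityˡ M)) (+-inverseʳ (H M))

  module _ (M a b : ℕ) (1≤M : 1 ℕ.≤ M) (1≤a : 1 ℕ.≤ a) (1≤b : 1 ℕ.≤ b) where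
    private
      d = b ℕ.* M ℕ.∸ M
      dM : d ℕ.+ M ≡ b ℕ.* M
      dM = ℕ.m∸n+n≡m (ℕ.m≤n*m M b {{ℕ.>-nonZero 1≤b}})
      e1 : (d ℕ.+ M) ℕ.* a ≡ (a ℕ.* b) ℕ.* M
      e1 = trans (cong (ℕ._* a) dM) (lem b M a)
        where
        lem : ∀ b M a → b ℕ.* M ℕ.* a ≡ a ℕ.* b ℕ.* M
        lem = solveℕ-∀
      e2 = ℕ.*-comm M a

    -- The part of the Riemann sum over (a, ab] is the dilation by `a` of the part over (1, b], so
    -- the two stretch bounds make `ℓ` additive up to the mesh.
    ℓ-*-≥ : ℓ M a + ℓ M b ≤ ℓ M (a ℕ.* b)
    ℓ-*-≥ = lem (H (a ℕ.* M)) (H M) (H (b ℕ.* M)) (H (a ℕ.* b ℕ.* M))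
      (subst₂ (λ s t → H s - H M ≤ H t - H (a ℕ.* M)) dM e1 (subst (λ t → H (d ℕ.+ M) - H M ≤ H ((d ℕ.+ M) ℕ.* a) - H t) e2 (H-stretch-≥ M a d 1≤a)))
      where
      lem : ∀ p m q r → q - m ≤ r - p → p - m + (q - m) ≤ r - m
      lem p m q r h1 = ≤-by (gap h1) (ring-≡ (p ∷ m ∷ q ∷ r ∷ []) (var 3 :- var 1) (var 0 :- var 1 :+ (var 2 :- var 1) :+ (var 3 :- var 0 :- (var 2 :- var 1))) refl)

    ℓ-*-≤ : ℓ M (a ℕ.* b) ≤ ℓ M a + ℓ M b + inv M
    ℓ-*-≤ = lem (H (a ℕ.* M)) (H M) (H (b ℕ.* M)) (H (a ℕ.* b ℕ.* M)) (inv M) (inv (b ℕ.* M)) (inv≥0 (b ℕ.* M))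
      (subst₂ (λ s t → H s - H (a ℕ.* M) ≤ H t - H M + (inv M - inv t)) e1 dM (subst (λ t → H ((d ℕ.+ M) ℕ.* a) - H t ≤ H (d ℕ.+ M) - H M + (inv M - inv (d ℕ.+ M))) e2 (H-stretch-≤ M a d 1≤M 1≤a)))
      where
      lem : ∀ p m q r i j → 0ℚ ≤ j → r - p ≤ q - m + (i - j) → r - m ≤ p - m + (q - m) + i
      lem p m q r i j h0 h1 = ≤-by (h0 ⊹ gap h1) (ring-≡ (p ∷ m ∷ q ∷ r ∷ i ∷ j ∷ []) (var 0 :- var 1 :+ (var 2 :- var 1) :+ var 4) (var 3 :- var 1 :+ (var 5 :+ (var 2 :- var 1 :+ (var 4 :- var 5) :- (var 3 :- var 0)))) refl)

  -- Prime factors and valuations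

  1≤prime : ∀ {p} → Prime p → 1 ℕ.≤ p
  1≤prime pp = ℕ.>-nonZero⁻¹ _ {{prime⇒nonZero pp}}

  2≤prime : ∀ {p} → Prime p → 2 ℕ.≤ p
  2≤prime pp = ℕ.nonTrivial⇒n>1 _ {{prime⇒nonTrivial pp}}

  1≤^ : ∀ p n → 1 ℕ.≤ p → 1 ℕ.≤ p ℕ.^ n
  1≤^ p n 1≤p = ℕ.m^n>0 p {{ℕ.>-nonZero 1≤p}} n

  n<p^n : ∀ p n → 2 ℕ.≤ p → n ℕ.< p ℕ.^ n
  n<p^n p zero 2≤p = s≤s z≤n
  n<p^n p (suc n) 2≤p = ℕ.≤-trans (ℕ.+-mono-≤ (ℕ.≤-trans (s≤s z≤n) (n<p^n p n 2≤p)) (n<p^n p n 2≤p))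
    (ℕ.≤-trans (ℕ.≤-reflexive (cong (p ℕ.^ n ℕ.+_) (sym (ℕ.+-identityʳ _)))) (ℕ.*-monoˡ-≤ (p ℕ.^ n) 2≤p))

  prime-divisor : ∀ n → 2 ℕ.≤ n → ∃ λ p → ∃ λ m → Prime p × n ≡ p ℕ.* m
  prime-divisor n 2≤n with factorise n {{ℕ.>-nonZero (ℕ.≤-trans (s≤s z≤n) 2≤n)}}
  ... | record { factors = [] ; isFactorisation = e ; factorsPrime = _ } = ⊥-elim (ℕ.<⇒≱ 2≤n (ℕ.≤-reflexive e))
  ... | record { factors = p ∷ ps ; isFactorisation = e ; factorsPrime = pp ∷ _ } = p , _ , pp , e

  1≤-factorʳ : ∀ m {n k} → 1 ℕ.≤ k → k ≡ m ℕ.* n → 1 ℕ.≤ n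
  1≤-factorʳ m {zero} 1≤k e = subst (1 ℕ.≤_) (trans e (ℕ.*-zeroʳ m)) 1≤k
  1≤-factorʳ m {suc n} _ _ = s≤s z≤n

  factor< : ∀ p {m n} → 2 ℕ.≤ p → 1 ℕ.≤ n → n ≡ p ℕ.* m → m ℕ.< n
  factor< p {m} 2≤p 1≤n e = subst (m ℕ.<_) (sym e) (ℕ.≤-trans (ℕ.≤-reflexive (sym (ℕ.+-comm m 1))) (ℕ.≤-trans (ℕ.+-monoʳ-≤ m (1≤-factorʳ p 1≤n e)) (ℕ.≤-trans (ℕ.≤-reflexive (cong (m ℕ.+_) (sym (ℕ.+-identityʳ m)))) (ℕ.*-monoˡ-≤ m 2≤p))))

  extract-power : ∀ p → Prime p → ∀ m → 1 ℕ.≤ m → ∃ λ i → ∃ λ u → m ≡ p ℕ.^ i ℕ.* u × p ∤ u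
  extract-power p pp = <-rec _ go
    where
    go : ∀ m → (∀ {k} → k ℕ.< m → 1 ℕ.≤ k → ∃ λ i → ∃ λ u → k ≡ p ℕ.^ i ℕ.* u × p ∤ u) → 1 ℕ.≤ m → ∃ λ i → ∃ λ u → m ≡ p ℕ.^ i ℕ.* u × p ∤ u
    go m rec 1≤m with p ∣? m
    ... | no p∤m = 0 , m , sym (ℕ.*-identityˡ m) , p∤m
    ... | yes p∣m with rec (factor< p (2≤prime pp) 1≤m (m∣n⇒n≡m*quotient p∣m)) (1≤-factorʳ p 1≤m (m∣n⇒n≡m*quotient p∣m))
    ...   | i , u , e , p∤u = suc i , u , trans (m∣n⇒n≡m*quotient p∣m) (trans (cong (p ℕ.*_) e) (sym (ℕ.*-assoc p (p ℕ.^ i) u))) , p∤u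

  -- The p-adic valuation of m, counted as the number of exponents a ≤ N with p^a ∣ m.
  val : ℕ → ℕ → ℕ → ℚ
  val N p m = sum N (λ a → 𝟙 (p ℕ.^ a ∣? m))

  p^a∣p^i*u⇒a≤i : ∀ p a i u → Prime p → p ∤ u → p ℕ.^ a ∣ p ℕ.^ i ℕ.* u → a ℕ.≤ i
  p^a∣p^i*u⇒a≤i p a i u pp p∤u h with ℕ.≤-<-connex a i
  ... | inj₁ q = q
  ... | inj₂ i<a = ⊥-elim (p∤u (*-cancelˡ-∣ (p ℕ.^ i) {{ℕ.m^n≢0 p i {{prime⇒nonZero pp}}}}
      (subst (_∣ p ℕ.^ i ℕ.* u) (ℕ.*-comm p (p ℕ.^ i)) (∣-trans pow h))))
    where
    pow : p ℕ.^ suc i ∣ p ℕ.^ a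
    pow = subst (p ℕ.^ suc i ∣_) (trans (sym (ℕ.^-distribˡ-+-* p (suc i) (a ℕ.∸ suc i))) (cong (p ℕ.^_) (ℕ.m+[n∸m]≡n i<a))) (m∣m*n _)

  a≤i⇒p^a∣p^i*u : ∀ p {a i} u → a ℕ.≤ i → p ℕ.^ a ∣ p ℕ.^ i ℕ.* u
  a≤i⇒p^a∣p^i*u p {a} {i} u a≤i = ∣m⇒∣m*n u (subst (p ℕ.^ a ∣_) (trans (sym (ℕ.^-distribˡ-+-* p a (i ℕ.∸ a))) (cong (p ℕ.^_) (ℕ.m+[n∸m]≡n a≤i))) (m∣m*n _))

  val-≡ : ∀ N p i u → Prime p → p ∤ u → i ℕ.≤ N → val N p (p ℕ.^ i ℕ.* u) ≡ ι i
  val-≡ N p i u pp p∤u i≤N = trans (sum-cong N (λ a _ _ → trans (𝟙-⇔ (p ℕ.^ a ∣? p ℕ.^ i ℕ.* u) (a ℕ.≤? i) (p^a∣p^i*u⇒a≤i p a i u pp p∤u) (a≤i⇒p^a∣p^i*u p u)) (sym (*-identityʳ _))))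
    (trans (sum-≤? N i (λ _ → 1ℚ) i≤N) (trans (sum-const i 1ℚ) (*-identityʳ _)))

  i≤p^i*u : ∀ p i u {m} → Prime p → 1 ℕ.≤ m → m ≡ p ℕ.^ i ℕ.* u → i ℕ.≤ m
  i≤p^i*u p i u pp 1≤m e = ℕ.≤-trans (ℕ.<⇒≤ (n<p^n p i (2≤prime pp))) (subst (p ℕ.^ i ℕ.≤_) (sym e) (ℕ.m≤m*n (p ℕ.^ i) u {{ℕ.>-nonZero (1≤-factorʳ (p ℕ.^ i) 1≤m e)}}))

  -- The count in `val` stops at exponent N. The bound on the product keeps all exponents below that
  -- cut, since an exponent never exceeds the number it divides (`i≤p^i*u`).
  val-* : ∀ N p m n → Prime p → 1 ℕ.≤ m → 1 ℕ.≤ n → m ℕ.* n ℕ.≤ N → val N p (m ℕ.* n) ≡ val N p m + val N p n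
  val-* N p m n pp 1≤m 1≤n mn≤N with extract-power p pp m 1≤m | extract-power p pp n 1≤n
  ... | i , u , em , p∤u | j , w , en , p∤w = trans (cong (val N p) emn) (trans (val-≡ N p (i ℕ.+ j) (u ℕ.* w) pp p∤uw (ℕ.≤-trans (i≤p^i*u p (i ℕ.+ j) (u ℕ.* w) pp (ℕ.*-mono-≤ 1≤m 1≤n) emn) mn≤N))
      (trans (ι-+ i j) (sym (cong₂ _+_ (trans (cong (val N p) em) (val-≡ N p i u pp p∤u (ℕ.≤-trans (i≤p^i*u p i u pp 1≤m em) m≤N)))
        (trans (cong (val N p) en) (val-≡ N p j w pp p∤w (ℕ.≤-trans (i≤p^i*u p j w pp 1≤n en) n≤N)))))))
    where
    m≤N : m ℕ.≤ N
    m≤N = ℕ.≤-trans (ℕ.m≤m*n m n {{ℕ.>-nonZero 1≤n}}) mn≤N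
    n≤N : n ℕ.≤ N
    n≤N = ℕ.≤-trans (ℕ.m≤n*m n m {{ℕ.>-nonZero 1≤m}}) mn≤N
    emn : m ℕ.* n ≡ p ℕ.^ (i ℕ.+ j) ℕ.* (u ℕ.* w)
    emn = trans (cong₂ ℕ._*_ em en) (trans (lem (p ℕ.^ i) u (p ℕ.^ j) w) (cong (ℕ._* (u ℕ.* w)) (sym (ℕ.^-distribˡ-+-* p i j))))
      where
      lem : ∀ a b c d → a ℕ.* b ℕ.* (c ℕ.* d) ≡ a ℕ.* c ℕ.* (b ℕ.* d)
      lem = solveℕ-∀
    p∤uw : p ∤ u ℕ.* w
    p∤uw d with euclidsLemma u w pp d
    ... | inj₁ a = p∤u a
    ... | inj₂ b = p∤w b

  prime∣prime : ∀ {p q} → Prime p → Prime q → p ∣ q → p ≡ q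
  prime∣prime pp pq d with prime⇒irreducible pq d
  ... | inj₁ refl = ⊥-elim (ℕ.<⇒≱ (2≤prime pp) ℕ.≤-refl)
  ... | inj₂ e = e

  val-prime : ∀ N p q → Prime p → Prime q → q ℕ.≤ N → val N p q ≡ 𝟙 (p ℕ.≟ q)
  val-prime N p q pp pq q≤N with p ℕ.≟ q
  ... | yes refl = trans (cong (val N p) (trans (sym (ℕ.*-identityʳ p)) (cong (ℕ._* 1) (sym (ℕ.*-identityʳ p))))) (trans (val-≡ N p 1 1 pp (λ d → ℕ.<⇒≱ (2≤prime pp) (∣⇒≤ d)) (ℕ.≤-trans (1≤prime pp) q≤N)) ι-1)
  ... | no p≢q = trans (cong (val N p) (sym (ℕ.*-identityˡ q))) (trans (val-≡ N p 0 q pp (λ d → p≢q (prime∣prime pp pq d)) z≤n) ι-0)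

  -- Sums over multiples and Möbius inversion

  Supp : ℕ → (ℕ → ℚ) → Set
  Supp x h = ∀ k → x ℕ.< k → h k ≡ 0ℚ

  Supp-* : ∀ {x h} d → 1 ℕ.≤ d → Supp x h → Supp x (λ e → h (d ℕ.* e))
  Supp-* d 1≤d s k x<k = s (d ℕ.* k) (ℕ.<-≤-trans x<k (ℕ.m≤n*m k d {{ℕ.>-nonZero 1≤d}}))

  sum-multiples : ∀ d n (h : ℕ → ℚ) → 1 ℕ.≤ d → sum (n ℕ.* d) (λ m → 𝟙 (d ∣? m) * h m) ≡ sum n (λ e → h (d ℕ.* e))
  sum-multiples d zero h 1≤d = refl
  sum-multiples d (suc n) h 1≤d = trans (cong (λ t → sum t f) (ℕ.+-comm d (n ℕ.* d))) (trans (sum-split (n ℕ.* d) d f)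
    (cong₂ _+_ (sum-multiples d n h 1≤d) (trans (sum-single d d _ 1≤d ℕ.≤-refl off) last)))
    where
    f = λ m → 𝟙 (d ∣? m) * h m
    nd+d : n ℕ.* d ℕ.+ d ≡ d ℕ.* suc n
    nd+d = lem n d
      where
      lem : ∀ n d → n ℕ.* d ℕ.+ d ≡ d ℕ.* suc n
      lem = solveℕ-∀
    last : f (n ℕ.* d ℕ.+ d) ≡ h (d ℕ.* suc n)
    last = trans (cong f nd+d) (trans (cong (_* h (d ℕ.* suc n)) (𝟙-yes (d ∣? d ℕ.* suc n) (m∣m*n (suc n)))) (*-identityˡ _))
    off : ∀ k → 1 ℕ.≤ k → k ℕ.≤ d → k ≢ d → f (n ℕ.* d ℕ.+ k) ≡ 0ℚ
    off k 1≤k k≤d k≢d = trans (cong (_* h (n ℕ.* d ℕ.+ k)) (𝟙-no (d ∣? n ℕ.* d ℕ.+ k) (λ d∣ → k≢d (ℕ.≤-antisym k≤d (∣⇒≤ {{ℕ.>-nonZero 1≤k}} (∣m+n∣m⇒∣n d∣ (n∣m*n n)))))))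
      (*-zeroˡ (h (n ℕ.* d ℕ.+ k)))

  -- As `h` vanishes beyond x, the cofactor e may run up to x instead of x / d. This lets all sums
  -- of the inversion share one range.
  sum-dilate : ∀ d x h → 1 ℕ.≤ d → Supp x h → sum x (λ m → 𝟙 (d ∣? m) * h m) ≡ sum x (λ e → h (d ℕ.* e))
  sum-dilate d x h 1≤d s = trans (sym (sum-ext _ (ℕ.m≤m*n x d {{ℕ.>-nonZero 1≤d}}) (λ k a _ → trans (cong (𝟙 (d ∣? k) *_) (s k a)) (*-zeroʳ (𝟙 (d ∣? k)))))) (sum-multiples d x h 1≤d)

  -- The Möbius function restricted to P-smooth numbers, and below it the indicator of the numbers without
  -- prime factors ≤ P; both are obtained by sieving with one prime at a time.
  μ : ℕ → ℕ → ℚ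
  μ zero n = 𝟙 (n ℕ.≟ 1)
  μ (suc P) n = μ P n - 𝟙 (prime? (suc P)) * (𝟙 (suc P ∣? n) * μ P (n ℕ./ suc P))

  sift : ℕ → ℕ → ℚ
  sift zero m = 1ℚ
  sift (suc P) m = sift P m - 𝟙 (prime? (suc P)) * (𝟙 (suc P ∣? m) * sift P m)

  sift-1 : ∀ P → sift P 1 ≡ 1ℚ
  sift-1 zero = refl
  sift-1 (suc P) with prime? (suc P) | suc P ∣? 1
  ... | no _ | d = trans (lem (sift P 1) (𝟙 d * sift P 1)) (sift-1 P)
    where
    lem : ∀ a b → a - 0ℚ * b ≡ a
    lem = solve-∀ ℚ-ring
  ... | yes pp | yes d = ⊥-elim (ℕ.<⇒≱ (2≤prime pp) (∣⇒≤ d))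
  ... | yes pp | no _ = trans (lem (sift P 1)) (sift-1 P)
    where
    lem : ∀ a → a - 1ℚ * (0ℚ * a) ≡ a
    lem = solve-∀ ℚ-ring

  sift-0 : ∀ P m p → Prime p → p ∣ m → p ℕ.≤ P → sift P m ≡ 0ℚ
  sift-0 zero m p pp d p≤P = ⊥-elim (ℕ.<⇒≱ (1≤prime pp) p≤P)
  sift-0 (suc P) m p pp d p≤P with ℕ.m≤n⇒m<n∨m≡n p≤P
  ... | inj₁ (s≤s q) = trans (cong (λ t → t - 𝟙 (prime? (suc P)) * (𝟙 (suc P ∣? m) * t)) (sift-0 P m p pp d q)) (lem (𝟙 (prime? (suc P))) (𝟙 (suc P ∣? m)))
    where
    lem : ∀ a b → 0ℚ - a * (b * 0ℚ) ≡ 0ℚ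
    lem = solve-∀ ℚ-ring
  ... | inj₂ refl = trans (cong₂ (λ s t → sift P m - s * (t * sift P m)) (𝟙-yes (prime? (suc P)) pp) (𝟙-yes (suc P ∣? m) d)) (lem (sift P m))
    where
    lem : ∀ a → a - 1ℚ * (1ℚ * a) ≡ 0ℚ
    lem = solve-∀ ℚ-ring

  sift-prime* : ∀ P q e → Prime q → P ℕ.< q → sift P (q ℕ.* e) ≡ sift P e
  sift-prime* zero q e pq P<q = refl
  sift-prime* (suc P) q e pq P<q = term (prime? (suc P))
    where
    ih = sift-prime* P q e pq (ℕ.<-trans (ℕ.n<1+n P) P<q)
    term : (d : Dec (Prime (suc P))) → sift P (q ℕ.* e) - 𝟙 d * (𝟙 (suc P ∣? q ℕ.* e) * sift P (q ℕ.* e)) ≡ sift P e - 𝟙 d * (𝟙 (suc P ∣? e) * sift P e)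
    term (no _) = trans (lem (sift P (q ℕ.* e)) (𝟙 (suc P ∣? q ℕ.* e) * sift P (q ℕ.* e))) (trans ih (sym (lem (sift P e) (𝟙 (suc P ∣? e) * sift P e))))
      where
      lem : ∀ a b → a - 0ℚ * b ≡ a
      lem = solve-∀ ℚ-ring
    term (yes pp) = cong₂ (λ s t → t - 1ℚ * (s * t)) (𝟙-⇔ (suc P ∣? q ℕ.* e) (suc P ∣? e) fwd (∣n⇒∣m*n q)) ih
      where
      fwd : suc P ∣ q ℕ.* e → suc P ∣ e
      fwd d with euclidsLemma q e pp d
      ... | inj₂ r = r
      ... | inj₁ r = ⊥-elim (ℕ.<⇒≢ P<q (prime∣prime pp pq r))

  μ-sift-0 : ∀ x (F : ℕ → ℚ) → sum x (λ n → μ 0 n * sum x (λ m → F (n ℕ.* m))) ≡ sum x (λ m → sift 0 m * F m)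
  μ-sift-0 zero F = refl
  μ-sift-0 (suc y) F = trans (sum-single (suc y) 1 _ ℕ.≤-refl (s≤s z≤n) (λ k _ _ k≢1 → trans (cong (_* sum (suc y) (λ m → F (k ℕ.* m))) (𝟙-no (k ℕ.≟ 1) k≢1)) (*-zeroˡ (sum (suc y) (λ m → F (k ℕ.* m))))))
      (trans (*-identityˡ (sum (suc y) (λ m → F (1 ℕ.* m)))) (sum-cong (suc y) (λ m _ _ → trans (cong F (ℕ.*-identityˡ m)) (sym (*-identityˡ (F m))))))

  module _ (x : ℕ) where
    private
      1≤suc : ∀ {n} → 1 ℕ.≤ suc n
      1≤suc = s≤s z≤n

    μ-sum-step : ∀ P g → Supp x g → sum x (λ n → μ (suc P) n * g n) ≡ sum x (λ n → μ P n * g n) - 𝟙 (prime? (suc P)) * sum x (λ e → μ P e * g (suc P ℕ.* e))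
    μ-sum-step P g s = trans (sum-cong x (λ n _ _ → lem (μ P n) (𝟙 (prime? (suc P))) (𝟙 (suc P ∣? n)) (μ P (n ℕ./ suc P)) (g n)))
      (trans (sum-- x (λ n → μ P n * g n) (λ n → 𝟙 (prime? (suc P)) * (𝟙 (suc P ∣? n) * h n)))
        (cong (λ t → sum x (λ n → μ P n * g n) - t) (trans (sum-*ˡ x (𝟙 (prime? (suc P))) (λ n → 𝟙 (suc P ∣? n) * h n))
          (cong (𝟙 (prime? (suc P)) *_) (trans (sum-dilate (suc P) x h 1≤suc (λ k a → trans (cong (μ P (k ℕ./ suc P) *_) (s k a)) (*-zeroʳ (μ P (k ℕ./ suc P)))))
            (sum-cong x (λ e _ _ → cong (λ t → μ P t * g (suc P ℕ.* e)) (trans (cong (ℕ._/ suc P) (ℕ.*-comm (suc P) e)) (ℕ.m*n/n≡m e (suc P))))))))))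
      where
      h = λ m → μ P (m ℕ./ suc P) * g m
      lem : ∀ a b c d g → (a - b * (c * d)) * g ≡ a * g - b * (c * (d * g))
      lem = solve-∀ ℚ-ring

    sift-sum-step : ∀ P F → Supp x F → sum x (λ m → sift (suc P) m * F m) ≡ sum x (λ m → sift P m * F m) - 𝟙 (prime? (suc P)) * sum x (λ m → sift P (suc P ℕ.* m) * F (suc P ℕ.* m))
    sift-sum-step P F s = trans (sum-cong x (λ m _ _ → lem (sift P m) (𝟙 (prime? (suc P))) (𝟙 (suc P ∣? m)) (F m)))
      (trans (sum-- x (λ m → sift P m * F m) (λ m → 𝟙 (prime? (suc P)) * (𝟙 (suc P ∣? m) * (sift P m * F m))))
        (cong (λ t → sum x (λ n → sift P n * F n) - t) (trans (sum-*ˡ x (𝟙 (prime? (suc P))) (λ m → 𝟙 (suc P ∣? m) * (sift P m * F m)))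
          (cong (𝟙 (prime? (suc P)) *_) (sum-dilate (suc P) x (λ m → sift P m * F m) 1≤suc (λ k a → trans (cong (sift P k *_) (s k a)) (*-zeroʳ (sift P k))))))))
      where
      lem : ∀ a b c g → (a - b * (c * a)) * g ≡ a * g - b * (c * (a * g))
      lem = solve-∀ ℚ-ring

    Supp-sum : ∀ F → Supp x F → Supp x (λ n → sum x (λ m → F (n ℕ.* m)))
    Supp-sum F s k x<k = trans (sum-cong x (λ m a _ → s (k ℕ.* m) (ℕ.<-≤-trans x<k (ℕ.m≤m*n k m {{ℕ.>-nonZero a}})))) (sum-0 x)

    -- Induction on P. Passing to a prime q = suc P subtracts on both sides the identity for k ↦ F
    -- (q k), because `sift P` does not see the factor q (`sift-prime*`).
    μ-sift : ∀ P F → Supp x F → sum x (λ n → μ P n * sum x (λ m → F (n ℕ.* m))) ≡ sum x (λ m → sift P m * F m)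
    μ-sift zero F s = μ-sift-0 x F
    μ-sift (suc P) F s = trans (μ-sum-step P (λ n → sum x (λ m → F (n ℕ.* m))) (Supp-sum F s))
      (trans (cong₂ _-_ (μ-sift P F s) (part (prime? (suc P)))) (sym (sift-sum-step P F s)))
      where
      q = suc P
      part : (d : Dec (Prime q)) → 𝟙 d * sum x (λ e → μ P e * sum x (λ m → F (q ℕ.* e ℕ.* m))) ≡ 𝟙 d * sum x (λ m → sift P (q ℕ.* m) * F (q ℕ.* m))
      part (no _) = trans (*-zeroˡ (sum x (λ e → μ P e * sum x (λ m → F (q ℕ.* e ℕ.* m))))) (sym (*-zeroˡ (sum x (λ m → sift P (q ℕ.* m) * F (q ℕ.* m)))))
      part (yes pq) = cong (1ℚ *_) (trans (sum-cong x (λ e _ _ → cong (μ P e *_) (sum-cong x (λ m _ _ → cong F (ℕ.*-assoc q e m)))))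
        (trans (μ-sift P (λ k → F (q ℕ.* k)) (Supp-* q 1≤suc s)) (sum-cong x (λ m _ _ → cong (_* F (q ℕ.* m)) (sym (sift-prime* P q m pq ℕ.≤-refl))))))

    -- After sifting by all primes up to x only m = 1 survives in [1, x].
    möbius-inversion : ∀ F → 1 ℕ.≤ x → Supp x F → sum x (λ n → μ x n * sum x (λ m → F (n ℕ.* m))) ≡ F 1
    möbius-inversion F 1≤x s = trans (μ-sift x F s) (trans (sum-single x 1 _ ℕ.≤-refl 1≤x off) (trans (cong (_* F 1) (sift-1 x)) (*-identityˡ (F 1))))
      where
      off : ∀ k → 1 ℕ.≤ k → k ℕ.≤ x → k ≢ 1 → sift x k * F k ≡ 0ℚ
      off k 1≤k k≤x k≢1 with prime-divisor k (ℕ.≤∧≢⇒< 1≤k (λ e → k≢1 (sym e)))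
      ... | p , m , pp , e = trans (cong (_* F k) (sift-0 x k p pp p∣k (ℕ.≤-trans (∣⇒≤ {{ℕ.>-nonZero 1≤k}} p∣k) k≤x))) (*-zeroˡ (F k))
        where
        p∣k : p ∣ k
        p∣k = subst (p ∣_) (sym e) (m∣m*n m)

  -- At a multiple of q = suc P this kills the first term of the recursion for `μ`, so that the two
  -- terms never add up and `μ-unit` follows.
  μ-0 : ∀ P n p → 1 ℕ.≤ n → Prime p → P ℕ.< p → p ∣ n → μ P n ≡ 0ℚ
  μ-0 zero n p 1≤n pp P<p d = 𝟙-no (n ℕ.≟ 1) (λ { refl → ℕ.<⇒≱ (2≤prime pp) (∣⇒≤ d) })
  μ-0 (suc P) n p 1≤n pp P<p d = trans (cong₂ _-_ (μ-0 P n p 1≤n pp (ℕ.<-trans (ℕ.n<1+n P) P<p) d) (term (prime? (suc P)) (suc P ∣? n))) refl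
    where
    term : (c : Dec (Prime (suc P))) (e : Dec (suc P ∣ n)) → 𝟙 c * (𝟙 e * μ P (n ℕ./ suc P)) ≡ 0ℚ
    term (no _) e = *-zeroˡ (𝟙 e * μ P (n ℕ./ suc P))
    term (yes _) (no _) = trans (cong (1ℚ *_) (*-zeroˡ (μ P (n ℕ./ suc P)))) refl
    term (yes pq) (yes e) = cong (λ t → 1ℚ * (1ℚ * t)) (μ-0 P (n ℕ./ suc P) p 1≤n/q pp (ℕ.<-trans (ℕ.n<1+n P) P<p) p∣n/q)
      where
      1≤n/q : 1 ℕ.≤ n ℕ./ suc P
      1≤n/q = 1≤-factorʳ (suc P) 1≤n (sym (ℕ.m*[n/m]≡n e))
      p∣n/q : p ∣ n ℕ./ suc P
      p∣n/q with euclidsLemma (suc P) (n ℕ./ suc P) pp (subst (p ∣_) (sym (ℕ.m*[n/m]≡n e)) d)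
      ... | inj₂ r = r
      ... | inj₁ r = ⊥-elim (ℕ.<⇒≢ P<p (sym (prime∣prime pp pq r)))

  Unit : ℚ → Set
  Unit a = (- 1ℚ ≤ a) × (a ≤ 1ℚ)

  μ-unit : ∀ P n → 1 ℕ.≤ n → Unit (μ P n)
  μ-unit zero n _ with n ℕ.≟ 1
  ... | yes _ = ≤-trans (neg-antimono-≤ (lit 1ℚ)) (lit 1ℚ) , ≤-refl
  ... | no _ = neg-antimono-≤ (lit 1ℚ) , lit 1ℚ
  μ-unit (suc P) n 1≤n = term (prime? (suc P)) (suc P ∣? n)
    where
    term : (c : Dec (Prime (suc P))) (e : Dec (suc P ∣ n)) → Unit (μ P n - 𝟙 c * (𝟙 e * μ P (n ℕ./ suc P)))
    term (no _) e = subst Unit (lem (μ P n) (𝟙 e * μ P (n ℕ./ suc P))) (μ-unit P n 1≤n)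
      where
      lem : ∀ a b → a ≡ a - 0ℚ * b
      lem = solve-∀ ℚ-ring
    term (yes _) (no _) = subst Unit (lem (μ P n) (μ P (n ℕ./ suc P))) (μ-unit P n 1≤n)
      where
      lem : ∀ a b → a ≡ a - 1ℚ * (0ℚ * b)
      lem = solve-∀ ℚ-ring
    term (yes pq) (yes e) = subst Unit (cong (_- 1ℚ * (1ℚ * b)) (sym (μ-0 P n (suc P) 1≤n pq ℕ.≤-refl e))) (lem₁ b (proj₂ ih) , lem₂ b (proj₁ ih))
      where
      b = μ P (n ℕ./ suc P)
      ih = μ-unit P (n ℕ./ suc P) (1≤-factorʳ (suc P) 1≤n (sym (ℕ.m*[n/m]≡n e)))
      lem₁ : ∀ b → b ≤ 1ℚ → (- 1ℚ) ≤ 0ℚ - 1ℚ * (1ℚ * b)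
      lem₁ b p = ≤-by (gap p) (ring-≡ (b ∷ []) (nat 0 :- nat 1 :* (nat 1 :* var 0)) ((:- nat 1) :+ (nat 1 :- var 0)) refl)
      lem₂ : ∀ b → (- 1ℚ) ≤ b → 0ℚ - 1ℚ * (1ℚ * b) ≤ 1ℚ
      lem₂ b p = ≤-by (gap p) (ring-≡ (b ∷ []) (nat 1) (nat 0 :- nat 1 :* (nat 1 :* var 0) :+ (var 0 :- (:- nat 1))) refl)

  -- Integer quotients and elementary estimates

  infixl 7 _⫽_
  _⫽_ : ℕ → ℕ → ℕ
  x ⫽ zero = 0
  x ⫽ suc k = x ℕ./ suc k

  *⫽≤ : ∀ x k → k ℕ.* (x ⫽ k) ℕ.≤ x
  *⫽≤ x zero = z≤n
  *⫽≤ x (suc k) = subst (ℕ._≤ x) (ℕ.*-comm (x ℕ./ suc k) (suc k)) (ℕ.m/n*n≤m x (suc k))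

  <*suc⫽ : ∀ x k → 1 ℕ.≤ k → x ℕ.< k ℕ.* suc (x ⫽ k)
  <*suc⫽ x (suc k) _ = subst₂ ℕ._<_ (sym (ℕ.m≡m%n+[m/n]*n x (suc k))) (trans (cong (suc k ℕ.+_) (ℕ.*-comm (x ℕ./ suc k) (suc k))) (sym (ℕ.*-suc (suc k) (x ℕ./ suc k))))
    (ℕ.+-monoˡ-< (x ℕ./ suc k ℕ.* suc k) (ℕ.m%n<n x (suc k)))

  *≤⇒≤⫽ : ∀ {x k m} → 1 ℕ.≤ k → k ℕ.* m ℕ.≤ x → m ℕ.≤ x ⫽ k
  *≤⇒≤⫽ {x} {k} {m} 1≤k h = ℕ.≤-pred (ℕ.*-cancelˡ-< k m (suc (x ⫽ k)) (ℕ.≤-<-trans h (<*suc⫽ x k 1≤k)))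

  ≤⫽⇒*≤ : ∀ {x k m} → m ℕ.≤ x ⫽ k → k ℕ.* m ℕ.≤ x
  ≤⫽⇒*≤ {x} {k} h = ℕ.≤-trans (ℕ.*-monoʳ-≤ k h) (*⫽≤ x k)

  ⫽-⫽ : ∀ x {n m} → 1 ℕ.≤ n → 1 ℕ.≤ m → x ⫽ n ⫽ m ≡ x ⫽ (n ℕ.* m)
  ⫽-⫽ x {suc n} {suc m} _ _ = ℕ.m/n/o≡m/[n*o] x (suc n) (suc m)

  ⫽-mono : ∀ {x y} k → x ℕ.≤ y → x ⫽ k ℕ.≤ y ⫽ k
  ⫽-mono zero _ = z≤n
  ⫽-mono {x} {y} (suc k) h = ℕ./-monoˡ-≤ (suc k) h

  ⫽≤ : ∀ x {k} → 1 ℕ.≤ k → x ⫽ k ℕ.≤ x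
  ⫽≤ x {k} 1≤k = ℕ.≤-trans (ℕ.m≤n*m (x ⫽ k) k {{ℕ.>-nonZero 1≤k}}) (*⫽≤ x k)

  ⫽-> : ∀ {x k} → x ℕ.< k → x ⫽ k ≡ 0
  ⫽-> {x} {k} x<k = ℕ.n<1⇒n≡0 (ℕ.*-cancelˡ-< k (x ⫽ k) 1 (ℕ.≤-<-trans (*⫽≤ x k) (subst (x ℕ.<_) (sym (ℕ.*-identityʳ k)) x<k)))

  ⫽-1 : ∀ x → x ⫽ 1 ≡ x
  ⫽-1 x = ℕ.n/1≡n x

  ι⫽≤ : ∀ x k → ι (x ⫽ k) ≤ ι x * inv k
  ι⫽≤ x zero = ≤-reflexive (trans ι-0 (sym (trans (cong (ι x *_) inv-0) (*-zeroʳ (ι x)))))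
  ι⫽≤ x k@(suc _) = lem (ι (x ⫽ k)) (ι x) (ι k) (inv k) (subst (_≤ ι x) (ι-* k (x ⫽ k)) (ι-mono (*⫽≤ x k))) (inv-r (s≤s z≤n)) (inv≥0 k) (ι≥0 (x ⫽ k))
    where
    lem : ∀ a x k i → k * a ≤ x → k * i ≡ 1ℚ → 0ℚ ≤ i → 0ℚ ≤ a → a ≤ x * i
    lem a x k i p e q r = ≤-by (gap p ⊠ q ⊹ gap (≤-reflexive (sym e)) ⊠ r) (ring-≡ (a ∷ x ∷ k ∷ i ∷ []) (var 1 :* var 3) (var 0 :+ ((var 1 :- var 2 :* var 0) :* var 3 :+ (var 2 :* var 3 :- nat 1) :* var 0)) refl)

  ≤ι⫽ : ∀ x k → 1 ℕ.≤ k → ι x * inv k ≤ ι (x ⫽ k) + 1ℚ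
  ≤ι⫽ x k 1≤k = lem (ι (x ⫽ k)) (ι x) (ι k) (inv k) (subst (ι x ≤_) (trans (ι-* k (suc (x ⫽ k))) (cong (ι k *_) (ι-suc (x ⫽ k)))) (ι-mono (ℕ.<⇒≤ (<*suc⫽ x k 1≤k)))) (inv-r 1≤k) (inv≥0 k) (ι≥0 (x ⫽ k))
    where
    lem : ∀ a x k i → x ≤ k * (1ℚ + a) → k * i ≡ 1ℚ → 0ℚ ≤ i → 0ℚ ≤ a → x * i ≤ a + 1ℚ
    lem a x k i p e q r = ≤-by (gap (≤-reflexive e) ⊹ gap p ⊠ q ⊹ gap (≤-reflexive e) ⊠ r) (ring-≡ (a ∷ x ∷ k ∷ i ∷ []) (var 0 :+ nat 1) (var 1 :* var 3 :+ (nat 1 :- var 2 :* var 3 :+ (var 2 :* (nat 1 :+ var 0) :- var 1) :* var 3 :+ (nat 1 :- var 2 :* var 3) :* var 0)) refl)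

  -- The exact counterpart of Stirling's formula: with H j = log j + γ + O(1/j) it evaluates the sum
  -- of the logarithms in `T-lo` and `T-hi`.
  sum-H : ∀ y → sum y H ≡ (ι y + 1ℚ) * H y - ι y
  sum-H zero = trans (lem (ι 0) ι-0) refl
    where
    lem : ∀ a → a ≡ 0ℚ → 0ℚ ≡ (a + 1ℚ) * 0ℚ - a
    lem a e = trans (sym (cong -_ e)) (l2 a)
      where
      l2 : ∀ a → - a ≡ (a + 1ℚ) * 0ℚ - a
      l2 = solve-∀ ℚ-ring
  sum-H (suc y) = trans (cong (_+ H (suc y)) (sum-H y)) (lem (ι y) (H y) (inv (suc y)) (ι (suc y)) (ι-suc y) (inv-r (s≤s z≤n)))
    where
    lem : ∀ y h i s → s ≡ 1ℚ + y → s * i ≡ 1ℚ → (y + 1ℚ) * h - y + (h + i) ≡ (s + 1ℚ) * (h + i) - s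
    lem y h i s a b = ≤-antisym (≤-by (gap (≤-reflexive a) ⊹ gap (≤-reflexive (sym b)) ⊹ eqgap (h) (sym a)) (ring-≡ (y ∷ h ∷ i ∷ s ∷ []) ((var 3 :+ nat 1) :* (var 1 :+ var 2) :- var 3) ((var 0 :+ nat 1) :* var 1 :- var 0 :+ (var 1 :+ var 2) :+ (nat 1 :+ var 0 :- var 3 :+ (var 3 :* var 2 :- nat 1) :+ (var 3 :- (nat 1 :+ var 0)) :* var 1)) refl)) (≤-by (gap (≤-reflexive (sym a)) ⊹ gap (≤-reflexive b) ⊹ eqgap (h) a) (ring-≡ (y ∷ h ∷ i ∷ s ∷ []) ((var 0 :+ nat 1) :* var 1 :- var 0 :+ (var 1 :+ var 2)) ((var 3 :+ nat 1) :* (var 1 :+ var 2) :- var 3 :+ (var 3 :- (nat 1 :+ var 0) :+ (nat 1 :- var 3 :* var 2) :+ (nat 1 :+ var 0 :- var 3) :* var 1)) refl))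

  ≤?-cong : ∀ {a b c d} → (a ℕ.≤ b → c ℕ.≤ d) → (c ℕ.≤ d → a ℕ.≤ b) → 𝟙 (a ℕ.≤? b) ≡ 𝟙 (c ℕ.≤? d)
  ≤?-cong {a} {b} {c} {d} = 𝟙-⇔ (a ℕ.≤? b) (c ℕ.≤? d)

  count-multiples : ∀ y d → 1 ℕ.≤ d → sum y (λ e → 𝟙 (d ℕ.* e ℕ.≤? y)) ≡ ι (y ⫽ d)
  count-multiples y d 1≤d = trans (sum-cong y (λ e _ _ → trans (≤?-cong (*≤⇒≤⫽ 1≤d) (≤⫽⇒*≤ {y} {d} {e})) (sym (*-identityʳ (𝟙 (e ℕ.≤? y ⫽ d))))))
    (trans (sum-≤? y (y ⫽ d) (λ _ → 1ℚ) (⫽≤ y 1≤d)) (trans (sum-const (y ⫽ d) 1ℚ) (*-identityʳ (ι (y ⫽ d)))))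

  S1-step : ∀ s L0 L1 x t → t ≡ s + x * (L1 - L0) → s ≤ # 2 * x → x * (L1 - L0) ≤ # 2 → t ≤ # 2 * (1ℚ + x)
  S1-step s L0 L1 x t e a b = ≤-by (gap (≤-reflexive e) ⊹ gap a ⊹ gap b) (ring-≡ (s ∷ L0 ∷ L1 ∷ x ∷ t ∷ []) (nat 2 :* (nat 1 :+ var 3)) (var 4 :+ (var 0 :+ var 3 :* (var 2 :- var 1) :- var 4 :+ (nat 2 :* var 3 :- var 0) :+ (nat 2 :- var 3 :* (var 2 :- var 1)))) refl)

  -- Put d = L1 - L0. From x d ≤ 2 and x ≥ 1 also d ≤ 2, so the increment 2ds + x d² is at most 8 +
  -- 4; hence the 12.
  S2-step : ∀ s s2 L0 L1 x t → t ≡ s2 + # 2 * ((L1 - L0) * s) + x * ((L1 - L0) * (L1 - L0)) → s ≤ # 2 * x → s2 ≤ # 12 * x → x * (L1 - L0) ≤ # 2 → L0 ≤ L1 → 1ℚ ≤ x → t ≤ # 12 * (1ℚ + x)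
  S2-step s s2 L0 L1 x t e a c b d f = ≤-by (gap (≤-reflexive e) ⊹ gap c ⊹ lit (# 6) ⊠ gap b ⊹ lit (# 2) ⊠ (gap a ⊠ gap d) ⊹ gap b ⊠ gap d ⊹ lit (# 2) ⊠ (gap f ⊠ gap d)) (ring-≡ (s ∷ s2 ∷ L0 ∷ L1 ∷ x ∷ t ∷ []) (nat 12 :* (nat 1 :+ var 4)) (var 5 :+ (var 1 :+ nat 2 :* ((var 3 :- var 2) :* var 0) :+ var 4 :* ((var 3 :- var 2) :* (var 3 :- var 2)) :- var 5 :+ (nat 12 :* var 4 :- var 1) :+ nat 6 :* (nat 2 :- var 4 :* (var 3 :- var 2)) :+ nat 2 :* ((nat 2 :* var 4 :- var 0) :* (var 3 :- var 2)) :+ (nat 2 :- var 4 :* (var 3 :- var 2)) :* (var 3 :- var 2) :+ nat 2 :* ((var 4 :- nat 1) :* (var 3 :- var 2)))) refl)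

  lip-2 : ∀ u d u1 → u * d ≤ u1 - u + 1ℚ → u1 ≡ 1ℚ + u → u * d ≤ # 2
  lip-2 u d u1 a b = ≤-by (gap a ⊹ gap (≤-reflexive b)) (ring-≡ (u ∷ d ∷ u1 ∷ []) (nat 2) (var 0 :* var 1 :+ (var 2 :- var 0 :+ nat 1 :- var 0 :* var 1 :+ (nat 1 :+ var 0 :- var 2))) refl)

  *-distribˡ-- : ∀ a b c → a * (b - c) ≡ a * b - a * c
  *-distribˡ-- = solve-∀ ℚ-ring

  floor-log : ∀ E z → 2 ℕ.≤ E → 1 ℕ.≤ z → ∃ λ i → E ℕ.^ i ℕ.≤ z × z ℕ.< E ℕ.^ suc i
  floor-log E (suc zero) 2≤E _ = 0 , ℕ.≤-refl , subst (2 ℕ.≤_) (sym (ℕ.*-identityʳ E)) 2≤E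
  floor-log E (suc z@(suc _)) 2≤E _ = next (floor-log E z 2≤E (s≤s z≤n))
    where
    next : (∃ λ i → E ℕ.^ i ℕ.≤ z × z ℕ.< E ℕ.^ suc i) → ∃ λ i → E ℕ.^ i ℕ.≤ suc z × suc z ℕ.< E ℕ.^ suc i
    next (i , lo , hi) with ℕ.≤-<-connex (E ℕ.^ suc i) (suc z)
    ... | inj₂ lt = i , ℕ.m≤n⇒m≤1+n lo , lt
    ... | inj₁ ge = suc i , ge , ℕ.≤-<-trans hi (ℕ.^-monoʳ-< E 2≤E (ℕ.n<1+n (suc i)))

  isqrt : ∀ n → ∃ λ s → s ℕ.* s ℕ.≤ n × n ℕ.< suc s ℕ.* suc s
  isqrt zero = 0 , z≤n , s≤s z≤n
  isqrt (suc n) = next (isqrt n)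
    where
    next : (∃ λ s → s ℕ.* s ℕ.≤ n × n ℕ.< suc s ℕ.* suc s) → ∃ λ s → s ℕ.* s ℕ.≤ suc n × suc n ℕ.< suc s ℕ.* suc s
    next (s , lo , hi) with ℕ.≤-<-connex (suc s ℕ.* suc s) (suc n)
    ... | inj₂ lt = s , ℕ.m≤n⇒m≤1+n lo , lt
    ... | inj₁ ge = suc s , ge , ℕ.≤-<-trans hi (ℕ.*-mono-< (ℕ.n<1+n (suc s)) (ℕ.n<1+n (suc s)))

  -- Starts from 1000 ≤ 1024; twice (10 + d)³ exceeds (11 + d)³ by a polynomial with positive
  -- coefficients. It makes z outgrow the square of log z in `hi₃`.
  i³≤2^i : ∀ i → 10 ℕ.≤ i → i ℕ.* (i ℕ.* i) ℕ.≤ 2 ℕ.^ i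
  i³≤2^i i 10≤i = subst (λ t → t ℕ.* (t ℕ.* t) ℕ.≤ 2 ℕ.^ t) (ℕ.m+[n∸m]≡n 10≤i) (go (i ℕ.∸ 10))
    where
    go : ∀ d → (10 ℕ.+ d) ℕ.* ((10 ℕ.+ d) ℕ.* (10 ℕ.+ d)) ℕ.≤ 2 ℕ.^ (10 ℕ.+ d)
    go zero = ℕ.≤ᵇ⇒≤ 1000 1024 _
    go (suc d) = ℕ.≤-trans (ℕ.≤-trans (ℕ.m≤m+n _ _) (ℕ.≤-reflexive (lem d))) (ℕ.*-monoʳ-≤ 2 (go d))
      where
      lem : ∀ d → (10 ℕ.+ suc d) ℕ.* ((10 ℕ.+ suc d) ℕ.* (10 ℕ.+ suc d)) ℕ.+ (d ℕ.* d ℕ.* d ℕ.+ 27 ℕ.* d ℕ.* d ℕ.+ 237 ℕ.* d ℕ.+ 669) ≡ 2 ℕ.* ((10 ℕ.+ d) ℕ.* ((10 ℕ.+ d) ℕ.* (10 ℕ.+ d)))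
      lem = solveℕ-∀

  sum-telescope : ∀ n (h : ℕ → ℚ) → sum n (λ k → h k - h (ℕ.pred k)) ≡ h n - h 0
  sum-telescope zero h = sym (+-inverseʳ (h 0))
  sum-telescope (suc n) h = trans (cong (_+ (h (suc n) - h n)) (sum-telescope n h)) (lem (h n) (h 0) (h (suc n)))
    where
    lem : ∀ a b c → (a - b) + (c - a) ≡ c - b
    lem = solve-∀ ℚ-ring

  -- A rational logarithm on [1, N]

  module Analysis (N : ℕ) (1≤N : 1 ℕ.≤ N) where

    -- With this mesh ℓ differs from L by at most η = 1/(2N²) on [1, N].
    private
      mesh = 2 ℕ.* (N ℕ.* (N ℕ.* N))
      1≤mesh : 1 ℕ.≤ mesh
      1≤mesh = ℕ.*-mono-≤ {1} {2} (s≤s z≤n) (ℕ.*-mono-≤ 1≤N (ℕ.*-mono-≤ 1≤N 1≤N))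
      η = ι N * inv mesh
      η≥0 : 0ℚ ≤ η
      η≥0 = ι≥0 N ⊠ inv≥0 mesh
      ι-mesh : # 2 * (ι N * (ι N * ι N)) ≡ ι mesh
      ι-mesh = sym (trans (ι-* 2 (N ℕ.* (N ℕ.* N))) (cong₂ _*_ (ι-lit 2) (trans (ι-* N (N ℕ.* N)) (cong (ι N *_) (ι-* N N)))))
      Nη : # 2 * (ι N * (ι N * η)) ≡ 1ℚ
      Nη = trans (lem (ι N) (inv mesh)) (trans (cong (_* inv mesh) ι-mesh) (inv-r 1≤mesh))
        where
        lem : ∀ n i → # 2 * (n * (n * (n * i))) ≡ # 2 * (n * (n * n)) * i
        lem = solve-∀ ℚ-ring

    opaque
      -- ℓ is only approximately additive; L is the completely additive function which agrees with it on primes.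
      weight : ℕ → ℚ
      weight p = 𝟙 (prime? p) * ℓ mesh p

      L : ℕ → ℚ
      L m = sum N (λ p → weight p * val N p m)

      weight-¬prime : ∀ p → ¬ Prime p → weight p ≡ 0ℚ
      weight-¬prime p ¬p = trans (cong (_* ℓ mesh p) (𝟙-no (prime? p) ¬p)) (*-zeroˡ (ℓ mesh p))

      private
        weight-prime : ∀ p → Prime p → weight p ≡ ℓ mesh p
        weight-prime p pp = trans (cong (_* ℓ mesh p) (𝟙-yes (prime? p) pp)) (*-identityˡ (ℓ mesh p))

      L-def : ∀ m → L m ≡ sum N (λ p → weight p * val N p m)
      L-def m = refl

      L-* : ∀ m n → 1 ℕ.≤ m → 1 ℕ.≤ n → m ℕ.* n ℕ.≤ N → L (m ℕ.* n) ≡ L m + L n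
      L-* m n 1≤m 1≤n mn≤N = trans (sum-cong N term) (sum-+ N (λ p → weight p * val N p m) (λ p → weight p * val N p n))
        where
        term : ∀ p → 1 ℕ.≤ p → p ℕ.≤ N → weight p * val N p (m ℕ.* n) ≡ weight p * val N p m + weight p * val N p n
        term p _ _ with prime? p
        ... | yes pp = trans (cong (1ℚ * ℓ mesh p *_) (val-* N p m n pp 1≤m 1≤n mn≤N)) (*-distribˡ-+ (1ℚ * ℓ mesh p) _ _)
        ... | no _ = lem (ℓ mesh p) (val N p (m ℕ.* n)) (val N p m) (val N p n)
          where
          lem : ∀ l a b c → 0ℚ * l * a ≡ 0ℚ * l * b + 0ℚ * l * c
          lem = solve-∀ ℚ-ring

      weight-L : ∀ q → Prime q → q ℕ.≤ N → weight q ≡ L q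
      weight-L q pq q≤N = sym (trans (sum-single N q _ (1≤prime pq) q≤N off)
          (trans (cong (weight q *_) (trans (val-prime N q q pq pq q≤N) (𝟙-yes (q ℕ.≟ q) refl))) (*-identityʳ _)))
        where
        off : ∀ p → 1 ℕ.≤ p → p ℕ.≤ N → p ≢ q → weight p * val N p q ≡ 0ℚ
        off p _ _ p≢q with prime? p
        ... | yes pp = trans (cong (1ℚ * ℓ mesh p *_) (trans (val-prime N p q pp pq q≤N) (𝟙-no (p ℕ.≟ q) p≢q))) (*-zeroʳ (1ℚ * ℓ mesh p))
        ... | no _ = lem (ℓ mesh p) (val N p q)
          where
          lem : ∀ l a → 0ℚ * l * a ≡ 0ℚ
          lem = solve-∀ ℚ-ring

      private
        L-prime : ∀ q → Prime q → q ℕ.≤ N → L q ≡ ℓ mesh q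
        L-prime q pq q≤N = trans (sym (weight-L q pq q≤N)) (weight-prime q pq)

    L-1 : L 1 ≡ 0ℚ
    L-1 = lem (L 1) (L-* 1 1 (s≤s z≤n) (s≤s z≤n) 1≤N)
      where
      lem : ∀ a → a ≡ a + a → a ≡ 0ℚ
      lem a e = ≤-antisym (≤-by (gap (≤-reflexive (sym e))) (ring-≡ (a ∷ []) (nat 0) (var 0 :+ (var 0 :- (var 0 :+ var 0))) refl)) (≤-by (gap (≤-reflexive e)) (ring-≡ (a ∷ []) (var 0) (nat 0 :+ (var 0 :+ var 0 :- var 0)) refl))

    approx-step-lo : ∀ lpm lp lm Lm Lpm → Lpm ≡ lp + Lm → lp + lm ≤ lpm → 0ℚ ≤ lm - Lm → 0ℚ ≤ lpm - Lpm
    approx-step-lo lpm lp lm Lm Lpm e a b = ≤-by (gap (≤-reflexive e) ⊹ gap a ⊹ b) (ring-≡ (lpm ∷ lp ∷ lm ∷ Lm ∷ Lpm ∷ []) (var 0 :- var 4) (nat 0 :+ (var 1 :+ var 3 :- var 4 :+ (var 0 :- (var 1 :+ var 2)) :+ (var 2 :- var 3))) refl)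

    approx-step-hi : ∀ lpm lp lm Lm Lpm i m n → Lpm ≡ lp + Lm → lpm ≤ lp + lm + i → lm - Lm ≤ m * i → 1ℚ + m ≤ n → 0ℚ ≤ i → lpm - Lpm ≤ n * i
    approx-step-hi lpm lp lm Lm Lpm i m n e a b c i0 = ≤-by (gap (≤-reflexive (sym e)) ⊹ gap a ⊹ gap b ⊹ gap c ⊠ i0) (ring-≡ (lpm ∷ lp ∷ lm ∷ Lm ∷ Lpm ∷ i ∷ m ∷ n ∷ []) (var 7 :* var 5) (var 0 :- var 4 :+ (var 4 :- (var 1 :+ var 3) :+ (var 1 :+ var 2 :+ var 5 :- var 0) :+ (var 6 :* var 5 :- (var 2 :- var 3)) :+ (var 7 :- (nat 1 :+ var 6)) :* var 5)) refl)

    private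
      -- Every prime factor split off costs at most `inv mesh` by `ℓ-*-≤`, and n has fewer than n
      -- prime factors. The cubic mesh absorbs this crude count.
      approx : ∀ n → 1 ℕ.≤ n → n ℕ.≤ N → (0ℚ ≤ ℓ mesh n - L n) × (ℓ mesh n - L n ≤ ι n * inv mesh)
      approx = <-rec _ go
        where
        Goal : ℕ → Set
        Goal n = 1 ℕ.≤ n → n ℕ.≤ N → (0ℚ ≤ ℓ mesh n - L n) × (ℓ mesh n - L n ≤ ι n * inv mesh)
        go : ∀ n → (∀ {k} → k ℕ.< n → Goal k) → Goal n
        go (suc zero) rec _ _ = ≤-reflexive (sym z) , subst (_≤ ι 1 * inv mesh) (sym z) (ι≥0 1 ⊠ inv≥0 mesh)
          where
          z : ℓ mesh 1 - L 1 ≡ 0ℚ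
          z = cong₂ _-_ (ℓ-1 mesh) L-1
        go n@(suc (suc _)) rec 1≤n n≤N with prime-divisor n (s≤s (s≤s z≤n))
        ... | p , m , pp , e = subst (λ t → 0ℚ ≤ ℓ mesh t - L t) (sym e) (approx-step-lo (ℓ mesh (p ℕ.* m)) (ℓ mesh p) (ℓ mesh m) (L m) (L (p ℕ.* m)) Le (ℓ-*-≥ mesh p m 1≤mesh 1≤p 1≤m) (proj₁ ih))
            , subst (λ t → ℓ mesh t - L t ≤ ι n * inv mesh) (sym e) (approx-step-hi (ℓ mesh (p ℕ.* m)) (ℓ mesh p) (ℓ mesh m) (L m) (L (p ℕ.* m)) (inv mesh) (ι m) (ι n) Le (ℓ-*-≤ mesh p m 1≤mesh 1≤p 1≤m) (proj₂ ih) (ι-< m<n) (inv≥0 mesh))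
          where
          1≤p = 1≤prime pp
          1≤m = 1≤-factorʳ p 1≤n e
          m<n = factor< p (2≤prime pp) 1≤n e
          p≤N : p ℕ.≤ N
          p≤N = ℕ.≤-trans (subst (p ℕ.≤_) (sym e) (ℕ.m≤m*n p m {{ℕ.>-nonZero 1≤m}})) n≤N
          ih = rec m<n 1≤m (ℕ.≤-trans (ℕ.<⇒≤ m<n) n≤N)
          Le : L (p ℕ.* m) ≡ ℓ mesh p + L m
          Le = trans (L-* p m 1≤p 1≤m (subst (ℕ._≤ N) e n≤N)) (cong (_+ L m) (L-prime p pp p≤N))

      L≤ℓ : ∀ n → 1 ℕ.≤ n → n ℕ.≤ N → L n ≤ ℓ mesh n
      L≤ℓ n a b = ungap (L n) (ℓ mesh n) (proj₁ (approx n a b))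

      ℓ≤L : ∀ n → 1 ℕ.≤ n → n ℕ.≤ N → ℓ mesh n - L n ≤ η
      ℓ≤L n a b = ≤-trans (proj₂ (approx n a b)) (lem (ι n) (ι N) (inv mesh) (ι-mono b) (inv≥0 mesh))
        where
        lem : ∀ n N i → n ≤ N → 0ℚ ≤ i → n * i ≤ N * i
        lem n N i a b = ≤-by (gap a ⊠ b) (ring-≡ (n ∷ N ∷ i ∷ []) (var 1 :* var 2) (var 0 :* var 2 :+ ((var 1 :- var 0) :* var 2)) refl)

    L-step-≤-lem : ∀ l0 l1 L0 L1 i η → l1 ≤ l0 + i → L1 ≤ l1 → l0 - L0 ≤ η → L1 - L0 ≤ i + η
    L-step-≤-lem l0 l1 L0 L1 i η s a b = ≤-by (gap s ⊹ gap a ⊹ gap b) (ring-≡ (l0 ∷ l1 ∷ L0 ∷ L1 ∷ i ∷ η ∷ []) (var 4 :+ var 5) (var 3 :- var 2 :+ (var 0 :+ var 4 :- var 1 :+ (var 1 :- var 3) :+ (var 5 :- (var 0 :- var 2)))) refl)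

    private
      L-step-≤η : ∀ n → 1 ℕ.≤ n → n ℕ.< N → L (suc n) - L n ≤ inv n + η
      L-step-≤η n 1≤n n<N = L-step-≤-lem (ℓ mesh n) (ℓ mesh (suc n)) (L n) (L (suc n)) (inv n) η (ℓ-step-≤ mesh n 1≤mesh 1≤n) (L≤ℓ (suc n) (s≤s z≤n) n<N) (ℓ≤L n 1≤n (ℕ.<⇒≤ n<N))

    η≤inv : ∀ n i η → 1ℚ ≤ n → n * i ≡ 1ℚ → # 2 * (n * (n * η)) ≡ 1ℚ → 0ℚ ≤ η → 0ℚ ≤ i → η ≤ i
    η≤inv n i η p q r e i0 = ≤-by (lit (ℤ.+ 1 / 2) ⊠ i0 ⊹ lit (ℤ.+ 1 / 2) ⊠ (gap (≤-reflexive r) ⊠ i0) ⊹ gap (≤-reflexive (sym q)) ⊠ e ⊹ gap p ⊠ e ⊠ i0 ⊹ gap p ⊠ gap p ⊠ e ⊠ i0) (ring-≡ (n ∷ i ∷ η ∷ []) (var 1) (var 2 :+ (con (ℤ.+ 1 / 2) :* var 1 :+ con (ℤ.+ 1 / 2) :* ((nat 1 :- nat 2 :* (var 0 :* (var 0 :* var 2))) :* var 1) :+ (var 0 :* var 1 :- nat 1) :* var 2 :+ (var 0 :- nat 1) :* var 2 :* var 1 :+ (var 0 :- nat 1) :* (var 0 :- nat 1) :* var 2 :* var 1)) refl)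

    L-mono-step-lem : ∀ l0 l1 L0 L1 i iN η → l0 + i ≤ l1 → L0 ≤ l0 → l1 - L1 ≤ η → η ≤ iN → iN ≤ i → L0 ≤ L1
    L-mono-step-lem l0 l1 L0 L1 i iN η s a b c d = ≤-by (gap s ⊹ gap a ⊹ gap b ⊹ gap c ⊹ gap d) (ring-≡ (l0 ∷ l1 ∷ L0 ∷ L1 ∷ i ∷ iN ∷ η ∷ []) (var 3) (var 2 :+ (var 1 :- (var 0 :+ var 4) :+ (var 0 :- var 2) :+ (var 6 :- (var 1 :- var 3)) :+ (var 5 :- var 6) :+ (var 4 :- var 5))) refl)

    -- A step of `ℓ` is at least `inv (suc n)`, hence at least `inv N` ≥ η, and this outweighs the
    -- distance between `ℓ` and `L`.
    L-mono : ∀ {m n} → 1 ℕ.≤ m → m ℕ.≤ n → n ℕ.≤ N → L m ≤ L n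
    L-mono {m} {zero} 1≤m m≤n n≤N = ⊥-elim (ℕ.<⇒≱ 1≤m m≤n)
    L-mono {m} {suc n} 1≤m m≤n n≤N with ℕ.m≤n⇒m<n∨m≡n m≤n
    ... | inj₂ refl = ≤-refl
    ... | inj₁ (s≤s m≤n') = ≤-trans (L-mono 1≤m m≤n' (ℕ.<⇒≤ n≤N))
      (L-mono-step-lem (ℓ mesh n) (ℓ mesh (suc n)) (L n) (L (suc n)) (inv (suc n)) (inv N) η (ℓ-step-≥ mesh n 1≤mesh) (L≤ℓ n (ℕ.≤-trans 1≤m m≤n') (ℕ.<⇒≤ n≤N)) (ℓ≤L (suc n) (s≤s z≤n) n≤N)
        (η≤inv (ι N) (inv N) η (1≤ι 1≤N) (inv-r 1≤N) Nη η≥0 (inv≥0 N)) (inv-anti (s≤s z≤n) n≤N))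

    L≥0 : ∀ {n} → 1 ℕ.≤ n → n ℕ.≤ N → 0ℚ ≤ L n
    L≥0 {n} a b = subst (_≤ L n) L-1 (L-mono (s≤s z≤n) a b)

    lip-step : ∀ Lu Lv Lv1 u v v1 iu iv η → Lv - Lu ≤ (v - u) * (iu + η) → Lv1 - Lv ≤ iv + η → iv ≤ iu → v1 ≡ 1ℚ + v → 0ℚ ≤ iu → 0ℚ ≤ η → Lv1 - Lu ≤ (v1 - u) * (iu + η)
    lip-step Lu Lv Lv1 u v v1 iu iv η ih s a e p q = ≤-by (gap ih ⊹ gap s ⊹ gap a ⊹ gap (≤-reflexive (sym e)) ⊠ p ⊹ gap (≤-reflexive (sym e)) ⊠ q) (ring-≡ (Lu ∷ Lv ∷ Lv1 ∷ u ∷ v ∷ v1 ∷ iu ∷ iv ∷ η ∷ []) ((var 5 :- var 3) :* (var 6 :+ var 8)) (var 2 :- var 0 :+ ((var 4 :- var 3) :* (var 6 :+ var 8) :- (var 1 :- var 0) :+ (var 7 :+ var 8 :- (var 2 :- var 1)) :+ (var 6 :- var 7) :+ (var 5 :- (nat 1 :+ var 4)) :* var 6 :+ (var 5 :- (nat 1 :+ var 4)) :* var 8)) refl)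

    lip-fin : ∀ Lu Lv u v n iu η → Lv - Lu ≤ (v - u) * (iu + η) → u * iu ≡ 1ℚ → # 2 * (n * (n * η)) ≡ 1ℚ → u ≤ v → v ≤ n → 0ℚ ≤ u → 0ℚ ≤ η → u * (Lv - Lu) ≤ v - u + 1ℚ
    lip-fin Lu Lv u v n iu η ih e f a b c q = ≤-by (gap (≤-reflexive f) ⊹ gap ih ⊠ c ⊹ gap (≤-reflexive e) ⊠ gap a ⊹ lit (# 4) ⊠ (gap a ⊠ gap b ⊠ q) ⊹ lit (# 3) ⊠ (gap a ⊠ c ⊠ q) ⊹ lit (# 4) ⊠ (gap b ⊠ c ⊠ q) ⊹ lit (# 2) ⊠ (gap b ⊠ gap b ⊠ q) ⊹ lit (# 2) ⊠ (gap a ⊠ gap a ⊠ q) ⊹ lit (# 2) ⊠ (c ⊠ c ⊠ q)) (ring-≡ (Lu ∷ Lv ∷ u ∷ v ∷ n ∷ iu ∷ η ∷ []) (var 3 :- var 2 :+ nat 1) (var 2 :* (var 1 :- var 0) :+ (nat 1 :- nat 2 :* (var 4 :* (var 4 :* var 6)) :+ ((var 3 :- var 2) :* (var 5 :+ var 6) :- (var 1 :- var 0)) :* var 2 :+ (nat 1 :- var 2 :* var 5) :* (var 3 :- var 2) :+ nat 4 :* ((var 3 :- var 2) :* (var 4 :- var 3) :* var 6) :+ nat 3 :* ((var 3 :- var 2) :* var 2 :* var 6) :+ nat 4 :* ((var 4 :- var 3) :* var 2 :* var 6) :+ nat 2 :* ((var 4 :- var 3) :* (var 4 :- var 3) :*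 var 6) :+ nat 2 :* ((var 3 :- var 2) :* (var 3 :- var 2) :* var 6) :+ nat 2 :* (var 2 :* var 2 :* var 6))) refl)

    -- Summing the one-step bounds gives v - u plus the error u (v - u) η. The final 1 absorbs it
    -- because 2N²η = 1.
    L-lip : ∀ {u v} → 1 ℕ.≤ u → u ℕ.≤ v → v ℕ.≤ N → ι u * (L v - L u) ≤ ι v - ι u + 1ℚ
    L-lip {u} {v} 1≤u u≤v v≤N = lip-fin (L u) (L v) (ι u) (ι v) (ι N) (inv u) η (go v u≤v v≤N) (inv-r 1≤u) Nη (ι-mono u≤v) (ι-mono v≤N) (ι≥0 u) η≥0
      where
      go : ∀ v → u ℕ.≤ v → v ℕ.≤ N → L v - L u ≤ (ι v - ι u) * (inv u + η)
      go zero p _ = ⊥-elim (ℕ.<⇒≱ 1≤u p)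
      go (suc v) p v≤N with ℕ.m≤n⇒m<n∨m≡n p
      ... | inj₂ refl = ≤-reflexive (lem (L u) (ι u) (inv u + η))
        where
        lem : ∀ a b c → a - a ≡ (b - b) * c
        lem = solve-∀ ℚ-ring
      ... | inj₁ (s≤s q) = lip-step (L u) (L v) (L (suc v)) (ι u) (ι v) (ι (suc v)) (inv u) (inv v) η (go v q (ℕ.<⇒≤ v≤N)) (L-step-≤η v (ℕ.≤-trans 1≤u q) v≤N) (inv-anti 1≤u q) (ι-suc v) (inv≥0 u) η≥0

    -- Euler's constant, up to 1/N.
    γ : ℚ
    γ = H N - ℓ mesh N

    γ-lem-lo : ∀ h l i l1 → l + i ≤ l1 → h + i - l1 ≤ h - l
    γ-lem-lo h l i l1 s = ≤-by (gap s) (ring-≡ (h ∷ l ∷ i ∷ l1 ∷ []) (var 0 :- var 1) (var 0 :+ var 2 :- var 3 :+ (var 3 :- (var 1 :+ var 2))) refl)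
    γ-lem-hi : ∀ h l i l1 i1 → l1 ≤ l + i → h - l - i ≤ h + i1 - l1 - i1
    γ-lem-hi h l i l1 i1 s = ≤-by (gap s) (ring-≡ (h ∷ l ∷ i ∷ l1 ∷ i1 ∷ []) (var 0 :+ var 4 :- var 3 :- var 4) (var 0 :- var 1 :- var 2 :+ (var 1 :+ var 2 :- var 3)) refl)

    private
      -- A step of `ℓ` lies between `inv (suc n)` and `inv n`, so `H - ℓ` decreases and
      -- `H - ℓ - inv` increases. Together with `γ-hi` this squeezes γ.
      γ-lo : ∀ {j} n → j ℕ.≤ n → H n - ℓ mesh n ≤ H j - ℓ mesh j
      γ-lo {zero} zero z≤n = ≤-refl
      γ-lo {j} (suc n) p with ℕ.m≤n⇒m<n∨m≡n p
      ... | inj₂ refl = ≤-refl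
      ... | inj₁ (s≤s q) = ≤-trans (γ-lem-lo (H n) (ℓ mesh n) (inv (suc n)) (ℓ mesh (suc n)) (ℓ-step-≥ mesh n 1≤mesh)) (γ-lo n q)

      γ-hi : ∀ {j} n → 1 ℕ.≤ j → j ℕ.≤ n → H j - ℓ mesh j - inv j ≤ H n - ℓ mesh n - inv n
      γ-hi zero a b = ⊥-elim (ℕ.<⇒≱ a b)
      γ-hi {j} (suc n) a p with ℕ.m≤n⇒m<n∨m≡n p
      ... | inj₂ refl = ≤-refl
      ... | inj₁ (s≤s q) = ≤-trans (γ-hi n a q) (γ-lem-hi (H n) (ℓ mesh n) (inv n) (ℓ mesh (suc n)) (inv (suc n)) (ℓ-step-≤ mesh n 1≤mesh (ℕ.≤-trans a q)))

      H1 : H 1 ≡ 1ℚ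
      H1 = trans (+-identityˡ (inv 1)) inv-1

    γ≤1 : γ ≤ 1ℚ
    γ≤1 = subst (γ ≤_) (cong₂ _-_ H1 (ℓ-1 mesh)) (γ-lo N 1≤N)

    γ≥0 : 0ℚ ≤ γ
    γ≥0 = lem (H N) (ℓ mesh N) (inv N) (subst (_≤ H N - ℓ mesh N - inv N) (trans (cong₂ (λ s t → s - t - inv 1) H1 (ℓ-1 mesh)) (cong (λ t → 1ℚ - 0ℚ - t) inv-1)) (γ-hi N (s≤s z≤n) 1≤N)) (inv≥0 N)
      where
      lem : ∀ a b i → 0ℚ ≤ a - b - i → 0ℚ ≤ i → 0ℚ ≤ a - b
      lem a b i p q = ≤-by (p ⊹ q) (ring-≡ (a ∷ b ∷ i ∷ []) (var 0 :- var 1) (nat 0 :+ (var 0 :- var 1 :- var 2 :+ var 2)) refl)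

    L-γ-lo : ∀ j → 1 ℕ.≤ j → j ℕ.≤ N → 0ℚ ≤ H j - L j - γ
    L-γ-lo j a b = lem (H j) (ℓ mesh j) (L j) γ (γ-lo N b) (L≤ℓ j a b)
      where
      lem : ∀ h l L g → g ≤ h - l → L ≤ l → 0ℚ ≤ h - L - g
      lem h l L g p q = ≤-by (gap p ⊹ gap q) (ring-≡ (h ∷ l ∷ L ∷ g ∷ []) (var 0 :- var 2 :- var 3) (nat 0 :+ (var 0 :- var 1 :- var 3 :+ (var 1 :- var 2))) refl)

    L-γ-hi : ∀ j → 1 ℕ.≤ j → j ℕ.≤ N → H j - L j - γ ≤ inv j
    L-γ-hi j a b = lem (H j) (ℓ mesh j) (L j) (H N) (ℓ mesh N) (inv N) (inv j) η (γ-hi N a b) (ℓ≤L j a b) (η≤inv (ι N) (inv N) η (1≤ι 1≤N) (inv-r 1≤N) Nη η≥0 (inv≥0 N)) (inv-anti a b)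
      where
      lem : ∀ h l L hN lN iN i η → h - l - i ≤ hN - lN - iN → l - L ≤ η → η ≤ iN → iN ≤ i → h - L - (hN - lN) ≤ i
      lem h l L hN lN iN i η p q r s = ≤-by (gap p ⊹ gap q ⊹ gap r) (ring-≡ (h ∷ l ∷ L ∷ hN ∷ lN ∷ iN ∷ i ∷ η ∷ []) (var 6) (var 0 :- var 2 :- (var 3 :- var 4) :+ (var 3 :- var 4 :- var 5 :- (var 0 :- var 1 :- var 6) :+ (var 7 :- (var 1 :- var 2)) :+ (var 5 :- var 7))) refl)

    -- The Riemann sum for log 2 is at least 1/2 and η ≤ 1/8. This crude 1/4 is the source of the
    -- factor 4 between powers of two and their logarithms in the later constants.
    1≤4*L2 : 2 ℕ.≤ N → 1ℚ ≤ # 4 * L 2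
    1≤4*L2 2≤N = lem (ℓ mesh 1) (ℓ mesh 2) (L 2) (inv 2) (ι N) η (ℓ-step-≥ mesh 1 1≤mesh) (ℓ-1 mesh) (ℓ≤L 2 (s≤s z≤n) 2≤N) (subst (λ t → t * inv 2 ≡ 1ℚ) (ι-lit 2) (inv-r (s≤s z≤n))) (subst (_≤ ι N) (ι-lit 2) (ι-mono 2≤N)) Nη η≥0
      where
      lem : ∀ l1 l2 L i n η → l1 + i ≤ l2 → l1 ≡ 0ℚ → l2 - L ≤ η → # 2 * i ≡ 1ℚ → # 2 ≤ n → # 2 * (n * (n * η)) ≡ 1ℚ → 0ℚ ≤ η → 1ℚ ≤ # 4 * L
      lem l1 l2 L i n η a b c d f g k = ≤-by (lit (# 4) ⊠ gap a ⊹ lit (# 4) ⊠ gap (≤-reflexive (sym b)) ⊹ lit (# 4) ⊠ gap c ⊹ lit (# 2) ⊠ gap (≤-reflexive (sym d)) ⊹ gap (≤-reflexive g) ⊹ lit (# 4) ⊠ k ⊹ lit (# 2) ⊠ (gap f ⊠ gap f ⊠ k) ⊹ lit (# 8) ⊠ (gap f ⊠ k)) (ring-≡ (l1 ∷ l2 ∷ L ∷ i ∷ n ∷ η ∷ []) (nat 4 :* var 2) (nat 1 :+ (nat 4 :* (var 1 :- (var 0 :+ var 3)) :+ nat 4 :* (var 0 :- nat 0) :+ nat 4 :* (var 5 :- (var 1 :- var 2)) :+ nat 2 :* (nat 2 :* var 3 :- nat 1) :+ (nat 1 :- nat 2 :* (var 4 :* (var 4 :* var 5))) :+ nat 4 :*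 var 5 :+ nat 2 :* ((var 4 :- nat 2) :* (var 4 :- nat 2) :* var 5) :+ nat 8 :* ((var 4 :- nat 2) :* var 5))) refl)

    weight≥0 : ∀ p → p ℕ.≤ N → 0ℚ ≤ weight p
    weight≥0 p p≤N = by (prime? p)
      where
      by : Dec (Prime p) → 0ℚ ≤ weight p
      by (yes pp) = subst (0ℚ ≤_) (sym (weight-L p pp p≤N)) (L≥0 (1≤prime pp) p≤N)
      by (no ¬p) = ≤-reflexive (sym (weight-¬prime p ¬p))

    -- The von Mangoldt function

    opaque
      -- A double sum over primes and exponents instead of a case distinction, so that a sum against
      -- `Λ` becomes a sum over pairs (p, a) by exchanging summations.
      Λ : ℕ → ℚ
      Λ d = sum N (λ p → sum N (λ a → weight p * 𝟙 (d ℕ.≟ p ℕ.^ a)))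

      Λ≥0 : ∀ d → 0ℚ ≤ Λ d
      Λ≥0 d = sum≥0 N (λ p _ p≤N → sum≥0 N (λ a _ _ → weight≥0 p p≤N ⊠ 𝟙≥0 (d ℕ.≟ p ℕ.^ a)))

      Λ-sum : ∀ x h → Supp x h → sum x (λ d → Λ d * h d) ≡ sum N (λ p → sum N (λ a → weight p * h (p ℕ.^ a)))
      Λ-sum x h s = trans (sum-cong x (λ d _ _ → trans (sym (sum-*ʳ N (h d) (λ p → sum N (λ a → weight p * 𝟙 (d ℕ.≟ p ℕ.^ a)))))
          (sum-cong N (λ p _ _ → sym (sum-*ʳ N (h d) (λ a → weight p * 𝟙 (d ℕ.≟ p ℕ.^ a)))))))
        (trans (sum-swap x N (λ d p → sum N (λ a → weight p * 𝟙 (d ℕ.≟ p ℕ.^ a) * h d))) (sum-cong N (λ p 1≤p _ →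
          trans (sum-swap x N (λ d a → weight p * 𝟙 (d ℕ.≟ p ℕ.^ a) * h d)) (sum-cong N (λ a _ _ → point p a 1≤p)))))
        where
        point : ∀ p a → 1 ℕ.≤ p → sum x (λ d → weight p * 𝟙 (d ℕ.≟ p ℕ.^ a) * h d) ≡ weight p * h (p ℕ.^ a)
        point p a 1≤p with ℕ.≤-<-connex (p ℕ.^ a) x
        ... | inj₁ q = trans (sum-single x (p ℕ.^ a) _ (1≤^ p a 1≤p) q (λ k _ _ k≢ → off k k≢)) (trans (cong (λ t → weight p * t * h (p ℕ.^ a)) (𝟙-yes (p ℕ.^ a ℕ.≟ p ℕ.^ a) refl)) (cong (_* h (p ℕ.^ a)) (*-identityʳ (weight p))))
          where
          off : ∀ k → k ≢ p ℕ.^ a → weight p * 𝟙 (k ℕ.≟ p ℕ.^ a) * h k ≡ 0ℚ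
          off k k≢ = trans (cong (λ t → weight p * t * h k) (𝟙-no (k ℕ.≟ p ℕ.^ a) k≢)) (lem (weight p) (h k))
            where
            lem : ∀ a b → a * 0ℚ * b ≡ 0ℚ
            lem = solve-∀ ℚ-ring
        ... | inj₂ q = trans (sum-cong x (λ d _ d≤x → trans (cong (λ t → weight p * t * h d) (𝟙-no (d ℕ.≟ p ℕ.^ a) (λ e → ℕ.<⇒≱ q (subst (ℕ._≤ x) e d≤x)))) (lem (weight p) (h d))))
            (trans (sum-0 x) (sym (trans (cong (weight p *_) (s (p ℕ.^ a) q)) (*-zeroʳ (weight p)))))
          where
          lem : ∀ a b → a * 0ℚ * b ≡ 0ℚ
          lem = solve-∀ ℚ-ring

    -- The convolution identity log = Λ * 1: the valuation in `L` counts the powers p^a dividing m,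
    -- and m = p^a e is summed over e instead.
    L-sum : ∀ x g → Supp x g → sum x (λ m → L m * g m) ≡ sum x (λ d → Λ d * sum x (λ e → g (d ℕ.* e)))
    L-sum x g s = trans (sum-cong x (λ m _ _ → trans (cong (_* g m) (L-def m)) (trans (sym (sum-*ʳ N (g m) (λ p → weight p * val N p m)))
        (sum-cong N (λ p _ _ → inner p m)))))
      (trans (sum-swap x N (λ m p → sum N (λ a → weight p * (𝟙 (p ℕ.^ a ∣? m) * g m))))
        (trans (sum-cong N (λ p 1≤p _ → trans (sum-swap x N (λ m a → weight p * (𝟙 (p ℕ.^ a ∣? m) * g m)))
          (sum-cong N (λ a _ _ → trans (sum-*ˡ x (weight p) (λ m → 𝟙 (p ℕ.^ a ∣? m) * g m)) (cong (weight p *_) (sum-dilate (p ℕ.^ a) x g (1≤^ p a 1≤p) s))))))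
          (sym (Λ-sum x (λ d → sum x (λ e → g (d ℕ.* e))) (Supp-sum x g s)))))
      where
      inner : ∀ p m → weight p * val N p m * g m ≡ sum N (λ a → weight p * (𝟙 (p ℕ.^ a ∣? m) * g m))
      inner p m = trans (*-assoc (weight p) (val N p m) (g m)) (trans (cong (weight p *_) (sym (sum-*ʳ N (g m) (λ a → 𝟙 (p ℕ.^ a ∣? m))))) (sym (sum-*ˡ N (weight p) (λ a → 𝟙 (p ℕ.^ a ∣? m) * g m))))

    -- log (x/n) = log (x/nm) + log m; the first term is removed by Möbius inversion, the second gives Λ = μ * log.
    tatuzawa-iseki : ∀ x F → 1 ℕ.≤ x → x ℕ.≤ N → Supp x F →
      sum x (λ n → μ x n * ((L x - L n) * sum x (λ m → F (n ℕ.* m)))) ≡ L x * F 1 + sum x (λ d → Λ d * F d)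
    tatuzawa-iseki x F 1≤x x≤N s = trans (sum-cong x (λ n a b → trans (cong (μ x n *_) (expand n a b)) (*-distribˡ-+ (μ x n) _ _)))
      (trans (sum-+ x (λ n → μ x n * sum x (λ m → F' (n ℕ.* m))) (λ n → μ x n * sum x (λ m → L m * F (n ℕ.* m))))
        (cong₂ _+_ (trans (möbius-inversion x F' 1≤x s') (trans (cong (λ t → (L x - t) * F 1) L-1) (lem (L x) (F 1)))) second))
      where
      lem : ∀ a b → (a - 0ℚ) * b ≡ a * b
      lem = solve-∀ ℚ-ring
      F' : ℕ → ℚ
      F' k = (L x - L k) * F k
      s' : Supp x F'
      s' k a = trans (cong ((L x - L k) *_) (s k a)) (*-zeroʳ (L x - L k))
      expand : ∀ n → 1 ℕ.≤ n → n ℕ.≤ x → (L x - L n) * sum x (λ m → F (n ℕ.* m)) ≡ sum x (λ m → F' (n ℕ.* m)) + sum x (λ m → L m * F (n ℕ.* m))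
      expand n 1≤n n≤x = trans (sym (sum-*ˡ x (L x - L n) (λ m → F (n ℕ.* m)))) (trans (sum-cong x term) (sum-+ x (λ m → F' (n ℕ.* m)) (λ m → L m * F (n ℕ.* m))))
        where
        term : ∀ m → 1 ℕ.≤ m → m ℕ.≤ x → (L x - L n) * F (n ℕ.* m) ≡ F' (n ℕ.* m) + L m * F (n ℕ.* m)
        term m 1≤m _ with ℕ.≤-<-connex (n ℕ.* m) x
        ... | inj₁ q = trans (l1 (L x) (L n) (L m) (F (n ℕ.* m))) (cong (λ t → (L x - t) * F (n ℕ.* m) + L m * F (n ℕ.* m)) (sym (L-* n m 1≤n 1≤m (ℕ.≤-trans q x≤N))))
          where
          l1 : ∀ x n m f → (x - n) * f ≡ (x - (n + m)) * f + m * f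
          l1 = solve-∀ ℚ-ring
        ... | inj₂ q = trans (cong ((L x - L n) *_) (s _ q)) (trans (l2 (L x - L n) (L x - L (n ℕ.* m)) (L m)) (cong (λ t → (L x - L (n ℕ.* m)) * t + L m * t) (sym (s _ q))))
          where
          l2 : ∀ a b c → a * 0ℚ ≡ b * 0ℚ + c * 0ℚ
          l2 = solve-∀ ℚ-ring
      second : sum x (λ n → μ x n * sum x (λ m → L m * F (n ℕ.* m))) ≡ sum x (λ d → Λ d * F d)
      second = trans (sum-cong x (λ n 1≤n _ → trans (cong (μ x n *_) (L-sum x (λ m → F (n ℕ.* m)) (Supp-* n 1≤n s)))
          (trans (sym (sum-*ˡ x (μ x n) (λ d → Λ d * sum x (λ e → F (n ℕ.* (d ℕ.* e)))))) (sum-cong x (λ d _ _ → comm n d)))))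
        (trans (sum-swap x x (λ n d → Λ d * (μ x n * sum x (λ e → F (d ℕ.* (n ℕ.* e))))))
          (sum-cong x (λ d 1≤d _ → trans (sum-*ˡ x (Λ d) (λ n → μ x n * sum x (λ e → F (d ℕ.* (n ℕ.* e)))))
            (cong (Λ d *_) (trans (möbius-inversion x (λ k → F (d ℕ.* k)) 1≤x (Supp-* d 1≤d s)) (cong F (ℕ.*-identityʳ d)))))))
        where
        comm : ∀ n d → μ x n * (Λ d * sum x (λ e → F (n ℕ.* (d ℕ.* e)))) ≡ Λ d * (μ x n * sum x (λ e → F (d ℕ.* (n ℕ.* e))))
        comm n d = trans (l1 (μ x n) (Λ d) _) (cong (λ t → Λ d * (μ x n * t)) (sum-cong x (λ e _ _ → cong F (l2 n d e))))
          where
          l1 : ∀ a b c → a * (b * c) ≡ b * (a * c)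
          l1 = solve-∀ ℚ-ring
          l2 : ∀ n d e → n ℕ.* (d ℕ.* e) ≡ d ℕ.* (n ℕ.* e)
          l2 = solveℕ-∀

    -- Chebyshev's function, log-factorials and Mertens' sum

    ψ T Q : ℕ → ℚ
    ψ n = sum n Λ
    T n = sum n L
    Q n = sum n (λ k → Λ k * inv k)

    ψ≥0 : ∀ n → 0ℚ ≤ ψ n
    ψ≥0 n = sum≥0 n (λ k _ _ → Λ≥0 k)

    ψ-mono : ∀ {m n} → m ℕ.≤ n → ψ m ≤ ψ n
    ψ-mono p = sum-mono-n Λ p (λ k _ _ → Λ≥0 k)

    -- Legendre's formula for the factorisation of y!.
    T-Λ : ∀ y → T y ≡ sum y (λ d → Λ d * ι (y ⫽ d))
    T-Λ y = trans (sym (sum-cong y (λ m _ b → trans (cong (L m *_) (𝟙-yes (m ℕ.≤? y) b)) (*-identityʳ (L m)))))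
      (trans (L-sum y (λ m → 𝟙 (m ℕ.≤? y)) (λ k a → 𝟙-no (k ℕ.≤? y) (ℕ.<⇒≱ a))) (sum-cong y (λ d 1≤d _ → cong (Λ d *_) (count-multiples y d 1≤d))))

    -- Chebyshev's identity: the pairs (d, e) with d e ≤ y of Legendre's formula, grouped by e.
    T-ψ : ∀ y → T y ≡ sum y (λ m → ψ (y ⫽ m))
    T-ψ y = trans (T-Λ y) (trans (sum-cong y (λ d 1≤d _ → trans (cong (Λ d *_) (sym (count-multiples y d 1≤d))) (sym (sum-*ˡ y (Λ d) (λ e → 𝟙 (d ℕ.* e ℕ.≤? y))))))
      (trans (sum-swap y y (λ d e → Λ d * 𝟙 (d ℕ.* e ℕ.≤? y))) (sum-cong y (λ m 1≤m _ →
        trans (sum-cong y (λ d _ _ → trans (*-comm (Λ d) _) (cong (_* Λ d) (≤?-cong (λ h → *≤⇒≤⫽ 1≤m (subst (ℕ._≤ y) (ℕ.*-comm d m) h)) (λ h → subst (ℕ._≤ y) (ℕ.*-comm m d) (≤⫽⇒*≤ {y} {m} h))))))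
          (sum-≤? y (y ⫽ m) Λ (⫽≤ y 1≤m))))))

    L-step-2 : ∀ n → 1 ℕ.≤ n → n ℕ.< N → ι n * (L (suc n) - L n) ≤ # 2
    L-step-2 n 1≤n n<N = lip-2 (ι n) (L (suc n) - L n) (ι (suc n)) (L-lip 1≤n (ℕ.n≤1+n n) n<N) (ι-suc n)

    S₁ S₂ : ℕ → ℚ
    S₁ x = sum x (λ n → L x - L n)
    S₂ x = sum x (λ n → (L x - L n) * (L x - L n))

    S₁-suc : ∀ x → S₁ (suc x) ≡ S₁ x + ι x * (L (suc x) - L x)
    S₁-suc x = trans (cong₂ _+_ (trans (sum-cong x (λ n _ _ → l1 (L (suc x)) (L x) (L n))) (trans (sum-+ x (λ n → L x - L n) (λ _ → L (suc x) - L x)) (cong (λ t → S₁ x + t) (sum-const x (L (suc x) - L x))))) (+-inverseʳ (L (suc x))))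
      (+-identityʳ _)
      where
      l1 : ∀ a b c → a - c ≡ (b - c) + (a - b)
      l1 = solve-∀ ℚ-ring

    S₂-suc : ∀ x → S₂ (suc x) ≡ S₂ x + # 2 * ((L (suc x) - L x) * S₁ x) + ι x * ((L (suc x) - L x) * (L (suc x) - L x))
    S₂-suc x = trans (cong₂ _+_ (trans (sum-cong x (λ n _ _ → l1 (L (suc x)) (L x) (L n))) (trans (sum-+ x _ _) (cong₂ _+_ (trans (sum-+ x _ _)
        (cong (λ t → S₂ x + t) (trans (sum-*ˡ x (# 2) _) (cong (# 2 *_) (sum-*ˡ x (L (suc x) - L x) (λ n → L x - L n)))))) (sum-const x _)))) (l2 (L (suc x))))
      (+-identityʳ _)
      where
      l1 : ∀ a b c → (a - c) * (a - c) ≡ (b - c) * (b - c) + # 2 * ((a - b) * (b - c)) + (a - b) * (a - b)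
      l1 = solve-∀ ℚ-ring
      l2 : ∀ a → (a - a) * (a - a) ≡ 0ℚ
      l2 = solve-∀ ℚ-ring

    S₁≤ : ∀ x → 1 ℕ.≤ x → x ℕ.≤ N → S₁ x ≤ # 2 * ι x
    S₁≤ (suc zero) _ _ = subst₂ _≤_ (sym (trans (+-identityˡ _) (+-inverseʳ (L 1)))) (cong (# 2 *_) (sym ι-1)) (lit (# 2))
    S₁≤ (suc x@(suc _)) _ h = subst (λ t → S₁ (suc x) ≤ # 2 * t) (sym (ι-suc x)) (S1-step (S₁ x) (L x) (L (suc x)) (ι x) (S₁ (suc x)) (S₁-suc x) (S₁≤ x (s≤s z≤n) (ℕ.<⇒≤ h)) (L-step-2 x (s≤s z≤n) h))

    S₂≤ : ∀ x → 1 ℕ.≤ x → x ℕ.≤ N → S₂ x ≤ # 12 * ι x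
    S₂≤ (suc zero) _ _ = subst₂ _≤_ (sym (trans (+-identityˡ _) (lem (L 1)))) (cong (# 12 *_) (sym ι-1)) (lit (# 12))
      where
      lem : ∀ a → (a - a) * (a - a) ≡ 0ℚ
      lem = solve-∀ ℚ-ring
    S₂≤ (suc x@(suc _)) _ h = subst (λ t → S₂ (suc x) ≤ # 12 * t) (sym (ι-suc x)) (S2-step (S₁ x) (S₂ x) (L x) (L (suc x)) (ι x) (S₂ (suc x)) (S₂-suc x)
      (S₁≤ x (s≤s z≤n) (ℕ.<⇒≤ h)) (S₂≤ x (s≤s z≤n) (ℕ.<⇒≤ h)) (L-step-2 x (s≤s z≤n) h) (L-mono (s≤s z≤n) (ℕ.n≤1+n x) h) (1≤ι (s≤s z≤n)))

    -- The constant for which Σ_{m ≤ y} (ψ (y/m) - y/m + C) = O(log y).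
    C : ℚ
    C = 1ℚ + γ

    -- Sum L j = H j - γ - O(1/j) with `sum-H`. The linear terms -y and -γ y are what `C` collects,
    -- and the remaining error lies between 0 and H y.
    T-lo : ∀ y → y ℕ.≤ N → 0ℚ ≤ T y - ι y * H y + C * ι y
    T-lo y y≤N = lem (sum y H) (T y) (ι y) (H y) γ (sum-H y) (≤-trans (sum-mono y (λ j a b → l1 (H j) (L j) γ (inv j) (L-γ-hi j a (ℕ.≤-trans b y≤N)))) (≤-reflexive (trans (sum-+ y (λ j → L j + γ) inv) (cong (_+ H y) (trans (sum-+ y L (λ _ → γ)) (cong (λ t → T y + t) (sum-const y γ)))))))
      where
      l1 : ∀ h l g i → h - l - g ≤ i → h ≤ l + g + i
      l1 h l g i p = ≤-by (gap p) (ring-≡ (h ∷ l ∷ g ∷ i ∷ []) (var 1 :+ var 2 :+ var 3) (var 0 :+ (var 3 :- (var 0 :- var 1 :- var 2))) refl)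
      lem : ∀ s t y h g → s ≡ (y + 1ℚ) * h - y → s ≤ t + y * g + h → 0ℚ ≤ t - y * h + (1ℚ + g) * y
      lem s t y h g e p = ≤-by (gap (≤-reflexive (sym e)) ⊹ gap p) (ring-≡ (s ∷ t ∷ y ∷ h ∷ g ∷ []) (var 1 :- var 2 :* var 3 :+ (nat 1 :+ var 4) :* var 2) (nat 0 :+ (var 0 :- ((var 2 :+ nat 1) :* var 3 :- var 2) :+ (var 1 :+ var 2 :* var 4 :+ var 3 :- var 0))) refl)

    T-hi : ∀ y → y ℕ.≤ N → T y - ι y * H y + C * ι y ≤ H y
    T-hi y y≤N = lem (sum y H) (T y) (ι y) (H y) γ (sum-H y) (≤-trans (≤-reflexive (sym (trans (sum-+ y L (λ _ → γ)) (cong (λ t → T y + t) (sum-const y γ))))) (sum-mono y (λ j a b → l1 (H j) (L j) γ (L-γ-lo j a (ℕ.≤-trans b y≤N)))))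
      where
      l1 : ∀ h l g → 0ℚ ≤ h - l - g → l + g ≤ h
      l1 h l g p = ≤-by (p) (ring-≡ (h ∷ l ∷ g ∷ []) (var 0) (var 1 :+ var 2 :+ (var 0 :- var 1 :- var 2)) refl)
      lem : ∀ s t y h g → s ≡ (y + 1ℚ) * h - y → t + y * g ≤ s → t - y * h + (1ℚ + g) * y ≤ h
      lem s t y h g e p = ≤-by (gap (≤-reflexive e) ⊹ gap p) (ring-≡ (s ∷ t ∷ y ∷ h ∷ g ∷ []) (var 3) (var 1 :- var 2 :* var 3 :+ (nat 1 :+ var 4) :* var 2 :+ ((var 2 :+ nat 1) :* var 3 :- var 2 :- var 0 :+ (var 0 :- (var 1 :+ var 2 :* var 4)))) refl)

    -- Selberg's formula, with Chebyshev's and Mertens' bounds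

    module _ (x : ℕ) (1≤x : 1 ℕ.≤ x) (x≤N : x ℕ.≤ N) where
      private
        -- The remainder ψ(x/k) - x/k, shifted by `C` so that its sum over the multiples of n is
        -- only logarithmic in x/n (`G-bound`).
        K : ℕ → ℚ
        K k = ψ (x ⫽ k) - ι x * inv k + C
        F : ℕ → ℚ
        F k = 𝟙 (k ℕ.≤? x) * K k
        F-supp : Supp x F
        F-supp k a = trans (cong (_* K k) (𝟙-no (k ℕ.≤? x) (ℕ.<⇒≱ a))) (*-zeroˡ (K k))
        G : ℕ → ℚ
        G n = sum x (λ m → F (n ℕ.* m))

        G-≡ : ∀ n → 1 ℕ.≤ n → G n ≡ T (x ⫽ n) - ι x * inv n * H (x ⫽ n) + C * ι (x ⫽ n)
        G-≡ n 1≤n = trans (sum-cong x (λ m 1≤m _ → trans (cong (_* K (n ℕ.* m)) (≤?-cong (*≤⇒≤⫽ 1≤n) (≤⫽⇒*≤ {x} {n} {m}))) (cong (𝟙 (m ℕ.≤? y) *_) (K-≡ m 1≤m))))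
          (trans (sum-≤? x y (λ m → ψ (y ⫽ m) - ι x * inv n * inv m + C) (⫽≤ x 1≤n))
            (trans (sum-+ y (λ m → ψ (y ⫽ m) - ι x * inv n * inv m) (λ _ → C)) (cong₂ _+_ (trans (sum-- y (λ m → ψ (y ⫽ m)) (λ m → ι x * inv n * inv m)) (cong₂ _-_ (sym (T-ψ y)) (sum-*ˡ y (ι x * inv n) inv)))
              (trans (sum-const y C) (*-comm (ι y) C)))))
          where
          y = x ⫽ n
          K-≡ : ∀ m → 1 ℕ.≤ m → K (n ℕ.* m) ≡ ψ (y ⫽ m) - ι x * inv n * inv m + C
          K-≡ m 1≤m = cong₂ (λ s t → ψ s - t + C) (sym (⫽-⫽ x 1≤n 1≤m)) (trans (cong (ι x *_) (inv-* 1≤n 1≤m)) (sym (*-assoc (ι x) (inv n) (inv m))))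

        L-⫽ : ∀ n → 1 ℕ.≤ n → n ℕ.≤ x → L n + L (x ⫽ n) ≤ L x
        L-⫽ n 1≤n n≤x = subst (_≤ L x) (L-* n (x ⫽ n) 1≤n 1≤y (ℕ.≤-trans (*⫽≤ x n) x≤N)) (L-mono (ℕ.*-mono-≤ 1≤n 1≤y) (*⫽≤ x n) x≤N)
          where
          1≤y : 1 ℕ.≤ x ⫽ n
          1≤y = *≤⇒≤⫽ 1≤n (subst (ℕ._≤ x) (sym (ℕ.*-identityʳ n)) n≤x)

        -- Apart from x/n in place of its floor y, this is `T-lo` and `T-hi` at y; the replacement
        -- costs at most H y. Finally H y ≤ L y + γ + 1/y ≤ L x - L n + 2.
        G-bound : ∀ n → 1 ℕ.≤ n → n ℕ.≤ x → (G n ≤ L x - L n + # 2) × (- (L x - L n + # 2) ≤ G n)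
        G-bound n 1≤n n≤x = subst (λ t → (t ≤ L x - L n + # 2) × (- (L x - L n + # 2) ≤ t)) (sym (G-≡ n 1≤n))
            ( l1 (T y) (ι y) (H y) C v (L x) (L n) (L y) γ (inv y) (T-hi y y≤N) (L-γ-hi y 1≤y y≤N) (⇒1 y 1≤y) γ≤1 (L-⫽ n 1≤n n≤x) (ι⫽≤ x n) H≥0
            , l2 (T y) (ι y) (H y) C v (L x) (L n) (L y) γ (inv y) (T-lo y y≤N) (L-γ-hi y 1≤y y≤N) (⇒1 y 1≤y) γ≤1 (L-⫽ n 1≤n n≤x) (≤ι⫽ x n 1≤n) H≥0)
          where
          y = x ⫽ n
          v = ι x * inv n
          y≤N = ℕ.≤-trans (⫽≤ x 1≤n) x≤N
          1≤y : 1 ℕ.≤ x ⫽ n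
          1≤y = *≤⇒≤⫽ 1≤n (subst (ℕ._≤ x) (sym (ℕ.*-identityʳ n)) n≤x)
          H≥0 : 0ℚ ≤ H y
          H≥0 = sum≥0 y (λ k _ _ → inv≥0 k)
          ⇒1 : ∀ y → 1 ℕ.≤ y → inv y ≤ 1ℚ
          ⇒1 y a = subst (inv y ≤_) inv-1 (inv-anti (s≤s z≤n) a)
          l1 : ∀ t y h c v lx ln ly g i → t - y * h + c * y ≤ h → h - ly - g ≤ i → i ≤ 1ℚ → g ≤ 1ℚ → ln + ly ≤ lx → y ≤ v → 0ℚ ≤ h → t - v * h + c * y ≤ lx - ln + # 2
          l1 t y h c v lx ln ly g i a b d e f k m = ≤-by (gap a ⊹ gap b ⊹ gap d ⊹ gap e ⊹ gap f ⊹ gap k ⊠ m) (ring-≡ (t ∷ y ∷ h ∷ c ∷ v ∷ lx ∷ ln ∷ ly ∷ g ∷ i ∷ []) (var 5 :- var 6 :+ nat 2) (var 0 :- var 4 :* var 2 :+ var 3 :* var 1 :+ (var 2 :- (var 0 :- var 1 :* var 2 :+ var 3 :* var 1) :+ (var 9 :- (var 2 :- var 7 :- var 8)) :+ (nat 1 :- var 9) :+ (nat 1 :- var 8) :+ (var 5 :- (var 6 :+ var 7)) :+ (var 4 :- var 1) :* var 2)) refl)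
          l2 : ∀ t y h c v lx ln ly g i → 0ℚ ≤ t - y * h + c * y → h - ly - g ≤ i → i ≤ 1ℚ → g ≤ 1ℚ → ln + ly ≤ lx → v ≤ y + 1ℚ → 0ℚ ≤ h → (- (lx - ln + # 2)) ≤ t - v * h + c * y
          l2 t y h c v lx ln ly g i a b d e f k m = ≤-by (a ⊹ gap b ⊹ gap d ⊹ gap e ⊹ gap f ⊹ gap k ⊠ m) (ring-≡ (t ∷ y ∷ h ∷ c ∷ v ∷ lx ∷ ln ∷ ly ∷ g ∷ i ∷ []) (var 0 :- var 4 :* var 2 :+ var 3 :* var 1) ((:- (var 5 :- var 6 :+ nat 2)) :+ (var 0 :- var 1 :* var 2 :+ var 3 :* var 1 :+ (var 9 :- (var 2 :- var 7 :- var 8)) :+ (nat 1 :- var 9) :+ (nat 1 :- var 8) :+ (var 5 :- (var 6 :+ var 7)) :+ (var 1 :+ nat 1 :- var 4) :* var 2)) refl)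

        M : ℕ → ℚ
        M n = μ x n * ((L x - L n) * G n)
        B : ℕ → ℚ
        B n = (L x - L n) * (L x - L n) + # 2 * (L x - L n)

        M-bound : ∀ n → 1 ℕ.≤ n → n ℕ.≤ x → (M n ≤ B n) × (- B n ≤ M n)
        M-bound n 1≤n n≤x = l1 (μ x n) (L x - L n) (G n) (proj₁ U) (proj₂ U) w≥0 (proj₁ g) (proj₂ g) , l2 (μ x n) (L x - L n) (G n) (proj₁ U) (proj₂ U) w≥0 (proj₁ g) (proj₂ g)
          where
          U = μ-unit x n 1≤n
          g = G-bound n 1≤n n≤x
          w≥0 : 0ℚ ≤ L x - L n
          w≥0 = gap (L-mono 1≤n n≤x x≤N)
          l1 : ∀ m w g → (- 1ℚ) ≤ m → m ≤ 1ℚ → 0ℚ ≤ w → g ≤ w + # 2 → (- (w + # 2)) ≤ g → m * (w * g) ≤ w * w + # 2 * w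
          l1 m w g a b c d e = ≤-by (lit (ℤ.+ 1 / 2) ⊠ (gap a ⊠ c ⊠ gap d) ⊹ lit (ℤ.+ 1 / 2) ⊠ (gap b ⊠ c ⊠ gap e)) (ring-≡ (m ∷ w ∷ g ∷ []) (var 1 :* var 1 :+ nat 2 :* var 1) (var 0 :* (var 1 :* var 2) :+ (con (ℤ.+ 1 / 2) :* ((var 0 :- (:- nat 1)) :* var 1 :* (var 1 :+ nat 2 :- var 2)) :+ con (ℤ.+ 1 / 2) :* ((nat 1 :- var 0) :* var 1 :* (var 2 :- (:- (var 1 :+ nat 2)))))) refl)
          l2 : ∀ m w g → (- 1ℚ) ≤ m → m ≤ 1ℚ → 0ℚ ≤ w → g ≤ w + # 2 → (- (w + # 2)) ≤ g → (- (w * w + # 2 * w)) ≤ m * (w * g)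
          l2 m w g a b c d e = ≤-by (lit (ℤ.+ 1 / 2) ⊠ (gap a ⊠ c ⊠ gap e) ⊹ lit (ℤ.+ 1 / 2) ⊠ (gap b ⊠ c ⊠ gap d)) (ring-≡ (m ∷ w ∷ g ∷ []) (var 0 :* (var 1 :* var 2)) ((:- (var 1 :* var 1 :+ nat 2 :* var 1)) :+ (con (ℤ.+ 1 / 2) :* ((var 0 :- (:- nat 1)) :* var 1 :* (var 2 :- (:- (var 1 :+ nat 2)))) :+ con (ℤ.+ 1 / 2) :* ((nat 1 :- var 0) :* var 1 :* (var 1 :+ nat 2 :- var 2)))) refl)

        ΣB : sum x B ≤ # 16 * ι x
        ΣB = lem (sum x B) (S₁ x) (S₂ x) (ι x) (trans (sum-+ x (λ n → (L x - L n) * (L x - L n)) (λ n → # 2 * (L x - L n))) (cong (λ t → S₂ x + t) (sum-*ˡ x (# 2) (λ n → L x - L n)))) (S₁≤ x 1≤x x≤N) (S₂≤ x 1≤x x≤N)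
          where
          lem : ∀ b s1 s2 x → b ≡ s2 + # 2 * s1 → s1 ≤ # 2 * x → s2 ≤ # 12 * x → b ≤ # 16 * x
          lem b s1 s2 x e p q = ≤-by (gap (≤-reflexive e) ⊹ lit (# 2) ⊠ gap p ⊹ gap q) (ring-≡ (b ∷ s1 ∷ s2 ∷ x ∷ []) (nat 16 :* var 3) (var 0 :+ (var 2 :+ nat 2 :* var 1 :- var 0 :+ nat 2 :* (nat 2 :* var 3 :- var 1) :+ (nat 12 :* var 3 :- var 2))) refl)

        ΣM-hi : sum x M ≤ # 16 * ι x
        ΣM-hi = ≤-trans (sum-mono x (λ n a b → proj₁ (M-bound n a b))) ΣB

        ΣM-lo : - (# 16 * ι x) ≤ sum x M
        ΣM-lo = ≤-trans (neg-antimono-≤ ΣB) (≤-trans (≤-reflexive neg-sum) (sum-mono x (λ n a b → proj₂ (M-bound n a b))))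
          where
          neg-sum : - sum x B ≡ sum x (λ n → - B n)
          neg-sum = trans (l1 (sum x B)) (trans (sym (sum-*ˡ x (- 1ℚ) B)) (sum-cong x (λ n _ _ → sym (l1 (B n)))))
            where
            l1 : ∀ a → - a ≡ (- 1ℚ) * a
            l1 = solve-∀ ℚ-ring

      Sel : ℚ
      Sel = L x * ψ x + sum x (λ k → Λ k * ψ (x ⫽ k))

      private
        -- Selberg's formula in raw form. The left side lies between -16x and 16x, since |μ| ≤ 1 and
        -- the sums of log(x/n) and log²(x/n) are O(x). It remains to evaluate `Q x` and to bound
        -- the term with `C`.
        TI-≡ : sum x M ≡ Sel - ι x * L x - ι x * Q x + C * (L x + ψ x)
        TI-≡ = trans (tatuzawa-iseki x F 1≤x x≤N F-supp) (trans (cong₂ _+_ (cong (L x *_) F1) ΛF) (lem (L x) (ψ x) (ι x) C (sum x (λ k → Λ k * ψ (x ⫽ k))) (Q x)))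
          where
          F1 : F 1 ≡ ψ x - ι x + C
          F1 = trans (cong (_* K 1) (𝟙-yes (1 ℕ.≤? x) 1≤x)) (trans (*-identityˡ (K 1)) (cong₂ (λ s t → ψ s - t + C) (⫽-1 x) (trans (cong (ι x *_) inv-1) (*-identityʳ (ι x)))))
          ΛF : sum x (λ d → Λ d * F d) ≡ sum x (λ k → Λ k * ψ (x ⫽ k)) - ι x * Q x + C * ψ x
          ΛF = trans (sum-cong x (λ d _ b → trans (cong (Λ d *_) (trans (cong (_* K d) (𝟙-yes (d ℕ.≤? x) b)) (*-identityˡ (K d)))) (l1 (Λ d) (ψ (x ⫽ d)) (ι x) (inv d) C)))
            (trans (sum-+ x _ _) (cong₂ _+_ (trans (sum-- x _ _) (cong (λ t → sum x (λ k → Λ k * ψ (x ⫽ k)) - t) (sum-*ˡ x (ι x) (λ k → Λ k * inv k)))) (sum-*ˡ x C Λ)))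
            where
            l1 : ∀ l p x i c → l * (p - x * i + c) ≡ l * p - x * (l * i) + c * l
            l1 = solve-∀ ℚ-ring
          lem : ∀ l p x c s q → l * (p - x + c) + (s - x * q + c * p) ≡ l * p + s - x * l - x * q + c * (l + p)
          lem = solve-∀ ℚ-ring

        ΣΛψ≥0 : 0ℚ ≤ sum x (λ k → Λ k * ψ (x ⫽ k))
        ΣΛψ≥0 = sum≥0 x (λ k _ _ → Λ≥0 k ⊠ ψ≥0 (x ⫽ k))

      L≤ι : L x ≤ ι x
      L≤ι = lem (ι 1) (L x) (L 1) (ι x) (L-lip (s≤s z≤n) 1≤x x≤N) ι-1 L-1
        where
        lem : ∀ o l l1 x → o * (l - l1) ≤ x - o + 1ℚ → o ≡ 1ℚ → l1 ≡ 0ℚ → l ≤ x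
        lem o l l1 x p e f = ≤-by (gap p ⊹ gap (≤-reflexive (sym e)) ⊹ gap (≤-reflexive f) ⊹ eqgap (l) (sym e) ⊹ eqgap (l1) e) (ring-≡ (o ∷ l ∷ l1 ∷ x ∷ []) (var 3) (var 1 :+ (var 3 :- var 0 :+ nat 1 :- var 0 :* (var 1 :- var 2) :+ (var 0 :- nat 1) :+ (nat 0 :- var 2) :+ (var 0 :- nat 1) :* var 1 :+ (nat 1 :- var 0) :* var 2)) refl)

      private
        Lx≥0 : 0ℚ ≤ L x
        Lx≥0 = L≥0 1≤x x≤N

        T≤ : T x ≤ ι x * L x
        T≤ = subst (T x ≤_) (sum-const x (L x)) (sum-mono x (λ j a b → L-mono a b x≤N))

        T≥ : ι x * L x - # 2 * ι x ≤ T x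
        T≥ = lem (ι x) (L x) (T x) (S₁ x) (trans (sum-- x (λ _ → L x) L) (cong (_- T x) (sum-const x (L x)))) (S₁≤ x 1≤x x≤N)
          where
          lem : ∀ x l t s → s ≡ x * l - t → s ≤ # 2 * x → x * l - # 2 * x ≤ t
          lem x l t s e p = ≤-by (gap (≤-reflexive (sym e)) ⊹ gap p) (ring-≡ (x ∷ l ∷ t ∷ s ∷ []) (var 2) (var 0 :* var 1 :- nat 2 :* var 0 :+ (var 3 :- (var 0 :* var 1 :- var 2) :+ (nat 2 :* var 0 :- var 3))) refl)

        T≤xQ : T x ≤ ι x * Q x
        T≤xQ = subst₂ _≤_ (sym (T-Λ x)) (sum-*ˡ x (ι x) (λ k → Λ k * inv k)) (sum-mono x (λ k _ _ → lem (Λ k) (ι (x ⫽ k)) (ι x) (inv k) (Λ≥0 k) (ι⫽≤ x k)))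
          where
          lem : ∀ l a x i → 0ℚ ≤ l → a ≤ x * i → l * a ≤ x * (l * i)
          lem l a x i p q = ≤-by (p ⊠ gap q) (ring-≡ (l ∷ a ∷ x ∷ i ∷ []) (var 2 :* (var 0 :* var 3)) (var 0 :* var 1 :+ (var 0 :* (var 2 :* var 3 :- var 1))) refl)

        xQ≤ : ι x * Q x ≤ T x + ψ x
        xQ≤ = subst₂ _≤_ (sum-*ˡ x (ι x) (λ k → Λ k * inv k)) (trans (sum-+ x (λ k → Λ k * ι (x ⫽ k)) Λ) (cong (_+ ψ x) (sym (T-Λ x)))) (sum-mono x (λ k a _ → lem (Λ k) (ι (x ⫽ k)) (ι x) (inv k) (Λ≥0 k) (≤ι⫽ x k a)))
          where
          lem : ∀ l a x i → 0ℚ ≤ l → x * i ≤ a + 1ℚ → x * (l * i) ≤ l * a + l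
          lem l a x i p q = ≤-by (p ⊠ gap q) (ring-≡ (l ∷ a ∷ x ∷ i ∷ []) (var 0 :* var 1 :+ var 0) (var 2 :* (var 0 :* var 3) :+ (var 0 :* (var 1 :+ nat 1 :- var 2 :* var 3))) refl)

        ψ≤T : ψ x ≤ T x
        ψ≤T = subst (ψ x ≤_) (sym (T-Λ x)) (sum-mono x (λ k a b → lem (Λ k) (ι (x ⫽ k)) (Λ≥0 k) (1≤ι (*≤⇒≤⫽ a (subst (ℕ._≤ x) (sym (ℕ.*-identityʳ k)) b)))))
          where
          lem : ∀ l a → 0ℚ ≤ l → 1ℚ ≤ a → l ≤ l * a
          lem l a p q = ≤-by (p ⊠ gap q) (ring-≡ (l ∷ a ∷ []) (var 0 :* var 1) (var 0 :+ (var 0 :* (var 1 :- nat 1))) refl)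

      -- In `TI-≡` the double sum and the term with `C` are nonnegative, and x Q ≤ x L + ψ, so (L -
      -- 1) ψ ≤ 16x + 2xL. For L ≥ 2 the left side is at least L ψ / 2 and 32x ≤ 16xL, which gives
      -- 20. For L ≤ 2 already ψ ≤ T ≤ xL suffices.
      chebyshev-≤ : ψ x ≤ # 20 * ι x
      chebyshev-≤ with ≤-total (L x) (# 2)
      ... | inj₁ small = l1 (ψ x) (T x) (ι x) (L x) ψ≤T T≤ small (ι≥0 x)
        where
        l1 : ∀ p t x l → p ≤ t → t ≤ x * l → l ≤ # 2 → 0ℚ ≤ x → p ≤ # 20 * x
        l1 p t x l a b c d = ≤-by (gap a ⊹ gap b ⊹ lit (# 18) ⊠ d ⊹ gap c ⊠ d) (ring-≡ (p ∷ t ∷ x ∷ l ∷ []) (nat 20 :* var 2) (var 0 :+ (var 1 :- var 0 :+ (var 2 :* var 3 :- var 1) :+ nat 18 :* var 2 :+ (nat 2 :- var 3) :* var 2)) refl)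
      ... | inj₂ big = cancel-≤ (L x) _ _ (<-≤-trans (*<* (ℤ.+<+ (s≤s z≤n))) big)
          (l2 (ψ x) (T x) (ι x) (L x) (Q x) C (sum x (λ k → Λ k * ψ (x ⫽ k))) (sum x M) TI-≡ ΣM-hi xQ≤ T≤ big (ψ≥0 x) (ι≥0 x) ΣΛψ≥0 (lit 1ℚ ⊹ γ≥0))
        where
        l2 : ∀ p t x l q c s m → m ≡ l * p + s - x * l - x * q + c * (l + p) → m ≤ # 16 * x → x * q ≤ t + p → t ≤ x * l → # 2 ≤ l → 0ℚ ≤ p → 0ℚ ≤ x → 0ℚ ≤ s → 0ℚ ≤ c → l * p ≤ l * (# 20 * x)
        l2 p t x l q c s m e a b d f g k n o = ≤-by (lit (# 2) ⊠ gap (≤-reflexive (sym e)) ⊹ lit (# 2) ⊠ gap a ⊹ lit (# 2) ⊠ gap b ⊹ lit (# 2) ⊠ gap d ⊹ lit (# 2) ⊠ n ⊹ lit (# 4) ⊠ o ⊹ gap f ⊠ g ⊹ lit (# 16) ⊠ (gap f ⊠ k) ⊹ lit (# 2) ⊠ (o ⊠ gap f) ⊹ lit (# 2) ⊠ (o ⊠ g)) (ring-≡ (p ∷ t ∷ x ∷ l ∷ q ∷ c ∷ s ∷ m ∷ []) (var 3 :* (nat 20 :* var 2)) (var 3 :* var 0 :+ (nat 2 :* (var 7 :- (var 3 :* var 0 :+ var 6 :- var 2 :* var 3 :- var 2 :* var 4 :+ var 5 :* (var 3 :+ var 0))) :+ nat 2 :* (nat 16 :* var 2 :- var 7) :+ nat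 2 :* (var 1 :+ var 0 :- var 2 :* var 4) :+ nat 2 :* (var 2 :* var 3 :- var 1) :+ nat 2 :* var 6 :+ nat 4 :* var 5 :+ (var 3 :- nat 2) :* var 0 :+ nat 16 :* ((var 3 :- nat 2) :* var 2) :+ nat 2 :* (var 5 :* (var 3 :- nat 2)) :+ nat 2 :* (var 5 :* var 0))) refl)

      mertens-≤ : Q x ≤ L x + # 20
      mertens-≤ = cancel-≤ (ι x) _ _ (ι-pos 1≤x) (lem (ι x) (Q x) (L x) (T x) (ψ x) xQ≤ T≤ chebyshev-≤)
        where
        lem : ∀ x q l t p → x * q ≤ t + p → t ≤ x * l → p ≤ # 20 * x → x * q ≤ x * (l + # 20)
        lem x q l t p a b c = ≤-by (gap a ⊹ gap b ⊹ gap c) (ring-≡ (x ∷ q ∷ l ∷ t ∷ p ∷ []) (var 0 :* (var 2 :+ nat 20)) (var 0 :* var 1 :+ (var 3 :+ var 4 :- var 0 :* var 1 :+ (var 0 :* var 2 :- var 3) :+ (nat 20 :* var 0 :- var 4))) refl)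

      mertens-≥ : L x - # 2 ≤ Q x
      mertens-≥ = cancel-≤ (ι x) _ _ (ι-pos 1≤x) (lem (ι x) (Q x) (L x) (T x) T≤xQ T≥)
        where
        lem : ∀ x q l t → t ≤ x * q → x * l - # 2 * x ≤ t → x * (l - # 2) ≤ x * q
        lem x q l t a b = ≤-by (gap a ⊹ gap b) (ring-≡ (x ∷ q ∷ l ∷ t ∷ []) (var 0 :* var 1) (var 0 :* (var 2 :- nat 2) :+ (var 0 :* var 1 :- var 3 :+ (var 3 :- (var 0 :* var 2 :- nat 2 :* var 0)))) refl)

      selberg-≤ : Sel ≤ # 2 * (ι x * L x) + # 60 * ι x
      selberg-≤ = lem (ι x) (L x) (ψ x) (Q x) C Sel (sum x M) TI-≡ ΣM-hi mertens-≤ (ι≥0 x) Lx≥0 (ψ≥0 x) (lit 1ℚ ⊹ γ≥0)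
        where
        lem : ∀ x l p q c s m → m ≡ s - x * l - x * q + c * (l + p) → m ≤ # 16 * x → q ≤ l + # 20 → 0ℚ ≤ x → 0ℚ ≤ l → 0ℚ ≤ p → 0ℚ ≤ c → s ≤ # 2 * (x * l) + # 60 * x
        lem x l p q c s m e a b d f g k = ≤-by (gap (≤-reflexive (sym e)) ⊹ gap a ⊹ lit (# 24) ⊠ d ⊹ gap b ⊠ d ⊹ k ⊠ f ⊹ k ⊠ g) (ring-≡ (x ∷ l ∷ p ∷ q ∷ c ∷ s ∷ m ∷ []) (nat 2 :* (var 0 :* var 1) :+ nat 60 :* var 0) (var 5 :+ (var 6 :- (var 5 :- var 0 :* var 1 :- var 0 :* var 3 :+ var 4 :* (var 1 :+ var 2)) :+ (nat 16 :* var 0 :- var 6) :+ nat 24 :* var 0 :+ (var 1 :+ nat 20 :- var 3) :* var 0 :+ var 4 :* var 1 :+ var 4 :* var 2)) refl)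

      -- The 60 is made of 16 from `ΣM-lo`, 2 from `mertens-≥`, and 2 (1 + 20) from C (L x + ψ x)
      -- with C ≤ 2.
      selberg-≥ : # 2 * (ι x * L x) - # 60 * ι x ≤ Sel
      selberg-≥ = lem (ι x) (L x) (ψ x) (Q x) γ Sel (sum x M) TI-≡ ΣM-lo mertens-≥ (ι≥0 x) Lx≥0 (ψ≥0 x) γ≤1 L≤ι chebyshev-≤
        where
        lem : ∀ x l p q g s m → m ≡ s - x * l - x * q + (1ℚ + g) * (l + p) → (- (# 16 * x)) ≤ m → l - # 2 ≤ q → 0ℚ ≤ x → 0ℚ ≤ l → 0ℚ ≤ p → g ≤ 1ℚ → l ≤ x → p ≤ # 20 * x → # 2 * (x * l) - # 60 * x ≤ s
        lem x l p q g s m e a b d f r k n o = ≤-by (gap (≤-reflexive e) ⊹ gap a ⊹ lit (# 2) ⊠ gap n ⊹ lit (# 2) ⊠ gap o ⊹ gap b ⊠ d ⊹ gap k ⊠ f ⊹ gap k ⊠ r) (ring-≡ (x ∷ l ∷ p ∷ q ∷ g ∷ s ∷ m ∷ []) (var 5) (nat 2 :* (var 0 :* var 1) :- nat 60 :* var 0 :+ (var 5 :- var 0 :* var 1 :- var 0 :* var 3 :+ (nat 1 :+ var 4) :* (var 1 :+ var 2) :- var 6 :+ (var 6 :- (:- (nat 16 :* var 0))) :+ nat 2 :* (var 0 :- var 1) :+ nat 2 :* (nat 20 :* var 0 :- var 2) :+ (var 3 :- (var 1 :- nat 2)) :* var 0 :+ (nat 1 :- var 4) :* var 1 :+ (nat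 1 :- var 4) :* var 2)) refl)

    -- The double sum of Selberg's formula, extended to k ≤ N. The new terms vanish, and sums for
    -- two different x can now be compared term by term.
    ψ⫽ : ℕ → ℚ
    ψ⫽ x = sum N (λ k → Λ k * ψ (x ⫽ k))

    Sel-≡ : ∀ x 1≤x x≤N → Sel x 1≤x x≤N ≡ L x * ψ x + ψ⫽ x
    Sel-≡ x 1≤x x≤N = cong (λ t → L x * ψ x + t) (sym (sum-ext (λ k → Λ k * ψ (x ⫽ k)) x≤N (λ k a _ → trans (cong (λ t → Λ k * ψ t) (⫽-> a)) (*-zeroʳ (Λ k)))))

    ψ⫽-mono : ∀ {u v} → u ℕ.≤ v → ψ⫽ u ≤ ψ⫽ v
    ψ⫽-mono u≤v = sum-mono N (λ k _ _ → *-monoˡ-≤-nonNeg (Λ k) {{nonNegative (Λ≥0 k)}} (ψ-mono (⫽-mono k u≤v)))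

    ψ⫽≥0 : ∀ v → 0ℚ ≤ ψ⫽ v
    ψ⫽≥0 v = sum≥0 N (λ k _ _ → Λ≥0 k ⊠ ψ≥0 (v ⫽ k))

    brun-titchmarsh : ∀ {u v} → u ℕ.≤ v → 1 ℕ.≤ v → v ℕ.≤ N → (ψ v - ψ u) * L v ≤ # 2 * ((ι v - ι u) * L v) + # 122 * ι v
    brun-titchmarsh {zero} {v} _ 1≤v v≤N = lem (ψ v) (L v) (ι v) (ι 0) (ψ⫽ v) (subst (_≤ # 2 * (ι v * L v) + # 60 * ι v) (Sel-≡ v 1≤v v≤N) (selberg-≤ v 1≤v v≤N)) ι-0 (ψ⫽≥0 v) (ι≥0 v)
      where
      lem : ∀ p l v o s → l * p + s ≤ # 2 * (v * l) + # 60 * v → o ≡ 0ℚ → 0ℚ ≤ s → 0ℚ ≤ v → (p - 0ℚ) * l ≤ # 2 * ((v - o) * l) + # 122 * v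
      lem p l v o s a e b c = ≤-by (gap a ⊹ b ⊹ lit (# 62) ⊠ c ⊹ lit (# 2) ⊠ eqgap (l) e) (ring-≡ (p ∷ l ∷ v ∷ o ∷ s ∷ []) (nat 2 :* ((var 2 :- var 3) :* var 1) :+ nat 122 :* var 2) ((var 0 :- nat 0) :* var 1 :+ (nat 2 :* (var 2 :* var 1) :+ nat 60 :* var 2 :- (var 1 :* var 0 :+ var 4) :+ var 4 :+ nat 62 :* var 2 :+ nat 2 :* ((nat 0 :- var 3) :* var 1))) refl)
    brun-titchmarsh {u@(suc _)} {v} u≤v 1≤v v≤N = lem (ψ v) (ψ u) (L v) (L u) (ι v) (ι u) (ψ⫽ v) (ψ⫽ u)
        (subst (_≤ # 2 * (ι v * L v) + # 60 * ι v) (Sel-≡ v 1≤v v≤N) (selberg-≤ v 1≤v v≤N)) (subst (# 2 * (ι u * L u) - # 60 * ι u ≤_) (Sel-≡ u 1≤u u≤N) (selberg-≥ u 1≤u u≤N))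
        (ψ⫽-mono u≤v) (L-lip 1≤u u≤v v≤N) (L-mono 1≤u u≤v v≤N) (ψ≥0 u) (ι-mono u≤v) (1≤ι 1≤u)
      where
      1≤u : 1 ℕ.≤ u
      1≤u = s≤s z≤n
      u≤N = ℕ.≤-trans u≤v v≤N
      lem : ∀ p p0 l l0 v u s s0 → l * p + s ≤ # 2 * (v * l) + # 60 * v → # 2 * (u * l0) - # 60 * u ≤ l0 * p0 + s0 → s0 ≤ s → u * (l - l0) ≤ v - u + 1ℚ → l0 ≤ l → 0ℚ ≤ p0 → u ≤ v → 1ℚ ≤ u → (p - p0) * l ≤ # 2 * ((v - u) * l) + # 122 * v
      lem p p0 l l0 v u s s0 a b c d e f g k = ≤-by (gap a ⊹ gap b ⊹ gap c ⊹ lit (# 2) ⊠ gap d ⊹ lit (# 60) ⊠ gap g ⊹ lit (# 2) ⊠ gap k ⊹ gap e ⊠ f) (ring-≡ (p ∷ p0 ∷ l ∷ l0 ∷ v ∷ u ∷ s ∷ s0 ∷ []) (nat 2 :* ((var 4 :- var 5) :* var 2) :+ nat 122 :* var 4) ((var 0 :- var 1) :* var 2 :+ (nat 2 :* (var 4 :* var 2) :+ nat 60 :* var 4 :- (var 2 :* var 0 :+ var 6) :+ (var 3 :* var 1 :+ var 7 :- (nat 2 :* (var 5 :* var 3) :- nat 60 :* var 5)) :+ (var 6 :- var 7) :+ nat 2 :* (var 4 :- var 5 :+ nat 1 :- var 5 :* (var 2 :- var 3)) :+ nat 60 :* (var 4 :- var 5) :+ nat 2 :* (var 5 :- nat 1)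 :+ (var 2 :- var 3) :* var 1)) refl)

    L-^* : ∀ c j e → 1 ℕ.≤ c → 1 ℕ.≤ e → c ℕ.^ j ℕ.* e ℕ.≤ N → L (c ℕ.^ j ℕ.* e) ≡ ι j * L c + L e
    L-^* c zero e _ _ _ = trans (cong L (ℕ.*-identityˡ e)) (sym (trans (cong (λ t → t * L c + L e) ι-0) (lem (L c) (L e))))
      where
      lem : ∀ a b → 0ℚ * a + b ≡ b
      lem = solve-∀ ℚ-ring
    L-^* c (suc j) e 1≤c 1≤e h = trans (cong L (ℕ.*-assoc c (c ℕ.^ j) e)) (trans (L-* c (c ℕ.^ j ℕ.* e) 1≤c 1≤r (subst (ℕ._≤ N) (ℕ.*-assoc c (c ℕ.^ j) e) h))
        (trans (cong (λ t → L c + t) (L-^* c j e 1≤c 1≤e (ℕ.≤-trans (ℕ.m≤n*m (c ℕ.^ j ℕ.* e) c {{ℕ.>-nonZero 1≤c}}) (subst (ℕ._≤ N) (ℕ.*-assoc c (c ℕ.^ j) e) h))))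
          (trans (lem (L c) (ι j) (L e)) (cong (λ t → t * L c + L e) (sym (ι-suc j))))))
      where
      1≤r : 1 ℕ.≤ c ℕ.^ j ℕ.* e
      1≤r = ℕ.*-mono-≤ (1≤^ c j 1≤c) 1≤e
      lem : ∀ a j b → a + (j * a + b) ≡ (1ℚ + j) * a + b
      lem = solve-∀ ℚ-ring

  -- The interval (qz, (q+1)z] and its contractions by k

  module Chain (q z : ℕ) (4≤q : 4 ℕ.≤ q) (1≤z : 1 ℕ.≤ z) where
    N : ℕ
    N = suc q ℕ.* z
    1≤N : 1 ℕ.≤ N
    1≤N = ℕ.*-mono-≤ {1} {suc q} (s≤s z≤n) 1≤z
    open Analysis N 1≤N public

    a b : ℕ → ℕ
    a k = q ℕ.* z ⫽ k
    b k = N ⫽ k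
    -- `κ k` is the unrounded length of (qz/k, (q+1)z/k] and `D k` its mass, so D k / κ k is the
    -- density that Brun-Titchmarsh bounds by about 2.
    κ D : ℕ → ℚ
    κ k = ι z * inv k
    D k = ψ (b k) - ψ (a k)

    z≤qz : z ℕ.≤ q ℕ.* z
    z≤qz = ℕ.m≤n*m z q {{ℕ.>-nonZero (ℕ.≤-trans (s≤s z≤n) 4≤q)}}

    κ≥0 : ∀ k → 0ℚ ≤ κ k
    κ≥0 k = ι≥0 z ⊠ inv≥0 k

    kκ : ∀ {k} → 1 ℕ.≤ k → ι k * κ k ≡ ι z
    kκ {k} 1≤k = trans (lem (ι k) (ι z) (inv k)) (trans (cong (ι z *_) (inv-r 1≤k)) (*-identityʳ (ι z)))
      where
      lem : ∀ a b c → a * (b * c) ≡ b * (a * c)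
      lem = solve-∀ ℚ-ring

    private
      qκ : ∀ k → ι (q ℕ.* z) * inv k ≡ ι q * κ k
      qκ k = trans (cong (_* inv k) (ι-* q z)) (*-assoc (ι q) (ι z) (inv k))
      Nκ : ∀ k → ι N * inv k ≡ (1ℚ + ι q) * κ k
      Nκ k = trans (cong (_* inv k) (trans (ι-* (suc q) z) (cong (_* ι z) (ι-suc q)))) (*-assoc (1ℚ + ι q) (ι z) (inv k))

    a-hi : ∀ k → ι (a k) ≤ ι q * κ k
    a-hi k = subst (ι (a k) ≤_) (qκ k) (ι⫽≤ (q ℕ.* z) k)
    a-lo : ∀ k → 1 ℕ.≤ k → ι q * κ k ≤ ι (a k) + 1ℚ
    a-lo k 1≤k = subst (_≤ ι (a k) + 1ℚ) (qκ k) (≤ι⫽ (q ℕ.* z) k 1≤k)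
    b-hi : ∀ k → ι (b k) ≤ (1ℚ + ι q) * κ k
    b-hi k = subst (ι (b k) ≤_) (Nκ k) (ι⫽≤ N k)
    b-lo : ∀ k → 1 ℕ.≤ k → (1ℚ + ι q) * κ k ≤ ι (b k) + 1ℚ
    b-lo k 1≤k = subst (_≤ ι (b k) + 1ℚ) (Nκ k) (≤ι⫽ N k 1≤k)

    a≤b : ∀ k → a k ℕ.≤ b k
    a≤b k = ⫽-mono k (ℕ.m≤n+m (q ℕ.* z) z)

    b≤N : ∀ {k} → 1 ℕ.≤ k → b k ℕ.≤ N
    b≤N 1≤k = ⫽≤ N 1≤k

    4≤ιq : # 4 ≤ ι q
    4≤ιq = subst (_≤ ι q) (ι-lit 4) (ι-mono 4≤q)

    -- At density 2 a piece of length κ k / 32 carries mass κ k / 16, so the deficiency κ k / 64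
    -- allowed by `Saturated` cannot empty it (`subinterval-mass`).
    t : ℕ → ℕ
    t k = z ⫽ (32 ℕ.* k)

    t-hi : ∀ k → 1 ℕ.≤ k → # 32 * ι (t k) ≤ κ k
    t-hi k 1≤k = cancel-≤ (ι k) _ _ (ι-pos 1≤k) (subst₂ _≤_ (trans (ι-* (32 ℕ.* k) (t k)) (trans (cong (_* ι (t k)) (trans (ι-* 32 k) (cong (_* ι k) (ι-lit 32)))) (lem (# 32) (ι k) (ι (t k))))) (sym (kκ 1≤k)) (ι-mono (*⫽≤ z (32 ℕ.* k))))
      where
      lem : ∀ a b c → a * b * c ≡ b * (a * c)
      lem = solve-∀ ℚ-ring

    t-lo : ∀ k → 1 ℕ.≤ k → κ k ≤ # 32 * (1ℚ + ι (t k))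
    t-lo k 1≤k = cancel-≤ (ι k) _ _ (ι-pos 1≤k) (subst₂ _≤_ (sym (kκ 1≤k)) (trans (ι-* (32 ℕ.* k) (suc (t k))) (trans (cong₂ _*_ (trans (ι-* 32 k) (cong (_* ι k) (ι-lit 32))) (ι-suc (t k))) (lem (# 32) (ι k) (1ℚ + ι (t k))))) (ι-mono (ℕ.<⇒≤ (<*suc⫽ z (32 ℕ.* k) (ℕ.*-mono-≤ {1} {32} (s≤s z≤n) 1≤k)))))
      where
      lem : ∀ a b c → a * b * c ≡ b * (a * c)
      lem = solve-∀ ℚ-ring

    x : ℕ
    x = q ℕ.* z

    x≤N : x ℕ.≤ N
    x≤N = ℕ.m≤n+m x z

    -- If p^(A+1) ≤ N, the terms add up to at most (A+1) log p = log p^(A+1). Otherwise the last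
    -- term is zero.
    powers-≤ : ∀ p → Prime p → p ℕ.≤ N → ∀ A → sum A (λ a → weight p * 𝟙 (p ℕ.^ a ℕ.≤? N)) ≤ L N
    powers-≤ p pp p≤N zero = L≥0 1≤N ℕ.≤-refl
    powers-≤ p pp p≤N (suc A) with ℕ.≤-<-connex (p ℕ.^ suc A) N
    ... | inj₂ gt = ≤-trans (≤-reflexive (trans (cong (λ t → sum A (λ a → weight p * 𝟙 (p ℕ.^ a ℕ.≤? N)) + weight p * t) (𝟙-no (p ℕ.^ suc A ℕ.≤? N) (ℕ.<⇒≱ gt))) (lem (sum A (λ a → weight p * 𝟙 (p ℕ.^ a ℕ.≤? N))) (weight p)))) (powers-≤ p pp p≤N A)
      where
      lem : ∀ a b → a + b * 0ℚ ≡ a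
      lem = solve-∀ ℚ-ring
    ... | inj₁ le = ≤-trans (sum-mono (suc A) (λ a _ _ → l1 (weight p) (𝟙 (p ℕ.^ a ℕ.≤? N)) (weight≥0 p p≤N) (𝟙≤1 (p ℕ.^ a ℕ.≤? N))))
        (≤-trans (≤-reflexive (trans (sum-const (suc A) (weight p)) (trans (cong (ι (suc A) *_) (weight-L p pp p≤N)) Lpow))) (L-mono (1≤^ p (suc A) (1≤prime pp)) le ℕ.≤-refl))
      where
      l1 : ∀ w i → 0ℚ ≤ w → i ≤ 1ℚ → w * i ≤ w
      l1 w i a b = ≤-by (a ⊠ gap b) (ring-≡ (w ∷ i ∷ []) (var 0) (var 0 :* var 1 :+ (var 0 :* (nat 1 :- var 1))) refl)
      Lpow : ι (suc A) * L p ≡ L (p ℕ.^ suc A)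
      Lpow = sym (trans (cong L (sym (ℕ.*-identityʳ (p ℕ.^ suc A)))) (trans (L-^* p (suc A) 1 (1≤prime pp) (s≤s z≤n) (subst (ℕ._≤ N) (sym (ℕ.*-identityʳ (p ℕ.^ suc A))) le)) (trans (cong (λ t → ι (suc A) * L p + t) L-1) (+-identityʳ _))))

    private
      h : ℕ → ℚ
      h d = 𝟙 (d ℕ.≤? N) - 𝟙 (d ℕ.≤? x)

      h-supp : Supp N h
      h-supp k N<k = cong₂ _-_ (𝟙-no (k ℕ.≤? N) (ℕ.<⇒≱ N<k)) (𝟙-no (k ℕ.≤? x) (ℕ.<⇒≱ (ℕ.≤-<-trans x≤N N<k)))

      h-out : ∀ k → ¬ (x ℕ.< k × k ℕ.≤ N) → h k ≡ 0ℚ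
      h-out k ¬in with ℕ.≤-<-connex k x
      ... | inj₁ k≤x = cong₂ _-_ (𝟙-yes (k ℕ.≤? N) (ℕ.≤-trans k≤x x≤N)) (𝟙-yes (k ℕ.≤? x) k≤x)
      ... | inj₂ x<k = h-supp k (ℕ.≰⇒> (λ k≤N → ¬in (x<k , k≤N)))

      h≤ : ∀ k → h k ≤ 𝟙 (k ℕ.≤? N)
      h≤ k = l1 (𝟙 (k ℕ.≤? N)) (𝟙 (k ℕ.≤? x)) (𝟙≥0 (k ℕ.≤? x))
        where
        l1 : ∀ a b → 0ℚ ≤ b → a - b ≤ a
        l1 a b p = ≤-by (p) (ring-≡ (a ∷ b ∷ []) (var 0) (var 0 :- var 1 :+ (var 1)) refl)

    Δψ-≡ : ψ N - ψ x ≡ sum N (λ p → sum N (λ a → weight p * h (p ℕ.^ a)))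
    Δψ-≡ = trans (sym (trans (sum-cong N (λ d _ _ → lem (Λ d) (𝟙 (d ℕ.≤? N)) (𝟙 (d ℕ.≤? x)))) (trans (sum-- N (λ d → 𝟙 (d ℕ.≤? N) * Λ d) (λ d → 𝟙 (d ℕ.≤? x) * Λ d)) (cong₂ _-_ (sum-≤? N N Λ ℕ.≤-refl) (sum-≤? N x Λ x≤N))))) (Λ-sum N h h-supp)
      where
      lem : ∀ l a b → l * (a - b) ≡ a * l - b * l
      lem = solve-∀ ℚ-ring

    -- Without primes only proper powers p^a with a ≥ 2 remain in (x, N]. They force p ≤ S, and all
    -- powers of one p together weigh at most log N.
    Δψ-≤ : (∀ p → Prime p → x ℕ.< p → p ℕ.≤ N → ⊥) → ∀ S → N ℕ.< suc S ℕ.* suc S → S ℕ.≤ N → ψ N - ψ x ≤ ι S * L N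
    Δψ-≤ no-prime S N<S² S≤N = ≤-trans (≤-reflexive Δψ-≡) (≤-trans (sum-mono N (λ p 1≤p p≤N → row p 1≤p p≤N (prime? p))) (≤-reflexive (trans (sum-≤? N S (λ _ → L N) S≤N) (sum-const S (L N)))))
      where
      row : ∀ p → 1 ℕ.≤ p → p ℕ.≤ N → Dec (Prime p) → sum N (λ a → weight p * h (p ℕ.^ a)) ≤ 𝟙 (p ℕ.≤? S) * L N
      row p 1≤p p≤N (no ¬p) = ≤-trans (≤-reflexive (trans (sum-cong N (λ a _ _ → trans (cong (_* h (p ℕ.^ a)) (weight-¬prime p ¬p)) (*-zeroˡ (h (p ℕ.^ a))))) (sum-0 N))) (𝟙≥0 (p ℕ.≤? S) ⊠ L≥0 1≤N ℕ.≤-refl)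
      row p 1≤p p≤N (yes pp) with ℕ.≤-<-connex p S
      ... | inj₁ p≤S = ≤-trans (sum-mono N (λ a _ _ → *-monoˡ-≤-nonNeg (weight p) {{nonNegative (weight≥0 p p≤N)}} (h≤ (p ℕ.^ a)))) (≤-trans (powers-≤ p pp p≤N N) (≤-reflexive (sym (trans (cong (_* L N) (𝟙-yes (p ℕ.≤? S) p≤S)) (*-identityˡ (L N))))))
      ... | inj₂ S<p = ≤-trans (≤-reflexive (trans (sum-cong N (λ a 1≤a _ → trans (cong (weight p *_) (h-out (p ℕ.^ a) (out a 1≤a))) (*-zeroʳ (weight p)))) (sum-0 N))) (𝟙≥0 (p ℕ.≤? S) ⊠ L≥0 1≤N ℕ.≤-refl)
        where
        out : ∀ a → 1 ℕ.≤ a → ¬ (x ℕ.< p ℕ.^ a × p ℕ.^ a ℕ.≤ N)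
        out (suc zero) _ (lo , hi) = no-prime p pp (subst (x ℕ.<_) (ℕ.*-identityʳ p) lo) (subst (ℕ._≤ N) (ℕ.*-identityʳ p) hi)
        out (suc (suc a)) _ (lo , hi) = ℕ.<⇒≱ (ℕ.<-≤-trans N<S² (ℕ.*-mono-≤ S<p S<p)) (ℕ.≤-trans (ℕ.*-monoʳ-≤ p (ℕ.m≤m*n p (p ℕ.^ a) {{ℕ.m^n≢0 p a {{ℕ.>-nonZero 1≤p}}}})) hi)

    ΣΛD : ℚ
    ΣΛD = sum N (λ k → Λ k * D k)

    ΣΛD-≡ : ΣΛD ≡ ψ⫽ N - ψ⫽ x
    ΣΛD-≡ = trans (sum-cong N (λ k _ _ → *-distribˡ-- (Λ k) (ψ (b k)) (ψ (a k)))) (sum-- N (λ k → Λ k * ψ (b k)) (λ k → Λ k * ψ (a k)))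

    1≤x : 1 ℕ.≤ x
    1≤x = ℕ.≤-trans 1≤z z≤qz

    -- Selberg's formula from below at N and from above at x = qz. As (x, N] itself has almost no
    -- mass, the main term 2z log N must come from the double sum.
    ΣΛD-≥ : ∀ δ → ψ N - ψ x ≤ δ * ι z → (# 2 - δ) * (ι z * L N) - # 120 * ι N - # 40 * ι z ≤ ΣΛD
    ΣΛD-≥ δ h = lem δ (ι z) (ι x) (ι N) (L N) (L x) (ψ N) (ψ x) (ψ⫽ N) (ψ⫽ x) ΣΛD ΣΛD-≡ h (ι-+ z x)
        (subst (# 2 * (ι N * L N) - # 60 * ι N ≤_) (Sel-≡ N 1≤N ℕ.≤-refl) (selberg-≥ N 1≤N ℕ.≤-refl))
        (subst (_≤ # 2 * (ι x * L x) + # 60 * ι x) (Sel-≡ x 1≤x x≤N) (selberg-≤ x 1≤x x≤N))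
        (L-lip 1≤x x≤N ℕ.≤-refl) (chebyshev-≤ x 1≤x x≤N) (gap (L-mono 1≤x x≤N ℕ.≤-refl)) (L≥0 1≤N ℕ.≤-refl) (1≤ι 1≤z) (ι≥0 x)
      where
      lem : ∀ d z x n l m pn px sn sx s → s ≡ sn - sx → pn - px ≤ d * z → n ≡ z + x → # 2 * (n * l) - # 60 * n ≤ l * pn + sn → m * px + sx ≤ # 2 * (x * m) + # 60 * x → x * (l - m) ≤ n - x + 1ℚ → px ≤ # 20 * x → 0ℚ ≤ l - m → 0ℚ ≤ l → 1ℚ ≤ z → 0ℚ ≤ x → (# 2 - d) * (z * l) - # 120 * n - # 40 * z ≤ s
      lem d z x n l m pn px sn sx s e A B E F G I J K M O = ≤-by (gap (≤-reflexive (sym e)) ⊹ lit (# 10) ⊠ gap (≤-reflexive (sym B)) ⊹ gap E ⊹ gap F ⊹ lit (# 50) ⊠ gap G ⊹ lit (# 50) ⊠ gap M ⊹ gap A ⊠ K ⊹ lit (# 2) ⊠ eqgap (l) (sym B) ⊹ lit (# 32) ⊠ (J ⊠ O) ⊹ gap I ⊠ J) (ring-≡ (d ∷ z ∷ x ∷ n ∷ l ∷ m ∷ pn ∷ px ∷ sn ∷ sx ∷ s ∷ []) (var 10) ((nat 2 :- var 0) :* (var 1 :* var 4) :- nat 120 :* var 3 :- nat 40 :* var 1 :+ (var 10 :- (var 8 :- var 9) :+ nat 10 :* (var 3 :- (var 1 :+ var 2)) :+ (var 4 :* var 6 :+ var 8 :- (nat 2 :* (var 3 :* var 4) :- nat 60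 :* var 3)) :+ (nat 2 :* (var 2 :* var 5) :+ nat 60 :* var 2 :- (var 5 :* var 7 :+ var 9)) :+ nat 50 :* (var 3 :- var 2 :+ nat 1 :- var 2 :* (var 4 :- var 5)) :+ nat 50 :* (var 1 :- nat 1) :+ (var 0 :* var 1 :- (var 6 :- var 7)) :* var 4 :+ nat 2 :* ((var 3 :- (var 1 :+ var 2)) :* var 4) :+ nat 32 :* ((var 4 :- var 5) :* var 2) :+ (nat 20 :* var 2 :- var 7) :* (var 4 :- var 5))) refl)

    -- By Mertens the largest possible value of the double sum is also about 2z log N, so almost
    -- nothing is lost on average. The coefficients 2 + δ and 2 - δ differ by 2δ, and the third δ
    -- absorbs all terms O(z) through the lower bound on δ log N.
    slack-total : ∀ δ W → 0ℚ ≤ δ → δ ≤ 1ℚ → 0ℚ ≤ W → ψ N - ψ x ≤ δ * ι z → # 100 + (# 20 * W + # 120) * (1ℚ + ι q) ≤ δ * L N →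
      sum N (λ k → Λ k * ((# 2 + δ) * κ k + W - D k)) ≤ # 3 * (δ * (ι z * L N))
    slack-total δ W δ≥0 δ≤1 W≥0 h big = lem δ W (ι z) (ι q) (ι N) (L N) (Q N) (ψ N) ΣΛD (sum N (λ k → Λ k * ((# 2 + δ) * κ k + W - D k))) sum-≡ (ΣΛD-≥ δ h) (mertens-≤ N 1≤N ℕ.≤-refl) (chebyshev-≤ N 1≤N ℕ.≤-refl)
        (trans (ι-* (suc q) z) (cong (_* ι z) (ι-suc q))) big δ≥0 δ≤1 W≥0 (ι≥0 z)
      where
      l1 : ∀ l d z i w k → l * ((# 2 + d) * (z * i) + w - k) ≡ (# 2 + d) * z * (l * i) + w * l - l * k
      l1 = solve-∀ ℚ-ring
      sum-≡ : sum N (λ k → Λ k * ((# 2 + δ) * κ k + W - D k)) ≡ (# 2 + δ) * ι z * Q N + W * ψ N - ΣΛD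
      sum-≡ = trans (sum-cong N (λ k _ _ → l1 (Λ k) δ (ι z) (inv k) W (D k))) (trans (sum-- N _ _) (cong (_- ΣΛD) (trans (sum-+ N _ _) (cong₂ _+_ (sum-*ˡ N ((# 2 + δ) * ι z) (λ k → Λ k * inv k)) (sum-*ˡ N W Λ)))))
      lem : ∀ d w z q n l m p s t → t ≡ (# 2 + d) * z * m + w * p - s → (# 2 - d) * (z * l) - # 120 * n - # 40 * z ≤ s → m ≤ l + # 20 → p ≤ # 20 * n → n ≡ (1ℚ + q) * z → # 100 + (# 20 * w + # 120) * (1ℚ + q) ≤ d * l → 0ℚ ≤ d → d ≤ 1ℚ → 0ℚ ≤ w → 0ℚ ≤ z → t ≤ # 3 * (d * (z * l))
      lem d w z q n l m p s t e A B E F G I J K M = ≤-by (gap (≤-reflexive e) ⊹ gap A ⊹ lit (# 120) ⊠ gap (≤-reflexive F) ⊹ lit (# 2) ⊠ (gap B ⊠ M) ⊹ gap B ⊠ M ⊠ I ⊹ gap E ⊠ K ⊹ lit (# 20) ⊠ eqgap (w) F ⊹ gap G ⊠ M ⊹ lit (# 20) ⊠ (gap J ⊠ M)) (ring-≡ (d ∷ w ∷ z ∷ q ∷ n ∷ l ∷ m ∷ p ∷ s ∷ t ∷ []) (nat 3 :* (var 0 :* (var 2 :* var 5))) (var 9 :+ ((nat 2 :+ var 0) :* var 2 :* var 6 :+ var 1 :* var 7 :- var 8 :- var 9 :+ (var 8 :- ((nat 2 :- var 0) :* (var 2 :* var 5) :- nat 120 :* var 4 :- nat 40 :* var 2)) :+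 nat 120 :* ((nat 1 :+ var 3) :* var 2 :- var 4) :+ nat 2 :* ((var 5 :+ nat 20 :- var 6) :* var 2) :+ (var 5 :+ nat 20 :- var 6) :* var 2 :* var 0 :+ (nat 20 :* var 4 :- var 7) :* var 1 :+ nat 20 :* (((nat 1 :+ var 3) :* var 2 :- var 4) :* var 1) :+ (var 0 :* var 5 :- (nat 100 :+ (nat 20 :* var 1 :+ nat 120) :* (nat 1 :+ var 3))) :* var 2 :+ nat 20 :* ((nat 1 :- var 0) :* var 2))) refl)

    -- Saturated intervals and how one leads to another

    module Descent (Y : ℕ) (512≤Y : 512 ℕ.≤ Y) (δ δ' W : ℚ) (δ≥0 : 0ℚ ≤ δ) (δ'≥0 : 0ℚ ≤ δ') (W≥0 : 0ℚ ≤ W)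
      (δ≤ : # 256 * δ ≤ 1ℚ) (δδ' : (1ℚ + ι q) * δ' ≡ δ)
      (short : ∀ {u v} → u ℕ.≤ v → v ℕ.≤ N → Y ℕ.≤ v → ψ v - ψ u ≤ # 2 * (ι v - ι u) + δ' * ι v) where

      -- How far (qz/k, (q+1)z/k] is from the maximal density 2: nonnegative by Brun-Titchmarsh, and small on
      -- average when (qz, (q+1)z] contains no primes.
      s : ℕ → ℚ
      s k = (# 2 + δ) * κ k + W - D k

      Saturated Large : ℕ → Set
      Saturated k = # 127 * κ k ≤ # 64 * D k
      Large k = k ℕ.* Y ℕ.≤ z

      slack : ℕ → ℕ → ℚ
      slack m n = sum n (λ k → Λ k * s k) - sum m (λ k → Λ k * s k)

      Large⇒512≤κ : ∀ {k} → 1 ℕ.≤ k → Large k → # 512 ≤ κ k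
      Large⇒512≤κ {k} 1≤k l = ≤-trans (subst (_≤ ι Y) (ι-lit 512) (ι-mono 512≤Y)) (cancel-≤ (ι k) _ _ (ι-pos 1≤k) (subst₂ _≤_ (ι-* k Y) (sym (kκ 1≤k)) (ι-mono l)))

      Large⇒Y≤a : ∀ {k} → 1 ℕ.≤ k → Large k → Y ℕ.≤ a k
      Large⇒Y≤a 1≤k l = *≤⇒≤⫽ 1≤k (ℕ.≤-trans l z≤qz)

      δ'b≤ : ∀ {k v} → v ℕ.≤ b k → # 256 * (δ' * ι v) ≤ κ k
      δ'b≤ {k} {v} v≤b = lem δ δ' (ι q) (ι v) (ι (b k)) (κ k) δδ' (ι-mono v≤b) (b-hi k) δ'≥0 (κ≥0 k) δ≤
        where
        lem : ∀ d d1 q v b k → (1ℚ + q) * d1 ≡ d → v ≤ b → b ≤ (1ℚ + q) * k → 0ℚ ≤ d1 → 0ℚ ≤ k → # 256 * d ≤ 1ℚ → # 256 * (d1 * v) ≤ k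
        lem d d1 q v b k e p r s t u = ≤-by (lit (# 256) ⊠ (gap p ⊠ s) ⊹ lit (# 256) ⊠ (gap r ⊠ s) ⊹ gap u ⊠ t ⊹ lit (# 256) ⊠ eqgap (k) e) (ring-≡ (d ∷ d1 ∷ q ∷ v ∷ b ∷ k ∷ []) (var 5) (nat 256 :* (var 1 :* var 3) :+ (nat 256 :* ((var 4 :- var 3) :* var 1) :+ nat 256 :* (((nat 1 :+ var 2) :* var 5 :- var 4) :* var 1) :+ (nat 1 :- nat 256 :* var 0) :* var 5 :+ nat 256 :* ((var 0 :- (nat 1 :+ var 2) :* var 1) :* var 5))) refl)

      a+t≤b : ∀ {k} → 1 ℕ.≤ k → Large k → a k ℕ.+ t k ℕ.≤ b k
      a+t≤b {k} 1≤k l = ι-cancel-≤ (subst (_≤ ι (b k)) (sym (ι-+ (a k) (t k))) (lem (ι (a k)) (ι (t k)) (ι (b k)) (ι q) (κ k) (a-hi k) (b-lo k 1≤k) (t-hi k 1≤k) (Large⇒512≤κ 1≤k l)))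
        where
        lem : ∀ a t b q k → a ≤ q * k → (1ℚ + q) * k ≤ b + 1ℚ → # 32 * t ≤ k → # 512 ≤ k → a + t ≤ b
        lem a t b q k p r s u = ≤-by (gap p ⊹ gap r ⊹ lit (ℤ.+ 1 / 32) ⊠ gap s ⊹ lit (ℤ.+ 31 / 32) ⊠ gap u ⊹ lit (# 495)) (ring-≡ (a ∷ t ∷ b ∷ q ∷ k ∷ []) (var 2) (var 0 :+ var 1 :+ (var 3 :* var 4 :- var 0 :+ (var 2 :+ nat 1 :- (nat 1 :+ var 3) :* var 4) :+ con (ℤ.+ 1 / 32) :* (var 4 :- nat 32 :* var 1) :+ con (ℤ.+ 31 / 32) :* (var 4 :- nat 512) :+ nat 495)) refl)

      -- The intervals around are at most saturated, so a saturated one has its share of mass in every short subinterval.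
      subinterval-mass : ∀ {k e f} → 1 ℕ.≤ k → Large k → Saturated k → a k ℕ.≤ e → e ℕ.≤ f → f ℕ.≤ b k → ι f ≡ ι e + ι (t k) → κ k ≤ # 32 * (ψ f - ψ e)
      subinterval-mass {k} {e} {f} 1≤k l g a≤e e≤f f≤b eq = lem (ι (a k)) (ι (b k)) (ι e) (ι f) (ι (t k)) (ι q) (κ k) (ψ (b k)) (ψ (a k)) (ψ f) (ψ e) (δ' * ι (b k)) (δ' * ι e)
          g (short f≤b (b≤N 1≤k) (ℕ.≤-trans Y≤a (a≤b k))) (short a≤e (ℕ.≤-trans e≤f (ℕ.≤-trans f≤b (b≤N 1≤k))) (ℕ.≤-trans Y≤a a≤e))
          (δ'b≤ {k} ℕ.≤-refl) (δ'b≤ {k} (ℕ.≤-trans e≤f f≤b)) (a-lo k 1≤k) (b-hi k) (t-lo k 1≤k) eq (Large⇒512≤κ 1≤k l)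
        where
        Y≤a = Large⇒Y≤a 1≤k l
        lem : ∀ a b e f t q k pb pa pf pe db de → # 127 * k ≤ # 64 * (pb - pa) → pb - pf ≤ # 2 * (b - f) + db → pe - pa ≤ # 2 * (e - a) + de → # 256 * db ≤ k → # 256 * de ≤ k → q * k ≤ a + 1ℚ → b ≤ (1ℚ + q) * k → k ≤ # 32 * (1ℚ + t) → f ≡ e + t → # 512 ≤ k → k ≤ # 32 * (pf - pe)
        lem a b e f t q k pb pa pf pe db de g s1 s2 d1 d2 a1 b1 t1 eq kk = ≤-by (lit (ℤ.+ 1 / 2) ⊠ gap g ⊹ lit (# 32) ⊠ gap s1 ⊹ lit (# 32) ⊠ gap s2 ⊹ lit (ℤ.+ 1 / 8) ⊠ gap d1 ⊹ lit (ℤ.+ 1 / 8) ⊠ gap d2 ⊹ lit (# 64) ⊠ gap a1 ⊹ lit (# 64) ⊠ gap b1 ⊹ lit (# 2) ⊠ gap t1 ⊹ lit (# 64) ⊠ gap (≤-reflexive (sym eq)) ⊹ lit (ℤ.+ 1 / 4) ⊠ gap kk) (ring-≡ (a ∷ b ∷ e ∷ f ∷ t ∷ q ∷ k ∷ pb ∷ pa ∷ pf ∷ pe ∷ db ∷ de ∷ []) (nat 32 :* (var 9 :- var 10)) (var 6 :+ (con (ℤ.+ 1 / 2) :* (nat 64 :* (var 7 :- var 8) :- nat 127 :* var 6) :+ nat 32 :* (nat 2 :* (var 1 :- var 3) :+ var 11 :- (var 7 :- var 9)) :+ nat 32 :* (nat 2 :* (var 2 :- var 0) :+ var 12 :- (var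 10 :- var 8)) :+ con (ℤ.+ 1 / 8) :* (var 6 :- nat 256 :* var 11) :+ con (ℤ.+ 1 / 8) :* (var 6 :- nat 256 :* var 12) :+ nat 64 :* (var 0 :+ nat 1 :- var 5 :* var 6) :+ nat 64 :* ((nat 1 :+ var 5) :* var 6 :- var 1) :+ nat 2 :* (nat 32 :* (nat 1 :+ var 4) :- var 6) :+ nat 64 :* (var 3 :- (var 2 :+ var 4)) :+ con (ℤ.+ 1 / 4) :* (var 6 :- nat 512))) refl)

      log-mass : ∀ m n → m ℕ.≤ n → inv n * (ψ n - ψ m) ≤ Q n - Q m
      log-mass m n m≤n = subst (_≤ Q n - Q m) (trans (cong₂ _-_ (sum-*ˡ n (inv n) Λ) (sum-*ˡ m (inv n) Λ)) (lem (inv n) (ψ n) (ψ m)))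
        (range-mono (λ k → inv n * Λ k) (λ k → Λ k * inv k) m≤n (λ k m<k k≤n → l2 (inv n) (inv k) (Λ k) (Λ≥0 k) (inv-anti (ℕ.≤-trans (s≤s z≤n) m<k) k≤n)))
        where
        lem : ∀ i a b → i * a - i * b ≡ i * (a - b)
        lem = solve-∀ ℚ-ring
        l2 : ∀ i j l → 0ℚ ≤ l → i ≤ j → i * l ≤ l * j
        l2 i j l p q = ≤-by (p ⊠ gap q) (ring-≡ (i ∷ j ∷ l ∷ []) (var 2 :* var 1) (var 0 :* var 2 :+ (var 2 :* (var 1 :- var 0))) refl)

      -- The right side is the sum of Λ κ over (e, f], so some g has 64 s g < κ g. The terms δ κ and
      -- W in `s` are nonnegative, hence D g ≥ (2 - 1/64) κ g.
      saturated-exists : ∀ {e f} → e ℕ.≤ f → # 64 * slack e f < ι z * (Q f - Q e) → ∃ λ g → e ℕ.< g × g ℕ.≤ f × Saturated g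
      saturated-exists {e} {f} e≤f h = conclude (range-<-pick (λ k → # 64 * (Λ k * s k)) (λ k → ι z * (Λ k * inv k)) e≤f
          (subst₂ _<_ (trans (*-distribˡ-- (# 64) (sum f (λ k → Λ k * s k)) (sum e (λ k → Λ k * s k))) (sym (cong₂ _-_ (sum-*ˡ f (# 64) (λ k → Λ k * s k)) (sum-*ˡ e (# 64) (λ k → Λ k * s k)))))
            (trans (*-distribˡ-- (ι z) (Q f) (Q e)) (sym (cong₂ _-_ (sum-*ˡ f (ι z) (λ k → Λ k * inv k)) (sum-*ˡ e (ι z) (λ k → Λ k * inv k))))) h))
        where
        conclude : (∃ λ g → e ℕ.< g × g ℕ.≤ f × # 64 * (Λ g * s g) < ι z * (Λ g * inv g)) → ∃ λ g → e ℕ.< g × g ℕ.≤ f × Saturated g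
        conclude (g , e<g , g≤f , lt) = g , e<g , g≤f , good (≤-total (# 64 * s g) (κ g))
         where
          Λs<Λκ : Λ g * (# 64 * s g) < Λ g * κ g
          Λs<Λκ = subst₂ _<_ (l2 (Λ g) (# 64) (s g)) (l2 (Λ g) (ι z) (inv g)) lt
            where
            l2 : ∀ l a b → a * (l * b) ≡ l * (a * b)
            l2 = solve-∀ ℚ-ring
          good : # 64 * s g ≤ κ g ⊎ κ g ≤ # 64 * s g → Saturated g
          good (inj₁ p) = l3 δ (κ g) W (D g) p δ≥0 (κ≥0 g) W≥0
            where
            l3 : ∀ d k w D → # 64 * ((# 2 + d) * k + w - D) ≤ k → 0ℚ ≤ d → 0ℚ ≤ k → 0ℚ ≤ w → # 127 * k ≤ # 64 * D
            l3 d k w D p a b c = ≤-by (gap p ⊹ lit (# 64) ⊠ c ⊹ lit (# 64) ⊠ (a ⊠ b)) (ring-≡ (d ∷ k ∷ w ∷ D ∷ []) (nat 64 :* var 3) (nat 127 :* var 1 :+ (var 1 :- nat 64 :* ((nat 2 :+ var 0) :* var 1 :+ var 2 :- var 3) :+ nat 64 :* var 2 :+ nat 64 :* (var 0 :* var 1))) refl)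
          good (inj₂ p) = ⊥-elim (<⇒≢ (<-≤-trans Λs<Λκ (*-monoˡ-≤-nonNeg (Λ g) {{nonNegative (Λ≥0 g)}} p)) refl)

      -- The piece has mass at least κ k / 32 and lies below (q+1) κ k, so Q f - Q e ≥ 1/(32(q+1)).
      -- The slack hypothesis gives 64 slack ≤ z/(64(q+1)), half of what is available; hence 4096 =
      -- 2 * 32 * 64.
      refine : ∀ {k e f} → 1 ℕ.≤ k → Large k → Saturated k → a k ℕ.≤ e → e ℕ.≤ f → f ℕ.≤ b k → ι f ≡ ι e + ι (t k) →
        # 4096 * (1ℚ + ι q) * slack e f ≤ ι z → ∃ λ g → e ℕ.< g × g ℕ.≤ f × Saturated g
      refine {k} {e} {f} 1≤k l g a≤e e≤f f≤b eq sl = saturated-exists e≤f (*-cancelˡ-<-nonNeg (# 64 * (1ℚ + ι q)) {{nonNegative (lit (# 64) ⊠ (lit 1ℚ ⊹ ι≥0 q))}} strict)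
        where
        1≤f : 1 ℕ.≤ f
        1≤f = ℕ.≤-trans (ℕ.≤-trans (s≤s z≤n) 512≤Y) (ℕ.≤-trans (Large⇒Y≤a 1≤k l) (ℕ.≤-trans a≤e e≤f))
        strict : # 64 * (1ℚ + ι q) * (# 64 * slack e f) < # 64 * (1ℚ + ι q) * (ι z * (Q f - Q e))
        strict = ≤-<-trans (≤-trans (≤-reflexive (l1 (ι q) (slack e f))) sl)
          (<-≤-trans (subst (_< # 2 * ι z) (*-identityˡ (ι z)) (*-monoˡ-<-pos (ι z) {{positive (ι-pos 1≤z)}} {1ℚ} {# 2} (*<* (ℤ.+<+ (s≤s (s≤s z≤n))))))
          (l2 (ι z) (ι q) (κ k) (ι f) (ι (b k)) (inv f) (ψ f - ψ e) (Q f - Q e) (subinterval-mass 1≤k l g a≤e e≤f f≤b eq) (log-mass e f e≤f) (inv-r 1≤f) (ι-mono f≤b) (b-hi k) (inv≥0 f) (ι≥0 z) (ι≥0 q)))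
          where
          l1 : ∀ q s → # 64 * (1ℚ + q) * (# 64 * s) ≡ # 4096 * (1ℚ + q) * s
          l1 = solve-∀ ℚ-ring
          l2 : ∀ z q k f b i p m → k ≤ # 32 * p → i * p ≤ m → f * i ≡ 1ℚ → f ≤ b → b ≤ (1ℚ + q) * k → 0ℚ ≤ i → 0ℚ ≤ z → 0ℚ ≤ q → # 2 * z ≤ # 64 * (1ℚ + q) * (z * m)
          l2 z q k f b i p m A B E F G I Z O = ≤-by (lit (# 2) ⊠ (gap A ⊠ I ⊠ Z) ⊹ lit (# 2) ⊠ (gap A ⊠ I ⊠ Z ⊠ O) ⊹ lit (# 64) ⊠ (gap B ⊠ Z) ⊹ lit (# 64) ⊠ (gap B ⊠ Z ⊠ O) ⊹ lit (# 2) ⊠ eqgap (z) (sym E) ⊹ lit (# 2) ⊠ (gap F ⊠ I ⊠ Z) ⊹ lit (# 2) ⊠ (gap G ⊠ I ⊠ Z)) (ring-≡ (z ∷ q ∷ k ∷ f ∷ b ∷ i ∷ p ∷ m ∷ []) (nat 64 :* (nat 1 :+ var 1) :* (var 0 :* var 7)) (nat 2 :* var 0 :+ (nat 2 :* ((nat 32 :* var 6 :- var 2) :* var 5 :* var 0) :+ nat 2 :* ((nat 32 :* var 6 :- var 2) :* var 5 :* var 0 :* var 1) :+ nat 64 :* ((var 7 :- var 5 :* var 6) :* var 0) :+ nat 64 :* ((var 7 :- var 5 :* var 6) :* var 0 :* var 1) :+ nat 2 :* ((var 3 :* var 5 :- nat 1) :* var 0) :+ nat 2 :* ((var 4 :-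 var 3) :* var 5 :* var 0) :+ nat 2 :* (((nat 1 :+ var 1) :* var 2 :- var 4) :* var 5 :* var 0))) refl)

      -- The chain of contiguous saturated intervals

      module Run (V U : ℕ) (hV : suc q ℕ.* Y ℕ.≤ V) (V≤U : V ℕ.≤ U) (hU : U ℕ.* Y ℕ.≤ z) (s≥0 : ∀ k → 1 ℕ.≤ k → 0ℚ ≤ s k)
        (slack-k : # 4096 * (1ℚ + ι q) * slack V U ≤ ι z)
        (slack-m : # 4096 * (1ℚ + ι q) * slack (N ⫽ (2 ℕ.* U)) (N ⫽ V) ≤ ι z) where

        private
          1≤Y : 1 ℕ.≤ Y
          1≤Y = ℕ.≤-trans (s≤s z≤n) 512≤Y
          1≤V : 1 ℕ.≤ V
          1≤V = ℕ.≤-trans (ℕ.*-mono-≤ {1} {suc q} (s≤s z≤n) 1≤Y) hV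

        slack-sub : ∀ {m n e f} → m ℕ.≤ e → f ℕ.≤ n → # 4096 * (1ℚ + ι q) * slack m n ≤ ι z → # 4096 * (1ℚ + ι q) * slack e f ≤ ι z
        slack-sub {m} {n} {e} {f} m≤e f≤n h = lem (ι q) (ι z) (sum m g) (sum n g) (sum e g) (sum f g) h (sum-mono-n g m≤e g≥0) (sum-mono-n g f≤n g≥0) (ι≥0 q)
          where
          g : ℕ → ℚ
          g k = Λ k * s k
          g≥0 : ∀ {m n} k → m ℕ.< k → k ℕ.≤ n → 0ℚ ≤ g k
          g≥0 k a _ = Λ≥0 k ⊠ s≥0 k (ℕ.≤-trans (s≤s z≤n) a)
          lem : ∀ q z m n e f → # 4096 * (1ℚ + q) * (n - m) ≤ z → m ≤ e → f ≤ n → 0ℚ ≤ q → # 4096 * (1ℚ + q) * (f - e) ≤ z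
          lem q z m n e f h a b c = ≤-by (gap h ⊹ lit (# 4096) ⊠ gap a ⊹ lit (# 4096) ⊠ gap b ⊹ lit (# 4096) ⊠ (gap a ⊠ c) ⊹ lit (# 4096) ⊠ (gap b ⊠ c)) (ring-≡ (q ∷ z ∷ m ∷ n ∷ e ∷ f ∷ []) (var 1) (nat 4096 :* (nat 1 :+ var 0) :* (var 5 :- var 4) :+ (var 1 :- nat 4096 :* (nat 1 :+ var 0) :* (var 3 :- var 2) :+ nat 4096 :* (var 4 :- var 2) :+ nat 4096 :* (var 3 :- var 5) :+ nat 4096 :* ((var 4 :- var 2) :* var 0) :+ nat 4096 :* ((var 3 :- var 5) :* var 0))) refl)

        -- Bounded by Mertens' theorem, but increased by every step.
        E : ℕ → ℚ
        E x = Q x - L x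

        -- From k to a prime power m just below (q+1)z/k, and from m to a prime power k' just above qz/m: then
        -- (qz/k', (q+1)z/k'] starts just below the end of (qz/k, (q+1)z/k].
        Step : ℕ → Set
        Step k = ∃ λ k' → Saturated k' × k' ℕ.≤ U × k ℕ.≤ 2 ℕ.* k' × 1ℚ ≤ # 4 * (1ℚ + ι q) * (E (a k') - E (a k))

        module _ (k : ℕ) (gk : Saturated k) (2V≤k : 2 ℕ.* V ℕ.≤ k) (k≤U : k ℕ.≤ U) where
          private
            V≤k : V ℕ.≤ k
            V≤k = ℕ.≤-trans (ℕ.m≤n*m V 2) 2V≤k
            1≤k : 1 ℕ.≤ k
            1≤k = ℕ.≤-trans 1≤V V≤k
            lk : Large k
            lk = ℕ.≤-trans (ℕ.*-monoˡ-≤ Y k≤U) hU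
            K512 = Large⇒512≤κ 1≤k lk
            t≤b : t k ℕ.≤ b k
            t≤b = ℕ.≤-trans (ℕ.m≤n+m (t k) (a k)) (a+t≤b 1≤k lk)
            e₀ = b k ℕ.∸ t k
            b≡ : ι (b k) ≡ ι e₀ + ι (t k)
            b≡ = trans (cong ι (sym (ℕ.m∸n+n≡m t≤b))) (ι-+ e₀ (t k))
            w = N ⫽ (2 ℕ.* U)
            2w≤ : # 2 * ι w ≤ (1ℚ + ι q) * κ k
            2w≤ = cancel-≤ (ι k) _ _ (ι-pos 1≤k) (subst₂ _≤_ (trans (ι-* (2 ℕ.* k) w) (trans (cong (_* ι w) (trans (ι-* 2 k) (cong (_* ι k) (ι-lit 2)))) (l1 (# 2) (ι k) (ι w))))
              (trans (ι-* (suc q) z) (trans (cong₂ _*_ (ι-suc q) (sym (kκ 1≤k))) (l2 (1ℚ + ι q) (ι k) (κ k))))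
              (ι-mono (ℕ.≤-trans (ℕ.*-monoˡ-≤ w (ℕ.*-monoʳ-≤ 2 k≤U)) (*⫽≤ N (2 ℕ.* U)))))
              where
              l1 : ∀ a b c → a * b * c ≡ b * (a * c)
              l1 = solve-∀ ℚ-ring
              l2 : ∀ a b c → a * (b * c) ≡ b * (a * c)
              l2 = solve-∀ ℚ-ring
            -- `w` is at most half of (q+1) κ k, while e₀ is only about κ k / 32 below it. This is
            -- why the window for m starts at N/(2U) and not at N/U.
            w≤e₀ : w ℕ.≤ e₀
            w≤e₀ = ι-cancel-≤ (lem (ι w) (ι e₀) (ι (t k)) (ι (b k)) (ι q) (κ k) b≡ 2w≤ (t-hi k 1≤k) (b-lo k 1≤k) K512 4≤ιq)
              where
              lem : ∀ w e t b q k → b ≡ e + t → # 2 * w ≤ (1ℚ + q) * k → # 32 * t ≤ k → (1ℚ + q) * k ≤ b + 1ℚ → # 512 ≤ k → # 4 ≤ q → w ≤ e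
              lem w e t b q k eq p r s u v = ≤-by (gap (≤-reflexive eq) ⊹ lit (ℤ.+ 1 / 2) ⊠ gap p ⊹ lit (ℤ.+ 1 / 32) ⊠ gap r ⊹ gap s ⊹ lit (ℤ.+ 79 / 32) ⊠ gap u ⊹ lit (# 256) ⊠ gap v ⊹ lit (ℤ.+ 1 / 2) ⊠ (gap u ⊠ gap v) ⊹ lit (# 1263)) (ring-≡ (w ∷ e ∷ t ∷ b ∷ q ∷ k ∷ []) (var 1) (var 0 :+ (var 1 :+ var 2 :- var 3 :+ con (ℤ.+ 1 / 2) :* ((nat 1 :+ var 4) :* var 5 :- nat 2 :* var 0) :+ con (ℤ.+ 1 / 32) :* (var 5 :- nat 32 :* var 2) :+ (var 3 :+ nat 1 :- (nat 1 :+ var 4) :* var 5) :+ con (ℤ.+ 79 / 32) :* (var 5 :- nat 512) :+ nat 256 :* (var 4 :- nat 4) :+ con (ℤ.+ 1 / 2) :* ((var 5 :- nat 512) :* (var 4 :- nat 4)) :+ nat 1263)) refl)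
            first : ∃ λ m → e₀ ℕ.< m × m ℕ.≤ b k × Saturated m
            first = refine 1≤k lk gk (ℕ.m+n≤o⇒m≤o∸n (a k) (a+t≤b 1≤k lk)) (ℕ.m∸n≤m (b k) (t k)) ℕ.≤-refl b≡ (slack-sub w≤e₀ (*≤⇒≤⫽ 1≤V (ℕ.≤-trans (ℕ.*-monoˡ-≤ (b k) V≤k) (*⫽≤ N k))) slack-m)

          module _ (m : ℕ) (e₀<m : e₀ ℕ.< m) (m≤b : m ℕ.≤ b k) (gm : Saturated m) where
            private
              1≤m : 1 ℕ.≤ m
              1≤m = ℕ.≤-trans (s≤s z≤n) e₀<m
              km≤N : k ℕ.* m ℕ.≤ N
              km≤N = ≤⫽⇒*≤ {N} {k} m≤b
              mk≤2qz : m ℕ.* k ℕ.≤ 2 ℕ.* (q ℕ.* z)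
              mk≤2qz = ℕ.≤-trans (subst (ℕ._≤ N) (ℕ.*-comm k m) km≤N) (ℕ.≤-trans (ℕ.+-monoˡ-≤ (q ℕ.* z) z≤qz) (ℕ.≤-reflexive (cong (q ℕ.* z ℕ.+_) (sym (ℕ.+-identityʳ (q ℕ.* z))))))
              -- The use of `hV`: (q+1) Y m ≤ V m ≤ k m ≤ N = (q+1) z.
              lm : Large m
              lm = ℕ.*-cancelˡ-≤ (suc q) (ℕ.≤-trans (ℕ.≤-reflexive (l1 q m Y)) (ℕ.≤-trans (ℕ.*-monoˡ-≤ m (ℕ.≤-trans hV V≤k)) km≤N))
                where
                l1 : ∀ q m Y → suc q ℕ.* (m ℕ.* Y) ≡ suc q ℕ.* Y ℕ.* m
                l1 = solveℕ-∀
              V≤am : V ℕ.≤ a m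
              V≤am = *≤⇒≤⫽ 1≤m (ℕ.*-cancelˡ-≤ 2 (ℕ.≤-trans (ℕ.≤-reflexive (l1 m V)) (ℕ.≤-trans (ℕ.*-monoʳ-≤ m 2V≤k) mk≤2qz)))
                where
                l1 : ∀ m V → 2 ℕ.* (m ℕ.* V) ≡ m ℕ.* (2 ℕ.* V)
                l1 = solveℕ-∀
              b≤m+t : ι (b k) ≤ ι m + ι (t k)
              b≤m+t = subst (_≤ ι m + ι (t k)) (sym b≡) (+-monoˡ-≤ (ι (t k)) (ι-mono (ℕ.<⇒≤ e₀<m)))
              f₀ = a m ℕ.+ t m
              mf≤ : # 32 * (ι m * ι f₀) ≤ (# 32 * ι q + 1ℚ) * ι z
              mf≤ = lem (ι m) (ι f₀) (ι (a m)) (ι (t m)) (κ m) (ι q) (ι z) (ι-+ (a m) (t m)) (a-hi m) (t-hi m 1≤m) (kκ 1≤m) (ι≥0 m)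
                where
                lem : ∀ m f a t k q z → f ≡ a + t → a ≤ q * k → # 32 * t ≤ k → m * k ≡ z → 0ℚ ≤ m → # 32 * (m * f) ≤ (# 32 * q + 1ℚ) * z
                lem m f a t k q z e p r s u = ≤-by (gap (≤-reflexive s) ⊹ lit (# 32) ⊠ eqgap (m) e ⊹ lit (# 32) ⊠ (gap p ⊠ u) ⊹ gap r ⊠ u ⊹ lit (# 32) ⊠ eqgap (q) s) (ring-≡ (m ∷ f ∷ a ∷ t ∷ k ∷ q ∷ z ∷ []) ((nat 32 :* var 5 :+ nat 1) :* var 6) (nat 32 :* (var 0 :* var 1) :+ (var 6 :- var 0 :* var 4 :+ nat 32 :* ((var 2 :+ var 3 :- var 1) :* var 0) :+ nat 32 :* ((var 5 :* var 4 :- var 2) :* var 0) :+ (var 4 :- nat 32 :* var 3) :* var 0 :+ nat 32 :* ((var 6 :- var 0 :* var 4) :* var 5))) refl)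
              -- The next index, chosen up to f₀, is about q/(q+1) times k. So the indices decrease
              -- and stay below U while the intervals move to the right.
              f₀≤k : f₀ ℕ.≤ k
              f₀≤k = ι-cancel-≤ (cancel-≤ (ι m) _ _ (ι-pos 1≤m) (lem (ι m) (ι f₀) (ι k) (κ k) (ι q) (ι z) (ι (b k)) (ι (t k)) mf≤ (kκ 1≤k) (b-lo k 1≤k) b≤m+t (t-hi k 1≤k) K512 (ι≥0 k)))
                where
                lem : ∀ m f k j q z b t → # 32 * (m * f) ≤ (# 32 * q + 1ℚ) * z → k * j ≡ z → (1ℚ + q) * j ≤ b + 1ℚ → b ≤ m + t → # 32 * t ≤ j → # 512 ≤ j → 0ℚ ≤ k → m * f ≤ m * k
                lem m f k j q z b t A E B M T J K = ≤-by (lit (ℤ.+ 1 / 32) ⊠ gap A ⊹ lit (ℤ.+ 1 / 32) ⊠ gap (≤-reflexive (sym E)) ⊹ lit (# 479) ⊠ K ⊹ eqgap (q) (sym E) ⊹ gap B ⊠ K ⊹ gap M ⊠ K ⊹ lit (ℤ.+ 1 / 32) ⊠ (gap T ⊠ K) ⊹ lit (ℤ.+ 15 / 16) ⊠ (gap J ⊠ K)) (ring-≡ (m ∷ f ∷ k ∷ j ∷ q ∷ z ∷ b ∷ t ∷ []) (var 0 :* var 2) (var 0 :* var 1 :+ (con (ℤ.+ 1 / 32) :* ((nat 32 :* var 4 :+ nat 1) :* var 5 :- nat 32 :* (var 0 :* var 1)) :+ con (ℤ.+ 1 / 32) :* (var 2 :* var 3 :- var 5) :+ nat 479 :* var 2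 :+ (var 2 :* var 3 :- var 5) :* var 4 :+ (var 6 :+ nat 1 :- (nat 1 :+ var 4) :* var 3) :* var 2 :+ (var 0 :+ var 7 :- var 6) :* var 2 :+ con (ℤ.+ 1 / 32) :* ((var 3 :- nat 32 :* var 7) :* var 2) :+ con (ℤ.+ 15 / 16) :* ((var 3 :- nat 512) :* var 2))) refl)
              second : ∃ λ k' → a m ℕ.< k' × k' ℕ.≤ f₀ × Saturated k'
              second = refine 1≤m lm gm ℕ.≤-refl (ℕ.m≤m+n (a m) (t m)) (a+t≤b 1≤m lm) (ι-+ (a m) (t m)) (slack-sub V≤am (ℕ.≤-trans f₀≤k k≤U) slack-k)

            module _ (k' : ℕ) (am<k' : a m ℕ.< k') (k'≤f₀ : k' ℕ.≤ f₀) where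
              private
                1≤k' : 1 ℕ.≤ k'
                1≤k' = ℕ.≤-trans (s≤s z≤n) am<k'
                qz<mk' : q ℕ.* z ℕ.< m ℕ.* k'
                qz<mk' = ℕ.<-≤-trans (<*suc⫽ (q ℕ.* z) m 1≤m) (ℕ.*-monoʳ-≤ m am<k')
                a'<m : a k' ℕ.< m
                a'<m = ℕ.*-cancelˡ-< k' (a k') m (ℕ.≤-<-trans (*⫽≤ (q ℕ.* z) k') (subst (q ℕ.* z ℕ.<_) (ℕ.*-comm m k') qz<mk'))
                a'≤b : a k' ℕ.≤ b k
                a'≤b = ℕ.≤-trans (ℕ.<⇒≤ a'<m) m≤b

              -- From m k ≤ N ≤ 2qz < 2 m k'. A step at most halves the index, so a start above 2^n
              -- V allows n steps.
              k≤2k' : k ℕ.≤ 2 ℕ.* k'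
              k≤2k' = ℕ.<⇒≤ (ℕ.*-cancelˡ-< m k (2 ℕ.* k') (ℕ.≤-<-trans mk≤2qz (subst (2 ℕ.* (q ℕ.* z) ℕ.<_) (l1 m k') (ℕ.*-monoʳ-< 2 qz<mk'))))
                where
                l1 : ∀ m k → 2 ℕ.* (m ℕ.* k) ≡ m ℕ.* (2 ℕ.* k)
                l1 = solveℕ-∀

              k'≤U : k' ℕ.≤ U
              k'≤U = ℕ.≤-trans k'≤f₀ (ℕ.≤-trans f₀≤k k≤U)

              private
                κ'≤2κ : κ k' ≤ # 2 * κ k
                κ'≤2κ = cancel-≤ (ι k) _ _ (ι-pos 1≤k) (lem (ι k) (ι k') (κ k) (κ k') (ι z) (kκ 1≤k) (kκ 1≤k') (subst (ι k ≤_) (trans (ι-* 2 k') (cong (_* ι k') (ι-lit 2))) (ι-mono k≤2k')) (κ≥0 k'))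
                  where
                  lem : ∀ k k1 j j1 z → k * j ≡ z → k1 * j1 ≡ z → k ≤ # 2 * k1 → 0ℚ ≤ j1 → k * j1 ≤ k * (# 2 * j)
                  lem k k1 j j1 z e e1 p r = ≤-by (lit (# 2) ⊠ gap (≤-reflexive (sym e)) ⊹ lit (# 2) ⊠ gap (≤-reflexive e1) ⊹ gap p ⊠ r) (ring-≡ (k ∷ k1 ∷ j ∷ j1 ∷ z ∷ []) (var 0 :* (nat 2 :* var 2)) (var 0 :* var 3 :+ (nat 2 :* (var 0 :* var 2 :- var 4) :+ nat 2 :* (var 4 :- var 1 :* var 3) :+ (nat 2 :* var 1 :- var 0) :* var 3)) refl)
                m≤κ' : # 32 * ι m ≤ (# 32 * ι q + 1ℚ) * κ k'
                m≤κ' = cancel-≤ (ι k') _ _ (ι-pos 1≤k') (lem (ι m) (ι f₀) (ι k') (κ k') (ι q) (ι z) mf≤ (kκ 1≤k') (ι-mono k'≤f₀) (ι≥0 m))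
                  where
                  lem : ∀ m f k j q z → # 32 * (m * f) ≤ (# 32 * q + 1ℚ) * z → k * j ≡ z → k ≤ f → 0ℚ ≤ m → k * (# 32 * m) ≤ k * ((# 32 * q + 1ℚ) * j)
                  lem m f k j q z A E B M = ≤-by (gap A ⊹ gap (≤-reflexive (sym E)) ⊹ lit (# 32) ⊠ (gap B ⊠ M) ⊹ lit (# 32) ⊠ eqgap (q) (sym E)) (ring-≡ (m ∷ f ∷ k ∷ j ∷ q ∷ z ∷ []) (var 2 :* ((nat 32 :* var 4 :+ nat 1) :* var 3)) (var 2 :* (nat 32 :* var 0) :+ ((nat 32 :* var 4 :+ nat 1) :* var 5 :- nat 32 :* (var 0 :* var 1) :+ (var 2 :* var 3 :- var 5) :+ nat 32 :* ((var 1 :- var 2) :* var 0) :+ nat 32 :* ((var 2 :* var 3 :- var 5) :* var 4))) refl)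
                -- How far before the end of the old interval the new one may start: κ k / 32 for
                -- the position of m, κ k' / 32 ≤ 2 κ k / 32 for the position of k', and 1 for
                -- rounding.
                overlap-bound : # 32 * ι (b k) ≤ # 32 * ι (a k') + # 32 + # 3 * κ k
                overlap-bound = lem (ι m) (κ k') (ι q) (ι (b k)) (ι (t k)) (κ k) (ι (a k')) m≤κ' κ'≤2κ (a-lo k' 1≤k') b≤m+t (t-hi k 1≤k)
                  where
                  lem : ∀ m j1 q b t j a1 → # 32 * m ≤ (# 32 * q + 1ℚ) * j1 → j1 ≤ # 2 * j → q * j1 ≤ a1 + 1ℚ → b ≤ m + t → # 32 * t ≤ j → # 32 * b ≤ # 32 * a1 + # 32 + # 3 * j
                  lem m j1 q b t j a1 A B E F G = ≤-by (gap A ⊹ gap B ⊹ lit (# 32) ⊠ gap E ⊹ lit (# 32) ⊠ gap F ⊹ gap G) (ring-≡ (m ∷ j1 ∷ q ∷ b ∷ t ∷ j ∷ a1 ∷ []) (nat 32 :* var 6 :+ nat 32 :+ nat 3 :* var 5) (nat 32 :* var 3 :+ ((nat 32 :* var 2 :+ nat 1) :* var 1 :- nat 32 :* var 0 :+ (nat 2 :* var 5 :- var 1) :+ nat 32 :* (var 6 :+ nat 1 :- var 2 :* var 1) :+ nat 32 :* (var 0 :+ var 4 :- var 3) :+ (var 5 :- nat 32 :* var 4))) refl)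
                a≤a' : a k ℕ.≤ a k'
                a≤a' = ι-cancel-≤ (lem (ι (a k)) (ι (b k)) (ι q) (κ k) (ι (a k')) overlap-bound (a-hi k) (b-lo k 1≤k) K512)
                  where
                  lem : ∀ a b q j a1 → # 32 * b ≤ # 32 * a1 + # 32 + # 3 * j → a ≤ q * j → (1ℚ + q) * j ≤ b + 1ℚ → # 512 ≤ j → a ≤ a1
                  lem a b q j a1 A B E F = ≤-by (lit (ℤ.+ 1 / 32) ⊠ gap A ⊹ gap B ⊹ gap E ⊹ lit (ℤ.+ 29 / 32) ⊠ gap F ⊹ lit (# 462)) (ring-≡ (a ∷ b ∷ q ∷ j ∷ a1 ∷ []) (var 4) (var 0 :+ (con (ℤ.+ 1 / 32) :* (nat 32 :* var 4 :+ nat 32 :+ nat 3 :* var 3 :- nat 32 :* var 1) :+ (var 2 :* var 3 :- var 0) :+ (var 1 :+ nat 1 :- (nat 1 :+ var 2) :* var 3) :+ con (ℤ.+ 29 / 32) :* (var 3 :- nat 512) :+ nat 462)) refl)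
                Y≤a : Y ℕ.≤ a k
                Y≤a = Large⇒Y≤a 1≤k lk
                -- Saturation gives 127/64 of κ k. The overlap takes away at most 6/32, and
                -- roundings and the error of `short` take less than 1/64, which leaves more than
                -- 7/4.
                mass : # 7 * κ k ≤ # 4 * (ψ (a k') - ψ (a k))
                mass = lem (ι (b k)) (ι (a k')) (κ k) (ψ (b k)) (ψ (a k)) (ψ (a k')) (δ' * ι (b k)) overlap-bound gk (short a'≤b (b≤N 1≤k) (ℕ.≤-trans Y≤a (a≤b k))) (δ'b≤ {k} ℕ.≤-refl) K512
                  where
                  lem : ∀ b a1 j pb pa pa1 d → # 32 * b ≤ # 32 * a1 + # 32 + # 3 * j → # 127 * j ≤ # 64 * (pb - pa) → pb - pa1 ≤ # 2 * (b - a1) + d → # 256 * d ≤ j → # 512 ≤ j → # 7 * j ≤ # 4 * (pa1 - pa)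
                  lem b a1 j pb pa pa1 d A G S D F = ≤-by (lit (ℤ.+ 1 / 4) ⊠ gap A ⊹ lit (ℤ.+ 1 / 16) ⊠ gap G ⊹ lit (# 4) ⊠ gap S ⊹ lit (ℤ.+ 1 / 64) ⊠ gap D ⊹ lit (ℤ.+ 11 / 64) ⊠ gap F ⊹ lit (# 80)) (ring-≡ (b ∷ a1 ∷ j ∷ pb ∷ pa ∷ pa1 ∷ d ∷ []) (nat 4 :* (var 5 :- var 4)) (nat 7 :* var 2 :+ (con (ℤ.+ 1 / 4) :* (nat 32 :* var 1 :+ nat 32 :+ nat 3 :* var 2 :- nat 32 :* var 0) :+ con (ℤ.+ 1 / 16) :* (nat 64 :* (var 3 :- var 4) :- nat 127 :* var 2) :+ nat 4 :* (nat 2 :* (var 0 :- var 1) :+ var 6 :- (var 3 :- var 5)) :+ con (ℤ.+ 1 / 64) :* (var 2 :- nat 256 :* var 6) :+ con (ℤ.+ 11 / 64) :* (var 2 :- nat 512) :+ nat 80)) refl)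
                1≤a : 1 ℕ.≤ a k
                1≤a = ℕ.≤-trans 1≤Y Y≤a
                1≤a' : 1 ℕ.≤ a k'
                1≤a' = ℕ.≤-trans 1≤a a≤a'
                ΔQ : # 7 ≤ # 4 * (1ℚ + ι q) * (Q (a k') - Q (a k))
                ΔQ = lem (κ k) (ψ (a k') - ψ (a k)) (inv (a k')) (Q (a k') - Q (a k)) (ι (a k')) (ι q) (ι (b k)) mass (log-mass (a k) (a k') a≤a') (inv-r 1≤a') (ι-mono a'≤b) (b-hi k) (inv≥0 (a k')) (ι≥0 q)
                  where
                  lem : ∀ j p i m a q b → # 7 * j ≤ # 4 * p → i * p ≤ m → a * i ≡ 1ℚ → a ≤ b → b ≤ (1ℚ + q) * j → 0ℚ ≤ i → 0ℚ ≤ q → # 7 ≤ # 4 * (1ℚ + q) * m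
                  lem j p i m a q b A B E F G I O = ≤-by (lit (# 4) ⊠ gap B ⊹ lit (# 7) ⊠ gap (≤-reflexive (sym E)) ⊹ gap A ⊠ I ⊹ gap A ⊠ I ⊠ O ⊹ lit (# 4) ⊠ (gap B ⊠ O) ⊹ lit (# 7) ⊠ (gap F ⊠ I) ⊹ lit (# 7) ⊠ (gap G ⊠ I)) (ring-≡ (j ∷ p ∷ i ∷ m ∷ a ∷ q ∷ b ∷ []) (nat 4 :* (nat 1 :+ var 5) :* var 3) (nat 7 :+ (nat 4 :* (var 3 :- var 2 :* var 1) :+ nat 7 :* (var 4 :* var 2 :- nat 1) :+ (nat 4 :* var 1 :- nat 7 :* var 0) :* var 2 :+ (nat 4 :* var 1 :- nat 7 :* var 0) :* var 2 :* var 5 :+ nat 4 :* ((var 3 :- var 2 :* var 1) :* var 5) :+ nat 7 :* ((var 6 :- var 4) :* var 2) :+ nat 7 :* (((nat 1 :+ var 5) :* var 0 :- var 6) :* var 2))) refl)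
                -- Up to rounding, L grows by at most κ k / (q κ k) = 1/q. Thus the left side is
                -- about 4(q+1)/q ≤ 5, which is where q ≥ 4 enters; 6 leaves room for rounding and
                -- stays below the 7 of `ΔQ`.
                ΔL : # 4 * (1ℚ + ι q) * (L (a k') - L (a k)) ≤ # 6
                ΔL = cancel-≤ (ι q * κ k - 1ℚ) _ _ qκ>1 (lem (ι q) (κ k) (L (a k') - L (a k)) (L (b k) - L (a k)) (ι (a k)) (ι (b k)) (L-lip 1≤a (a≤b k) (b≤N 1≤k)) (a-lo k 1≤k) (b-hi k) (mono₁) (gap (L-mono 1≤a a≤a' (ℕ.≤-trans a'≤b (b≤N 1≤k)))) K512 4≤ιq (ι≥0 (a k)))
                  where
                  mono₁ : L (a k') - L (a k) ≤ L (b k) - L (a k)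
                  mono₁ = +-monoˡ-≤ (- L (a k)) (L-mono 1≤a' a'≤b (b≤N 1≤k))
                  qκ>1 : 0ℚ < ι q * κ k - 1ℚ
                  qκ>1 = <-≤-trans (*<* (ℤ.+<+ (s≤s z≤n))) (l1 (ι q) (κ k) K512 4≤ιq)
                    where
                    l1 : ∀ q j → # 512 ≤ j → # 4 ≤ q → 1ℚ ≤ q * j - 1ℚ
                    l1 q j A B = ≤-by (lit (# 4) ⊠ gap A ⊹ lit (# 512) ⊠ gap B ⊹ gap A ⊠ gap B ⊹ lit (# 2046)) (ring-≡ (q ∷ j ∷ []) (var 0 :* var 1 :- nat 1) (nat 1 :+ (nat 4 :* (var 1 :- nat 512) :+ nat 512 :* (var 0 :- nat 4) :+ (var 1 :- nat 512) :* (var 0 :- nat 4) :+ nat 2046)) refl)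
                  lem : ∀ q j x y a b → a * y ≤ b - a + 1ℚ → q * j ≤ a + 1ℚ → b ≤ (1ℚ + q) * j → x ≤ y → 0ℚ ≤ x → # 512 ≤ j → # 4 ≤ q → 0ℚ ≤ a → (q * j - 1ℚ) * (# 4 * (1ℚ + q) * x) ≤ (q * j - 1ℚ) * # 6
                  lem q j x y a b A B E F G J O N = ≤-by (lit (# 20) ⊠ gap A ⊹ lit (ℤ.+ 38938 / 2047) ⊠ gap B ⊹ lit (# 20) ⊠ gap E ⊹ lit (ℤ.+ 180 / 2047) ⊠ gap J ⊹ lit (ℤ.+ 1054728 / 2047) ⊠ gap O ⊹ lit (ℤ.+ 2002 / 2047) ⊠ N ⊹ lit (# 4) ⊠ (gap A ⊠ gap O) ⊹ lit (# 4) ⊠ (gap B ⊠ G ⊠ gap O) ⊹ lit (# 20) ⊠ (gap B ⊠ G) ⊹ lit (# 4) ⊠ (gap E ⊠ gap O) ⊹ lit (ℤ.+ 2092 / 2047) ⊠ (gap J ⊠ gap O) ⊹ lit (# 4) ⊠ (gap B ⊠ gap O) ⊹ lit (# 20) ⊠ (gap F ⊠ N) ⊹ lit (# 4) ⊠ (gap F ⊠ N ⊠ gap O)) (ring-≡ (q ∷ j ∷ x ∷ y ∷ a ∷ b ∷ []) ((var 0 :* var 1 :- nat 1) :* nat 6) ((var 0 :* var 1 :- nat 1) :* (nat 4 :* (nat 1 :+ var 0) :* var 2) :+ (nat 20 :* (var 5 :- var 4 :+ nat 1 :- var 4 :* var 3) :+ con (ℤ.+ 38938 / 2047) :* (var 4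 :+ nat 1 :- var 0 :* var 1) :+ nat 20 :* ((nat 1 :+ var 0) :* var 1 :- var 5) :+ con (ℤ.+ 180 / 2047) :* (var 1 :- nat 512) :+ con (ℤ.+ 1054728 / 2047) :* (var 0 :- nat 4) :+ con (ℤ.+ 2002 / 2047) :* var 4 :+ nat 4 :* ((var 5 :- var 4 :+ nat 1 :- var 4 :* var 3) :* (var 0 :- nat 4)) :+ nat 4 :* ((var 4 :+ nat 1 :- var 0 :* var 1) :* var 2 :* (var 0 :- nat 4)) :+ nat 20 :* ((var 4 :+ nat 1 :- var 0 :* var 1) :* var 2) :+ nat 4 :* (((nat 1 :+ var 0) :* var 1 :- var 5) :* (var 0 :- nat 4)) :+ con (ℤ.+ 2092 / 2047) :* ((var 1 :- nat 512) :* (var 0 :- nat 4)) :+ nat 4 :* ((var 4 :+ nat 1 :- var 0 :* var 1) :* (var 0 :- nat 4)) :+ nat 20 :* ((var 3 :- var 2) :* var 4) :+ nat 4 :* ((var 3 :- var 2) :* var 4 :* (var 0 :- nat 4)))) refl)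

              gain : 1ℚ ≤ # 4 * (1ℚ + ι q) * (E (a k') - E (a k))
              gain = lem (ι q) (Q (a k')) (Q (a k)) (L (a k')) (L (a k)) ΔQ ΔL
                where
                lem : ∀ q x y u v → # 7 ≤ # 4 * (1ℚ + q) * (x - y) → # 4 * (1ℚ + q) * (u - v) ≤ # 6 → 1ℚ ≤ # 4 * (1ℚ + q) * (x - u - (y - v))
                lem q x y u v A B = ≤-by (gap A ⊹ gap B) (ring-≡ (q ∷ x ∷ y ∷ u ∷ v ∷ []) (nat 4 :* (nat 1 :+ var 0) :* (var 1 :- var 3 :- (var 2 :- var 4))) (nat 1 :+ (nat 4 :* (nat 1 :+ var 0) :* (var 1 :- var 2) :- nat 7 :+ (nat 6 :- nat 4 :* (nat 1 :+ var 0) :* (var 3 :- var 4)))) refl)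

            step-m : Step k
            step-m = conclude second
              where
              conclude : (∃ λ k' → a m ℕ.< k' × k' ℕ.≤ f₀ × Saturated k') → Step k
              conclude (k' , p , r , g) = k' , g , k'≤U k' p r , k≤2k' k' p r , gain k' p r

          step : Step k
          step = conclude first
            where
            conclude : (∃ λ m → e₀ ℕ.< m × m ℕ.≤ b k × Saturated m) → Step k
            conclude (m , p , r , g) = step-m m p r g

        Chained : ℕ → ℕ → Set
        Chained i k = ∃ λ k' → V ℕ.≤ k' × k' ℕ.≤ U × ι i ≤ # 4 * (1ℚ + ι q) * (E (a k') - E (a k))

        chain : ∀ i k → Saturated k → 2 ℕ.^ i ℕ.* V ℕ.≤ k → k ℕ.≤ U → Chained i k
        chain zero k g h k≤U = k , subst (ℕ._≤ k) (ℕ.*-identityˡ V) h , k≤U , ≤-reflexive (trans ι-0 (l1 (ι q) (E (a k))))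
          where
          l1 : ∀ q e → 0ℚ ≡ # 4 * (1ℚ + q) * (e - e)
          l1 = solve-∀ ℚ-ring
        chain (suc i) k g h k≤U = next (step k g (ℕ.≤-trans (ℕ.*-monoˡ-≤ V (ℕ.*-monoʳ-≤ 2 (ℕ.m^n>0 2 i))) h) k≤U)
          where
          next : Step k → Chained (suc i) k
          next (k' , g' , k'≤U , k≤2k' , d) = finish (chain i k' g' (ℕ.*-cancelˡ-≤ 2 (ℕ.≤-trans (ℕ.≤-reflexive (sym (ℕ.*-assoc 2 (2 ℕ.^ i) V))) (ℕ.≤-trans h k≤2k'))) k'≤U)
            where
            finish : Chained i k' → Chained (suc i) k
            finish (k″ , v , u , d') = k″ , v , u , lem (ι q) (ι (suc i)) (ι i) (E (a k″)) (E (a k')) (E (a k)) (ι-suc i) d d'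
              where
              lem : ∀ q s i x y z → s ≡ 1ℚ + i → 1ℚ ≤ # 4 * (1ℚ + q) * (y - z) → i ≤ # 4 * (1ℚ + q) * (x - y) → s ≤ # 4 * (1ℚ + q) * (x - z)
              lem q s i x y z e A B = ≤-by (gap (≤-reflexive e) ⊹ gap A ⊹ gap B) (ring-≡ (q ∷ s ∷ i ∷ x ∷ y ∷ z ∷ []) (nat 4 :* (nat 1 :+ var 0) :* (var 3 :- var 5)) (var 1 :+ (nat 1 :+ var 2 :- var 1 :+ (nat 4 :* (nat 1 :+ var 0) :* (var 4 :- var 5) :- nat 1) :+ (nat 4 :* (nat 1 :+ var 0) :* (var 3 :- var 4) :- var 2))) refl)

        E-bounds : ∀ k → V ℕ.≤ k → k ℕ.≤ U → (- # 2 ≤ E (a k)) × (E (a k) ≤ # 20)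
        E-bounds k V≤k k≤U = l1 (Q (a k)) (L (a k)) (mertens-≥ (a k) 1≤a a≤N) , l2 (Q (a k)) (L (a k)) (mertens-≤ (a k) 1≤a a≤N)
          where
          1≤k = ℕ.≤-trans 1≤V V≤k
          1≤a = ℕ.≤-trans 1≤Y (Large⇒Y≤a 1≤k (ℕ.≤-trans (ℕ.*-monoˡ-≤ Y k≤U) hU))
          a≤N = ℕ.≤-trans (a≤b k) (b≤N 1≤k)
          l1 : ∀ q l → l - # 2 ≤ q → (- # 2) ≤ q - l
          l1 q l p = ≤-by (gap p) (ring-≡ (q ∷ l ∷ []) (var 0 :- var 1) ((:- nat 2) :+ (var 0 :- (var 1 :- nat 2))) refl)
          l2 : ∀ q l → q ≤ l + # 20 → q - l ≤ # 20
          l2 q l p = ≤-by (gap p) (ring-≡ (q ∷ l ∷ []) (nat 20) (var 0 :- var 1 :+ (var 1 :+ nat 20 :- var 0)) refl)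

        -- A chain of n ≥ 92(q+1) steps raises `E` by at least 92/4 = 23, but its values lie in
        -- [-2, 20].
        no-saturated : ∀ {n} k → 92 ℕ.* suc q ℕ.≤ n → Saturated k → 2 ℕ.^ n ℕ.* V ℕ.≤ k → k ℕ.≤ U → ⊥
        no-saturated {n} k hn g h k≤U = conclude (chain n k g h k≤U)
          where
          conclude : Chained n k → ⊥
          conclude (k' , V≤k' , k'≤U , d) = 1≰0 (lem (ι q) (ι n) (E (a k')) (E (a k)) (subst (_≤ ι n) (trans (ι-* 92 (suc q)) (cong₂ _*_ (ι-lit 92) (ι-suc q))) (ι-mono hn)) d
              (proj₂ (E-bounds k' V≤k' k'≤U)) (proj₁ (E-bounds k (ℕ.≤-trans (ℕ.m≤n*m V (2 ℕ.^ n) {{ℕ.m^n≢0 2 n}}) h) k≤U)) (ι≥0 q))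
            where
            lem : ∀ q n x y → # 92 * (1ℚ + q) ≤ n → n ≤ # 4 * (1ℚ + q) * (x - y) → x ≤ # 20 → (- # 2) ≤ y → 0ℚ ≤ q → 1ℚ ≤ 0ℚ
            lem q n x y A B E F G = ≤-by (lit (ℤ.+ 1 / 4) ⊠ gap A ⊹ lit (ℤ.+ 1 / 4) ⊠ gap B ⊹ gap E ⊹ gap F ⊹ G ⊹ gap E ⊠ G ⊹ gap F ⊠ G) (ring-≡ (q ∷ n ∷ x ∷ y ∷ []) (nat 0) (nat 1 :+ (con (ℤ.+ 1 / 4) :* (var 1 :- nat 92 :* (nat 1 :+ var 0)) :+ con (ℤ.+ 1 / 4) :* (nat 4 :* (nat 1 :+ var 0) :* (var 2 :- var 3) :- var 1) :+ (nat 20 :- var 2) :+ (var 3 :- (:- nat 2)) :+ var 0 :+ (nat 20 :- var 2) :* var 0 :+ (var 3 :- (:- nat 2)) :* var 0)) refl)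

        U≤N : U ℕ.≤ N
        U≤N = ℕ.≤-trans (ℕ.m≤m*n U Y {{ℕ.>-nonZero 1≤Y}}) (ℕ.≤-trans hU (ℕ.m≤n*m z (suc q)))

        -- The factor 2^j provides the start of the chain: Q U - Q e ≥ j L 2 - 22 ≥ 92/4 - 22 = 1,
        -- which exceeds the slack, so some k in (e, U] is saturated.
        impossible : ∀ {j n} → 92 ℕ.≤ j → 92 ℕ.* suc q ℕ.≤ n → U ≡ 2 ℕ.^ j ℕ.* (2 ℕ.^ n ℕ.* V) → ⊥
        impossible {j} {n} hj hn refl = conclude (saturated-exists e≤U strict)
          where
          e = 2 ℕ.^ n ℕ.* V
          V≤e : V ℕ.≤ e
          V≤e = ℕ.m≤n*m V (2 ℕ.^ n) {{ℕ.m^n≢0 2 n}}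
          e≤U : e ℕ.≤ U
          e≤U = ℕ.m≤n*m e (2 ℕ.^ j) {{ℕ.m^n≢0 2 j}}
          1≤e = ℕ.≤-trans 1≤V V≤e
          1≤U = ℕ.≤-trans 1≤e e≤U
          ΔQ : 1ℚ ≤ Q U - Q e
          ΔQ = lem (Q U) (Q e) (L U) (L e) (ι j) (L 2) (mertens-≥ U 1≤U U≤N) (mertens-≤ e 1≤e (ℕ.≤-trans e≤U U≤N)) (L-^* 2 j e (s≤s z≤n) 1≤e U≤N) (subst (_≤ ι j) (ι-lit 92) (ι-mono hj))
            (1≤4*L2 (ℕ.≤-trans (ℕ.≤-trans (s≤s (s≤s z≤n)) 512≤Y) (ℕ.≤-trans (ℕ.m≤n*m Y (suc q)) (ℕ.≤-trans hV (ℕ.≤-trans V≤U U≤N)))))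
            where
            lem : ∀ u v l m j t → l - # 2 ≤ u → v ≤ m + # 20 → l ≡ j * t + m → # 92 ≤ j → 1ℚ ≤ # 4 * t → 1ℚ ≤ u - v
            lem u v l m j t A B E F G = ≤-by (gap A ⊹ gap B ⊹ gap (≤-reflexive (sym E)) ⊹ lit (ℤ.+ 1 / 4) ⊠ gap F ⊹ lit (# 23) ⊠ gap G ⊹ lit (ℤ.+ 1 / 4) ⊠ (gap F ⊠ gap G)) (ring-≡ (u ∷ v ∷ l ∷ m ∷ j ∷ t ∷ []) (var 0 :- var 1) (nat 1 :+ (var 0 :- (var 2 :- nat 2) :+ (var 3 :+ nat 20 :- var 1) :+ (var 2 :- (var 4 :* var 5 :+ var 3)) :+ con (ℤ.+ 1 / 4) :* (var 4 :- nat 92) :+ nat 23 :* (nat 4 :* var 5 :- nat 1) :+ con (ℤ.+ 1 / 4) :* ((var 4 :- nat 92) :* (nat 4 :* var 5 :- nat 1)))) refl)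
          slack≥0 : 0ℚ ≤ slack e U
          slack≥0 = gap (sum-mono-n (λ k → Λ k * s k) e≤U (λ k a _ → Λ≥0 k ⊠ s≥0 k (ℕ.≤-trans (s≤s z≤n) a)))
          strict : # 64 * slack e U < ι z * (Q U - Q e)
          strict = ≤-<-trans (l1 (slack e U) (ι q) (ι z) (slack-sub {V} {U} {e} {U} V≤e ℕ.≤-refl slack-k) slack≥0 (ι≥0 q))
            (<-≤-trans (subst (ℤ.+ 1 / 64 * ι z <_) (*-identityˡ (ι z)) (*-monoˡ-<-pos (ι z) {{positive (ι-pos 1≤z)}} {ℤ.+ 1 / 64} {1ℚ} (*<* (ℤ.+<+ (s≤s (s≤s z≤n))))))
              (l2 (ι z) (Q U - Q e) (ι≥0 z) ΔQ))
            where
            l1 : ∀ s q z → # 4096 * (1ℚ + q) * s ≤ z → 0ℚ ≤ s → 0ℚ ≤ q → # 64 * s ≤ ℤ.+ 1 / 64 * z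
            l1 s q z h h1 h2 = ≤-by ((lit (ℤ.+ 1 / 64) ⊠ gap h) ⊹ (lit (# 64) ⊠ (h2 ⊠ h1))) (l3 s q z)
              where
              l3 : ∀ s q z → ℤ.+ 1 / 64 * z ≡ # 64 * s + (ℤ.+ 1 / 64 * (z - # 4096 * (1ℚ + q) * s) + # 64 * (q * s))
              l3 = solve-∀ ℚ-ring
            l2 : ∀ z m → 0ℚ ≤ z → 1ℚ ≤ m → z ≤ z * m
            l2 z m A B = ≤-by (A ⊠ gap B) (ring-≡ (z ∷ m ∷ []) (var 0 :* var 1) (var 0 :+ (var 0 :* (var 1 :- nat 1))) refl)
          conclude : (∃ λ g → e ℕ.< g × g ℕ.≤ U × Saturated g) → ⊥
          conclude (g , a , b , c) = no-saturated g hn c (ℕ.<⇒≤ a) b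

  -- Parameters, and a block with small slack

  module NoPrimes (q z i E Δ Y J₀ J j n : ℕ) (4≤q : 4 ℕ.≤ q) (1≤z : 1 ℕ.≤ z)
    (hj : 92 ℕ.≤ j) (hn : 92 ℕ.* suc q ℕ.≤ n) (hE : E ≡ 2 ℕ.* (2 ℕ.^ j ℕ.* 2 ℕ.^ n)) (hΔ : Δ ≡ 4096 ℕ.* suc q ℕ.* 12 ℕ.* E)
    (hY : 2 ℕ.^ (488 ℕ.* (Δ ℕ.* suc q)) ℕ.≤ Y) (512≤Y : 512 ℕ.≤ Y) (hJ₀ : suc q ℕ.* Y ℕ.≤ E ℕ.^ J₀) (hi : i ≡ J₀ ℕ.+ J₀ ℕ.+ suc J)
    (E^i≤z : E ℕ.^ i ℕ.≤ z) (z<E^1+i : z ℕ.< E ℕ.^ suc i) (hi₁ : E ℕ.+ 4 ℕ.* J₀ ℕ.≤ i)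
    (hi₂ : 4 ℕ.* (Δ ℕ.* (100 ℕ.+ (20 ℕ.* (20 ℕ.* Y ℕ.+ 2) ℕ.+ 120) ℕ.* suc q)) ℕ.≤ i)
    (hi₃ : (suc q ℕ.* (Δ ℕ.* (i ℕ.* E ℕ.+ E ℕ.* E))) ℕ.* (suc q ℕ.* (Δ ℕ.* (i ℕ.* E ℕ.+ E ℕ.* E))) ℕ.≤ z) where

    open Chain q z 4≤q 1≤z

    private
      z≤N : z ℕ.≤ N
      z≤N = ℕ.m≤n*m z (suc q)
      1≤2^j2^n : 1 ℕ.≤ 2 ℕ.^ j ℕ.* 2 ℕ.^ n
      1≤2^j2^n = ℕ.*-mono-≤ (ℕ.m^n>0 2 j) (ℕ.m^n>0 2 n)
      2≤E : 2 ℕ.≤ E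
      2≤E = subst (2 ℕ.≤_) (sym hE) (ℕ.*-monoʳ-≤ 2 1≤2^j2^n)
      1≤E : 1 ℕ.≤ E
      1≤E = ℕ.≤-trans (s≤s z≤n) 2≤E
      1+q≤E : suc q ℕ.≤ E
      1+q≤E = ℕ.≤-trans (ℕ.m≤n*m (suc q) 92) (ℕ.≤-trans hn (ℕ.≤-trans (ℕ.<⇒≤ (n<p^n 2 n ℕ.≤-refl)) (subst (2 ℕ.^ n ℕ.≤_) (sym hE) (ℕ.≤-trans (ℕ.m≤n*m (2 ℕ.^ n) (2 ℕ.^ j) {{ℕ.m^n≢0 2 j}}) (ℕ.m≤n*m (2 ℕ.^ j ℕ.* 2 ℕ.^ n) 2)))))
      1≤Δ : 1 ℕ.≤ Δ
      1≤Δ = subst (1 ℕ.≤_) (sym hΔ) (ℕ.*-mono-≤ {1} {4096 ℕ.* suc q ℕ.* 12} (ℕ.*-mono-≤ {1} {4096 ℕ.* suc q} (ℕ.*-mono-≤ {1} {4096} (s≤s z≤n) (s≤s z≤n)) (s≤s z≤n)) 1≤E)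
      1≤Y : 1 ℕ.≤ Y
      1≤Y = ℕ.≤-trans (s≤s z≤n) 512≤Y
      E^i≤N : E ℕ.^ i ℕ.≤ N
      E^i≤N = ℕ.≤-trans E^i≤z z≤N
      1≤E^i : 1 ℕ.≤ E ℕ.^ i
      1≤E^i = 1≤^ E i 1≤E
      1≤i : 1 ℕ.≤ i
      1≤i = ℕ.≤-trans 1≤E (ℕ.≤-trans (ℕ.m≤m+n E (4 ℕ.* J₀)) hi₁)
      E≤E^i : E ℕ.≤ E ℕ.^ i
      E≤E^i = subst (ℕ._≤ E ℕ.^ i) (ℕ.*-identityʳ E) (ℕ.^-monoʳ-≤ E {{ℕ.>-nonZero 1≤E}} 1≤i)
      E≤N : E ℕ.≤ N
      E≤N = ℕ.≤-trans E≤E^i E^i≤N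

      -- δ' = δ/(q+1) turns an error relative to b k into one relative to κ k. In W, the 20Y covers
      -- the intervals ending below Y by Chebyshev's bound, and the 2 covers the rounding of the end
      -- points of the others.
      δ δ' W : ℚ
      δ = inv Δ
      δ' = inv (Δ ℕ.* suc q)
      W = ι (20 ℕ.* Y ℕ.+ 2)
      Δδ : ι Δ * δ ≡ 1ℚ
      Δδ = inv-r 1≤Δ

      W≡ : W ≡ # 20 * ι Y + # 2
      W≡ = trans (ι-+ (20 ℕ.* Y) 2) (cong₂ _+_ (trans (ι-* 20 Y) (cong (_* ι Y) (ι-lit 20))) (ι-lit 2))
      Δ≡ : ι Δ ≡ # 49152 * (1ℚ + ι q) * ι E
      Δ≡ = trans (cong ι hΔ) (trans (ι-* (4096 ℕ.* suc q ℕ.* 12) E) (cong (_* ι E) (trans (cong ι (l1 q)) (trans (ι-* 49152 (suc q)) (cong₂ _*_ (ι-lit 49152) (ι-suc q))))))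
        where
        l1 : ∀ q → 4096 ℕ.* suc q ℕ.* 12 ≡ 49152 ℕ.* suc q
        l1 = solveℕ-∀
      δδ' : (1ℚ + ι q) * δ' ≡ δ
      δδ' = trans (cong₂ _*_ (sym (ι-suc q)) (inv-* 1≤Δ (s≤s z≤n))) (trans (l1 (ι (suc q)) (inv Δ) (inv (suc q))) (trans (cong (inv Δ *_) (inv-r (s≤s z≤n))) (*-identityʳ _)))
        where
        l1 : ∀ a b c → a * (b * c) ≡ b * (a * c)
        l1 = solve-∀ ℚ-ring
      256δ≤1 : # 256 * δ ≤ 1ℚ
      256δ≤1 = lem (ι Δ) δ (ι q) (ι E) Δδ Δ≡ (ι≥0 q) (1≤ι 1≤E) (inv≥0 Δ)
        where
        lem : ∀ D d q e → D * d ≡ 1ℚ → D ≡ # 49152 * (1ℚ + q) * e → 0ℚ ≤ q → 1ℚ ≤ e → 0ℚ ≤ d → # 256 * d ≤ 1ℚ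
        lem D d q e A B E F G = ≤-by (gap (≤-reflexive A) ⊹ lit (# 48896) ⊠ G ⊹ eqgap (d) (sym B) ⊹ lit (# 49152) ⊠ (gap F ⊠ G) ⊹ lit (# 49152) ⊠ (E ⊠ gap F ⊠ G) ⊹ lit (# 49152) ⊠ (E ⊠ G)) (ring-≡ (D ∷ d ∷ q ∷ e ∷ []) (nat 1) (nat 256 :* var 1 :+ (nat 1 :- var 0 :* var 1 :+ nat 48896 :* var 1 :+ (var 0 :- nat 49152 :* (nat 1 :+ var 2) :* var 3) :* var 1 :+ nat 49152 :* ((var 3 :- nat 1) :* var 1) :+ nat 49152 :* (var 2 :* (var 3 :- nat 1) :* var 1) :+ nat 49152 :* (var 2 :* var 1))) refl)
      δ≤1 : δ ≤ 1ℚ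
      δ≤1 = l1 δ 256δ≤1 (inv≥0 Δ)
        where
        l1 : ∀ d → # 256 * d ≤ 1ℚ → 0ℚ ≤ d → d ≤ 1ℚ
        l1 d A B = ≤-by (gap A ⊹ lit (# 255) ⊠ B) (ring-≡ (d ∷ []) (nat 1) (var 0 :+ (nat 1 :- nat 256 :* var 0 :+ nat 255 :* var 0)) refl)

      LE^i : L (E ℕ.^ i) ≡ ι i * L E
      LE^i = trans (cong L (sym (ℕ.*-identityʳ (E ℕ.^ i)))) (trans (L-^* E i 1 1≤E (s≤s z≤n) (subst (ℕ._≤ N) (sym (ℕ.*-identityʳ (E ℕ.^ i))) E^i≤N)) (trans (cong (λ t → ι i * L E + t) L-1) (+-identityʳ _)))

      -- N ≤ E² E^i, and for the fixed base E the crude bound log E ≤ E is good enough.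
      L-hi : L N ≤ ι (i ℕ.* E ℕ.+ E ℕ.* E)
      L-hi = subst (L N ≤_) (sym (trans (ι-+ (i ℕ.* E) (E ℕ.* E)) (cong₂ _+_ (ι-* i E) (ι-* E E)))) (cancel-≤ (ι (E ℕ.^ i)) _ _ (ι-pos 1≤E^i)
          (lem (ι (E ℕ.^ i)) (ι N) (L N) (L (E ℕ.^ i)) (ι i) (L E) (ι E) (L-lip 1≤E^i E^i≤N ℕ.≤-refl) LE^i (L≤ι E 1≤E E≤N) (subst (ι N ≤_) (trans (ι-* (E ℕ.* E) (E ℕ.^ i)) (cong (_* ι (E ℕ.^ i)) (ι-* E E))) (ι-mono N≤)) (1≤ι 1≤E^i) (ι≥0 i)))
        where
        N≤ : N ℕ.≤ E ℕ.* E ℕ.* E ℕ.^ i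
        N≤ = ℕ.≤-trans (ℕ.*-mono-≤ 1+q≤E (ℕ.<⇒≤ z<E^1+i)) (ℕ.≤-reflexive (sym (ℕ.*-assoc E E (E ℕ.^ i))))
        lem : ∀ u n l m i k e → u * (l - m) ≤ n - u + 1ℚ → m ≡ i * k → k ≤ e → n ≤ e * e * u → 1ℚ ≤ u → 0ℚ ≤ i → u * l ≤ u * (i * e + e * e)
        lem u n l m i k e A B E F G I = ≤-by (gap A ⊹ gap F ⊹ gap G ⊹ eqgap (u) B ⊹ gap E ⊠ I ⊠ gap G ⊹ gap E ⊠ I) (ring-≡ (u ∷ n ∷ l ∷ m ∷ i ∷ k ∷ e ∷ []) (var 0 :* (var 4 :* var 6 :+ var 6 :* var 6)) (var 0 :* var 2 :+ (var 1 :- var 0 :+ nat 1 :- var 0 :* (var 2 :- var 3) :+ (var 6 :* var 6 :* var 0 :- var 1) :+ (var 0 :- nat 1) :+ (var 4 :* var 5 :- var 3) :* var 0 :+ (var 6 :- var 5) :* var 4 :* (var 0 :- nat 1) :+ (var 6 :- var 5) :* var 4)) refl)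

      L-lo : ι i ≤ # 4 * L N
      L-lo = lem (ι i) (L N) (L (E ℕ.^ i)) (L E) (L 2) (L-mono 1≤E^i E^i≤N ℕ.≤-refl) LE^i (L-mono (s≤s z≤n) 2≤E E≤N) (1≤4*L2 (ℕ.≤-trans 2≤E E≤N)) (ι≥0 i)
        where
        lem : ∀ i l m e t → m ≤ l → m ≡ i * e → t ≤ e → 1ℚ ≤ # 4 * t → 0ℚ ≤ i → i ≤ # 4 * l
        lem i l m e t A B E F G = ≤-by (lit (# 4) ⊠ gap A ⊹ lit (# 4) ⊠ gap (≤-reflexive (sym B)) ⊹ lit (# 4) ⊠ (gap E ⊠ G) ⊹ gap F ⊠ G) (ring-≡ (i ∷ l ∷ m ∷ e ∷ t ∷ []) (nat 4 :* var 1) (var 0 :+ (nat 4 :* (var 1 :- var 2) :+ nat 4 :* (var 2 :- var 0 :* var 3) :+ nat 4 :* ((var 3 :- var 4) :* var 0) :+ (nat 4 :* var 4 :- nat 1) :* var 0)) refl)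

      big : # 100 + (# 20 * W + # 120) * (1ℚ + ι q) ≤ δ * L N
      big = subst (_≤ δ * L N) K≡ (lem (ι K₄) δ (ι Δ) (L N) (ι i) Δδ L-lo (subst (_≤ ι i) (trans (ι-* 4 (Δ ℕ.* K₄)) (cong₂ _*_ (ι-lit 4) (ι-* Δ K₄))) (ι-mono hi₂)) (inv≥0 Δ))
        where
        K₄ = 100 ℕ.+ (20 ℕ.* (20 ℕ.* Y ℕ.+ 2) ℕ.+ 120) ℕ.* suc q
        K≡ : ι K₄ ≡ # 100 + (# 20 * W + # 120) * (1ℚ + ι q)
        K≡ = trans (ι-+ 100 ((20 ℕ.* (20 ℕ.* Y ℕ.+ 2) ℕ.+ 120) ℕ.* suc q)) (cong₂ _+_ (ι-lit 100) (trans (ι-* (20 ℕ.* (20 ℕ.* Y ℕ.+ 2) ℕ.+ 120) (suc q)) (cong₂ _*_ (trans (ι-+ (20 ℕ.* (20 ℕ.* Y ℕ.+ 2)) 120) (cong₂ _+_ (trans (ι-* 20 (20 ℕ.* Y ℕ.+ 2)) (cong (_* W) (ι-lit 20))) (ι-lit 120))) (ι-suc q))))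
        lem : ∀ k d D l i → D * d ≡ 1ℚ → i ≤ # 4 * l → # 4 * (D * k) ≤ i → 0ℚ ≤ d → k ≤ d * l
        lem k d D l i A B E F = ≤-by (lit (ℤ.+ 1 / 4) ⊠ (gap B ⊠ F) ⊹ lit (ℤ.+ 1 / 4) ⊠ (gap E ⊠ F) ⊹ eqgap (k) (sym A)) (ring-≡ (k ∷ d ∷ D ∷ l ∷ i ∷ []) (var 1 :* var 3) (var 0 :+ (con (ℤ.+ 1 / 4) :* ((nat 4 :* var 3 :- var 4) :* var 1) :+ con (ℤ.+ 1 / 4) :* ((var 4 :- nat 4 :* (var 2 :* var 0)) :* var 1) :+ (var 2 :* var 1 :- nat 1) :* var 0)) refl)

      -- `hi₃` gives S ≥ w = (q+1) Δ m with m ≥ log N, and S² ≤ (q+1) z; hence S log N ≤ z/Δ.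
      few : (∀ p → Prime p → x ℕ.< p → p ℕ.≤ N → ⊥) → ψ N - ψ x ≤ δ * ι z
      few no-prime = conclude (isqrt N)
        where
        m = i ℕ.* E ℕ.+ E ℕ.* E
        w = suc q ℕ.* (Δ ℕ.* m)
        conclude : (∃ λ s → s ℕ.* s ℕ.≤ N × N ℕ.< suc s ℕ.* suc s) → ψ N - ψ x ≤ δ * ι z
        conclude (S , lo , up) = ≤-trans (Δψ-≤ no-prime S up S≤N) (cancel-≤ (ι Δ * (1ℚ + ι q)) _ _ c>0
            (lem (ι S) (L N) (ι m) (ι w) (ι q) (ι z) (ι Δ) δ L-hi (trans (ι-* (suc q) (Δ ℕ.* m)) (cong₂ _*_ (ι-suc q) (ι-* Δ m))) (ι-mono w≤S) (subst₂ _≤_ (ι-* S S) (trans (ι-* (suc q) z) (cong (_* ι z) (ι-suc q))) (ι-mono lo)) Δδ (ι≥0 S) (ι≥0 Δ) (ι≥0 q)))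
          where
          S≤N : S ℕ.≤ N
          S≤N = S≤S² S lo
            where
            S≤S² : ∀ S → S ℕ.* S ℕ.≤ N → S ℕ.≤ N
            S≤S² zero _ = z≤n
            S≤S² (suc S) h = ℕ.≤-trans (ℕ.m≤m*n (suc S) (suc S)) h
          w≤S : w ℕ.≤ S
          w≤S = ℕ.≮⇒≥ (λ S<w → ℕ.<⇒≱ up (ℕ.≤-trans (ℕ.*-mono-≤ S<w S<w) (ℕ.≤-trans hi₃ z≤N)))
          c>0 : 0ℚ < ι Δ * (1ℚ + ι q)
          c>0 = subst (0ℚ <_) (trans (ι-* Δ (suc q)) (cong (ι Δ *_) (ι-suc q))) (ι-pos (ℕ.*-mono-≤ 1≤Δ (s≤s z≤n)))
          lem : ∀ s l m w q z D d → l ≤ m → w ≡ (1ℚ + q) * (D * m) → w ≤ s → s * s ≤ (1ℚ + q) * z → D * d ≡ 1ℚ → 0ℚ ≤ s → 0ℚ ≤ D → 0ℚ ≤ q → D * (1ℚ + q) * (s * l) ≤ D * (1ℚ + q) * (d * z)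
          lem s l m w q z D d A B E F G I J K = ≤-by (gap F ⊹ gap A ⊠ I ⊠ J ⊹ gap A ⊠ I ⊠ J ⊠ K ⊹ eqgap (s) (sym B) ⊹ gap E ⊠ I ⊹ eqgap (z) (sym G) ⊹ eqgap (z * q) (sym G)) (ring-≡ (s ∷ l ∷ m ∷ w ∷ q ∷ z ∷ D ∷ d ∷ []) (var 6 :* (nat 1 :+ var 4) :* (var 7 :* var 5)) (var 6 :* (nat 1 :+ var 4) :* (var 0 :* var 1) :+ ((nat 1 :+ var 4) :* var 5 :- var 0 :* var 0 :+ (var 2 :- var 1) :* var 0 :* var 6 :+ (var 2 :- var 1) :* var 0 :* var 6 :* var 4 :+ (var 3 :- (nat 1 :+ var 4) :* (var 6 :* var 2)) :* var 0 :+ (var 0 :- var 3) :* var 0 :+ (var 6 :* var 7 :- nat 1) :* var 5 :+ (var 6 :* var 7 :- nat 1) :* (var 5 :* var 4))) refl)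

      -- Brun-Titchmarsh divided by log v. With 488 = 4 * 122, v ≥ Y ≥ 2^p gives log v ≥ 122 Δ (q+1)
      -- = 122/δ'.
      short : ∀ {u v} → u ℕ.≤ v → v ℕ.≤ N → Y ℕ.≤ v → ψ v - ψ u ≤ # 2 * (ι v - ι u) + δ' * ι v
      short {u} {v} u≤v v≤N Y≤v = cancel-≤ (L v) _ _ Lv>0 (lem (ψ v) (ψ u) (ι v) (ι u) (L v) δ' (brun-titchmarsh u≤v 1≤v v≤N) 122≤ (ι≥0 v))
        where
        p = 488 ℕ.* (Δ ℕ.* suc q)
        1≤v = ℕ.≤-trans 1≤Y Y≤v
        2^p≤v : 2 ℕ.^ p ℕ.≤ v
        2^p≤v = ℕ.≤-trans hY Y≤v
        L2^p : L (2 ℕ.^ p) ≡ ι p * L 2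
        L2^p = trans (cong L (sym (ℕ.*-identityʳ (2 ℕ.^ p)))) (trans (L-^* 2 p 1 (s≤s z≤n) (s≤s z≤n) (subst (ℕ._≤ N) (sym (ℕ.*-identityʳ (2 ℕ.^ p))) (ℕ.≤-trans 2^p≤v v≤N))) (trans (cong (λ t → ι p * L 2 + t) L-1) (+-identityʳ _)))
        122≤ : # 122 ≤ δ' * L v
        122≤ = l1 (L v) (L (2 ℕ.^ p)) (ι p) (L 2) (ι (Δ ℕ.* suc q)) δ' (L-mono (ℕ.m^n>0 2 p) 2^p≤v v≤N) L2^p (1≤4*L2 (ℕ.≤-trans 2≤E E≤N)) (trans (ι-* 488 (Δ ℕ.* suc q)) (cong (_* ι (Δ ℕ.* suc q)) (ι-lit 488))) (inv-r (ℕ.*-mono-≤ 1≤Δ (s≤s z≤n))) (inv≥0 (Δ ℕ.* suc q)) (ι≥0 p)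
          where
          l1 : ∀ l m p t D d → m ≤ l → m ≡ p * t → 1ℚ ≤ # 4 * t → p ≡ # 488 * D → D * d ≡ 1ℚ → 0ℚ ≤ d → 0ℚ ≤ p → # 122 ≤ d * l
          l1 l m p t D d A B E F G I J = ≤-by (lit (# 122) ⊠ gap (≤-reflexive (sym G)) ⊹ gap A ⊠ I ⊹ eqgap (d) (sym B) ⊹ lit (ℤ.+ 1 / 4) ⊠ (gap E ⊠ I ⊠ J) ⊹ lit (ℤ.+ 1 / 4) ⊠ eqgap (d) (sym F)) (ring-≡ (l ∷ m ∷ p ∷ t ∷ D ∷ d ∷ []) (var 5 :* var 0) (nat 122 :+ (nat 122 :* (var 4 :* var 5 :- nat 1) :+ (var 0 :- var 1) :* var 5 :+ (var 1 :- var 2 :* var 3) :* var 5 :+ con (ℤ.+ 1 / 4) :* ((nat 4 :* var 3 :- nat 1) :* var 5 :* var 2) :+ con (ℤ.+ 1 / 4) :* ((var 2 :- nat 488 :* var 4) :* var 5))) refl)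
        Lv>0 : 0ℚ < L v
        Lv>0 = ≰⇒> (λ Lv≤0 → 1≰0 (l2 (L v) δ' Lv≤0 122≤ (inv≥0 (Δ ℕ.* suc q))))
          where
          l2 : ∀ l d → l ≤ 0ℚ → # 122 ≤ d * l → 0ℚ ≤ d → 1ℚ ≤ 0ℚ
          l2 l d A B E = ≤-by (lit (ℤ.+ 1 / 122) ⊠ gap B ⊹ lit (ℤ.+ 1 / 122) ⊠ (gap A ⊠ E)) (ring-≡ (l ∷ d ∷ []) (nat 0) (nat 1 :+ (con (ℤ.+ 1 / 122) :* (var 1 :* var 0 :- nat 122) :+ con (ℤ.+ 1 / 122) :* ((nat 0 :- var 0) :* var 1))) refl)
        lem : ∀ p p0 v u l d → (p - p0) * l ≤ # 2 * ((v - u) * l) + # 122 * v → # 122 ≤ d * l → 0ℚ ≤ v → l * (p - p0) ≤ l * (# 2 * (v - u) + d * v)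
        lem p p0 v u l d A B E = ≤-by (gap A ⊹ gap B ⊠ E) (ring-≡ (p ∷ p0 ∷ v ∷ u ∷ l ∷ d ∷ []) (var 4 :* (nat 2 :* (var 2 :- var 3) :+ var 5 :* var 2)) (var 4 :* (var 0 :- var 1) :+ (nat 2 :* ((var 2 :- var 3) :* var 4) :+ nat 122 :* var 2 :- (var 0 :- var 1) :* var 4 :+ (var 5 :* var 4 :- nat 122) :* var 2)) refl)

    open Descent Y 512≤Y δ δ' W (inv≥0 Δ) (inv≥0 (Δ ℕ.* suc q)) (ι≥0 (20 ℕ.* Y ℕ.+ 2)) 256δ≤1 δδ' short

    private
      s≥0 : ∀ k → 1 ℕ.≤ k → 0ℚ ≤ s k
      s≥0 k 1≤k = choose (ℕ.≤-<-connex Y (b k))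
        where
        choose : Y ℕ.≤ b k ⊎ b k ℕ.< Y → 0ℚ ≤ s k
        choose (inj₁ Y≤b) = l1 δ δ' (ι q) (κ k) W (ι Y) (ψ (b k)) (ψ (a k)) (ι (a k)) (ι (b k)) (short (a≤b k) (b≤N 1≤k) Y≤b) (a-lo k 1≤k) (b-hi k) W≡ δδ' (ι≥0 Y) (inv≥0 (Δ ℕ.* suc q))
          where
          l1 : ∀ d e q k w y pb pa a b → pb - pa ≤ # 2 * (b - a) + e * b → q * k ≤ a + 1ℚ → b ≤ (1ℚ + q) * k → w ≡ # 20 * y + # 2 → (1ℚ + q) * e ≡ d → 0ℚ ≤ y → 0ℚ ≤ e → 0ℚ ≤ (# 2 + d) * k + w - (pb - pa)
          l1 d e q k w y pb pa a b A B E F G I J = ≤-by (gap A ⊹ lit (# 2) ⊠ gap B ⊹ lit (# 2) ⊠ gap E ⊹ gap (≤-reflexive (sym F)) ⊹ lit (# 20) ⊠ I ⊹ gap E ⊠ J ⊹ eqgap (k) G) (ring-≡ (d ∷ e ∷ q ∷ k ∷ w ∷ y ∷ pb ∷ pa ∷ a ∷ b ∷ []) ((nat 2 :+ var 0) :* var 3 :+ var 4 :- (var 6 :- var 7)) (nat 0 :+ (nat 2 :* (var 9 :- var 8) :+ var 1 :* var 9 :- (var 6 :- var 7) :+ nat 2 :* (var 8 :+ nat 1 :- var 2 :* var 3) :+ nat 2 :* ((nat 1 :+ var 2) :* var 3 :- var 9) :+ (var 4 :- (nat 20 :* var 5 :+ nat 2)) :+ nat 20 :* var 5 :+ ((nat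 1 :+ var 2) :* var 3 :- var 9) :* var 1 :+ (var 0 :- (nat 1 :+ var 2) :* var 1) :* var 3)) refl)
        choose (inj₂ b<Y) = l2 δ (κ k) W (ι Y) (ψ (b k)) (ψ (a k)) (ι (b k)) (cheb (b k) (b≤N 1≤k)) (ψ≥0 (a k)) (ι-mono (ℕ.<⇒≤ b<Y)) W≡ (κ≥0 k) (inv≥0 Δ)
          where
          cheb : ∀ v → v ℕ.≤ N → ψ v ≤ # 20 * ι v
          cheb zero _ = ≤-reflexive (trans (sym (*-zeroʳ (# 20))) (cong (# 20 *_) (sym ι-0)))
          cheb v@(suc _) v≤N = chebyshev-≤ v (s≤s z≤n) v≤N
          l2 : ∀ d k w y pb pa b → pb ≤ # 20 * b → 0ℚ ≤ pa → b ≤ y → w ≡ # 20 * y + # 2 → 0ℚ ≤ k → 0ℚ ≤ d → 0ℚ ≤ (# 2 + d) * k + w - (pb - pa)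
          l2 d k w y pb pa b A B E F G I = ≤-by (gap A ⊹ B ⊹ lit (# 20) ⊠ gap E ⊹ gap (≤-reflexive (sym F)) ⊹ lit (# 2) ⊠ G ⊹ G ⊠ I ⊹ lit (# 2)) (ring-≡ (d ∷ k ∷ w ∷ y ∷ pb ∷ pa ∷ b ∷ []) ((nat 2 :+ var 0) :* var 1 :+ var 2 :- (var 4 :- var 5)) (nat 0 :+ (nat 20 :* var 6 :- var 4 :+ var 5 :+ nat 20 :* (var 3 :- var 6) :+ (var 2 :- (nat 20 :* var 3 :+ nat 2)) :+ nat 2 :* var 1 :+ var 1 :* var 0 :+ nat 2)) refl)

      g : ℕ → ℚ
      g m = sum m (λ k → Λ k * s k)
      g≥0 : ∀ {m n} k → m ℕ.< k → k ℕ.≤ n → 0ℚ ≤ Λ k * s k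
      g≥0 k a _ = Λ≥0 k ⊠ s≥0 k (ℕ.≤-trans (s≤s z≤n) a)
      g-mono : ∀ {m n} → m ℕ.≤ n → g m ≤ g n
      g-mono p = sum-mono-n (λ k → Λ k * s k) p g≥0
      c : ℚ
      c = # 4096 * (1ℚ + ι q)
      -- Increments of h add the slack of a block (E^m, E^(m+1)] and that of its image under k ↦ N/k.
      h : ℕ → ℚ
      h k = c * (g (E ℕ.^ (J₀ ℕ.+ k)) - g (N ⫽ (E ℕ.^ (J₀ ℕ.+ k))))

      -- In the ratio E = 2 * 2^j * 2^n of a block, 2^n is room for the chain, 2^j is the range for
      -- its start, and the last 2 is the margin for m. Keeping J₀ powers of E free at both ends
      -- ensures (q+1) Y ≤ V and U Y ≤ z.
      block : ∀ k → k ℕ.< suc J → h (suc k) - h k ≤ ι z → ⊥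
      block k k<J small = Run.impossible V U hV V≤U hU s≥0 slack₁ slack₂ hj hn refl
        where
        V = E ℕ.^ (J₀ ℕ.+ k)
        U = 2 ℕ.^ j ℕ.* (2 ℕ.^ n ℕ.* V)
        1≤V = 1≤^ E (J₀ ℕ.+ k) 1≤E
        V≤U : V ℕ.≤ U
        V≤U = ℕ.≤-trans (ℕ.m≤n*m V (2 ℕ.^ n) {{ℕ.m^n≢0 2 n}}) (ℕ.m≤n*m (2 ℕ.^ n ℕ.* V) (2 ℕ.^ j) {{ℕ.m^n≢0 2 j}})
        next≡ : E ℕ.^ (J₀ ℕ.+ suc k) ≡ 2 ℕ.* U
        next≡ = trans (cong (E ℕ.^_) (ℕ.+-suc J₀ k)) (trans (cong (ℕ._* V) hE) (trans (ℕ.*-assoc 2 (2 ℕ.^ j ℕ.* 2 ℕ.^ n) V) (cong (2 ℕ.*_) (ℕ.*-assoc (2 ℕ.^ j) (2 ℕ.^ n) V))))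
        hV : suc q ℕ.* Y ℕ.≤ V
        hV = ℕ.≤-trans hJ₀ (ℕ.^-monoʳ-≤ E {{ℕ.>-nonZero 1≤E}} (ℕ.m≤m+n J₀ k))
        Y≤E^J₀ : Y ℕ.≤ E ℕ.^ J₀
        Y≤E^J₀ = ℕ.≤-trans (ℕ.m≤n*m Y (suc q)) hJ₀
        hU : U ℕ.* Y ℕ.≤ z
        hU = ℕ.≤-trans (ℕ.*-mono-≤ (ℕ.≤-trans (ℕ.m≤n*m U 2) (ℕ.≤-reflexive (sym next≡))) Y≤E^J₀)
          (ℕ.≤-trans (ℕ.≤-reflexive (sym (ℕ.^-distribˡ-+-* E (J₀ ℕ.+ suc k) J₀))) (ℕ.≤-trans (ℕ.^-monoʳ-≤ E {{ℕ.>-nonZero 1≤E}} (ℕ.≤-trans (ℕ.+-monoˡ-≤ J₀ (ℕ.+-monoʳ-≤ J₀ k<J)) (ℕ.≤-reflexive (trans (l1 J₀ (suc J)) (sym hi))))) E^i≤z))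
          where
          l1 : ∀ a b → a ℕ.+ b ℕ.+ a ≡ a ℕ.+ a ℕ.+ b
          l1 = solveℕ-∀
        small' : c * (g (2 ℕ.* U) - g (N ⫽ (2 ℕ.* U))) - c * (g V - g (N ⫽ V)) ≤ ι z
        small' = subst (λ t → c * (g t - g (N ⫽ t)) - h k ≤ ι z) next≡ small
        V≤2U : V ℕ.≤ 2 ℕ.* U
        V≤2U = ℕ.≤-trans V≤U (ℕ.m≤n*m U 2)
        N⫽2U≤N⫽V : N ⫽ (2 ℕ.* U) ℕ.≤ N ⫽ V
        N⫽2U≤N⫽V = *≤⇒≤⫽ 1≤V (ℕ.≤-trans (ℕ.*-monoˡ-≤ (N ⫽ (2 ℕ.* U)) V≤2U) (*⫽≤ N (2 ℕ.* U)))
        slack₁ : # 4096 * (1ℚ + ι q) * (g U - g V) ≤ ι z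
        slack₁ = lem (ι q) (ι z) (g (2 ℕ.* U)) (g (N ⫽ (2 ℕ.* U))) (g V) (g (N ⫽ V)) (g U) small' (g-mono (ℕ.m≤n*m U 2)) (g-mono N⫽2U≤N⫽V) (ι≥0 q)
          where
          lem : ∀ q z u2 n2 v nv u → # 4096 * (1ℚ + q) * (u2 - n2) - # 4096 * (1ℚ + q) * (v - nv) ≤ z → u ≤ u2 → n2 ≤ nv → 0ℚ ≤ q → # 4096 * (1ℚ + q) * (u - v) ≤ z
          lem q z u2 n2 v nv u A B E F = ≤-by (gap A ⊹ lit (# 4096) ⊠ gap B ⊹ lit (# 4096) ⊠ gap E ⊹ lit (# 4096) ⊠ (gap B ⊠ F) ⊹ lit (# 4096) ⊠ (gap E ⊠ F)) (ring-≡ (q ∷ z ∷ u2 ∷ n2 ∷ v ∷ nv ∷ u ∷ []) (var 1) (nat 4096 :* (nat 1 :+ var 0) :* (var 6 :- var 4) :+ (var 1 :- (nat 4096 :* (nat 1 :+ var 0) :* (var 2 :- var 3) :- nat 4096 :* (nat 1 :+ var 0) :* (var 4 :- var 5)) :+ nat 4096 :* (var 2 :- var 6) :+ nat 4096 :* (var 5 :- var 3) :+ nat 4096 :* ((var 2 :- var 6) :* var 0) :+ nat 4096 :* ((var 5 :- var 3) :* var 0))) refl)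
        slack₂ : # 4096 * (1ℚ + ι q) * (g (N ⫽ V) - g (N ⫽ (2 ℕ.* U))) ≤ ι z
        slack₂ = lem (ι q) (ι z) (g (2 ℕ.* U)) (g (N ⫽ (2 ℕ.* U))) (g V) (g (N ⫽ V)) small' (g-mono V≤2U) (ι≥0 q)
          where
          lem : ∀ q z u2 n2 v nv → # 4096 * (1ℚ + q) * (u2 - n2) - # 4096 * (1ℚ + q) * (v - nv) ≤ z → v ≤ u2 → 0ℚ ≤ q → # 4096 * (1ℚ + q) * (nv - n2) ≤ z
          lem q z u2 n2 v nv A B F = ≤-by (gap A ⊹ lit (# 4096) ⊠ gap B ⊹ lit (# 4096) ⊠ (gap B ⊠ F)) (ring-≡ (q ∷ z ∷ u2 ∷ n2 ∷ v ∷ nv ∷ []) (var 1) (nat 4096 :* (nat 1 :+ var 0) :* (var 5 :- var 3) :+ (var 1 :- (nat 4096 :* (nat 1 :+ var 0) :* (var 2 :- var 3) :- nat 4096 :* (nat 1 :+ var 0) :* (var 4 :- var 5)) :+ nat 4096 :* (var 2 :- var 4) :+ nat 4096 :* ((var 2 :- var 4) :* var 0))) refl)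

    contradiction : (∀ p → Prime p → x ℕ.< p → p ℕ.≤ N → ⊥) → ⊥
    contradiction no-prime = conclude (sum-≤-pick J (λ k → h k - h (ℕ.pred k)) (λ _ → ι z) average)
      where
      total : g N ≤ # 3 * (δ * (ι z * L N))
      total = slack-total δ W (inv≥0 Δ) δ≤1 (ι≥0 (20 ℕ.* Y ℕ.+ 2)) (few no-prime) big
      J≥ : ι i + ι E ≤ # 2 * ι (suc J)
      J≥ = lem (ι i) (ι E) (ι J₀) (ι (suc J)) (trans (cong ι hi) (trans (ι-+ (J₀ ℕ.+ J₀) (suc J)) (cong (_+ ι (suc J)) (ι-+ J₀ J₀)))) (subst (_≤ ι i) (trans (ι-+ E (4 ℕ.* J₀)) (cong (λ t → ι E + t) (trans (ι-* 4 J₀) (cong (_* ι J₀) (ι-lit 4))))) (ι-mono hi₁))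
        where
        lem : ∀ i e o j → i ≡ o + o + j → e + # 4 * o ≤ i → i + e ≤ # 2 * j
        lem i e o j A B = ≤-by (lit (# 2) ⊠ gap (≤-reflexive A) ⊹ gap B) (ring-≡ (i ∷ e ∷ o ∷ j ∷ []) (nat 2 :* var 3) (var 0 :+ var 1 :+ (nat 2 :* (var 2 :+ var 2 :+ var 3 :- var 0) :+ (var 0 :- (var 1 :+ nat 4 :* var 2)))) refl)
      -- With c = 4096(q+1), both windows of all blocks together weigh at most 2c * 3δ z E (i + E).
      -- As Δ = 12 c E this is z (i + E)/2, at most z per block by `J≥`.
      average : sum (suc J) (λ k → h k - h (ℕ.pred k)) ≤ sum (suc J) (λ _ → ι z)
      average = subst₂ _≤_ (sym (sum-telescope (suc J) h)) (sym (sum-const (suc J) (ι z)))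
        (l1 (ι q) (ι z) (ι (suc J)) (ι i) (ι E) (ι Δ) δ (L N) (g N) (g (E ℕ.^ (J₀ ℕ.+ suc J))) (g (N ⫽ (E ℕ.^ (J₀ ℕ.+ suc J)))) (g (E ℕ.^ (J₀ ℕ.+ 0))) (g (N ⫽ (E ℕ.^ (J₀ ℕ.+ 0))))
          total (g-mono top≤N) (g-mono (⫽≤ N (1≤^ E (J₀ ℕ.+ 0) 1≤E))) (g-nonneg (N ⫽ (E ℕ.^ (J₀ ℕ.+ suc J)))) (g-nonneg (E ℕ.^ (J₀ ℕ.+ 0)))
          (subst (L N ≤_) (trans (ι-+ (i ℕ.* E) (E ℕ.* E)) (cong₂ _+_ (ι-* i E) (ι-* E E))) L-hi) J≥ Δδ Δ≡ (ι≥0 q) (ι≥0 z) (inv≥0 Δ))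
        where
        g-nonneg : ∀ m → 0ℚ ≤ g m
        g-nonneg m = sum≥0 m (λ k a _ → Λ≥0 k ⊠ s≥0 k a)
        top≤N : E ℕ.^ (J₀ ℕ.+ suc J) ℕ.≤ N
        top≤N = ℕ.≤-trans (ℕ.^-monoʳ-≤ E {{ℕ.>-nonZero 1≤E}} (ℕ.≤-trans (ℕ.+-monoˡ-≤ (suc J) (ℕ.m≤m+n J₀ J₀)) (ℕ.≤-reflexive (sym hi)))) E^i≤N
        l1 : ∀ q z j i e D d l G gt nt gb nb → G ≤ # 3 * (d * (z * l)) → gt ≤ G → nb ≤ G → 0ℚ ≤ nt → 0ℚ ≤ gb → l ≤ i * e + e * e → i + e ≤ # 2 * j → D * d ≡ 1ℚ → D ≡ # 49152 * (1ℚ + q) * e → 0ℚ ≤ q → 0ℚ ≤ z → 0ℚ ≤ d → # 4096 * (1ℚ + q) * (gt - nt) - # 4096 * (1ℚ + q) * (gb - nb) ≤ j * z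
        l1 q z j i e D d l G gt nt gb nb A B B1 B2 B3 E F I J K M O = ≤-by (lit (# 8192) ⊠ gap A ⊹ lit (# 4096) ⊠ gap B ⊹ lit (# 4096) ⊠ gap B1 ⊹ lit (# 4096) ⊠ B2 ⊹ lit (# 4096) ⊠ B3 ⊹ lit (# 8192) ⊠ (gap A ⊠ K) ⊹ lit (# 4096) ⊠ (gap B ⊠ K) ⊹ lit (# 4096) ⊠ (gap B1 ⊠ K) ⊹ lit (# 4096) ⊠ (B2 ⊠ K) ⊹ lit (# 4096) ⊠ (B3 ⊠ K) ⊹ lit (# 24576) ⊠ (gap E ⊠ M ⊠ O) ⊹ lit (# 24576) ⊠ (gap E ⊠ M ⊠ O ⊠ K) ⊹ lit (ℤ.+ 1 / 2) ⊠ (gap F ⊠ M) ⊹ lit (ℤ.+ 1 / 2) ⊠ eqgap (d * z * i) (sym J) ⊹ lit (ℤ.+ 1 / 2) ⊠ eqgap (d * z * e) (sym J) ⊹ lit (ℤ.+ 1 / 2) ⊠ eqgap (z * i) I ⊹ lit (ℤ.+ 1 / 2) ⊠ eqgap (z * e) I) (ring-≡ (q ∷ z ∷ j ∷ i ∷ e ∷ D ∷ d ∷ l ∷ G ∷ gt ∷ nt ∷ gb ∷ nb ∷ []) (var 2 :* var 1) (nat 4096 :* (nat 1 :+ var 0) :* (var 9 :- var 10) :- nat 4096 :* (nat 1 :+ var 0) :* (var 11 :- var 12) :+ (nat 8192 :* (nat 3 :* (var 6 :* (var 1 :* var 7)) :- var 8) :+ nat 4096 :* (var 8 :- var 9) :+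 nat 4096 :* (var 8 :- var 12) :+ nat 4096 :* var 10 :+ nat 4096 :* var 11 :+ nat 8192 :* ((nat 3 :* (var 6 :* (var 1 :* var 7)) :- var 8) :* var 0) :+ nat 4096 :* ((var 8 :- var 9) :* var 0) :+ nat 4096 :* ((var 8 :- var 12) :* var 0) :+ nat 4096 :* (var 10 :* var 0) :+ nat 4096 :* (var 11 :* var 0) :+ nat 24576 :* ((var 3 :* var 4 :+ var 4 :* var 4 :- var 7) :* var 1 :* var 6) :+ nat 24576 :* ((var 3 :* var 4 :+ var 4 :* var 4 :- var 7) :* var 1 :* var 6 :* var 0) :+ con (ℤ.+ 1 / 2) :* ((nat 2 :* var 2 :- (var 3 :+ var 4)) :* var 1) :+ con (ℤ.+ 1 / 2) :* ((var 5 :- nat 49152 :* (nat 1 :+ var 0) :* var 4) :* (var 6 :* var 1 :* var 3)) :+ con (ℤ.+ 1 / 2) :* ((var 5 :- nat 49152 :* (nat 1 :+ var 0) :* var 4) :* (var 6 :* var 1 :* var 4)) :+ con (ℤ.+ 1 / 2) :* ((nat 1 :- var 5 :* var 6) :* (var 1 :* var 3)) :+ con (ℤ.+ 1 / 2) :* ((nat 1 :- var 5 :* var 6) :* (var 1 :* var 4)))) refl)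
      conclude : (∃ λ k → 1 ℕ.≤ k × k ℕ.≤ suc J × h k - h (ℕ.pred k) ≤ ι z) → ⊥
      conclude (suc k , _ , k≤J , small) = block k k≤J small

  -- A prime in (qz, (q+1)z] for large z

  module Thresholds (q j n E Δ Y J₀ K₄ G : ℕ) (4≤q : 4 ℕ.≤ q) (hj : 92 ℕ.≤ j) (hn : 92 ℕ.* suc q ℕ.≤ n)
    (hE : E ≡ 2 ℕ.* (2 ℕ.^ j ℕ.* 2 ℕ.^ n)) (hΔ : Δ ≡ 4096 ℕ.* suc q ℕ.* 12 ℕ.* E) (hY : Y ≡ 512 ℕ.+ 2 ℕ.^ (488 ℕ.* (Δ ℕ.* suc q)))
    (hJ₀ : J₀ ≡ suc q ℕ.* Y) (hK₄ : K₄ ≡ 4 ℕ.* (Δ ℕ.* (100 ℕ.+ (20 ℕ.* (20 ℕ.* Y ℕ.+ 2) ℕ.+ 120) ℕ.* suc q)))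
    (hG : G ≡ suc q ℕ.* (Δ ℕ.* (2 ℕ.* E))) where

    -- The summands are the lower bounds on i needed for `i³≤2^i`, for the logarithm to beat the
    -- fixed errors (`K₄`), for enough blocks (`E` and `J₀`), and for z to beat the square of log z
    -- (`G`).
    I₀ : ℕ
    I₀ = (10 ℕ.+ K₄) ℕ.+ (E ℕ.+ 4 ℕ.* J₀) ℕ.+ G ℕ.* G

    private
      1≤2^j2^n : 1 ℕ.≤ 2 ℕ.^ j ℕ.* 2 ℕ.^ n
      1≤2^j2^n = ℕ.*-mono-≤ (ℕ.m^n>0 2 j) (ℕ.m^n>0 2 n)
      2≤E : 2 ℕ.≤ E
      2≤E = subst (2 ℕ.≤_) (sym hE) (ℕ.*-monoʳ-≤ 2 1≤2^j2^n)

    prime-between : ∀ z → E ℕ.^ I₀ ℕ.≤ z → ∃ λ p → Prime p × q ℕ.* z ℕ.< p × p ℕ.≤ suc q ℕ.* z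
    prime-between z Z≤z = search (ℕ.anyUpTo? (λ p → both (prime? p) (suc (q ℕ.* z) ℕ.≤? p)) (suc (suc q ℕ.* z)))
      where
      both : ∀ {A B : Set} → Dec A → Dec B → Dec (A × B)
      both (yes a) (yes b) = yes (a , b)
      both (no ¬a) _ = no (λ p → ¬a (proj₁ p))
      both (yes _) (no ¬b) = no (λ p → ¬b (proj₂ p))
      1≤z : 1 ℕ.≤ z
      1≤z = ℕ.≤-trans (1≤^ E I₀ (ℕ.≤-trans (s≤s z≤n) 2≤E)) Z≤z
      none : (∀ p → Prime p → q ℕ.* z ℕ.< p → p ℕ.≤ suc q ℕ.* z → ⊥) → (∃ λ i → E ℕ.^ i ℕ.≤ z × z ℕ.< E ℕ.^ suc i) → ⊥
      none no-prime (i , lo , hi) = NoPrimes.contradiction q z i E Δ Y J₀ J′ j n 4≤q 1≤z hj hn hE hΔ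
          (subst (2 ℕ.^ (488 ℕ.* (Δ ℕ.* suc q)) ℕ.≤_) (sym hY) (ℕ.m≤n+m _ 512)) (subst (512 ℕ.≤_) (sym hY) (ℕ.m≤m+n 512 _))
          (subst (ℕ._≤ E ℕ.^ J₀) hJ₀ (ℕ.<⇒≤ (n<p^n E J₀ 2≤E))) i≡ lo hi hi₁
          (subst (ℕ._≤ i) hK₄ (ℕ.≤-trans (ℕ.m≤n+m K₄ 10) hA)) hi₃ no-prime
        where
        I₀≤i : I₀ ℕ.≤ i
        I₀≤i = ℕ.≮⇒≥ (λ i<I₀ → ℕ.<⇒≱ hi (ℕ.≤-trans (ℕ.^-monoʳ-≤ E {{ℕ.>-nonZero (ℕ.≤-trans (s≤s z≤n) 2≤E)}} i<I₀) Z≤z))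
        hAB : (10 ℕ.+ K₄) ℕ.+ (E ℕ.+ 4 ℕ.* J₀) ℕ.≤ i
        hAB = ℕ.≤-trans (ℕ.m≤m+n _ (G ℕ.* G)) I₀≤i
        hA : 10 ℕ.+ K₄ ℕ.≤ i
        hA = ℕ.≤-trans (ℕ.m≤m+n _ (E ℕ.+ 4 ℕ.* J₀)) hAB
        hi₁ : E ℕ.+ 4 ℕ.* J₀ ℕ.≤ i
        hi₁ = ℕ.≤-trans (ℕ.m≤n+m _ (10 ℕ.+ K₄)) hAB
        J′ = i ℕ.∸ suc (J₀ ℕ.+ J₀)
        i≡ : i ≡ J₀ ℕ.+ J₀ ℕ.+ suc J′
        i≡ = trans (sym (ℕ.m+[n∸m]≡n big)) (sym (ℕ.+-suc (J₀ ℕ.+ J₀) J′))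
          where
          big : suc (J₀ ℕ.+ J₀) ℕ.≤ i
          big = ℕ.≤-trans (ℕ.+-mono-≤ {1} {E} (ℕ.≤-trans (s≤s z≤n) 2≤E) (ℕ.+-monoʳ-≤ J₀ (ℕ.m≤m+n J₀ (J₀ ℕ.+ (J₀ ℕ.+ 0))))) hi₁
        E≤i : E ℕ.≤ i
        E≤i = ℕ.≤-trans (ℕ.m≤m+n E (4 ℕ.* J₀)) hi₁
        w = suc q ℕ.* (Δ ℕ.* (i ℕ.* E ℕ.+ E ℕ.* E))
        w≤ : w ℕ.≤ G ℕ.* i
        w≤ = ℕ.≤-trans (ℕ.*-monoʳ-≤ (suc q) (ℕ.*-monoʳ-≤ Δ (ℕ.+-monoʳ-≤ (i ℕ.* E) (ℕ.*-monoˡ-≤ E E≤i)))) (ℕ.≤-reflexive (trans (lem q Δ E i) (cong (ℕ._* i) (sym hG))))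
          where
          lem : ∀ q D E i → suc q ℕ.* (D ℕ.* (i ℕ.* E ℕ.+ i ℕ.* E)) ≡ suc q ℕ.* (D ℕ.* (2 ℕ.* E)) ℕ.* i
          lem = solveℕ-∀
        -- w² ≤ G² i² ≤ i³ ≤ 2^i ≤ E^i ≤ z.
        hi₃ : w ℕ.* w ℕ.≤ z
        hi₃ = ℕ.≤-trans (ℕ.*-mono-≤ w≤ w≤) (ℕ.≤-trans (ℕ.≤-reflexive (lem G i)) (ℕ.≤-trans (ℕ.*-monoˡ-≤ (i ℕ.* i) (ℕ.≤-trans (ℕ.m≤n+m (G ℕ.* G) _) I₀≤i))
            (ℕ.≤-trans (i³≤2^i i (ℕ.≤-trans (ℕ.m≤m+n 10 K₄) hA)) (ℕ.≤-trans (ℕ.^-monoˡ-≤ i 2≤E) lo))))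
          where
          lem : ∀ G i → G ℕ.* i ℕ.* (G ℕ.* i) ≡ G ℕ.* G ℕ.* (i ℕ.* i)
          lem = solveℕ-∀
      search : Dec (∃ λ p → p ℕ.< suc (suc q ℕ.* z) × (Prime p × q ℕ.* z ℕ.< p)) → ∃ λ p → Prime p × q ℕ.* z ℕ.< p × p ℕ.≤ suc q ℕ.* z
      search (yes (p , s≤s le , pp , lt)) = p , pp , lt , le
      search (no ¬p) = ⊥-elim (none (λ p pp lt le → ¬p (p , s≤s le , pp , lt)) (floor-log E z 2≤E 1≤z))

  opaque
    -- The only place where the parameters get values; the proofs by reflexivity determine them. The
    -- threshold is an iterated exponential, so it stays opaque.
    prime-gap : ∀ q → 4 ℕ.≤ q → ∃ λ Z → ∀ z → Z ℕ.≤ z → ∃ λ p → Prime p × q ℕ.* z ℕ.< p × p ℕ.≤ suc q ℕ.* z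
    prime-gap q 4≤q = _ , Thresholds.prime-between q 92 _ _ _ _ _ _ _ 4≤q ℕ.≤-refl ℕ.≤-refl refl refl refl refl refl refl

open import Defs

-- Cardinalities of finite subsets

module Subsets where

  open import Data.Nat as ℕ using (ℕ; zero; suc)
  import Data.Nat.Properties as ℕ
  open import Data.Fin as Fin using (Fin)
  import Data.Fin.Properties as Fin
  open import Data.Fin.Patterns using (0F; 1F; 2F)
  open import Data.Fin.Subset using (Subset; _∈_; _∪_; ⁅_⁆; inside; outside) renaming (∣_∣ to card)
  open import Data.Fin.Subset.Properties using (x∈⁅x⁆; x∈⁅y⁆⇒x≡y; x∈p∪q⁺; x∈p∪q⁻)
  open import Data.Vec using (_∷_; here; there)
  import Data.Vec.Properties as Vec
  open import Data.List using (List; lookup)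
  open import Data.List.Membership.Propositional.Properties using (∈-lookup)
  open import Data.List.Relation.Unary.Unique.Propositional using (Unique)
  open import Data.List.Relation.Unary.AllPairs using (_∷_)
  import Data.List.Relation.Unary.All as All
  open import Data.Sum using (_⊎_; inj₁; inj₂)
  open import Data.Empty using (⊥-elim)
  open import Function using (_∘_)
  open import Function.Definitions using (Injective)
  open import Relation.Nullary using (yes; no)
  open import Relation.Nullary.Decidable using (⌊_⌋; dec-true; isYes≗does)
  open import Relation.Binary.PropositionalEquality

  lookup-injective : ∀ {A : Set} {xs : List A} → Unique xs → ∀ i j → lookup xs i ≡ lookup xs j → i ≡ j
  lookup-injective (_ ∷ _) Fin.zero Fin.zero _ = refl
  lookup-injective (x≢ ∷ _) Fin.zero (Fin.suc j) e = ⊥-elim (All.lookup x≢ (∈-lookup j) e)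
  lookup-injective (x≢ ∷ _) (Fin.suc i) Fin.zero e = ⊥-elim (All.lookup x≢ (∈-lookup i) (sym e))
  lookup-injective (_ ∷ u) (Fin.suc i) (Fin.suc j) e = cong Fin.suc (lookup-injective u i j e)

  nth : ∀ {n} (s : Subset n) → Fin (card s) → Fin n
  nth (outside ∷ s) i = Fin.suc (nth s i)
  nth (inside ∷ s) Fin.zero = Fin.zero
  nth (inside ∷ s) (Fin.suc i) = Fin.suc (nth s i)

  nth∈ : ∀ {n} (s : Subset n) i → nth s i ∈ s
  nth∈ (outside ∷ s) i = there (nth∈ s i)
  nth∈ (inside ∷ s) Fin.zero = here
  nth∈ (inside ∷ s) (Fin.suc i) = there (nth∈ s i)

  nth-injective : ∀ {n} (s : Subset n) → Injective _≡_ _≡_ (nth s)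
  nth-injective (outside ∷ s) e = nth-injective s (Fin.suc-injective e)
  nth-injective (inside ∷ s) {Fin.zero} {Fin.zero} e = refl
  nth-injective (inside ∷ s) {Fin.suc i} {Fin.suc j} e = cong Fin.suc (nth-injective s (Fin.suc-injective e))

  rank : ∀ {n} {s : Subset n} {x} → x ∈ s → Fin (card s)
  rank {s = inside ∷ s} here = Fin.zero
  rank {s = outside ∷ s} (there p) = rank p
  rank {s = inside ∷ s} (there p) = Fin.suc (rank p)

  rank-injective : ∀ {n} {s : Subset n} {x y} (p : x ∈ s) (q : y ∈ s) → rank p ≡ rank q → x ≡ y
  rank-injective here here e = refl
  rank-injective {s = outside ∷ s} (there p) (there q) e = cong Fin.suc (rank-injective p q e)
  rank-injective {s = inside ∷ s} (there p) (there q) e = cong Fin.suc (rank-injective p q (Fin.suc-injective e))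

  card-≤ : ∀ {n k} (s : Subset n) (f : Fin n → Fin k) → (∀ {x y} → x ∈ s → y ∈ s → f x ≡ f y → x ≡ y) → card s ℕ.≤ k
  card-≤ s f inj = Fin.injective⇒≤ {f = f ∘ nth s} (λ e → nth-injective s (inj (nth∈ s _) (nth∈ s _) e))

  ≤-card : ∀ {n k} (s : Subset n) (f : Fin k → Fin n) → Injective _≡_ _≡_ f → (∀ i → f i ∈ s) → k ℕ.≤ card s
  ≤-card s f inj f∈ = Fin.injective⇒≤ {f = λ i → rank (f∈ i)} (λ e → inj (rank-injective (f∈ _) (f∈ _) e))

  ∈Part⇒ : ∀ {n r} (part : Fin n → Fin r) j {x} → x ∈ Part part j → part x ≡ j
  ∈Part⇒ part j {x} p with part x Fin.≟ j | trans (sym (Vec.lookup∘tabulate (λ x → ⌊ part x Fin.≟ j ⌋) x)) (Vec.[]=⇒lookup p)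
  ... | yes e | _ = e
  ... | no _ | ()

  ⇒∈Part : ∀ {n r} (part : Fin n → Fin r) j {x} → part x ≡ j → x ∈ Part part j
  ⇒∈Part part j {x} e = Vec.lookup⇒[]= x _ (trans (Vec.lookup∘tabulate (λ x → ⌊ part x Fin.≟ j ⌋) x) (trans (isYes≗does (part x Fin.≟ j)) (dec-true (part x Fin.≟ j) e)))

  three : ∀ {n} → Fin n → Fin n → Fin n → Subset n
  three u v w = ⁅ u ⁆ ∪ (⁅ v ⁆ ∪ ⁅ w ⁆)

  module _ {n : ℕ} {u v w : Fin n} where
    three⁻ : ∀ {x} → x ∈ three u v w → x ≡ u ⊎ (x ≡ v ⊎ x ≡ w)
    three⁻ p with x∈p∪q⁻ ⁅ u ⁆ (⁅ v ⁆ ∪ ⁅ w ⁆) p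
    ... | inj₁ q = inj₁ (x∈⁅y⁆⇒x≡y u q)
    ... | inj₂ q with x∈p∪q⁻ ⁅ v ⁆ ⁅ w ⁆ q
    ...   | inj₁ q′ = inj₂ (inj₁ (x∈⁅y⁆⇒x≡y v q′))
    ...   | inj₂ q′ = inj₂ (inj₂ (x∈⁅y⁆⇒x≡y w q′))

    three₁ : u ∈ three u v w
    three₁ = x∈p∪q⁺ (inj₁ (x∈⁅x⁆ u))
    three₂ : v ∈ three u v w
    three₂ = x∈p∪q⁺ (inj₂ (x∈p∪q⁺ (inj₁ (x∈⁅x⁆ v))))
    three₃ : w ∈ three u v w
    three₃ = x∈p∪q⁺ (inj₂ (x∈p∪q⁺ (inj₂ (x∈⁅x⁆ w))))

    card-three : u ≢ v → u ≢ w → v ≢ w → card (three u v w) ≡ 3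
    card-three u≢v u≢w v≢w = ℕ.≤-antisym (card-≤ (three u v w) f f-inj) (≤-card (three u v w) g g-inj g∈)
      where
      g : Fin 3 → Fin n
      g 0F = u
      g 1F = v
      g 2F = w
      g-inj : Injective _≡_ _≡_ g
      g-inj {0F} {0F} _ = refl
      g-inj {0F} {1F} e = ⊥-elim (u≢v e)
      g-inj {0F} {2F} e = ⊥-elim (u≢w e)
      g-inj {1F} {0F} e = ⊥-elim (u≢v (sym e))
      g-inj {1F} {1F} _ = refl
      g-inj {1F} {2F} e = ⊥-elim (v≢w e)
      g-inj {2F} {0F} e = ⊥-elim (u≢w (sym e))
      g-inj {2F} {1F} e = ⊥-elim (v≢w (sym e))
      g-inj {2F} {2F} _ = refl
      g∈ : ∀ i → g i ∈ three u v w
      g∈ 0F = three₁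
      g∈ 1F = three₂
      g∈ 2F = three₃
      f : Fin n → Fin 3
      f x with x Fin.≟ u | x Fin.≟ v
      ... | yes _ | _ = 0F
      ... | no _ | yes _ = 1F
      ... | no _ | no _ = 2F
      gf : ∀ {x} → x ∈ three u v w → g (f x) ≡ x
      gf {x} p with x Fin.≟ u | x Fin.≟ v | three⁻ p
      ... | yes e | _ | _ = sym e
      ... | no _ | yes e | _ = sym e
      ... | no ¬u | no _ | inj₁ e = ⊥-elim (¬u e)
      ... | no _ | no ¬v | inj₂ (inj₁ e) = ⊥-elim (¬v e)
      ... | no _ | no _ | inj₂ (inj₂ e) = sym e
      f-inj : ∀ {x y} → x ∈ three u v w → y ∈ three u v w → f x ≡ f y → x ≡ y
      f-inj p q e = trans (sym (gf p)) (trans (cong g e) (gf q))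

-- The hypergraph over a prime p ≥ r

module UpperBound where

  open Subsets
  open import Data.Nat as ℕ using (ℕ; zero; suc; NonZero)
  import Data.Nat.Properties as ℕ
  import Data.Nat.Divisibility as ℕ using (_∣_; >⇒∤)
  open import Data.Nat.Primality using (Prime; prime⇒nonZero; euclidsLemma)
  open import Data.Integer as ℤ using (ℤ; +_; _+_; _*_; _-_; -_) renaming (∣_∣ to abs)
  import Data.Integer.Properties as ℤ
  open import Data.Integer.DivMod using (_%ℕ_; _/ℕ_; n%ℕd<d; a≡a%ℕn+[a/ℕn]*n)
  open import Data.Integer.Divisibility.Signed using (_∣_; divides; ∣m∣n⇒∣m+n; ∣m∣n⇒∣m-n; ∣⇒∣ᵤ; ∣ᵤ⇒∣; ∣m⇒∣-m)
  open import Data.Integer.Tactic.RingSolver using (solve-∀)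
  open import Data.Fin as Fin using (Fin; toℕ; fromℕ<; combine; remQuot)
  import Data.Fin.Properties as Fin
  open import Data.Fin.Patterns using (0F; 1F; 2F; 3F)
  open import Data.Fin.Subset using (Subset; _∈_; _∩_; _⊆_; ⁅_⁆) renaming (∣_∣ to card)
  open import Data.Fin.Subset.Properties using (x∈⁅x⁆; x∈⁅y⁆⇒x≡y; x∈p∩q⁺; x∈p∩q⁻; ⊆-antisym; ∣⁅x⁆∣≡1)
  import Data.Vec.Properties as Vec
  import Data.Bool.Properties as Bool
  open import Data.List using (List; map; filter; deduplicate; cartesianProduct; allFin; length; lookup)
  open import Data.List.Membership.Propositional renaming (_∈_ to _∈ₗ_)
  open import Data.List.Membership.Propositional.Properties using (∈-deduplicate⁺; ∈-deduplicate⁻; ∈-filter⁺; ∈-filter⁻; ∈-map⁺; ∈-map⁻; ∈-cartesianProduct⁺; ∈-allFin; ∈-lookup)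
  import Data.List.Relation.Unary.All as All
  open import Data.List.Relation.Unary.Unique.Propositional using (Unique)
  open import Data.List.Relation.Unary.Unique.DecPropositional.Properties using (deduplicate-!)
  open import Data.Product using (∃; _×_; _,_; proj₁; proj₂)
  open import Data.Sum using (_⊎_; inj₁; inj₂)
  open import Data.Empty using (⊥; ⊥-elim)
  open import Function using (_∘_)
  open import Relation.Nullary using (¬_; Dec; yes; no)
  open import Relation.Binary.PropositionalEquality

  module Construction (r p : ℕ) (pp : Prime p) (r≤p : r ℕ.≤ p) (3≤p : 3 ℕ.≤ p) where

    private
      instance
        p≢0 : NonZero p
        p≢0 = prime⇒nonZero pp

      P : ℤ
      P = + p

      res : ℤ → Fin p
      res a = fromℕ< (n%ℕd<d a p)

      val : Fin p → ℤ
      val a = + toℕ a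

      val-res : ∀ a → P ∣ a - val (res a)
      val-res a = divides (a /ℕ p) (trans (cong₂ _-_ (a≡a%ℕn+[a/ℕn]*n a p) (cong +_ (Fin.toℕ-fromℕ< (n%ℕd<d a p)))) (lem (+ (a %ℕ p)) (a /ℕ p * P)))
        where
        lem : ∀ a b → a + b - a ≡ b
        lem = solve-∀

      P∣⇒ : ∀ {a} → P ∣ a → abs a ℕ.< p → a ≡ + 0
      P∣⇒ {a} d lt with abs a in eq
      ... | zero = ℤ.∣i∣≡0⇒i≡0 eq
      ... | suc k = ⊥-elim (ℕ.>⇒∤ lt (subst (p ℕ.∣_) eq (∣⇒∣ᵤ d)))

      small : ∀ {m n} → m ℕ.< p → n ℕ.< p → P ∣ + m - + n → m ≡ n
      small {m} {n} m<p n<p d = ℤ.+-injective (ℤ.i-j≡0⇒i≡j (+ m) (+ n) (P∣⇒ d (ℕ.≤-<-trans (ℕ.≤-trans (ℕ.≤-reflexive (cong abs (ℤ.m-n≡m⊖n m n))) (ℤ.∣m⊝n∣≤m⊔n m n)) (ℕ.⊔-lub m<p n<p))))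

      prime-∣ : ∀ a b → P ∣ a * b → (P ∣ a) ⊎ (P ∣ b)
      prime-∣ a b d with euclidsLemma (abs a) (abs b) pp (subst (p ℕ.∣_) (ℤ.abs-* a b) (∣⇒∣ᵤ d))
      ... | inj₁ q = inj₁ (∣ᵤ⇒∣ q)
      ... | inj₂ q = inj₂ (∣ᵤ⇒∣ q)

    V : ℕ
    V = r ℕ.* p

    part : Fin V → Fin r
    part v = proj₁ (remQuot p v)

    private
      X : Fin r → ℤ
      X x = + toℕ x

      Y : Fin V → ℤ
      Y v = val (proj₂ (remQuot {r} p v))

      -- The first coordinates are the part numbers, residues below r ≤ p; this is the use of r ≤ p.
      X-injective : ∀ {x y} → P ∣ X x - X y → x ≡ y
      X-injective {x} {y} d = Fin.toℕ-injective (small (ℕ.<-≤-trans (Fin.toℕ<n x) r≤p) (ℕ.<-≤-trans (Fin.toℕ<n y) r≤p) d)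

      vertex-≡ : ∀ {u v} → part u ≡ part v → P ∣ Y u - Y v → u ≡ v
      vertex-≡ {u} {v} e d = trans (sym (Fin.combine-remQuot {r} p u)) (trans (cong₂ combine e (Fin.toℕ-injective (small (Fin.toℕ<n (proj₂ (remQuot {r} p u))) (Fin.toℕ<n (proj₂ (remQuot {r} p v))) d))) (Fin.combine-remQuot {r} p v))

    -- The polarity graph of the affine plane: C₄-free, and every edge lies in at most one triangle.
    Adj : Fin V → Fin V → Set
    Adj u v = part u ≢ part v × P ∣ Y u + Y v - + 2 * (X (part u) * X (part v))

    private
      Adj-sym : ∀ {u v} → Adj u v → Adj v u
      Adj-sym {u} {v} (ne , d) = (λ e → ne (sym e)) , subst (P ∣_) (lem (Y u) (Y v) (X (part u)) (X (part v))) d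
        where
        lem : ∀ a b x y → a + b - + 2 * (x * y) ≡ b + a - + 2 * (y * x)
        lem = solve-∀

      -- The second difference of the four adjacency relations cancels all second coordinates and
      -- leaves 2(x - x')(y - y') divisible by the odd prime p. Equal first coordinates on one side
      -- then force equal vertices on that side.
      common-neighbour : ∀ {u u' v v'} → u ≢ u' → Adj u v → Adj u' v → Adj u v' → Adj u' v' → v ≡ v'
      common-neighbour {u} {u'} {v} {v'} u≢u' (_ , d₁) (_ , d₂) (_ , d₃) (_ , d₄) = conclude (prime-∣ (+ 2) _ (subst (P ∣_) (lem (Y u) (Y u') (Y v) (Y v') x x' y y') (∣m∣n⇒∣m-n (∣m∣n⇒∣m-n d₂ d₁) (∣m∣n⇒∣m-n d₄ d₃))))
        where
        x = X (part u)
        x' = X (part u')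
        y = X (part v)
        y' = X (part v')
        lem : ∀ a a' b b' x x' y y' → ((a' + b - + 2 * (x' * y)) - (a + b - + 2 * (x * y))) - ((a' + b' - + 2 * (x' * y')) - (a + b' - + 2 * (x * y'))) ≡ + 2 * ((x - x') * (y - y'))
        lem = solve-∀
        same : part v ≡ part v' → v ≡ v'
        same e = vertex-≡ e (subst (P ∣_) (trans (cong (λ t → (Y u + Y v - + 2 * (x * X t)) - (Y u + Y v' - + 2 * (x * y'))) e) (l2 (Y u) (Y v) (Y v') x y')) (∣m∣n⇒∣m-n d₁ d₃))
          where
          l2 : ∀ a b b' x y → (a + b - + 2 * (x * y)) - (a + b' - + 2 * (x * y)) ≡ b - b'
          l2 = solve-∀
        same' : part u ≡ part u' → ⊥
        same' e = u≢u' (vertex-≡ e (subst (P ∣_) (trans (cong (λ t → (Y u + Y v - + 2 * (X t * y)) - (Y u' + Y v - + 2 * (x' * y))) e) (l2 (Y u) (Y u') (Y v) x' y)) (∣m∣n⇒∣m-n d₁ d₂)))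
          where
          l2 : ∀ a a' b x y → (a + b - + 2 * (x * y)) - (a' + b - + 2 * (x * y)) ≡ a - a'
          l2 = solve-∀
        conclude : (P ∣ + 2) ⊎ (P ∣ (x - x') * (y - y')) → v ≡ v'
        conclude (inj₁ d) = ⊥-elim (ℕ.>⇒∤ 3≤p (∣⇒∣ᵤ d))
        conclude (inj₂ d) with prime-∣ (x - x') (y - y') d
        ... | inj₁ d' = ⊥-elim (same' (X-injective d'))
        ... | inj₂ d' = same (X-injective d')

      opaque
        -- (x , xy + xz - yz) is the vertex over x of the triangle with first coordinates x, y, z.
        vertex : Fin r → Fin r → Fin r → Fin V
        vertex i j l = combine i (res (X i * X j + X i * X l - X j * X l))

        part-vertex : ∀ i j l → part (vertex i j l) ≡ i
        part-vertex i j l = cong proj₁ (Fin.remQuot-combine i (res (X i * X j + X i * X l - X j * X l)))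

        Y-vertex : ∀ i j l → P ∣ (X i * X j + X i * X l - X j * X l) - Y (vertex i j l)
        Y-vertex i j l = subst (λ t → P ∣ f - val t) (sym (cong proj₂ (Fin.remQuot-combine i (res f)))) (val-res f)
          where
          f : ℤ
          f = X i * X j + X i * X l - X j * X l

        vertex-sym : ∀ i j l → vertex i j l ≡ vertex i l j
        vertex-sym i j l = cong (λ t → combine i (res t)) (lem (X i) (X j) (X l))
          where
          lem : ∀ x y z → x * y + x * z - y * z ≡ x * z + x * y - z * y
          lem = solve-∀

      -- With f(x; y, z) = xy + xz - yz this is the identity f(x; y, z) + f(y; x, z) = 2xy.
      adj : ∀ {i j} l → i ≢ j → Adj (vertex i j l) (vertex j i l)
      adj {i} {j} l i≢j = (λ e → i≢j (trans (sym (part-vertex i j l)) (trans e (part-vertex j i l))))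
        , subst (P ∣_) (trans (lem (X i) (X j) (X l) (Y (vertex i j l)) (Y (vertex j i l))) (cong₂ (λ s t → Y (vertex i j l) + Y (vertex j i l) - + 2 * (X s * X t)) (sym (part-vertex i j l)) (sym (part-vertex j i l))))
          (∣m⇒∣-m (∣m∣n⇒∣m+n (Y-vertex i j l) (Y-vertex j i l)))
        where
        lem : ∀ x y z a b → - ((x * y + x * z - y * z - a) + (y * x + y * z - x * z - b)) ≡ a + b - + 2 * (x * y)
        lem = solve-∀

      edge : Fin r × Fin r × Fin r → Subset V
      edge (i , j , l) = three (vertex i j l) (vertex j i l) (vertex l i j)

      Distinct : Fin r × Fin r × Fin r → Set
      Distinct (i , j , l) = i ≢ j × i ≢ l × j ≢ l

      distinct? : ∀ t → Dec (Distinct t)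
      distinct? (i , j , l) with i Fin.≟ j | i Fin.≟ l | j Fin.≟ l
      ... | no a | no b | no c = yes (a , b , c)
      ... | yes e | _ | _ = no (λ (a , _ , _) → a e)
      ... | no _ | yes e | _ = no (λ (_ , b , _) → b e)
      ... | no _ | no _ | yes e = no (λ (_ , _ , c) → c e)

      triples : List (Fin r × Fin r × Fin r)
      triples = filter distinct? (cartesianProduct (allFin r) (cartesianProduct (allFin r) (allFin r)))

      _≟ₛ_ : (s t : Subset V) → Dec (s ≡ t)
      _≟ₛ_ = Vec.≡-dec Bool._≟_

      opaque
        -- The six orderings of a triple of parts give the same set, hence the deduplication.
        edgeList : List (Subset V)
        edgeList = deduplicate _≟ₛ_ (map edge triples)

        edge∈ : ∀ t → Distinct t → edge t ∈ₗ edgeList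
        edge∈ t@(i , j , l) d = ∈-deduplicate⁺ _≟ₛ_ (∈-map⁺ edge (∈-filter⁺ distinct? (∈-cartesianProduct⁺ (∈-allFin i) (∈-cartesianProduct⁺ (∈-allFin j) (∈-allFin l))) d))

        edge∈⁻ : ∀ {e} → e ∈ₗ edgeList → ∃ λ t → Distinct t × e ≡ edge t
        edge∈⁻ {e} p = conclude (∈-map⁻ edge (∈-deduplicate⁻ _≟ₛ_ (map edge triples) p))
          where
          conclude : (∃ λ t → t ∈ₗ triples × e ≡ edge t) → ∃ λ t → Distinct t × e ≡ edge t
          conclude (t , t∈ , eq) = t , proj₂ (∈-filter⁻ distinct? {xs = cartesianProduct (allFin r) (cartesianProduct (allFin r) (allFin r))} t∈) , eq

        edgeList-unique : Unique edgeList
        edgeList-unique = deduplicate-! _≟ₛ_ (map edge triples)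

      vertex-≢ : ∀ {i j l i' j' l'} → i ≢ i' → vertex i j l ≢ vertex i' j' l'
      vertex-≢ i≢ e = i≢ (trans (sym (part-vertex _ _ _)) (trans (cong part e) (part-vertex _ _ _)))

      card-edge : ∀ t → Distinct t → card (edge t) ≡ 3
      card-edge (i , j , l) (a , b , c) = card-three (vertex-≢ a) (vertex-≢ b) (vertex-≢ c)

    G : Hypergraph3 V
    G = record
      { edges = edgeList
      ; uniform = All.tabulate (λ p → let t , d , eq = edge∈⁻ p in trans (cong card eq) (card-edge t d))
      ; distinct = edgeList-unique
      }

    private
      clique : ∀ t → Distinct t → ∀ {u v} → u ∈ edge t → v ∈ edge t → u ≢ v → Adj u v
      clique (i , j , l) (a , b , c) {u} {v} p q u≢v with three⁻ p | three⁻ q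
      ... | inj₁ refl | inj₁ refl = ⊥-elim (u≢v refl)
      ... | inj₁ refl | inj₂ (inj₁ refl) = adj l a
      ... | inj₁ refl | inj₂ (inj₂ refl) = subst (λ w → Adj w (vertex l i j)) (vertex-sym i l j) (adj j b)
      ... | inj₂ (inj₁ refl) | inj₁ refl = Adj-sym (adj l a)
      ... | inj₂ (inj₁ refl) | inj₂ (inj₁ refl) = ⊥-elim (u≢v refl)
      ... | inj₂ (inj₁ refl) | inj₂ (inj₂ refl) = subst₂ Adj (vertex-sym j l i) (vertex-sym l j i) (adj i c)
      ... | inj₂ (inj₂ refl) | inj₁ refl = Adj-sym (subst (λ w → Adj w (vertex l i j)) (vertex-sym i l j) (adj j b))
      ... | inj₂ (inj₂ refl) | inj₂ (inj₁ refl) = Adj-sym (subst₂ Adj (vertex-sym j l i) (vertex-sym l j i) (adj i c))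
      ... | inj₂ (inj₂ refl) | inj₂ (inj₂ refl) = ⊥-elim (u≢v refl)

      third : ∀ t → Distinct t → ∀ {u v} → u ∈ edge t → v ∈ edge t → ∃ λ w → w ∈ edge t × w ≢ u × w ≢ v
      third (i , j , l) (a , b , c) p q with three⁻ p | three⁻ q
      ... | inj₁ refl | inj₁ refl = _ , three₂ , vertex-≢ (a ∘ sym) , vertex-≢ (a ∘ sym)
      ... | inj₁ refl | inj₂ (inj₁ refl) = _ , three₃ , vertex-≢ (b ∘ sym) , vertex-≢ (c ∘ sym)
      ... | inj₁ refl | inj₂ (inj₂ refl) = _ , three₂ , vertex-≢ (a ∘ sym) , vertex-≢ c
      ... | inj₂ (inj₁ refl) | inj₁ refl = _ , three₃ , vertex-≢ (c ∘ sym) , vertex-≢ (b ∘ sym)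
      ... | inj₂ (inj₁ refl) | inj₂ (inj₁ refl) = _ , three₁ , vertex-≢ a , vertex-≢ a
      ... | inj₂ (inj₁ refl) | inj₂ (inj₂ refl) = _ , three₁ , vertex-≢ a , vertex-≢ b
      ... | inj₂ (inj₂ refl) | inj₁ refl = _ , three₂ , vertex-≢ c , vertex-≢ (a ∘ sym)
      ... | inj₂ (inj₂ refl) | inj₂ (inj₁ refl) = _ , three₁ , vertex-≢ b , vertex-≢ a
      ... | inj₂ (inj₂ refl) | inj₂ (inj₂ refl) = _ , three₁ , vertex-≢ b , vertex-≢ b

      module _ {e : Subset V} (e∈ : e ∈ₗ edgeList) where
        private
          t = proj₁ (edge∈⁻ e∈)
          d = proj₁ (proj₂ (edge∈⁻ e∈))
          eq = proj₂ (proj₂ (edge∈⁻ e∈))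

        edge-adj : ∀ {u v} → u ∈ e → v ∈ e → u ≢ v → Adj u v
        edge-adj {u} {v} p q = clique t d (subst (u ∈_) eq p) (subst (v ∈_) eq q)

        edge-third : ∀ {u v} → u ∈ e → v ∈ e → ∃ λ w → w ∈ e × w ≢ u × w ≢ v
        edge-third {u} {v} p q = conclude (third t d (subst (u ∈_) eq p) (subst (v ∈_) eq q))
          where
          conclude : (∃ λ w → w ∈ edge t × w ≢ u × w ≢ v) → ∃ λ w → w ∈ e × w ≢ u × w ≢ v
          conclude (w , w∈ , a , b) = w , subst (w ∈_) (sym eq) w∈ , a , b

        -- Both the third vertex of e and w are common neighbours of u and v.
        closed : ∀ {u v w} → u ∈ e → v ∈ e → u ≢ v → Adj u w → Adj v w → w ∈ e
        closed {u} {v} {w} p q u≢v a b = conclude (edge-third p q)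
          where
          conclude : (∃ λ w' → w' ∈ e × w' ≢ u × w' ≢ v) → w ∈ e
          conclude (w' , w'∈ , w'≢u , w'≢v) = subst (_∈ e) (common-neighbour u≢v (edge-adj p w'∈ (w'≢u ∘ sym)) (edge-adj q w'∈ (w'≢v ∘ sym)) a b) w'∈

      edge-⊆ : ∀ {e e'} → e ∈ₗ edgeList → e' ∈ₗ edgeList → ∀ {u v} → u ≢ v → u ∈ e → v ∈ e → u ∈ e' → v ∈ e' → e ⊆ e'
      edge-⊆ {e} {e'} e∈ e'∈ {u} {v} u≢v p q p' q' {w} w∈ with w Fin.≟ u | w Fin.≟ v
      ... | yes refl | _ = p'
      ... | no _ | yes refl = q'
      ... | no w≢u | no w≢v = closed e'∈ p' q' u≢v (edge-adj e∈ p w∈ (w≢u ∘ sym)) (edge-adj e∈ q w∈ (w≢v ∘ sym))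

      E : Fin (length edgeList) → Subset V
      E = lookup edgeList

      E-linear : ∀ {a b u v} → u ≢ v → u ∈ E a → v ∈ E a → u ∈ E b → v ∈ E b → a ≡ b
      E-linear {a} {b} ne p q p' q' = lookup-injective (edgeList-unique) a b (⊆-antisym (edge-⊆ (∈-lookup a) (∈-lookup b) ne p q p' q') (edge-⊆ (∈-lookup b) (∈-lookup a) ne p' q' p q))

    no-C₂ : ¬ ContainsBergeCycle 2 G
    no-C₂ (v , e , v-inj , e-inj , inc) with e-inj (E-linear {e 0F} {e 1F} (λ eq → 0≢1 (v-inj eq)) (proj₁ (inc 0F)) (proj₂ (inc 0F)) (proj₂ (inc 1F)) (proj₁ (inc 1F)))
      where
      0≢1 : 0F ≢ 1F
      0≢1 ()
    ... | ()

    -- The third vertex of the cycle is adjacent to both others, so it lies in the edge through them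
    -- (`closed`). That edge then shares two vertices with the next one.
    no-C₃ : ¬ ContainsBergeCycle 3 G
    no-C₃ (v , e , v-inj , e-inj , inc) = ⊥-elim (0≢1 (e-inj (E-linear {e 0F} {e 1F} v₁≢v₂ (proj₂ (inc 0F)) v₂∈ (proj₁ (inc 1F)) (proj₂ (inc 1F)))))
      where
      0≢1 : 0F ≢ 1F
      0≢1 ()
      v₁≢v₂ : v 1F ≢ v 2F
      v₁≢v₂ eq with () ← v-inj eq
      v₀≢v₁ : v 0F ≢ v 1F
      v₀≢v₁ eq with () ← v-inj eq
      v₂≢v₀ : v 2F ≢ v 0F
      v₂≢v₀ eq with () ← v-inj eq
      v₂∈ : v 2F ∈ E (e 0F)
      v₂∈ = closed (∈-lookup (e 0F)) (proj₁ (inc 0F)) (proj₂ (inc 0F)) v₀≢v₁ (Adj-sym (edge-adj (∈-lookup (e 2F)) (proj₁ (inc 2F)) (proj₂ (inc 2F)) v₂≢v₀)) (edge-adj (∈-lookup (e 1F)) (proj₁ (inc 1F)) (proj₂ (inc 1F)) v₁≢v₂)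

    -- Opposite vertices v₁ and v₃ would be two common neighbours of v₀ and v₂.
    no-C₄ : ¬ ContainsBergeCycle 4 G
    no-C₄ (v , e , v-inj , e-inj , inc) = v₁≢v₃ (common-neighbour v₀≢v₂ (a 0F v₀≢v₁) (Adj-sym (a 1F v₁≢v₂)) (Adj-sym (a 3F v₃≢v₀)) (a 2F v₂≢v₃))
      where
      a : ∀ i → v i ≢ v (next 4 i) → Adj (v i) (v (next 4 i))
      a i = edge-adj (∈-lookup (e i)) (proj₁ (inc i)) (proj₂ (inc i))
      v₁≢v₃ : v 1F ≢ v 3F
      v₁≢v₃ eq with () ← v-inj eq
      v₀≢v₂ : v 0F ≢ v 2F
      v₀≢v₂ eq with () ← v-inj eq
      v₀≢v₁ : v 0F ≢ v 1F
      v₀≢v₁ eq with () ← v-inj eq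
      v₁≢v₂ : v 1F ≢ v 2F
      v₁≢v₂ eq with () ← v-inj eq
      v₂≢v₃ : v 2F ≢ v 3F
      v₂≢v₃ eq with () ← v-inj eq
      v₃≢v₀ : v 3F ≢ v 0F
      v₃≢v₀ eq with () ← v-inj eq

    card-Part : ∀ j → card (Part part j) ℕ.≤ p
    card-Part j = card-≤ (Part part j) (λ v → proj₂ (remQuot {r} p v)) (λ {u} {v} a b e → trans (sym (Fin.combine-remQuot {r} p u)) (trans (cong₂ combine (trans (∈Part⇒ part j a) (sym (∈Part⇒ part j b))) e) (Fin.combine-remQuot {r} p v)))

    private
      card-∩ : ∀ {e : Subset V} j u → u ∈ e → part u ≡ j → (∀ {w} → w ∈ e → part w ≡ j → w ≡ u) → card (e ∩ Part part j) ≡ 1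
      card-∩ {e} j u u∈ pu only = trans (cong card (⊆-antisym fwd bwd)) (∣⁅x⁆∣≡1 u)
        where
        fwd : e ∩ Part part j ⊆ ⁅ u ⁆
        fwd {w} w∈ = subst (_∈ ⁅ u ⁆) (sym (only (proj₁ (x∈p∩q⁻ e (Part part j) w∈)) (∈Part⇒ part j (proj₂ (x∈p∩q⁻ e (Part part j) w∈))))) (x∈⁅x⁆ u)
        bwd : ⁅ u ⁆ ⊆ e ∩ Part part j
        bwd {w} w∈ with x∈⁅y⁆⇒x≡y u w∈
        ... | refl = x∈p∩q⁺ (u∈ , ⇒∈Part part j pu)

    is-rk : IsRKHypergraph r p G
    is-rk = part , card-Part , λ i j l a b c → edge (i , j , l) , edge∈ (i , j , l) (a , b , c)
      , card-∩ i (vertex i j l) three₁ (part-vertex i j l) (λ w∈ pw → only₁ a b w∈ pw)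
      , card-∩ j (vertex j i l) three₂ (part-vertex j i l) (λ w∈ pw → only₂ a c w∈ pw)
      , card-∩ l (vertex l i j) three₃ (part-vertex l i j) (λ w∈ pw → only₃ b c w∈ pw)
      where
      only₁ : ∀ {i j l} → i ≢ j → i ≢ l → ∀ {w} → w ∈ edge (i , j , l) → part w ≡ i → w ≡ vertex i j l
      only₁ {i} {j} {l} a b w∈ pw with three⁻ w∈
      ... | inj₁ e = e
      ... | inj₂ (inj₁ refl) = ⊥-elim (a (trans (sym pw) (part-vertex j i l)))
      ... | inj₂ (inj₂ refl) = ⊥-elim (b (trans (sym pw) (part-vertex l i j)))
      only₂ : ∀ {i j l} → i ≢ j → j ≢ l → ∀ {w} → w ∈ edge (i , j , l) → part w ≡ j → w ≡ vertex j i l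
      only₂ {i} {j} {l} a c w∈ pw with three⁻ w∈
      ... | inj₁ refl = ⊥-elim (a (trans (sym (part-vertex i j l)) pw))
      ... | inj₂ (inj₁ e) = e
      ... | inj₂ (inj₂ refl) = ⊥-elim (c (trans (sym pw) (part-vertex l i j)))
      only₃ : ∀ {i j l} → i ≢ l → j ≢ l → ∀ {w} → w ∈ edge (i , j , l) → part w ≡ l → w ≡ vertex l i j
      only₃ {i} {j} {l} b c w∈ pw with three⁻ w∈
      ... | inj₁ refl = ⊥-elim (b (trans (sym (part-vertex i j l)) pw))
      ... | inj₂ (inj₁ refl) = ⊥-elim (c (trans (sym (part-vertex j i l)) pw))
      ... | inj₂ (inj₂ e) = e

    good : Good r p
    good = V , G , is-rk , no-C₂ , no-C₃ , no-C₄

-- Counting paths of length two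

module LowerBound where

  open Subsets
  open import Data.Nat as ℕ using (ℕ; zero; suc; _+_; _*_; _≤_; _<_; s≤s; z≤n)
  import Data.Nat.Properties as ℕ
  open import Data.Nat.Tactic.RingSolver using (solve-∀)
  open import Data.Fin as Fin using (Fin; combine; remQuot)
  import Data.Fin.Properties as Fin
  open import Data.Fin.Patterns using (0F; 1F; 2F; 3F)
  open import Data.Fin.Subset using (Subset; _∈_; _∩_) renaming (∣_∣ to card)
  open import Data.Fin.Subset.Properties using (x∈p∩q⁻)
  open import Data.Vec using (tabulate)
  open import Data.List using (length; lookup)
  open import Data.List.Membership.Propositional renaming (_∈_ to _∈ₗ_)
  open import Data.List.Membership.Propositional.Properties using (∈-lookup)
  import Data.List.Relation.Unary.Any as Any
  import Data.List.Relation.Unary.Any.Properties as Any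
  import Data.List.Relation.Unary.All as All
  open import Data.Product using (∃; _×_; _,_; proj₁; proj₂)
  open import Data.Sum using (_⊎_; inj₁; inj₂)
  open import Data.Empty using (⊥; ⊥-elim)
  open import Function.Definitions using (Injective)
  open import Relation.Nullary using (¬_; Dec; yes; no)
  open import Relation.Nullary.Decidable using (⌊_⌋; _×-dec_; ¬?)
  open import Relation.Binary.PropositionalEquality

  ∑ : ∀ {n} → (Fin n → ℕ) → ℕ
  ∑ {zero} f = 0
  ∑ {suc n} f = f Fin.zero + ∑ (λ i → f (Fin.suc i))

  ∑-mono : ∀ {n} {f g : Fin n → ℕ} → (∀ i → f i ≤ g i) → ∑ f ≤ ∑ g
  ∑-mono {zero} h = z≤n
  ∑-mono {suc n} h = ℕ.+-mono-≤ (h Fin.zero) (∑-mono (λ i → h (Fin.suc i)))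

  ∑-cong : ∀ {n} {f g : Fin n → ℕ} → (∀ i → f i ≡ g i) → ∑ f ≡ ∑ g
  ∑-cong {zero} h = refl
  ∑-cong {suc n} h = cong₂ _+_ (h Fin.zero) (∑-cong (λ i → h (Fin.suc i)))

  ∑-+ : ∀ {n} (f g : Fin n → ℕ) → ∑ (λ i → f i + g i) ≡ ∑ f + ∑ g
  ∑-+ {zero} f g = refl
  ∑-+ {suc n} f g = trans (cong (f Fin.zero + g Fin.zero +_) (∑-+ (λ i → f (Fin.suc i)) (λ i → g (Fin.suc i)))) (lem (f Fin.zero) (g Fin.zero) (∑ (λ i → f (Fin.suc i))) (∑ (λ i → g (Fin.suc i))))
    where
    lem : ∀ a b c d → a + b + (c + d) ≡ a + c + (b + d)
    lem = solve-∀

  ∑-*ˡ : ∀ {n} c (f : Fin n → ℕ) → ∑ (λ i → c * f i) ≡ c * ∑ f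
  ∑-*ˡ {zero} c f = sym (ℕ.*-zeroʳ c)
  ∑-*ˡ {suc n} c f = trans (cong (c * f Fin.zero +_) (∑-*ˡ c (λ i → f (Fin.suc i)))) (sym (ℕ.*-distribˡ-+ c (f Fin.zero) (∑ (λ i → f (Fin.suc i)))))

  ∑-const : ∀ n c → ∑ {n} (λ _ → c) ≡ n * c
  ∑-const zero c = refl
  ∑-const (suc n) c = cong (c +_) (∑-const n c)

  ∑-swap : ∀ {m n} (f : Fin m → Fin n → ℕ) → ∑ (λ i → ∑ (f i)) ≡ ∑ (λ j → ∑ (λ i → f i j))
  ∑-swap {zero} {n} f = sym (trans (∑-const n 0) (ℕ.*-zeroʳ n))
  ∑-swap {suc m} f = trans (cong (∑ (f Fin.zero) +_) (∑-swap (λ i → f (Fin.suc i)))) (sym (∑-+ (f Fin.zero) (λ j → ∑ (λ i → f (Fin.suc i) j))))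

  ∑-pos : ∀ {n} (f : Fin n → ℕ) → 1 ≤ ∑ f → ∃ λ i → 1 ≤ f i
  ∑-pos {suc n} f h with f Fin.zero in eq
  ... | suc _ = Fin.zero , subst (1 ≤_) (sym eq) (s≤s z≤n)
  ... | zero with ∑-pos (λ i → f (Fin.suc i)) h
  ...   | i , p = Fin.suc i , p

  ∑-at-most-one : ∀ {n} (f : Fin n → ℕ) → (∀ i → f i ≤ 1) → (∀ i j → 1 ≤ f i → 1 ≤ f j → i ≡ j) → ∑ f ≤ 1
  ∑-at-most-one {zero} f _ _ = z≤n
  ∑-at-most-one {suc n} f f≤1 unique with f Fin.zero in eq
  ... | zero = ∑-at-most-one (λ i → f (Fin.suc i)) (λ i → f≤1 (Fin.suc i)) (λ i j p q → Fin.suc-injective (unique _ _ p q))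
  ... | suc k = subst (_≤ 1) (cong (_+ ∑ (λ i → f (Fin.suc i))) eq) (ℕ.≤-trans (ℕ.≤-reflexive (trans (cong (f Fin.zero +_) tail0) (ℕ.+-identityʳ (f Fin.zero)))) (f≤1 Fin.zero))
    where
    tail0 : ∑ (λ i → f (Fin.suc i)) ≡ 0
    tail0 with ∑ (λ i → f (Fin.suc i)) in e
    ... | zero = refl
    ... | suc _ with ∑-pos (λ i → f (Fin.suc i)) (subst (1 ≤_) (sym e) (s≤s z≤n))
    ...   | i , p with () ← unique Fin.zero (Fin.suc i) (subst (1 ≤_) (sym eq) (s≤s z≤n)) p

  𝟏 : ∀ {P : Set} → Dec P → ℕ
  𝟏 (yes _) = 1
  𝟏 (no _) = 0

  𝟏≤1 : ∀ {P : Set} (d : Dec P) → 𝟏 d ≤ 1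
  𝟏≤1 (yes _) = ℕ.≤-refl
  𝟏≤1 (no _) = z≤n

  𝟏-yes : ∀ {P : Set} (d : Dec P) → P → 𝟏 d ≡ 1
  𝟏-yes (yes _) _ = refl
  𝟏-yes (no ¬p) p = ⊥-elim (¬p p)

  𝟏-mono : ∀ {P Q : Set} (d : Dec P) (e : Dec Q) → (P → Q) → 𝟏 d ≤ 𝟏 e
  𝟏-mono (yes p) e f = ℕ.≤-reflexive (sym (𝟏-yes e (f p)))
  𝟏-mono (no _) e f = z≤n

  ∑-𝟏-≟ : ∀ {n} (j : Fin n) → 1 ≤ ∑ (λ i → 𝟏 (j Fin.≟ i))
  ∑-𝟏-≟ {suc n} Fin.zero = s≤s z≤n
  ∑-𝟏-≟ {suc n} (Fin.suc j) = ℕ.≤-trans (∑-𝟏-≟ j) (∑-mono (λ i → shift i))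
    where
    shift : ∀ i → 𝟏 (j Fin.≟ i) ≤ 𝟏 (Fin.suc j Fin.≟ Fin.suc i)
    shift i = 𝟏-mono (j Fin.≟ i) (Fin.suc j Fin.≟ Fin.suc i) (cong Fin.suc)

  -- Double counting of the graph of `g`: a pair satisfying P meets one value z, and a value z is
  -- met by at most one such pair.
  count₂-≤ : ∀ {a b m} {P : Fin a → Fin b → Set} (P? : ∀ x y → Dec (P x y)) (g : Fin a → Fin b → Fin m) →
    (∀ x y x' y' → P x y → P x' y' → g x y ≡ g x' y' → x ≡ x' × y ≡ y') → ∑ (λ x → ∑ (λ y → 𝟏 (P? x y))) ≤ m
  count₂-≤ {a} {b} {m} {P} P? g inj = ℕ.≤-trans (∑-mono (λ x → ∑-mono (λ y → spread x y))) (ℕ.≤-trans (ℕ.≤-reflexive (trans (∑-cong (λ x → ∑-swap (λ y z → R x y z))) (∑-swap (λ x z → ∑ (λ y → R x y z)))))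
      (ℕ.≤-trans (∑-mono one) (ℕ.≤-reflexive (trans (∑-const m 1) (ℕ.*-identityʳ m)))))
    where
    R : Fin a → Fin b → Fin m → ℕ
    R x y z = 𝟏 (P? x y) * 𝟏 (g x y Fin.≟ z)
    R⇒ : ∀ {x y z} → 1 ≤ R x y z → P x y × g x y ≡ z
    R⇒ {x} {y} {z} h with P? x y | g x y Fin.≟ z
    ... | yes p | yes e = p , e
    ... | yes _ | no _ with () ← h
    R⇒ h | no _ | _ with () ← h
    spread : ∀ x y → 𝟏 (P? x y) ≤ ∑ (λ z → R x y z)
    spread x y = ℕ.≤-trans (ℕ.≤-trans (ℕ.≤-reflexive (sym (ℕ.*-identityʳ _))) (ℕ.*-monoʳ-≤ (𝟏 (P? x y)) (∑-𝟏-≟ (g x y)))) (ℕ.≤-reflexive (sym (∑-*ˡ (𝟏 (P? x y)) (λ z → 𝟏 (g x y Fin.≟ z)))))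
    one : ∀ z → ∑ (λ x → ∑ (λ y → R x y z)) ≤ 1
    one z = ∑-at-most-one _ (λ x → ∑-at-most-one _ (λ y → ℕ.*-mono-≤ (𝟏≤1 (P? x y)) (𝟏≤1 (g x y Fin.≟ z))) (λ y y' h h' → proj₂ (both h h')))
        (λ x x' h h' → let y , p = ∑-pos (λ y → R x y z) h ; y' , p' = ∑-pos (λ y → R x' y z) h' in proj₁ (both p p'))
      where
      both : ∀ {x x' y y'} → 1 ≤ R x y z → 1 ≤ R x' y' z → x ≡ x' × y ≡ y'
      both h h' = let p , e = R⇒ h ; p' , e' = R⇒ h' in inj _ _ _ _ p p' (trans e (sym e'))

  count-≤ : ∀ {a m} {P : Fin a → Set} (P? : ∀ x → Dec (P x)) (g : Fin a → Fin m) → (∀ x x' → P x → P x' → g x ≡ g x' → x ≡ x') → ∑ (λ x → 𝟏 (P? x)) ≤ m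
  count-≤ {a} P? g inj = ℕ.≤-trans (∑-mono {a} {λ x → 𝟏 (P? x)} {λ x → 𝟏 (P? x) + 0} (λ x → ℕ.≤-reflexive (sym (ℕ.+-identityʳ (𝟏 (P? x)))))) (count₂-≤ {b = 1} (λ x _ → P? x) (λ x _ → g x) (λ { x 0F x' 0F p p' e → inj x x' p p' e , refl }))

  card-tabulate : ∀ {n} {P : Fin n → Set} (P? : ∀ x → Dec (P x)) → card (tabulate (λ x → ⌊ P? x ⌋)) ≡ ∑ (λ x → 𝟏 (P? x))
  card-tabulate {zero} P? = refl
  card-tabulate {suc n} P? with P? Fin.zero
  ... | yes _ = cong suc (card-tabulate (λ x → P? (Fin.suc x)))
  ... | no _ = card-tabulate (λ x → P? (Fin.suc x))

  vertices-≤ : ∀ {n r k} (part : Fin n → Fin r) → (∀ j → card (Part part j) ≤ k) → n ≤ r * k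
  vertices-≤ {n} {r} {k} part small = ℕ.≤-trans (ℕ.≤-trans (ℕ.≤-reflexive (trans (sym (ℕ.*-identityʳ n)) (sym (∑-const n 1)))) (∑-mono (λ v → ∑-𝟏-≟ (part v))))
    (ℕ.≤-trans (ℕ.≤-reflexive (∑-swap (λ v j → 𝟏 (part v Fin.≟ j)))) (ℕ.≤-trans (∑-mono (λ j → ℕ.≤-trans (ℕ.≤-reflexive (sym (card-tabulate (λ v → part v Fin.≟ j)))) (small j))) (ℕ.≤-reflexive (∑-const r k))))

  nonempty : ∀ {n} (s : Subset n) → card s ≡ 1 → ∃ λ x → x ∈ s
  nonempty s e = nth s i , nth∈ s i
    where
    i = subst Fin (sym e) Fin.zero

  only-three : ∀ {n} (s : Subset n) → card s ≡ 3 → ∀ {u v w x} → u ∈ s → v ∈ s → w ∈ s → x ∈ s → u ≢ v → u ≢ w → v ≢ w → x ≡ u ⊎ (x ≡ v ⊎ x ≡ w)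
  only-three {n} s e {u} {v} {w} {x} u∈ v∈ w∈ x∈ u≢v u≢w v≢w with x Fin.≟ u | x Fin.≟ v | x Fin.≟ w
  ... | yes a | _ | _ = inj₁ a
  ... | no _ | yes b | _ = inj₂ (inj₁ b)
  ... | no _ | no _ | yes c = inj₂ (inj₂ c)
  ... | no a | no b | no c = ⊥-elim (ℕ.<⇒≱ (≤-card s f f-inj f∈) (ℕ.≤-reflexive e))
    where
    f : Fin 4 → Fin n
    f 0F = u
    f 1F = v
    f 2F = w
    f 3F = x
    f∈ : ∀ i → f i ∈ s
    f∈ 0F = u∈
    f∈ 1F = v∈
    f∈ 2F = w∈
    f∈ 3F = x∈
    f-inj : Injective _≡_ _≡_ f
    f-inj {0F} {0F} _ = refl
    f-inj {0F} {1F} q = ⊥-elim (u≢v q)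
    f-inj {0F} {2F} q = ⊥-elim (u≢w q)
    f-inj {0F} {3F} q = ⊥-elim (a (sym q))
    f-inj {1F} {0F} q = ⊥-elim (u≢v (sym q))
    f-inj {1F} {1F} _ = refl
    f-inj {1F} {2F} q = ⊥-elim (v≢w q)
    f-inj {1F} {3F} q = ⊥-elim (b (sym q))
    f-inj {2F} {0F} q = ⊥-elim (u≢w (sym q))
    f-inj {2F} {1F} q = ⊥-elim (v≢w (sym q))
    f-inj {2F} {2F} _ = refl
    f-inj {2F} {3F} q = ⊥-elim (c (sym q))
    f-inj {3F} {0F} q = ⊥-elim (a q)
    f-inj {3F} {1F} q = ⊥-elim (b q)
    f-inj {3F} {2F} q = ⊥-elim (c q)
    f-inj {3F} {3F} _ = refl

  module Girth {n : ℕ} (G : Hypergraph3 n) (no-C₂ : ¬ ContainsBergeCycle 2 G) (no-C₃ : ¬ ContainsBergeCycle 3 G) (no-C₄ : ¬ ContainsBergeCycle 4 G) where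

    Edge : Set
    Edge = Fin (length (edges G))

    E : Edge → Subset n
    E = lookup (edges G)

    linear : ∀ {u v a b} → u ≢ v → u ∈ E a → v ∈ E a → u ∈ E b → v ∈ E b → a ≡ b
    linear {u} {v} {a} {b} u≢v p q p' q' with a Fin.≟ b
    ... | yes e = e
    ... | no a≢b = ⊥-elim (no-C₂ (vs , es , vs-inj , es-inj , inc))
      where
      vs : Fin 2 → Fin n
      vs 0F = u
      vs 1F = v
      es : Fin 2 → Edge
      es 0F = a
      es 1F = b
      vs-inj : Injective _≡_ _≡_ vs
      vs-inj {0F} {0F} _ = refl
      vs-inj {0F} {1F} e = ⊥-elim (u≢v e)
      vs-inj {1F} {0F} e = ⊥-elim (u≢v (sym e))
      vs-inj {1F} {1F} _ = refl
      es-inj : Injective _≡_ _≡_ es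
      es-inj {0F} {0F} _ = refl
      es-inj {0F} {1F} e = ⊥-elim (a≢b e)
      es-inj {1F} {0F} e = ⊥-elim (a≢b (sym e))
      es-inj {1F} {1F} _ = refl
      inc : ∀ i → (vs i ∈ E (es i)) × (vs (next 2 i) ∈ E (es i))
      inc 0F = p , q
      inc 1F = q' , p'

    triangle-free : ∀ {u v w a b c} → u ≢ v → v ≢ w → u ≢ w → a ≢ b → b ≢ c → a ≢ c →
      u ∈ E a → v ∈ E a → v ∈ E b → w ∈ E b → w ∈ E c → u ∈ E c → ⊥
    triangle-free {u} {v} {w} {a} {b} {c} u≢v v≢w u≢w a≢b b≢c a≢c p₁ p₂ p₃ p₄ p₅ p₆ = no-C₃ (vs , es , vs-inj , es-inj , inc)
      where
      vs : Fin 3 → Fin n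
      vs 0F = u
      vs 1F = v
      vs 2F = w
      es : Fin 3 → Edge
      es 0F = a
      es 1F = b
      es 2F = c
      vs-inj : Injective _≡_ _≡_ vs
      vs-inj {0F} {0F} _ = refl
      vs-inj {0F} {1F} e = ⊥-elim (u≢v e)
      vs-inj {0F} {2F} e = ⊥-elim (u≢w e)
      vs-inj {1F} {0F} e = ⊥-elim (u≢v (sym e))
      vs-inj {1F} {1F} _ = refl
      vs-inj {1F} {2F} e = ⊥-elim (v≢w e)
      vs-inj {2F} {0F} e = ⊥-elim (u≢w (sym e))
      vs-inj {2F} {1F} e = ⊥-elim (v≢w (sym e))
      vs-inj {2F} {2F} _ = refl
      es-inj : Injective _≡_ _≡_ es
      es-inj {0F} {0F} _ = refl
      es-inj {0F} {1F} e = ⊥-elim (a≢b e)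
      es-inj {0F} {2F} e = ⊥-elim (a≢c e)
      es-inj {1F} {0F} e = ⊥-elim (a≢b (sym e))
      es-inj {1F} {1F} _ = refl
      es-inj {1F} {2F} e = ⊥-elim (b≢c e)
      es-inj {2F} {0F} e = ⊥-elim (a≢c (sym e))
      es-inj {2F} {1F} e = ⊥-elim (b≢c (sym e))
      es-inj {2F} {2F} _ = refl
      inc : ∀ i → (vs i ∈ E (es i)) × (vs (next 3 i) ∈ E (es i))
      inc 0F = p₁ , p₂
      inc 1F = p₃ , p₄
      inc 2F = p₅ , p₆

    quadrilateral-free : ∀ {u v w x a b c d} → u ≢ v → u ≢ w → u ≢ x → v ≢ w → v ≢ x → w ≢ x → a ≢ b → a ≢ c → a ≢ d → b ≢ c → b ≢ d → c ≢ d →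
      u ∈ E a → v ∈ E a → v ∈ E b → w ∈ E b → w ∈ E c → x ∈ E c → x ∈ E d → u ∈ E d → ⊥
    quadrilateral-free {u} {v} {w} {x} {a} {b} {c} {d} uv uw ux vw vx wx ab ac ad bc bd cd p₁ p₂ p₃ p₄ p₅ p₆ p₇ p₈ = no-C₄ (vs , es , vs-inj , es-inj , inc)
      where
      quad : ∀ {A : Set} → A → A → A → A → Fin 4 → A
      quad p q r s 0F = p
      quad p q r s 1F = q
      quad p q r s 2F = r
      quad p q r s 3F = s
      quad-inj : ∀ {A : Set} {p q r s : A} → p ≢ q → p ≢ r → p ≢ s → q ≢ r → q ≢ s → r ≢ s → Injective _≡_ _≡_ (quad p q r s)
      quad-inj pq pr ps qr qs rs {0F} {0F} _ = refl
      quad-inj pq pr ps qr qs rs {0F} {1F} e = ⊥-elim (pq e)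
      quad-inj pq pr ps qr qs rs {0F} {2F} e = ⊥-elim (pr e)
      quad-inj pq pr ps qr qs rs {0F} {3F} e = ⊥-elim (ps e)
      quad-inj pq pr ps qr qs rs {1F} {0F} e = ⊥-elim (pq (sym e))
      quad-inj pq pr ps qr qs rs {1F} {1F} _ = refl
      quad-inj pq pr ps qr qs rs {1F} {2F} e = ⊥-elim (qr e)
      quad-inj pq pr ps qr qs rs {1F} {3F} e = ⊥-elim (qs e)
      quad-inj pq pr ps qr qs rs {2F} {0F} e = ⊥-elim (pr (sym e))
      quad-inj pq pr ps qr qs rs {2F} {1F} e = ⊥-elim (qr (sym e))
      quad-inj pq pr ps qr qs rs {2F} {2F} _ = refl
      quad-inj pq pr ps qr qs rs {2F} {3F} e = ⊥-elim (rs e)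
      quad-inj pq pr ps qr qs rs {3F} {0F} e = ⊥-elim (ps (sym e))
      quad-inj pq pr ps qr qs rs {3F} {1F} e = ⊥-elim (qs (sym e))
      quad-inj pq pr ps qr qs rs {3F} {2F} e = ⊥-elim (rs (sym e))
      quad-inj pq pr ps qr qs rs {3F} {3F} _ = refl
      vs = quad u v w x
      es = quad a b c d
      vs-inj : Injective _≡_ _≡_ vs
      vs-inj = quad-inj uv uw ux vw vx wx
      es-inj : Injective _≡_ _≡_ es
      es-inj = quad-inj ab ac ad bc bd cd
      inc : ∀ i → (vs i ∈ E (es i)) × (vs (next 4 i) ∈ E (es i))
      inc 0F = p₁ , p₂
      inc 1F = p₃ , p₄
      inc 2F = p₅ , p₆
      inc 3F = p₇ , p₈

    -- Two vertices are joined by at most one path of length two through distinct edges.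
    centre-unique : ∀ {x y c c' a b a' b'} → x ≢ c → c ≢ y → x ≢ c' → c' ≢ y → a ≢ b → a' ≢ b' →
      x ∈ E a → c ∈ E a → c ∈ E b → y ∈ E b → x ∈ E a' → c' ∈ E a' → c' ∈ E b' → y ∈ E b' → c ≡ c'
    centre-unique {x} {y} {c} {c'} {a} {b} {a'} {b'} x≢c c≢y x≢c' c'≢y a≢b a'≢b' p₁ p₂ p₃ p₄ q₁ q₂ q₃ q₄ with c Fin.≟ c'
    ... | yes e = e
    ... | no c≢c' = ⊥-elim (quadrilateral-free x≢c x≢y x≢c' c≢y c≢c' (≢-sym c'≢y) a≢b a≢b' a≢a' b≢b' b≢a' (≢-sym a'≢b') p₁ p₂ p₃ p₄ q₄ q₃ q₂ q₁)
      where
      x≢y : x ≢ y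
      x≢y refl = a≢b (linear x≢c p₁ p₂ p₄ p₃)
      a≢b' : a ≢ b'
      a≢b' refl = a≢b (linear c≢y p₂ q₄ p₃ p₄)
      b≢a' : b ≢ a'
      b≢a' refl = a≢b (linear x≢c p₁ p₂ q₁ p₃)
      -- If the edges at x coincide, then c, y, c' lie on a Berge triangle; if those at y coincide,
      -- then x, c, c' do.
      a≢a' : a ≢ a'
      a≢a' refl = triangle-free c≢y (≢-sym c'≢y) c≢c' b≢b'₁ (≢-sym a'≢b') (≢-sym a≢b) p₃ p₄ q₄ q₃ q₂ p₂
        where
        b≢b'₁ : b ≢ b'
        b≢b'₁ refl = a≢b (linear c≢c' p₂ q₂ p₃ q₃)
      b≢b' : b ≢ b'
      b≢b' refl = triangle-free x≢c c≢c' x≢c' a≢b (≢-sym a'≢b') a≢a' p₁ p₂ p₃ q₃ q₂ q₁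

  2ab≤a²+b² : ∀ a b → 2 * (a * b) ≤ a * a + b * b
  2ab≤a²+b² a b with ℕ.≤-total a b
  ... | inj₁ p = subst (λ b → 2 * (a * b) ≤ a * a + b * b) (ℕ.m+[n∸m]≡n p) (subst (2 * (a * (a + (b ℕ.∸ a))) ≤_) (lem a (b ℕ.∸ a)) (ℕ.m≤m+n _ _))
    where
    lem : ∀ a d → 2 * (a * (a + d)) + d * d ≡ a * a + (a + d) * (a + d)
    lem = solve-∀
  ... | inj₂ p = subst (λ a → 2 * (a * b) ≤ a * a + b * b) (ℕ.m+[n∸m]≡n p) (subst (2 * ((b + (a ℕ.∸ b)) * b) ≤_) (lem b (a ℕ.∸ b)) (ℕ.m≤m+n _ _))
    where
    lem : ∀ b d → 2 * ((b + d) * b) + d * d ≡ (b + d) * (b + d) + b * b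
    lem = solve-∀

  module Counting {n k r : ℕ} (i₀ j₀ l₀ : Fin r) (i₀≢j₀ : i₀ ≢ j₀) (i₀≢l₀ : i₀ ≢ l₀) (j₀≢l₀ : j₀ ≢ l₀) (G : Hypergraph3 n) (part : Fin n → Fin r) (small : ∀ j → card (Part part j) ≤ k)
    (meet : ∀ i₁ i₂ i₃ → i₁ ≢ i₂ → i₁ ≢ i₃ → i₂ ≢ i₃ → ∃ λ e → (e ∈ₗ edges G) × (card (e ∩ Part part i₁) ≡ 1) × (card (e ∩ Part part i₂) ≡ 1) × (card (e ∩ Part part i₃) ≡ 1))
    (no-C₂ : ¬ ContainsBergeCycle 2 G) (no-C₃ : ¬ ContainsBergeCycle 3 G) (no-C₄ : ¬ ContainsBergeCycle 4 G) where

    open Girth G no-C₂ no-C₃ no-C₄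

    private
      m = r * (r * r)

      opaque
        i j l : Fin m → Fin r
        i τ = proj₁ (remQuot (r * r) τ)
        j τ = proj₁ (remQuot {r} r (proj₂ (remQuot {r} (r * r) τ)))
        l τ = proj₂ (remQuot {r} r (proj₂ (remQuot {r} (r * r) τ)))

        τ-≡ : ∀ {τ σ} → i τ ≡ i σ → j τ ≡ j σ → l τ ≡ l σ → τ ≡ σ
        τ-≡ {τ} {σ} a b c = trans (sym (Fin.combine-remQuot {r} (r * r) τ)) (trans (cong₂ combine a (trans (sym (Fin.combine-remQuot {r} r (proj₂ (remQuot {r} (r * r) τ)))) (trans (cong₂ combine b c) (Fin.combine-remQuot {r} r (proj₂ (remQuot {r} (r * r) σ)))))) (Fin.combine-remQuot {r} (r * r) σ))

      Ok : Fin m → Set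
      Ok τ = i τ ≢ j τ × i τ ≢ l τ × j τ ≢ l τ

      ok? : ∀ τ → Dec (Ok τ)
      ok? τ = ¬? (i τ Fin.≟ j τ) ×-dec (¬? (i τ Fin.≟ l τ) ×-dec ¬? (j τ Fin.≟ l τ))

      -- A half-path with centre c and outer end x. The third vertex y enters only through its part.
      Meets : Edge → Fin n → Fin n → Fin r → Fin r → Fin r → Set
      Meets e c x i j l = (c ∈ E e × part c ≡ i) × (x ∈ E e × part x ≡ j) × (∃ λ y → y ∈ E e × part y ≡ l)

      pick : ∀ i j l → i ≢ j → i ≢ l → j ≢ l → ∃ λ ((e , c , x) : Edge × Fin n × Fin n) → Meets e c x i j l
      pick i j l a b c with meet i j l a b c
      ... | s , s∈ , p , q , t = (Any.index s∈ , proj₁ (vert i p) , proj₁ (vert j q)) , proj₂ (vert i p) , proj₂ (vert j q) , vert l t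
        where
        vert : ∀ i → card (s ∩ Part part i) ≡ 1 → ∃ λ v → v ∈ E (Any.index s∈) × part v ≡ i
        vert i e with nonempty (s ∩ Part part i) e
        ... | v , v∈ = v , subst (v ∈_) (Any.lookup-index s∈) (proj₁ (x∈p∩q⁻ s (Part part i) v∈)) , ∈Part⇒ part i (proj₂ (x∈p∩q⁻ s (Part part i) v∈))

      -- The value of the choice functions at triples with a repeated part; the three given distinct
      -- parts supply it.
      default : Edge × Fin n × Fin n
      default = proj₁ (pick i₀ j₀ l₀ i₀≢j₀ i₀≢l₀ j₀≢l₀)

      choice : ∀ τ → Dec (Ok τ) → Edge × Fin n × Fin n
      choice τ (yes (a , b , c)) = proj₁ (pick (i τ) (j τ) (l τ) a b c)
      choice τ (no _) = default

      opaque
        ed : Fin m → Edge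
        ed τ = proj₁ (choice τ (ok? τ))
        ce ax : Fin m → Fin n
        ce τ = proj₁ (proj₂ (choice τ (ok? τ)))
        ax τ = proj₂ (proj₂ (choice τ (ok? τ)))

        meets : ∀ τ → Ok τ → Meets (ed τ) (ce τ) (ax τ) (i τ) (j τ) (l τ)
        meets τ ok = go (ok? τ)
          where
          go : (d : Dec (Ok τ)) → Meets (proj₁ (choice τ d)) (proj₁ (proj₂ (choice τ d))) (proj₂ (proj₂ (choice τ d))) (i τ) (j τ) (l τ)
          go (yes (a , b , c)) = proj₂ (pick (i τ) (j τ) (l τ) a b c)
          go (no ¬ok) = ⊥-elim (¬ok ok)

      module _ {τ : Fin m} (ok : Ok τ) where
        ce∈ : ce τ ∈ E (ed τ)
        ce∈ = proj₁ (proj₁ (meets τ ok))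
        part-ce : part (ce τ) ≡ i τ
        part-ce = proj₂ (proj₁ (meets τ ok))
        ax∈ : ax τ ∈ E (ed τ)
        ax∈ = proj₁ (proj₁ (proj₂ (meets τ ok)))
        part-ax : part (ax τ) ≡ j τ
        part-ax = proj₂ (proj₁ (proj₂ (meets τ ok)))

        ax≢ce : ax τ ≢ ce τ
        ax≢ce e = proj₁ ok (trans (sym part-ce) (trans (cong part (sym e)) part-ax))

        parts : ∀ {w} → w ∈ E (ed τ) → part w ≡ i τ ⊎ (part w ≡ j τ ⊎ part w ≡ l τ)
        parts {w} w∈ with proj₂ (proj₂ (meets τ ok))
        ... | y , y∈ , part-y with only-three (E (ed τ)) (All.lookup (uniform G) (∈-lookup (ed τ))) ce∈ ax∈ y∈ w∈ (≢-sym ax≢ce)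
                (λ e → proj₁ (proj₂ ok) (trans (sym part-ce) (trans (cong part e) part-y))) (λ e → proj₂ (proj₂ ok) (trans (sym part-ax) (trans (cong part e) part-y)))
        ...   | inj₁ refl = inj₁ part-ce
        ...   | inj₂ (inj₁ refl) = inj₂ (inj₁ part-ax)
        ...   | inj₂ (inj₂ refl) = inj₂ (inj₂ part-y)

      -- An edge has three vertices in three different parts, so two of the parts force the third.
      determined : ∀ {τ σ} → Ok τ → Ok σ → ed τ ≡ ed σ → i τ ≡ i σ → j τ ≡ j σ → τ ≡ σ
      determined {τ} {σ} ok ok' e a b with proj₂ (proj₂ (meets σ ok'))
      ... | y , y∈ , part-y with parts ok (subst (λ t → y ∈ E t) (sym e) y∈)
      ...   | inj₁ q = ⊥-elim (proj₁ (proj₂ ok') (trans (sym a) (trans (sym q) part-y)))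
      ...   | inj₂ (inj₁ q) = ⊥-elim (proj₂ (proj₂ ok') (trans (sym b) (trans (sym q) part-y)))
      ...   | inj₂ (inj₂ q) = τ-≡ a b (trans (sym q) part-y)

      S : ℕ
      S = ∑ (λ τ → 𝟏 (ok? τ))

      S-≥ : m ≤ S + 3 * (r * r)
      S-≥ = ℕ.≤-trans (ℕ.≤-reflexive (trans (sym (ℕ.*-identityʳ m)) (sym (∑-const m 1)))) (ℕ.≤-trans (∑-mono cover)
        (ℕ.≤-trans (ℕ.≤-reflexive (trans (∑-+ (λ τ → 𝟏 (ok? τ)) _) (cong (S +_) (trans (∑-+ (λ τ → 𝟏 (i τ Fin.≟ j τ)) _) (cong (∑ (λ τ → 𝟏 (i τ Fin.≟ j τ)) +_) (∑-+ (λ τ → 𝟏 (i τ Fin.≟ l τ)) (λ τ → 𝟏 (j τ Fin.≟ l τ))))))))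
          (ℕ.+-monoʳ-≤ S (ℕ.≤-trans (ℕ.+-mono-≤ c₁ (ℕ.+-mono-≤ c₂ c₃)) (ℕ.≤-reflexive (lem (r * r)))))))
        where
        lem : ∀ a → a + (a + a) ≡ 3 * a
        lem = solve-∀
        cover : ∀ τ → 1 ≤ 𝟏 (ok? τ) + (𝟏 (i τ Fin.≟ j τ) + (𝟏 (i τ Fin.≟ l τ) + 𝟏 (j τ Fin.≟ l τ)))
        cover τ = go (i τ Fin.≟ j τ) (i τ Fin.≟ l τ) (j τ Fin.≟ l τ)
          where
          go : (a : Dec (i τ ≡ j τ)) (b : Dec (i τ ≡ l τ)) (c : Dec (j τ ≡ l τ)) → 1 ≤ 𝟏 (¬? a ×-dec (¬? b ×-dec ¬? c)) + (𝟏 a + (𝟏 b + 𝟏 c))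
          go (yes _) _ _ = s≤s z≤n
          go (no _) (yes _) _ = s≤s z≤n
          go (no _) (no _) (yes _) = s≤s z≤n
          go (no _) (no _) (no _) = s≤s z≤n
        c₁ : ∑ (λ τ → 𝟏 (i τ Fin.≟ j τ)) ≤ r * r
        c₁ = count-≤ (λ τ → i τ Fin.≟ j τ) (λ τ → combine (i τ) (l τ)) (λ τ σ p q e → let a , b = Fin.combine-injective (i τ) (l τ) (i σ) (l σ) e in τ-≡ a (trans (sym p) (trans a q)) b)
        c₂ : ∑ (λ τ → 𝟏 (i τ Fin.≟ l τ)) ≤ r * r
        c₂ = count-≤ (λ τ → i τ Fin.≟ l τ) (λ τ → combine (i τ) (j τ)) (λ τ σ p q e → let a , b = Fin.combine-injective (i τ) (j τ) (i σ) (j σ) e in τ-≡ a b (trans (sym p) (trans a q)))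
        c₃ : ∑ (λ τ → 𝟏 (j τ Fin.≟ l τ)) ≤ r * r
        c₃ = count-≤ (λ τ → j τ Fin.≟ l τ) (λ τ → combine (i τ) (j τ)) (λ τ σ p q e → let a , b = Fin.combine-injective (i τ) (j τ) (i σ) (j σ) e in τ-≡ a b (trans (sym p) (trans b q)))

      Same : Fin m → Fin m → Set
      Same τ σ = (Ok τ × Ok σ) × ce τ ≡ ce σ

      same? : ∀ τ σ → Dec (Same τ σ)
      same? τ σ = (ok? τ ×-dec ok? σ) ×-dec (ce τ Fin.≟ ce σ)

      -- Given τ, a triple σ with the same centre and edge has i σ = i τ and j σ equal to j τ or l
      -- τ, and the rest is forced. The flag records which case occurs.
      one-edge : ∑ (λ τ → ∑ (λ σ → 𝟏 (same? τ σ ×-dec (ed τ Fin.≟ ed σ)))) ≤ m * 2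
      one-edge = count₂-≤ (λ τ σ → same? τ σ ×-dec (ed τ Fin.≟ ed σ)) (λ τ σ → combine τ (flag τ σ)) inj
        where
        toFlag : ∀ {P : Set} → Dec P → Fin 2
        toFlag (yes _) = 0F
        toFlag (no _) = 1F
        flag : Fin m → Fin m → Fin 2
        flag τ σ = toFlag (j τ Fin.≟ j σ)
        j-≡ : ∀ {τ σ σ'} → j τ ≢ l τ → (j σ ≡ j τ ⊎ j σ ≡ l τ) → (j σ' ≡ j τ ⊎ j σ' ≡ l τ) → flag τ σ ≡ flag τ σ' → j σ ≡ j σ'
        j-≡ {τ} {σ} {σ'} ne p q e with j τ Fin.≟ j σ | j τ Fin.≟ j σ'
        ... | yes a | yes b = trans (sym a) b
        ... | yes _ | no _ with () ← e
        j-≡ ne p q () | no _ | yes _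
        j-≡ ne (inj₁ p) q e | no a | no b = ⊥-elim (a (sym p))
        j-≡ ne (inj₂ p) (inj₁ q) e | no a | no b = ⊥-elim (b (sym q))
        j-≡ ne (inj₂ p) (inj₂ q) e | no a | no b = trans p (sym q)
        inj : ∀ τ σ τ' σ' → Same τ σ × ed τ ≡ ed σ → Same τ' σ' × ed τ' ≡ ed σ' → combine τ (flag τ σ) ≡ combine τ' (flag τ' σ') → τ ≡ τ' × σ ≡ σ'
        inj τ σ τ' σ' (((ok , okσ) , c) , e) (((ok' , okσ') , c') , e') eq = conclude (Fin.combine-injective τ (flag τ σ) τ' (flag τ' σ') eq) c' e'
          where
          conclude : τ ≡ τ' × flag τ σ ≡ flag τ' σ' → ce τ' ≡ ce σ' → ed τ' ≡ ed σ' → τ ≡ τ' × σ ≡ σ'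
          conclude (refl , f) c' e' = refl , determined okσ okσ' (trans (sym e) e') (trans (sym (i-≡ okσ c)) (i-≡ okσ' c')) (j-≡ {τ} {σ} {σ'} (proj₂ (proj₂ ok)) (side okσ c e) (side okσ' c' e') f)
           where
           i-≡ : ∀ {ρ} → Ok ρ → ce τ ≡ ce ρ → i τ ≡ i ρ
           i-≡ okρ c = trans (sym (part-ce ok)) (trans (cong part c) (part-ce okρ))
           side : ∀ {ρ} → Ok ρ → ce τ ≡ ce ρ → ed τ ≡ ed ρ → j ρ ≡ j τ ⊎ j ρ ≡ l τ
           side {ρ} okρ c e with parts ok (subst (λ t → ax ρ ∈ E t) (sym e) (ax∈ okρ))
           ... | inj₁ q = ⊥-elim (proj₁ okρ (trans (sym (i-≡ okρ c)) (trans (sym q) (part-ax okρ))))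
           ... | inj₂ (inj₁ q) = inj₁ (trans (sym (part-ax okρ)) q)
           ... | inj₂ (inj₂ q) = inj₂ (trans (sym (part-ax okρ)) q)

      -- The outer ends of such a pair determine the centre by `centre-unique`, then both edges by
      -- linearity, then both triples.
      two-edges : ∑ (λ τ → ∑ (λ σ → 𝟏 (same? τ σ ×-dec ¬? (ed τ Fin.≟ ed σ)))) ≤ n * n
      two-edges = count₂-≤ (λ τ σ → same? τ σ ×-dec ¬? (ed τ Fin.≟ ed σ)) (λ τ σ → combine (ax τ) (ax σ)) inj
        where
        inj : ∀ τ σ τ' σ' → Same τ σ × ed τ ≢ ed σ → Same τ' σ' × ed τ' ≢ ed σ' → combine (ax τ) (ax σ) ≡ combine (ax τ') (ax σ') → τ ≡ τ' × σ ≡ σ'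
        inj τ σ τ' σ' (((okτ , okσ) , c) , ne) (((okτ' , okσ') , c') , ne') eq = arm okτ okτ' cc p , arm okσ okσ' (trans (sym c) (trans cc c')) q
          where
          pq = Fin.combine-injective (ax τ) (ax σ) (ax τ') (ax σ') eq
          p = proj₁ pq
          q = proj₂ pq
          cc : ce τ ≡ ce τ'
          cc = centre-unique (ax≢ce okτ) (λ e → ax≢ce okσ (trans (sym e) c)) (subst (_≢ ce τ') (sym p) (ax≢ce okτ')) (λ e → ax≢ce okσ' (trans (sym q) (trans (sym e) c'))) ne ne'
            (ax∈ okτ) (ce∈ okτ) (subst (_∈ E (ed σ)) (sym c) (ce∈ okσ)) (ax∈ okσ)
            (subst (_∈ E (ed τ')) (sym p) (ax∈ okτ')) (ce∈ okτ') (subst (_∈ E (ed σ')) (sym c') (ce∈ okσ')) (subst (_∈ E (ed σ')) (sym q) (ax∈ okσ'))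
          arm : ∀ {ρ ρ'} → Ok ρ → Ok ρ' → ce ρ ≡ ce ρ' → ax ρ ≡ ax ρ' → ρ ≡ ρ'
          arm {ρ} {ρ'} okρ okρ' c p = determined okρ okρ' (linear (ax≢ce okρ) (ax∈ okρ) (ce∈ okρ) (subst (_∈ E (ed ρ')) (sym p) (ax∈ okρ')) (subst (_∈ E (ed ρ')) (sym c) (ce∈ okρ')))
            (trans (sym (part-ce okρ)) (trans (cong part c) (part-ce okρ'))) (trans (sym (part-ax okρ)) (trans (cong part p) (part-ax okρ')))

      A : Fin m → Fin n → ℕ
      A τ v = 𝟏 (ok? τ) * 𝟏 (ce τ Fin.≟ v)

      degree : Fin n → ℕ
      degree v = ∑ (λ τ → A τ v)

      Σdegree : S ≤ ∑ degree
      Σdegree = ℕ.≤-trans (∑-mono (λ τ → ℕ.≤-trans (ℕ.≤-trans (ℕ.≤-reflexive (sym (ℕ.*-identityʳ _))) (ℕ.*-monoʳ-≤ (𝟏 (ok? τ)) (∑-𝟏-≟ (ce τ)))) (ℕ.≤-reflexive (sym (∑-*ˡ (𝟏 (ok? τ)) (λ v → 𝟏 (ce τ Fin.≟ v)))))))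
        (ℕ.≤-reflexive (∑-swap A))

      A⇒ : ∀ {τ v} → 1 ≤ A τ v → Ok τ × ce τ ≡ v
      A⇒ {τ} {v} h with ok? τ | ce τ Fin.≟ v
      ... | yes o | yes e = o , e
      ... | yes _ | no _ with () ← h
      A⇒ () | no _ | _

      1≤*ˡ : ∀ {a b} → 1 ≤ a * b → 1 ≤ a
      1≤*ˡ {suc a} _ = s≤s z≤n
      1≤*ʳ : ∀ {a b} → 1 ≤ a * b → 1 ≤ b
      1≤*ʳ {a} {b} h = 1≤*ˡ {b} {a} (subst (1 ≤_) (ℕ.*-comm a b) h)

      -- Expanding the squares counts pairs of triples with a common centre, which are then split by
      -- whether they use the same edge.
      Σdegree² : ∑ (λ v → degree v * degree v) ≤ m * 2 + n * n
      Σdegree² = ℕ.≤-trans (ℕ.≤-reflexive (trans (∑-cong expand) (trans (∑-swap (λ v τ → ∑ (λ σ → A τ v * A σ v))) (∑-cong (λ τ → ∑-swap (λ v σ → A τ v * A σ v))))))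
        (ℕ.≤-trans (∑-mono (λ τ → ∑-mono (λ σ → ℕ.≤-trans (pair τ σ) (split τ σ))))
          (ℕ.≤-trans (ℕ.≤-reflexive (trans (∑-cong (λ τ → ∑-+ (λ σ → 𝟏 (same? τ σ ×-dec (ed τ Fin.≟ ed σ))) (λ σ → 𝟏 (same? τ σ ×-dec ¬? (ed τ Fin.≟ ed σ)))))
              (∑-+ (λ τ → ∑ (λ σ → 𝟏 (same? τ σ ×-dec (ed τ Fin.≟ ed σ)))) (λ τ → ∑ (λ σ → 𝟏 (same? τ σ ×-dec ¬? (ed τ Fin.≟ ed σ)))))))
            (ℕ.+-mono-≤ one-edge two-edges)))
        where
        expand : ∀ v → degree v * degree v ≡ ∑ (λ τ → ∑ (λ σ → A τ v * A σ v))
        expand v = trans (sym (∑-*ˡ (degree v) (λ τ → A τ v))) (∑-cong (λ τ → trans (ℕ.*-comm (degree v) (A τ v)) (sym (∑-*ˡ (A τ v) (λ σ → A σ v)))))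
        split : ∀ τ σ → 𝟏 (same? τ σ) ≤ 𝟏 (same? τ σ ×-dec (ed τ Fin.≟ ed σ)) + 𝟏 (same? τ σ ×-dec ¬? (ed τ Fin.≟ ed σ))
        split τ σ = go (same? τ σ) (ed τ Fin.≟ ed σ)
          where
          go : ∀ {P Q : Set} (a : Dec P) (b : Dec Q) → 𝟏 a ≤ 𝟏 (a ×-dec b) + 𝟏 (a ×-dec ¬? b)
          go (yes _) (yes _) = s≤s z≤n
          go (yes _) (no _) = s≤s z≤n
          go (no _) _ = z≤n
        pair : ∀ τ σ → ∑ (λ v → A τ v * A σ v) ≤ 𝟏 (same? τ σ)
        pair τ σ = go (same? τ σ)
          where
          both : ∀ {v} → 1 ≤ A τ v * A σ v → Same τ σ × ce τ ≡ v
          both {v} h = let o , e = A⇒ (1≤*ˡ h) ; o' , e' = A⇒ (1≤*ʳ {A τ v} h) in ((o , o') , trans e (sym e')) , e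
          go : (d : Dec (Same τ σ)) → ∑ (λ v → A τ v * A σ v) ≤ 𝟏 d
          go (yes _) = ∑-at-most-one _ (λ v → ℕ.*-mono-≤ (ℕ.*-mono-≤ (𝟏≤1 (ok? τ)) (𝟏≤1 (ce τ Fin.≟ v))) (ℕ.*-mono-≤ (𝟏≤1 (ok? σ)) (𝟏≤1 (ce σ Fin.≟ v)))) (λ v w h h' → trans (sym (proj₂ (both h))) (proj₂ (both h')))
          go (no ¬s) = ℕ.≮⇒≥ (λ h → ¬s (proj₁ (both (proj₂ (∑-pos (λ v → A τ v * A σ v) h)))))

    -- Proved after multiplication by r². Of the 8r, 2r comes from pairs on a single edge and 6r
    -- from triples with repeated parts.
    counting : 2 * (r * r) ≤ 8 * r + (k * k + r * k)
    counting = ℕ.*-cancelˡ-≤ (r * r) {{ℕ.>-nonZero (ℕ.*-mono-≤ 1≤r 1≤r)}} (begin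
      r * r * (2 * (r * r))                          ≡⟨ lem₁ r ⟩
      2 * r * m                                      ≤⟨ ℕ.*-monoʳ-≤ (2 * r) S-≥ ⟩
      2 * r * (S + 3 * (r * r))                      ≡⟨ lem₂ r S ⟩
      2 * r * S + 6 * (r * (r * r))                  ≤⟨ ℕ.+-monoˡ-≤ (6 * (r * (r * r))) main ⟩
      m * 2 + n * n + n * (r * r) + 6 * (r * (r * r)) ≤⟨ ℕ.+-monoˡ-≤ (6 * (r * (r * r))) (ℕ.+-mono-≤ (ℕ.+-monoʳ-≤ (m * 2) (ℕ.*-mono-≤ n≤ n≤)) (ℕ.*-monoˡ-≤ (r * r) n≤)) ⟩
      m * 2 + r * k * (r * k) + r * k * (r * r) + 6 * (r * (r * r)) ≡⟨ lem₃ r k ⟩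
      r * r * (8 * r + (k * k + r * k))              ∎)
      where
      open ℕ.≤-Reasoning
      1≤r : 1 ≤ r
      1≤r = ℕ.≤-trans (s≤s z≤n) (Fin.toℕ<n i₀)
      n≤ : n ≤ r * k
      n≤ = vertices-≤ part small
      lem₁ : ∀ r → r * r * (2 * (r * r)) ≡ 2 * r * (r * (r * r))
      lem₁ = solve-∀
      lem₂ : ∀ r s → 2 * r * (s + 3 * (r * r)) ≡ 2 * r * s + 6 * (r * (r * r))
      lem₂ = solve-∀
      lem₃ : ∀ r k → r * (r * r) * 2 + r * k * (r * k) + r * k * (r * r) + 6 * (r * (r * r)) ≡ r * r * (8 * r + (k * k + r * k))
      lem₃ = solve-∀
      main : 2 * r * S ≤ m * 2 + n * n + n * (r * r)
      main = begin
        2 * r * S                                    ≤⟨ ℕ.*-monoʳ-≤ (2 * r) Σdegree ⟩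
        2 * r * ∑ degree                             ≡⟨ sym (∑-*ˡ (2 * r) degree) ⟩
        -- Cauchy-Schwarz in tangent form at r, the average degree to be expected: about r³ triples
        -- on r k vertices with k near r.
        ∑ (λ v → 2 * r * degree v)                   ≤⟨ ∑-mono (λ v → ℕ.≤-trans (ℕ.≤-reflexive (lem r (degree v))) (2ab≤a²+b² (degree v) r)) ⟩
        ∑ (λ v → degree v * degree v + r * r)        ≡⟨ trans (∑-+ (λ v → degree v * degree v) (λ _ → r * r)) (cong (∑ (λ v → degree v * degree v) +_) (∑-const n (r * r))) ⟩
        ∑ (λ v → degree v * degree v) + n * (r * r)  ≤⟨ ℕ.+-monoˡ-≤ (n * (r * r)) Σdegree² ⟩
        m * 2 + n * n + n * (r * r)                  ∎
        where
        lem : ∀ r d → 2 * r * d ≡ 2 * (d * r)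
        lem = solve-∀

  -- The counting inequality bounds the deficit r - k by the absolute constant 4, and r/M is at
  -- least 4 once 4M ≤ r.
  lower-bound : ∀ M r k → 3 ≤ r → 4 * M ≤ r → Good r k → M * r ≤ M * k + r
  lower-bound M r@(suc (suc (suc r₀))) k (s≤s (s≤s (s≤s _))) 4M≤r (n , G , (part , small , meet) , a , b , c) = ℕ.≮⇒≥ absurd
    where
    count : 2 * (r * r) ≤ 8 * r + (k * k + r * k)
    count = Counting.counting 0F 1F 2F (λ ()) (λ ()) (λ ()) G part small meet a b c
    absurd : M * k + r < M * r → ⊥
    absurd h with ℕ.≤-total r k
    ... | inj₁ r≤k = ℕ.<⇒≱ h (ℕ.≤-trans (ℕ.*-monoʳ-≤ M r≤k) (ℕ.m≤m+n (M * k) r))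
    ... | inj₂ k≤r = ℕ.<⇒≱ r<Md (ℕ.≤-trans (ℕ.*-monoʳ-≤ M d≤4) (ℕ.≤-trans (ℕ.≤-reflexive (ℕ.*-comm M 4)) 4M≤r))
      where
      d = r ℕ.∸ k
      k+d : k + d ≡ r
      k+d = ℕ.m+[n∸m]≡n k≤r
      r<Md : r < M * d
      r<Md = ℕ.+-cancelˡ-< (M * k) r (M * d) (subst (M * k + r <_) (trans (cong (M *_) (sym k+d)) (ℕ.*-distribˡ-+ M k d)) h)
      -- 2r² - k² - rk = (2r + k) d, so 2r d ≤ 8r.
      d≤4 : d ≤ 4
      d≤4 = ℕ.*-cancelˡ-≤ (2 * r) (ℕ.+-cancelʳ-≤ (2 * (k * k) + k * d) _ _ (begin
        2 * r * d + (2 * (k * k) + k * d)                ≡⟨ cong (λ t → 2 * t * d + (2 * (k * k) + k * d)) (sym k+d) ⟩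
        2 * (k + d) * d + (2 * (k * k) + k * d)          ≤⟨ ℕ.m≤m+n _ (k * d) ⟩
        2 * (k + d) * d + (2 * (k * k) + k * d) + k * d  ≡⟨ lem₁ k d ⟩
        2 * ((k + d) * (k + d))                          ≡⟨ cong (λ t → 2 * (t * t)) k+d ⟩
        2 * (r * r)                                      ≤⟨ count ⟩
        8 * r + (k * k + r * k)                          ≡⟨ cong (λ t → 8 * r + (k * k + t * k)) (sym k+d) ⟩
        8 * r + (k * k + (k + d) * k)                    ≡⟨ lem₂ r k d ⟩
        2 * r * 4 + (2 * (k * k) + k * d)                ∎))
        where
        open ℕ.≤-Reasoning
        lem₁ : ∀ k d → 2 * (k + d) * d + (2 * (k * k) + k * d) + k * d ≡ 2 * ((k + d) * (k + d))
        lem₁ = solve-∀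
        lem₂ : ∀ r k d → 8 * r + (k * k + (k + d) * k) ≡ 2 * r * 4 + (2 * (k * k) + k * d)
        lem₂ = solve-∀

open import Data.Nat using (ℕ; suc; _+_; _*_; _≤_)
open import Data.Nat using (_<_; _/_; _%_; s≤s; z≤n)
open import Data.Nat.DivMod using (m≡m%n+[m/n]*n; m%n<n)
open import Data.Nat.Primality using (Prime)
import Data.Nat.Properties as ℕ
open import Data.Nat.Tactic.RingSolver using (solve-∀)
open import Data.Product using (Σ; _×_; _,_; ∃)
open import Relation.Binary.PropositionalEquality
open PrimeGaps using (prime-gap)
open UpperBound using (module Construction)
open LowerBound using (lower-bound)

-- From primes in short intervals to the asymptotic formula

module _ (m Z : ℕ) where
  private
    M q : ℕ
    M = suc m
    q = 4 * M

  -- The first summand gives z ≥ Z. With q = 4M the factor (q+1)/q costs r/(4M), and rounding z up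
  -- costs q + 1, which is at most 3r/(4M) once r ≥ 8M².
  threshold : ℕ
  threshold = q * Z + 8 * (M * M)

  module _ (r : ℕ) (large : threshold ≤ r) where
    private
      z : ℕ
      z = suc (r / q)
      div : r ≡ r % q + (r / q) * q
      div = m≡m%n+[m/n]*n r q

    8M²≤r : 8 * (M * M) ≤ r
    8M²≤r = ℕ.≤-trans (ℕ.m≤n+m _ (q * Z)) large

    r<qz : r < q * z
    r<qz = begin-strict
      r                    ≡⟨ div ⟩
      r % q + (r / q) * q  <⟨ ℕ.+-monoˡ-< ((r / q) * q) (m%n<n r q) ⟩
      q + (r / q) * q      ≡⟨ ℕ.*-comm z q ⟩
      q * z                ∎
      where open ℕ.≤-Reasoning

    Z≤z : Z ≤ z
    Z≤z = ℕ.<⇒≤ (ℕ.*-cancelˡ-< q Z z (ℕ.≤-<-trans (ℕ.≤-trans (ℕ.m≤m+n (q * Z) _) large) r<qz))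

    M[1+q]z≤ : M * (suc q * z) ≤ M * r + r
    M[1+q]z≤ = ℕ.*-cancelˡ-≤ 4 (begin
      4 * (M * (suc q * z))                            ≡⟨ lem₁ M (r / q) ⟩
      (1 + q) * ((r / q) * q) + 4 * (M * (1 + q))      ≤⟨ ℕ.+-monoˡ-≤ (4 * (M * (1 + q))) (ℕ.*-monoʳ-≤ (1 + q) (subst ((r / q) * q ≤_) (sym div) (ℕ.m≤n+m _ (r % q)))) ⟩
      (1 + q) * r + 4 * (M * (1 + q))                  ≤⟨ ℕ.+-monoʳ-≤ ((1 + q) * r) small ⟩
      (1 + q) * r + 3 * r                              ≡⟨ lem₂ M r ⟩
      4 * (M * r + r)                                  ∎)
      where
      open ℕ.≤-Reasoning
      lem₁ : ∀ M d → 4 * (M * (suc (4 * M) * suc d)) ≡ (1 + 4 * M) * (d * (4 * M)) + 4 * (M * (1 + 4 * M))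
      lem₁ = solve-∀
      lem₂ : ∀ M r → (1 + 4 * M) * r + 3 * r ≡ 4 * (M * r + r)
      lem₂ = solve-∀
      lem₃ : ∀ M → 4 * (M * (1 + 4 * M)) ≡ 4 * M + 16 * (M * M)
      lem₃ = solve-∀
      lem₄ : ∀ M → 8 * (M * M) + 16 * (M * M) ≡ 3 * (8 * (M * M))
      lem₄ = solve-∀
      small : 4 * (M * (1 + q)) ≤ 3 * r
      small = begin
        4 * (M * (1 + q))            ≡⟨ lem₃ M ⟩
        4 * M + 16 * (M * M)         ≤⟨ ℕ.+-monoˡ-≤ (16 * (M * M)) (ℕ.*-mono-≤ {4} {8} (s≤s (s≤s (s≤s (s≤s z≤n)))) (ℕ.m≤m*n M M)) ⟩
        8 * (M * M) + 16 * (M * M)   ≡⟨ lem₄ M ⟩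
        3 * (8 * (M * M))            ≤⟨ ℕ.*-monoʳ-≤ 3 8M²≤r ⟩
        3 * r                        ∎

    4M≤r : 4 * M ≤ r
    4M≤r = ℕ.≤-trans (ℕ.*-mono-≤ {4} {8} (s≤s (s≤s (s≤s (s≤s z≤n)))) (ℕ.m≤m*n M M)) 8M²≤r

    upper-bound : 3 ≤ r → (∃ λ p → Prime p × q * z < p × p ≤ suc q * z) → Σ ℕ λ k → Good r k × (M * k ≤ M * r + r)
    upper-bound 3≤r (p , prime-p , qz<p , p≤) = p , Construction.good r p prime-p r≤p (ℕ.≤-trans 3≤r r≤p) , ℕ.≤-trans (ℕ.*-monoʳ-≤ M p≤) M[1+q]z≤
      where
      r≤p : r ≤ p
      r≤p = ℕ.<⇒≤ (ℕ.<-trans r<qz qz<p)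

-- The term o(r) is expressed with ε = 1/(m+1) and cleared denominators. A good k bounds the minimum
-- f₃ from above, and the estimate for all good k bounds it from below.
theorem1p10 : (m : ℕ) → Σ ℕ λ R → (r : ℕ) → 3 ≤ r → R ≤ r →
    (Σ ℕ λ k → Good r k × (suc m * k ≤ suc m * r + r))
    × ((k : ℕ) → Good r k → suc m * r ≤ suc m * k + r)
theorem1p10 m = assemble (prime-gap (4 * suc m) (ℕ.*-monoʳ-≤ 4 (s≤s z≤n)))
  where
  assemble : (∃ λ Z → ∀ z → Z ≤ z → ∃ λ p → Prime p × 4 * suc m * z < p × p ≤ suc (4 * suc m) * z) →
    Σ ℕ λ R → (r : ℕ) → 3 ≤ r → R ≤ r →
      (Σ ℕ λ k → Good r k × (suc m * k ≤ suc m * r + r))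
      × ((k : ℕ) → Good r k → suc m * r ≤ suc m * k + r)
  assemble (Z , gap) = threshold m Z , λ r 3≤r large →
    upper-bound m Z r large 3≤r (gap (suc (r / (4 * suc m))) (Z≤z m Z r large)) ,
    λ k → lower-bound (suc m) r k 3≤r (4M≤r m Z r large)
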